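{- Assume the Elliott–Halberstam conjecture for $\mathcal{P}$ and for $E_2$, i.e. assume $BV[1,\mathcal{P}]$ and $BV[1,E_2]$. Then \[ \liminf_{n\to\infty}(q_{n+2}-q_n)\le 12, \] where $q_n$ denotes the $n$-th product of two distinct primes.
   Context: $\mathcal{P}$ is the set of primes and $E_2$ is the set of products of two distinct primes ($q_1=6,q_2=10,q_3=14,\dots$). For $N$ large let $\pi^\flat(N)=\#\{p\in\mathcal{P}: N\le p<2N\}$ and $\pi^\flat(N;q,a)=\#\{p\in\mathcal{P}: N\le p<2N,\ p\equiv a \pmod q\}$. $BV[\theta,\mathcal{P}]$ means: for every $\epsilon>0$ and every $A>0$, \[ \sum_{q\le N^{\theta-\epsilon}}\mu^2(q)\max_{(a,q)=1}\left|\pi^\flat(N;q,a)-\frac{\pi^\flat(N)}{\varphi(q)}\right|\ll_A \frac{N}{(\log N)^A}\quad(N\to\infty). \] For fixed $0<\eta<1/4$ and $Y=N^\eta$, let $\beta(n)=1$ if $n=p_1p_2$ with primes $Y<p_1\le N^{1/2}<p_2$, and $\beta(n)=0$ otherwise; let $\pi_{\beta,q}(N)=\sum_{N<n\le 2N,\,(n,q)=1}\beta(n)$ and $\pi_\beta(N;q,a)=\sum_{N<n\le 2N,\,n\equiv a\ (\mathrm{mod}\ q)}\beta(n)$. $BV[\theta,E_2]$ means: for every fixed $\eta\in(0,1/4)$, every $\epsilon>0$ and every $A>0$, \[ \sum_{q\le N^{\theta-\epsilon}}\mu^2(q)\max_{(a,q)=1}\left|\pi_\beta(N;q,a)-\frac{\pi_{\beta,q}(N)}{\varphi(q)}\right|\ll_A\frac{N}{(\log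 N)^A}\quad(N\to\infty). \] -}

module Defs where

open import Data.Bool using (Bool; true; false; _∧_; _∨_; not; if_then_else_)
open import Data.Nat using (ℕ; zero; suc; _+_; _*_; _∸_; _^_; _≤_; _<_; _≥_; _%_; _/_; _≡ᵇ_; _<ᵇ_; _≤ᵇ_)
open import Data.Nat.GCD using (gcd)
open import Data.Nat.Divisibility using (_∣?_)
open import Data.Nat.Primality using (Prime; prime?)
open import Data.Nat.Logarithm using (⌊log₂_⌋)
open import Data.List using (List; []; _∷_; map; foldr; filterᵇ; length; upTo)
open import Data.Bool.ListAction using (any)
open import Data.Integer as ℤ using ()
open import Data.Rational.Unnormalised as Q using (ℚᵘ; mkℚᵘ; 0ℚᵘ; ∣_∣; _⊔_)
open import Relation.Nullary.Decidable using (⌊_⌋)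
open import Data.Product using (Σ; _×_; ∃; _,_)
open import Relation.Binary.PropositionalEquality using (_≡_)

ℕ→ℚ : ℕ → ℚᵘ
ℕ→ℚ n = mkℚᵘ (ℤ.+ n) 0

-- a / d as a rational, intended (and only used) for d ≥ 1
-- (mkℚᵘ n k denotes n / (k+1))
frac : ℕ → ℕ → ℚᵘ
frac a d = mkℚᵘ (ℤ.+ a) (d ∸ 1)

isPrime : ℕ → Bool
isPrime p = ⌊ prime? p ⌋

range : ℕ → ℕ → List ℕ
range m n = map (λ t → m + t) (upTo (n ∸ m))

countIn : ℕ → ℕ → (ℕ → Bool) → ℕ
countIn m n P = length (filterᵇ P (range m n))

sumℚ : List ℚᵘ → ℚᵘ
sumℚ = foldr Q._+_ 0ℚᵘ

-- maximum of a list of (non-negative) rationals; 0 for the empty list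
maxℚ : List ℚᵘ → ℚᵘ
maxℚ = foldr _⊔_ 0ℚᵘ

coprime : ℕ → ℕ → Bool
coprime a b = gcd a b ≡ᵇ 1

φ : ℕ → ℕ
φ q = countIn 1 (suc q) (λ a → coprime a q)

-- μ²(q) = 1 iff q is squarefree, i.e. no d ≥ 2 has d² ∣ q  (used for q ≥ 1)
μ² : ℕ → Bool
μ² q = not (any (λ d → ⌊ (d * d) ∣? q ⌋) (range 2 (suc q)))

π♭ : ℕ → ℕ
π♭ N = countIn N (2 * N) isPrime

-- π♭(N;q,a) = #{p prime : N ≤ p < 2N, p ≡ a (mod q)}   (q ≥ 1, 0 ≤ a < q)
π♭AP : ℕ → ℕ → ℕ → ℕ
π♭AP N q a = countIn N (2 * N) (λ p → isPrime p ∧ ((p % suc (q ∸ 1)) ≡ᵇ (a % suc (q ∸ 1))))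

-- The weight β for E₂, with η = i / j (0 < η < 1/4), Y = N^η:
-- β(n) = 1 iff n = p₁ p₂ with primes Y < p₁ ≤ N^{1/2} < p₂.
--   Y < p₁        ⇔ N^i < p₁^j
--   p₁ ≤ N^{1/2}  ⇔ p₁² ≤ N
--   N^{1/2} < p₂  ⇔ N < p₂²
β : (i j N : ℕ) → ℕ → Bool
β i j N n = any test (range 1 (suc n))
  where
  test : ℕ → Bool
  test p₁ = isPrime p₁ ∧ ⌊ p₁ ∣? n ⌋ ∧ isPrime (n / suc (p₁ ∸ 1))
            ∧ ((N ^ i) <ᵇ (p₁ ^ j)) ∧ ((p₁ ^ 2) ≤ᵇ N) ∧ (N <ᵇ ((n / suc (p₁ ∸ 1)) ^ 2))

πβq : (i j N q : ℕ) → ℕ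
πβq i j N q = countIn (suc N) (suc (2 * N)) (λ n → coprime n q ∧ β i j N n)

πβAP : (i j N q a : ℕ) → ℕ
πβAP i j N q a = countIn (suc N) (suc (2 * N))
  (λ n → ((n % suc (q ∸ 1)) ≡ᵇ (a % suc (q ∸ 1))) ∧ β i j N n)

-- Bombieri–Vinogradov type sums at level θ = 1 with ε = 1/k:
-- the q-range q ≤ N^{1 - 1/k} is  1 ≤ q  and  q^k ≤ N^(k-1)  (such q satisfy q ≤ N)

inLevel : (k N q : ℕ) → Bool
inLevel k N q = (q ^ k) ≤ᵇ (N ^ (k ∸ 1))

bvSum : (k N : ℕ) → (ℕ → ℕ → ℚᵘ) → ℚᵘ
bvSum k N D = sumℚ (map term (range 1 (suc N)))
  where
  term : ℕ → ℚᵘ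
  term q = if inLevel k N q ∧ μ² q
           then maxℚ (map (λ a → if coprime a q then ∣ D q a ∣ else 0ℚᵘ) (range 0 q))
           else 0ℚᵘ

primeDiscrepancy : ℕ → ℕ → ℕ → ℚᵘ
primeDiscrepancy N q a = ℕ→ℚ (π♭AP N q a) Q.- frac (π♭ N) (φ q)

e2Discrepancy : (i j N : ℕ) → ℕ → ℕ → ℚᵘ
e2Discrepancy i j N q a = ℕ→ℚ (πβAP i j N q a) Q.- frac (πβq i j N q) (φ q)

-- "S(N) ≪_A N / (log N)^A": for every A there are C, N₀ with
--   S(N) · (⌊log₂ N⌋)^A ≤ C · N  for all N ≥ N₀.
SavesAllLogs : (ℕ → ℚᵘ) → Set
SavesAllLogs S = ∀ (A : ℕ) → Σ ℕ λ C → Σ ℕ λ N₀ → ∀ N → N₀ ≤ N →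
  (S N Q.* ℕ→ℚ (⌊log₂ N ⌋ ^ A)) Q.≤ ℕ→ℚ (C * N)

-- BV[1, 𝒫]  (ε = 1/k, k ≥ 1)
BV1-Primes : Set
BV1-Primes = ∀ (k : ℕ) → 1 ≤ k → SavesAllLogs (λ N → bvSum k N (primeDiscrepancy N))

-- BV[1, E₂]  (η = i/j with 0 < η < 1/4, ε = 1/k)
BV1-E2 : Set
BV1-E2 = ∀ (i j : ℕ) → 0 < i → 4 * i < j → ∀ (k : ℕ) → 1 ≤ k →
  SavesAllLogs (λ N → bvSum k N (e2Discrepancy i j N))

E₂ : ℕ → Set
E₂ n = Σ ℕ λ p₁ → Σ ℕ λ p₂ → Prime p₁ × Prime p₂ × p₁ < p₂ × n ≡ p₁ * p₂

-- q : ℕ → ℕ enumerates E₂ in increasing order (q 0 = 6, q 1 = 10, ...)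
IsE₂Enumeration : (ℕ → ℕ) → Set
IsE₂Enumeration q = (∀ n → q n < q (suc n)) × (∀ n → E₂ (q n)) × (∀ m → E₂ m → ∃ λ n → q n ≡ m)

-- liminf_{n→∞} (q (n+2) - q n) ≤ c, for an integer-valued (increasing) sequence:
-- for every M there is n ≥ M with q(n+2) - q(n) ≤ c
LiminfGapLe : (ℕ → ℕ) → ℕ → Set
LiminfGapLe q c = ∀ M → ∃ λ n → M ≤ n × (q (suc (suc n)) ∸ q n) ≤ c

{-# OPTIONS --safe #-}
-- Idea (Goldston–Graham–Pintz–Yıldırım): for the five forms n + h, h ∈ {0, 2, 6, 8, 12}, compare ∑ Λ(n)² with
-- ∑_h ∑ β(n + h) Λ(n)², where Λ(n) = ∑ μ(d) λ(d) over squarefree d ∣ ∏ (n + h) and n runs over a class modulo the product W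
-- of the small primes for which every n + h is prime to W. If the second sum exceeds twice the first, then three of the
-- forms are products of two primes for some n, so two gaps of E₂ fit into an interval of length 12. The level 1 of
-- distribution lets the weights have support up to N^{1/2 - ε}; the weight λ is a step function of the dyadic size
-- lg d of d, given by a quadratic polynomial f with a jump at the end point. Both sums are quadratic forms in the
-- weights, which are diagonalised one prime at a time and compared with iterates of F ↦ ∑ F(x + lg d) / d. Averaging over
-- N with weight 1/N² turns the number of products p₁ p₂ with p₁ of given size into sums of reciprocals of primes, which
-- Mertens' theorem evaluates. The resulting ratio of two explicit sums exceeds 1 by only 0.1%.
module Submission where

open import Defs
open import Data.Nat as N using (ℕ; zero; suc; z≤n; s≤s; _∸_; NonZero)
import Data.Nat.Properties as N
open import Data.Nat.Solver using (module +-*-Solver)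
open +-*-Solver using () renaming (solve to solveℕ; _:*_ to _⊛_; _:+_ to _⊞_; _:=_ to _≗_; con to conℕ)
import Data.Integer as ℤ
import Data.Integer.Properties as ℤ
import Data.Rational as ℚ
import Data.Rational.Properties as ℚ
import Data.Rational.Unnormalised as ℚᵘ
import Data.Rational.Unnormalised.Properties as ℚᵘ
open import Data.Product using (Σ; ∃; _×_; _,_) renaming (proj₁ to π₁; proj₂ to π₂)
open import Data.Sum using (_⊎_; inj₁; inj₂; [_,_]′)
open import Data.Empty using (⊥; ⊥-elim)
open import Data.Unit using (⊤; tt)
open import Data.Bool using (Bool; true; false; T; _∧_; _∨_; not; if_then_else_)
import Data.Bool.Properties as Bool
open import Data.Maybe using (Maybe; just; nothing)
open import Data.List using (List; []; _∷_; _++_; map; foldr; filterᵇ; length; upTo; filter)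
import Data.List.Properties as List
import Relation.Binary.Definitions as Tri
open import Data.List.Relation.Binary.Sublist.Propositional using (_⊆_; []; _∷_; _∷ʳ_; ⊆-refl)
import Data.List.Relation.Binary.Sublist.Propositional as Sublist
open import Data.List.Relation.Unary.All as All using (All; []; _∷_)
open import Data.List.Relation.Unary.AllPairs using (AllPairs; []; _∷_)
import Data.List.Relation.Unary.AllPairs.Properties as AllPairs
open import Data.List.Relation.Unary.Unique.Propositional using (Unique)
import Data.List.Relation.Unary.Unique.Propositional.Properties as Unique
open import Relation.Nullary using (¬_; Dec; yes; no; contradiction)
open import Relation.Nullary.Decidable using (⌊_⌋; toWitness; fromWitness; ¬?)
open import Relation.Binary.PropositionalEquality using (_≡_; _≢_; refl; sym; trans; cong; cong₂; subst; subst₂; module ≡-Reasoning)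
open import Function using (_∘_; id; case_of_)
open import Function.Strict using (force; force-≡)
open import Data.List.Membership.Propositional using (_∈_; _∉_)
open import Data.List.Membership.Propositional.Properties using (∈-++⁻; ∈-++⁺ˡ; ∈-++⁺ʳ; ∈-map⁺; ∈-map⁻; ∈-filter⁺; ∈-filter⁻)
open import Data.List.Relation.Unary.Any using (here; there)
open import Data.Nat.Divisibility as ∣ using (_∣_; _∣?_)
open import Data.Nat.Primality using (Prime; prime?; euclidsLemma; prime⇒nonTrivial; prime⇒nonZero; prime⇒irreducible)
open import Data.Nat.GCD using (gcd)
import Data.Nat.GCD as GCD
import Data.Nat.Coprimality as Cop
import Data.Nat.DivMod as DM
open import Data.Nat.Primality.Factorisation using (factorise)
open import Data.Nat.Induction using (<-rec)
open import Data.Nat.Logarithm using (⌊log₂_⌋; ⌊log₂⌋-mono-≤; ⌊log₂[2^n]⌋≡n; ⌊log₂⌊n/2⌋⌋≡⌊log₂n⌋∸1)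
open import Data.Nat.ListAction using (product)
open import Data.Bool.ListAction using (any)
open import Algebra.Bundles using (CommutativeRing)
open import Algebra.Structures using (IsCommutativeRing)
import Algebra.Solver.Ring
import Algebra.Solver.Ring.AlmostCommutativeRing as ACR

-- The step function enters as the coefficient `F` of products of κ(p) - t(p) [p divides ∏ (n + h)],
-- with κ(p) = 5/(p - 5) and t(p) = p/(p - 5). These products are orthogonal when p divides ∏ (n +
-- h) with density 5/p, so the plain sum is diagonal from the start. In the other sum n + h = q m
-- with q < m: a sieving prime other than q then hits with density 4/(p - 1), while q hits with
-- certainty, which turns F(x) into F(x) - F(x + lg q). Logarithms are irrational, so sizes are
-- binary lengths, and one parameter `V` controls the precision: sieving starts at 2^V, and every
-- comparison costs a factor 1 + O(1/V). First the number `G` of blocks and the step function are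
-- fixed, then `V`, then the block length `L`. In a common unit the plain sum is D/5! and the sum
-- for each of the five forms is Q/4!. The requirement 5 Q/24 > 2 D/120 reads Q > 0.08 D; the
-- computation gives Q ≥ 0.08004 D.

infixr 4.5 _∙_ _⨟_

_∙_ : ∀ {A : Set} {a b c : A} → a ≡ b → b ≡ c → a ≡ c
_∙_ = trans

reflexive : ∀ {a b} → a ≡ b → a N.≤ b
reflexive = N.≤-reflexive

_⨟_ : ∀ {a b c} → a N.≤ b → b N.≤ c → a N.≤ c
_⨟_ = N.≤-trans

infixr 4.5 _⨾_ _≡⨾_ _⨾≡_
infixl 6 _+_ _-_
infixl 7 _*_
infix 8 -_
infix 4 _≤_ _<_ _≤?_

-- The ordered field of rationals

abstract
 -- Opaque, so that no fraction is ever normalised during type checking; arithmetic goes through the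
 -- ring solver with integer coefficients.
 𝔽 : Set
 𝔽 = ℚ.ℚ

 _+_ _*_ : 𝔽 → 𝔽 → 𝔽
 _+_ = ℚ._+_
 _*_ = ℚ._*_

 -_ : 𝔽 → 𝔽
 -_ = ℚ.-_

 _≤_ _<_ : 𝔽 → 𝔽 → Set
 _≤_ = ℚ._≤_
 _<_ = ℚ._<_

 fromℤ : ℤ.ℤ → 𝔽
 fromℤ z = ℚ.fromℚᵘ (ℚᵘ.mkℚᵘ z 0)

 fromℚᵘ : ℚᵘ.ℚᵘ → 𝔽
 fromℚᵘ = ℚ.fromℚᵘ

 -- inv 0 = 1
 inv : ℕ → 𝔽
 inv n = ℚ.fromℚᵘ (frac 1 n)

#_ : ℕ → 𝔽
# n = fromℤ (ℤ.+ n)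
infix 9 #_

_-_ : 𝔽 → 𝔽 → 𝔽
a - b = a + (- b)

private
 fu-homo : (f : ℚᵘ.ℚᵘ) (a : ℚ.ℚ) → ℚ.toℚᵘ a ℚᵘ.≃ f → a ≡ ℚ.fromℚᵘ f
 fu-homo f a e = ℚ.toℚᵘ-injective (ℚᵘ.≃-trans e (ℚᵘ.≃-sym (ℚ.toℚᵘ-fromℚᵘ f)))

abstract
 +-*-isCommutativeRing : IsCommutativeRing _≡_ _+_ _*_ (-_) (# 0) (# 1)
 +-*-isCommutativeRing = ℚ.+-*-isCommutativeRing

 fromℤ-+ : ∀ a b → fromℤ (a ℤ.+ b) ≡ fromℤ a + fromℤ b
 fromℤ-+ a b = sym (fu-homo (ℚᵘ.mkℚᵘ (a ℤ.+ b) 0) _ (ℚᵘ.≃-trans (ℚ.toℚᵘ-homo-+ (fromℤ a) (fromℤ b))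
  (ℚᵘ.≃-trans (ℚᵘ.+-cong (ℚ.toℚᵘ-fromℚᵘ (ℚᵘ.mkℚᵘ a 0)) (ℚ.toℚᵘ-fromℚᵘ (ℚᵘ.mkℚᵘ b 0)))
   (ℚᵘ.*≡* (cong₂ ℤ._*_ {y = a ℤ.+ b} (cong₂ ℤ._+_ (ℤ.*-identityʳ a) (ℤ.*-identityʳ b)) refl)))))

 fromℤ-* : ∀ a b → fromℤ (a ℤ.* b) ≡ fromℤ a * fromℤ b
 fromℤ-* a b = sym (fu-homo (ℚᵘ.mkℚᵘ (a ℤ.* b) 0) _ (ℚᵘ.≃-trans (ℚ.toℚᵘ-homo-* (fromℤ a) (fromℤ b))
  (ℚᵘ.≃-trans (ℚᵘ.*-cong (ℚ.toℚᵘ-fromℚᵘ (ℚᵘ.mkℚᵘ a 0)) (ℚ.toℚᵘ-fromℚᵘ (ℚᵘ.mkℚᵘ b 0)))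
   (ℚᵘ.*≡* refl))))

 fromℤ-neg : ∀ a → fromℤ (ℤ.- a) ≡ - fromℤ a
 fromℤ-neg a = sym (fu-homo (ℚᵘ.mkℚᵘ (ℤ.- a) 0) _ (ℚᵘ.≃-trans (ℚ.toℚᵘ-homo‿- (fromℤ a))
  (ℚᵘ.-‿cong (ℚ.toℚᵘ-fromℚᵘ (ℚᵘ.mkℚᵘ a 0)))))

𝔽-commutativeRing : CommutativeRing _ _
𝔽-commutativeRing = record { isCommutativeRing = +-*-isCommutativeRing }

private
 acr = ACR.fromCommutativeRing 𝔽-commutativeRing
 ℤ-raw = CommutativeRing.rawRing ℤ.+-*-commutativeRing

 fromℤ-morphism : ℤ-raw ACR.-Raw-AlmostCommutative⟶ acr
 fromℤ-morphism = record
  { ⟦_⟧ = fromℤ ; +-homo = fromℤ-+ ; *-homo = fromℤ-* ; -‿homo = fromℤ-neg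
  ; 0-homo = refl ; 1-homo = refl }

 coeff≟ : ∀ a b → Maybe (fromℤ a ≡ fromℤ b)
 coeff≟ a b with a ℤ.≟ b
 ... | yes refl = just refl
 ... | no _ = nothing

module Solver = Algebra.Solver.Ring ℤ-raw acr fromℤ-morphism coeff≟
open Solver using (solve; _:+_; _:*_; _:-_; :-_; _:=_; con) public

κ : ∀ {n} → ℕ → Solver.Polynomial n
κ n = con (ℤ.+ n)

1* : ∀ x → # 1 * x ≡ x
1* = solve 1 (λ x → κ 1 :* x := x) refl

1*˘ : ∀ x → x ≡ # 1 * x
1*˘ = solve 1 (λ x → x := κ 1 :* x) refl

*1 : ∀ x → x * # 1 ≡ x
*1 = solve 1 (λ x → x :* κ 1 := x) refl

*1˘ : ∀ x → x ≡ x * # 1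
*1˘ = solve 1 (λ x → x := x :* κ 1) refl

0* : ∀ x → # 0 * x ≡ # 0
0* = solve 1 (λ x → κ 0 :* x := κ 0) refl

0*˘ : ∀ x → # 0 ≡ # 0 * x
0*˘ = solve 1 (λ x → κ 0 := κ 0 :* x) refl

*0 : ∀ x → x * # 0 ≡ # 0
*0 = solve 1 (λ x → x :* κ 0 := κ 0) refl

*0˘ : ∀ x → # 0 ≡ x * # 0
*0˘ = solve 1 (λ x → κ 0 := x :* κ 0) refl

+0 : ∀ x → x + # 0 ≡ x
+0 = solve 1 (λ x → x :+ κ 0 := x) refl

+0˘ : ∀ x → x ≡ x + # 0
+0˘ = solve 1 (λ x → x := x :+ κ 0) refl

0+ : ∀ x → # 0 + x ≡ x
0+ = solve 1 (λ x → κ 0 :+ x := x) refl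

0+˘ : ∀ x → x ≡ # 0 + x
0+˘ = solve 1 (λ x → x := κ 0 :+ x) refl

*-comm : ∀ x y → x * y ≡ y * x
*-comm = solve 2 (λ x y → x :* y := y :* x) refl

*-assoc : ∀ x y z → x * y * z ≡ x * (y * z)
*-assoc = solve 3 (λ x y z → x :* y :* z := x :* (y :* z)) refl

*-assoc˘ : ∀ x y z → x * (y * z) ≡ x * y * z
*-assoc˘ = solve 3 (λ x y z → x :* (y :* z) := x :* y :* z) refl

*-swap : ∀ x y z → x * (y * z) ≡ y * (x * z)
*-swap = solve 3 (λ x y z → x :* (y :* z) := y :* (x :* z)) refl

*-rotate : ∀ x y z → x * (y * z) ≡ x * z * y
*-rotate = solve 3 (λ x y z → x :* (y :* z) := x :* z :* y) refl

*-pull : ∀ x y z → x * y * z ≡ y * (x * z)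
*-pull = solve 3 (λ x y z → x :* y :* z := y :* (x :* z)) refl

*-swapʳ : ∀ x y z → x * y * z ≡ x * z * y
*-swapʳ = solve 3 (λ x y z → x :* y :* z := x :* z :* y) refl

*-swapˡ : ∀ x y z → x * (y * z) ≡ y * x * z
*-swapˡ = solve 3 (λ x y z → x :* (y :* z) := y :* x :* z) refl

*-interchange : ∀ x y z w → x * y * (z * w) ≡ x * z * (y * w)
*-interchange = solve 4 (λ x y z w → x :* y :* (z :* w) := x :* z :* (y :* w)) refl

abstract
 ≤-refl : ∀ {a} → a ≤ a
 ≤-refl = ℚ.≤-refl

 ≤-trans : ∀ {a b c} → a ≤ b → b ≤ c → a ≤ c
 ≤-trans = ℚ.≤-trans

 _⨾_ : ∀ {a b c} → a ≤ b → b ≤ c → a ≤ c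
 _⨾_ = ≤-trans

 ≤-antisym : ∀ {a b} → a ≤ b → b ≤ a → a ≡ b
 ≤-antisym = ℚ.≤-antisym

 ≤-total : ∀ a b → a ≤ b ⊎ b ≤ a
 ≤-total = ℚ.≤-total

 _≤?_ : ∀ a b → Dec (a ≤ b)
 _≤?_ = ℚ._≤?_

 ≰⇒> : ∀ {a b} → ¬ (a ≤ b) → b < a
 ≰⇒> = ℚ.≰⇒>

 <⇒≱ : ∀ {a b} → a < b → ¬ (b ≤ a)
 <⇒≱ p q = ℚ.<-irrefl refl (ℚ.<-≤-trans p q)

 _⊕_ : ∀ {a b c d} → a ≤ b → c ≤ d → a + c ≤ b + d
 _⊕_ = ℚ.+-mono-≤

 scale : ∀ {k a b} → # 0 ≤ k → a ≤ b → k * a ≤ k * b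
 scale {k} h p = ℚ.*-monoˡ-≤-nonNeg k ⦃ ℚ.nonNegative h ⦄ p

 scale-cancel : ∀ {k a b} → # 0 < k → k * a ≤ k * b → a ≤ b
 scale-cancel {k} h p = ℚ.*-cancelˡ-≤-pos k ⦃ ℚ.positive h ⦄ p

 #-mono : ∀ {m n} → m N.≤ n → # m ≤ # n
 #-mono {m} {n} p = ℚ.toℚᵘ-cancel-≤ (ℚᵘ.≤-respˡ-≃ (ℚᵘ.≃-sym (ℚ.toℚᵘ-fromℚᵘ (ℕ→ℚ m)))
  (ℚᵘ.≤-respʳ-≃ (ℚᵘ.≃-sym (ℚ.toℚᵘ-fromℚᵘ (ℕ→ℚ n)))
   (ℚᵘ.*≤* (subst₂ ℤ._≤_ (sym (ℤ.*-identityʳ (ℤ.+ m))) (sym (ℤ.*-identityʳ (ℤ.+ n))) (ℤ.+≤+ p)))))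

 #-cancel-≤ : ∀ {m n} → # m ≤ # n → m N.≤ n
 #-cancel-≤ {m} {n} p with ℚᵘ.≤-respˡ-≃ (ℚ.toℚᵘ-fromℚᵘ (ℕ→ℚ m)) (ℚᵘ.≤-respʳ-≃ (ℚ.toℚᵘ-fromℚᵘ (ℕ→ℚ n)) (ℚ.toℚᵘ-mono-≤ p))
 ... | ℚᵘ.*≤* q with subst₂ ℤ._≤_ (ℤ.*-identityʳ (ℤ.+ m)) (ℤ.*-identityʳ (ℤ.+ n)) q
 ... | ℤ.+≤+ r = r

 inv-nonneg : ∀ n → # 0 ≤ inv n
 inv-nonneg n = ℚ.toℚᵘ-cancel-≤ (ℚᵘ.≤-respʳ-≃ (ℚᵘ.≃-sym (ℚ.toℚᵘ-fromℚᵘ (frac 1 n)))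
   (ℚᵘ.*≤* (ℤ.+≤+ z≤n)))

 #-inv : ∀ n → 1 N.≤ n → # n * inv n ≡ # 1
 #-inv (suc n) _ = fu-homo (ℕ→ℚ 1) _ (ℚᵘ.≃-trans (ℚ.toℚᵘ-homo-* (fromℤ (ℤ.+ suc n)) (inv (suc n)))
  (ℚᵘ.≃-trans (ℚᵘ.*-cong (ℚ.toℚᵘ-fromℚᵘ (ℕ→ℚ (suc n))) (ℚ.toℚᵘ-fromℚᵘ (frac 1 (suc n))))
   (ℚᵘ.*≡* (cong (λ x → ℤ.+ suc x) (N.*-identityʳ (n N.* 1) ∙ N.*-identityʳ n ∙ sym (N.+-identityʳ (n N.+ 0) ∙ N.+-identityʳ n))))))

 archimedean : ∀ a → ∃ λ n → a ≤ # n
 archimedean a@(ℚ.mkℚ z d c) = ℤ.∣ z ∣ , ℚ.toℚᵘ-cancel-≤ (ℚᵘ.≤-respʳ-≃ (ℚᵘ.≃-sym (ℚ.toℚᵘ-fromℚᵘ (ℕ→ℚ ℤ.∣ z ∣)))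
   (ℚᵘ.*≤* (ℤ.≤-trans (ℤ.≤-reflexive (ℤ.*-identityʳ z)) (ℤ.≤-trans (z≤∣z∣ z)
    (subst (ℤ._≤ (ℤ.+ ℤ.∣ z ∣) ℤ.* (ℤ.+ suc d)) (ℤ.*-identityʳ _) (ℤ.*-monoˡ-≤-nonNeg (ℤ.+ ℤ.∣ z ∣) (ℤ.+≤+ (s≤s z≤n))))))))
  where
  z≤∣z∣ : ∀ z → z ℤ.≤ ℤ.+ ℤ.∣ z ∣
  z≤∣z∣ (ℤ.+ n) = ℤ.≤-refl
  z≤∣z∣ ℤ.-[1+ n ] = ℤ.-≤+

 reciprocal : ∀ {a} → # 0 < a → ∃ λ b → # 0 ≤ b × a * b ≡ # 1
 reciprocal {a} h = ℚ.1/_ a ⦃ ℚ.pos⇒nonZero a ⦃ ℚ.positive h ⦄ ⦄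
  , ℚ.nonNegative⁻¹ _ ⦃ ℚ.pos⇒nonNeg (ℚ.1/_ a ⦃ ℚ.pos⇒nonZero a ⦃ ℚ.positive h ⦄ ⦄) ⦃ ℚ.1/pos⇒pos a ⦃ ℚ.positive h ⦄ ⦄ ⦄
  , ℚ.*-inverseʳ a ⦃ ℚ.pos⇒nonZero a ⦃ ℚ.positive h ⦄ ⦄

 fromℚᵘ-+ : ∀ x y → fromℚᵘ (x ℚᵘ.+ y) ≡ fromℚᵘ x + fromℚᵘ y
 fromℚᵘ-+ x y = sym (fu-homo (x ℚᵘ.+ y) _ (ℚᵘ.≃-trans (ℚ.toℚᵘ-homo-+ (fromℚᵘ x) (fromℚᵘ y)) (ℚᵘ.+-cong (ℚ.toℚᵘ-fromℚᵘ x) (ℚ.toℚᵘ-fromℚᵘ y))))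

 fromℚᵘ-* : ∀ x y → fromℚᵘ (x ℚᵘ.* y) ≡ fromℚᵘ x * fromℚᵘ y
 fromℚᵘ-* x y = sym (fu-homo (x ℚᵘ.* y) _ (ℚᵘ.≃-trans (ℚ.toℚᵘ-homo-* (fromℚᵘ x) (fromℚᵘ y)) (ℚᵘ.*-cong (ℚ.toℚᵘ-fromℚᵘ x) (ℚ.toℚᵘ-fromℚᵘ y))))

 fromℚᵘ-neg : ∀ x → fromℚᵘ (ℚᵘ.- x) ≡ - fromℚᵘ x
 fromℚᵘ-neg x = sym (fu-homo (ℚᵘ.- x) _ (ℚᵘ.≃-trans (ℚ.toℚᵘ-homo‿- (fromℚᵘ x)) (ℚᵘ.-‿cong (ℚ.toℚᵘ-fromℚᵘ x))))

 fromℚᵘ-mono : ∀ {x y} → x ℚᵘ.≤ y → fromℚᵘ x ≤ fromℚᵘ y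
 fromℚᵘ-mono {x} {y} p = ℚ.toℚᵘ-cancel-≤ (ℚᵘ.≤-respˡ-≃ (ℚᵘ.≃-sym (ℚ.toℚᵘ-fromℚᵘ x)) (ℚᵘ.≤-respʳ-≃ (ℚᵘ.≃-sym (ℚ.toℚᵘ-fromℚᵘ y)) p))

 fromℚᵘ-ℕ : ∀ n → fromℚᵘ (ℕ→ℚ n) ≡ # n
 fromℚᵘ-ℕ n = refl

 fromℚᵘ-frac : ∀ a d → fromℚᵘ (frac a d) ≡ # a * inv d
 fromℚᵘ-frac a d = sym (fu-homo (frac a d) _ (ℚᵘ.≃-trans (ℚ.toℚᵘ-homo-* (# a) (inv d)) (ℚᵘ.≃-trans (ℚᵘ.*-cong (ℚ.toℚᵘ-fromℚᵘ (ℕ→ℚ a)) (ℚ.toℚᵘ-fromℚᵘ (frac 1 d)))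
  (ℚᵘ.*≡* (cong₂ ℤ._*_ (ℤ.*-identityʳ (ℤ.+ a)) (cong (λ n → ℤ.+ suc n) (sym (N.+-identityʳ (d ∸ 1)))))))))

infixl 6 _⊕_

#-+ : ∀ m n → # (m N.+ n) ≡ # m + # n
#-+ m n = fromℤ-+ (ℤ.+ m) (ℤ.+ n)

#-* : ∀ m n → # (m N.* n) ≡ # m * # n
#-* m n = cong fromℤ (ℤ.pos-* m n) ∙ fromℤ-* (ℤ.+ m) (ℤ.+ n)

≡⇒≤ : ∀ {a b} → a ≡ b → a ≤ b
≡⇒≤ refl = ≤-refl

_≡⨾_ : ∀ {a b c} → a ≡ b → b ≤ c → a ≤ c
refl ≡⨾ p = p

_⨾≡_ : ∀ {a b c} → a ≤ b → b ≡ c → a ≤ c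
p ⨾≡ refl = p

-- The form in which linear arithmetic is done throughout: known inequalities, multiplied by `scale`
-- and added by `⊕`, make up a' ≤ b', and the remaining equation is a polynomial identity for the
-- solver. Numerical multipliers at the call sites are the coefficients of this combination.
lin : ∀ {a b a' b'} → a' ≤ b' → b + a' ≡ a + b' → a ≤ b
lin {a} {b} {a'} {b'} h e = subst₂ _≤_
 (solve 2 (λ a a' → (:- a') :+ (a' :+ a) := a) refl a a')
 (cong (- a' +_) (sym (solve 2 (λ b a' → b :+ a' := a' :+ b) refl b a' ∙ solve 2 (λ b a' → a' :+ b := b :+ a') refl b a' ∙ e)) ∙
  solve 2 (λ b a' → :- a' :+ (b :+ a') := b) refl b a')
 (≤-refl { - a'} ⊕ lem)
 where
 lem : a' + a ≤ a + b'
 lem = subst (_≤ a + b') (solve 2 (λ a a' → a :+ a' := a' :+ a) refl a a') (≤-refl {a} ⊕ h)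

<⇒≤ : ∀ {a b} → a < b → a ≤ b
<⇒≤ {a} {b} p with ≤-total a b
... | inj₁ q = q
... | inj₂ q = ⊥-elim (<⇒≱ p q)

0≤1 : # 0 ≤ # 1
0≤1 = #-mono z≤n

#≥0 : ∀ n → # 0 ≤ # n
#≥0 n = #-mono z≤n

0≢1 : ¬ (# 1 ≤ # 0)
0≢1 p with #-cancel-≤ {1} {0} p
... | ()

#-pos : ∀ n → 1 N.≤ n → # 0 < # n
#-pos n p = ≰⇒> λ q → 0≢1 (#-mono p ⨾ q)

<-≤-trans : ∀ {a b c} → a < b → b ≤ c → a < c
<-≤-trans p q = ≰⇒> λ r → <⇒≱ p (q ⨾ r)

≤-<-trans : ∀ {a b c} → a ≤ b → b < c → a < c
≤-<-trans p q = ≰⇒> λ r → <⇒≱ q (r ⨾ p)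

*≥0 : ∀ {a b} → # 0 ≤ a → # 0 ≤ b → # 0 ≤ a * b
*≥0 {a} {b} p q = subst (_≤ a * b) (*0 a) (scale p q)

+≥0 : ∀ {a b} → # 0 ≤ a → # 0 ≤ b → # 0 ≤ a + b
+≥0 {a} {b} p q = subst (_≤ a + b) (solve 0 (κ 0 :+ κ 0 := κ 0) refl) (p ⊕ q)

sq-nonneg : ∀ a → # 0 ≤ a * a
sq-nonneg a with ≤-total (# 0) a
... | inj₁ p = *≥0 p p
... | inj₂ p = subst (# 0 ≤_) (solve 1 (λ a → (κ 0 :- a) :* (κ 0 :- a) := a :* a) refl a) (*≥0 q q)
 where
 q : # 0 ≤ # 0 - a
 q = lin p (solve 1 (λ a → (κ 0 :- a) :+ a := κ 0 :+ κ 0) refl a)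

*-pos : ∀ {a b} → # 0 < a → # 0 < b → # 0 < a * b
*-pos {a} {b} p q = ≰⇒> λ r → <⇒≱ q (scale-cancel p (r ⨾≡ *0˘ a))

scaleʳ : ∀ {k a b} → # 0 ≤ k → a ≤ b → a * k ≤ b * k
scaleʳ {k} {a} {b} h p = subst₂ _≤_ (*-comm k a) (*-comm k b) (scale h p)

*-mono : ∀ {a b c d} → # 0 ≤ c → # 0 ≤ b → a ≤ b → c ≤ d → a * c ≤ b * d
*-mono hc hb p q = scaleʳ hc p ⨾ scale hb q

inv-pos : ∀ n → 1 N.≤ n → # 0 < inv n
inv-pos n p = ≰⇒> λ q → 0≢1 (≡⇒≤ (sym (#-inv n p)) ⨾
  scale (#≥0 n) q ⨾≡ *0 (# n))

≤-sub : ∀ {a b} → # 0 ≤ b - a → a ≤ b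
≤-sub {a} {b} h = lin h (solve 2 (λ a b → b :+ κ 0 := a :+ (b :- a)) refl a b)

sub-nonneg : ∀ {a b} → a ≤ b → # 0 ≤ b - a
sub-nonneg {a} {b} h = lin h (solve 2 (λ a b → (b :- a) :+ a := κ 0 :+ b) refl a b)

infixr 8 _^_
_^_ : 𝔽 → ℕ → 𝔽
a ^ zero = # 1
a ^ suc n = a * a ^ n

-- Finite sums, indicators and intervals of integers

∑ : ∀ {A : Set} → List A → (A → 𝔽) → 𝔽
∑ [] f = # 0
∑ (x ∷ xs) f = f x + ∑ xs f

module _ {A : Set} where

 ∑-cong : ∀ (xs : List A) {f g} → (∀ x → x ∈ xs → f x ≡ g x) → ∑ xs f ≡ ∑ xs g
 ∑-cong [] h = refl
 ∑-cong (x ∷ xs) h = cong₂ _+_ (h x (here refl)) (∑-cong xs λ y p → h y (there p))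

 ∑-ext : ∀ (xs : List A) {f g} → (∀ x → f x ≡ g x) → ∑ xs f ≡ ∑ xs g
 ∑-ext xs h = ∑-cong xs λ x _ → h x

 ∑-mono : ∀ (xs : List A) {f g} → (∀ x → x ∈ xs → f x ≤ g x) → ∑ xs f ≤ ∑ xs g
 ∑-mono [] h = ≤-refl
 ∑-mono (x ∷ xs) h = h x (here refl) ⊕ ∑-mono xs λ y p → h y (there p)

 ∑-+ : ∀ (xs : List A) f g → ∑ xs (λ x → f x + g x) ≡ ∑ xs f + ∑ xs g
 ∑-+ [] f g = solve 0 (κ 0 := κ 0 :+ κ 0) refl
 ∑-+ (x ∷ xs) f g = cong (f x + g x +_) (∑-+ xs f g) ∙
  solve 4 (λ a b c d → a :+ b :+ (c :+ d) := a :+ c :+ (b :+ d)) refl _ _ _ _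

 ∑-scale : ∀ (xs : List A) k f → ∑ xs (λ x → k * f x) ≡ k * ∑ xs f
 ∑-scale [] k f = *0˘ k
 ∑-scale (x ∷ xs) k f = cong (k * f x +_) (∑-scale xs k f) ∙
  solve 3 (λ a b c → a :* b :+ a :* c := a :* (b :+ c)) refl _ _ _

 ∑-scaleʳ : ∀ (xs : List A) k f → ∑ xs (λ x → f x * k) ≡ ∑ xs f * k
 ∑-scaleʳ xs k f = (∑-ext xs λ x → *-comm (f x) k) ∙
  ∑-scale xs k f ∙ *-comm k (∑ xs f)

 ∑-0 : ∀ (xs : List A) → ∑ xs (λ _ → # 0) ≡ # 0
 ∑-0 [] = refl
 ∑-0 (x ∷ xs) = cong (# 0 +_) (∑-0 xs) ∙ solve 0 (κ 0 :+ κ 0 := κ 0) refl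

 ∑≥0 : ∀ (xs : List A) {f} → (∀ x → x ∈ xs → # 0 ≤ f x) → # 0 ≤ ∑ xs f
 ∑≥0 xs {f} h = subst (_≤ ∑ xs f) (∑-0 xs) (∑-mono xs h)

 ∑-zero : ∀ (xs : List A) {f} → (∀ x → x ∈ xs → f x ≡ # 0) → ∑ xs f ≡ # 0
 ∑-zero xs h = ∑-cong xs h ∙ ∑-0 xs

 ∑-++ : ∀ (xs ys : List A) f → ∑ (xs ++ ys) f ≡ ∑ xs f + ∑ ys f
 ∑-++ [] ys f = 0+˘ _
 ∑-++ (x ∷ xs) ys f = cong (f x +_) (∑-++ xs ys f) ∙
  solve 3 (λ a b c → a :+ (b :+ c) := a :+ b :+ c) refl _ _ _

 ∑-const : ∀ (xs : List A) c → ∑ xs (λ _ → c) ≡ # (length xs) * c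
 ∑-const [] c = 0*˘ c
 ∑-const (x ∷ xs) c = cong (c +_) (∑-const xs c) ∙
  solve 2 (λ c n → c :+ n :* c := (κ 1 :+ n) :* c) refl c _ ∙ cong (_* c) (sym (#-+ 1 (length xs)))

 ∑-term : ∀ (xs : List A) {f} → (∀ x → x ∈ xs → # 0 ≤ f x) → ∀ {x} → x ∈ xs → f x ≤ ∑ xs f
 ∑-term (x ∷ xs) {f} h (here refl) = lin (∑≥0 xs (λ y p → h y (there p))) (solve 2 (λ a b → a :+ b :+ κ 0 := a :+ b) refl (f x) (∑ xs f))
 ∑-term (y ∷ xs) {f} h {x} (there p) = lin (h y (here refl) ⊕ ∑-term xs (λ y p → h y (there p)) p)
  (solve 3 (λ a b c → a :+ b :+ (κ 0 :+ c) := c :+ (a :+ b)) refl (f y) (∑ xs f) (f x))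

 ∑-filter : ∀ {P : A → Set} (P? : ∀ x → Dec (P x)) (xs : List A) f → ∑ (filter P? xs) f ≡ ∑ xs (λ x → if ⌊ P? x ⌋ then f x else # 0)
 ∑-filter P? [] f = refl
 ∑-filter P? (x ∷ xs) f with P? x
 ... | yes _ = cong (f x +_) (∑-filter P? xs f)
 ... | no _ = ∑-filter P? xs f ∙ 0+˘ _

 pos-term : ∀ (xs : List A) f → # 0 < ∑ xs f → ∃ λ x → x ∈ xs × # 0 < f x
 pos-term [] f p = contradiction ≤-refl (<⇒≱ p)
 pos-term (x ∷ xs) f p with f x ≤? # 0
 ... | no q = x , here refl , ≰⇒> q
 ... | yes q with pos-term xs f (≰⇒> λ r → <⇒≱ p (lin (q ⊕ r) (solve 2 (λ a b → κ 0 :+ (a :+ b) := a :+ b :+ (κ 0 :+ κ 0)) refl _ _)))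
 ... | y , m , s = y , there m , s

∑-map : ∀ {A B : Set} (h : A → B) (xs : List A) f → ∑ (map h xs) f ≡ ∑ xs (f ∘ h)
∑-map h [] f = refl
∑-map h (x ∷ xs) f = cong (f (h x) +_) (∑-map h xs f)

∑-swap : ∀ {A B : Set} (xs : List A) (ys : List B) (f : A → B → 𝔽) →
     ∑ xs (λ x → ∑ ys (f x)) ≡ ∑ ys (λ y → ∑ xs (λ x → f x y))
∑-swap [] ys f = sym (∑-0 ys)
∑-swap (x ∷ xs) ys f = cong (∑ ys (f x) +_) (∑-swap xs ys f) ∙ sym (∑-+ ys (f x) _)

𝟙 : Bool → 𝔽
𝟙 b = if b then # 1 else # 0

𝟙≥0 : ∀ b → # 0 ≤ 𝟙 b
𝟙≥0 true = 0≤1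
𝟙≥0 false = ≤-refl

𝟙≤1 : ∀ b → 𝟙 b ≤ # 1
𝟙≤1 true = ≤-refl
𝟙≤1 false = 0≤1

𝟙-mono : ∀ {a b} → (T a → T b) → 𝟙 a ≤ 𝟙 b
𝟙-mono {false} h = 𝟙≥0 _
𝟙-mono {true} {true} h = ≤-refl
𝟙-mono {true} {false} h = ⊥-elim (h tt)

𝟙-cong : ∀ {a b} → (T a → T b) → (T b → T a) → 𝟙 a ≡ 𝟙 b
𝟙-cong h k = ≤-antisym (𝟙-mono h) (𝟙-mono k)

𝟙-true : ∀ {a} → T a → 𝟙 a ≡ # 1
𝟙-true {true} _ = refl

𝟙-false : ∀ {a} → ¬ T a → 𝟙 a ≡ # 0
𝟙-false {false} _ = refl
𝟙-false {true} h = ⊥-elim (h tt)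

𝟙-∧ : ∀ a b → 𝟙 (a ∧ b) ≡ 𝟙 a * 𝟙 b
𝟙-∧ true b = 1*˘ (𝟙 b)
𝟙-∧ false b = 0*˘ (𝟙 b)

𝟙-idem : ∀ a → 𝟙 a * 𝟙 a ≡ 𝟙 a
𝟙-idem true = solve 0 (κ 1 :* κ 1 := κ 1) refl
𝟙-idem false = solve 0 (κ 0 :* κ 0 := κ 0) refl

∧⁺ : ∀ {a b} → T a → T b → T (a ∧ b)
∧⁺ {true} _ q = q

∧⁻ : ∀ {a b} → T (a ∧ b) → T a × T b
∧⁻ {true} q = tt , q

⌊⌋⁺ : ∀ {P : Set} {d : Dec P} → P → T ⌊ d ⌋
⌊⌋⁺ {d = d} = fromWitness {a? = d}

⌊⌋⁻ : ∀ {P : Set} {d : Dec P} → T ⌊ d ⌋ → P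
⌊⌋⁻ {d = d} = toWitness {a? = d}

if-𝟙 : ∀ b x → (if b then x else # 0) ≡ 𝟙 b * x
if-𝟙 true x = 1*˘ x
if-𝟙 false x = 0*˘ x

length-filterᵇ : ∀ {A : Set} (P : A → Bool) xs → # (length (filterᵇ P xs)) ≡ ∑ xs (𝟙 ∘ P)
length-filterᵇ P [] = refl
length-filterᵇ P (x ∷ xs) with P x
... | true = #-+ 1 _ ∙ cong (# 1 +_) (length-filterᵇ P xs)
... | false = length-filterᵇ P xs ∙ 0+˘ _

abstract
 -- An opaque copy of `range`, so that intervals with huge end points are not unfolded into lists.
 rg : ℕ → ℕ → List ℕ
 rg = range

 rg≡range : ∀ a b → rg a b ≡ range a b
 rg≡range a b = refl

 unique-rg : ∀ a b → Unique (rg a b)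
 unique-rg a b = Unique.map⁺ (N.+-cancelˡ-≡ a _ _) (Unique.upTo⁺ (b ∸ a))

 length-rg : ∀ a b → length (rg a b) ≡ b ∸ a
 length-rg a b = List.length-map _ (upTo (b ∸ a)) ∙ List.length-upTo (b ∸ a)

 range-suc : ∀ {a b} → a N.≤ b → rg a (suc b) ≡ rg a b ++ (b ∷ [])
 range-suc {a} {b} p rewrite N.+-∸-assoc 1 p =
  cong (map (λ t → a N.+ t)) (sym (List.upTo-∷ʳ (b ∸ a))) ∙ List.map-++ (λ t → a N.+ t) (upTo (b ∸ a)) _ ∙ cong (λ z → range a b ++ (z ∷ [])) (N.m+[n∸m]≡n p)

 range-nil : ∀ {a b} → b N.≤ a → rg a b ≡ []
 range-nil p rewrite N.m≤n⇒m∸n≡0 p = refl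

range-ind : ∀ {a} (P : ℕ → Set) → (∀ b → b N.≤ a → P b) → (∀ b → a N.≤ b → P b → P (suc b)) → ∀ b → P b
range-ind {a} P base step zero = base zero z≤n
range-ind {a} P base step (suc b) with a N.≤? b
... | yes p = step b p (range-ind P base step b)
... | no p = base (suc b) (N.≰⇒> p)

∑-suc : ∀ {a b} → a N.≤ b → ∀ f → ∑ (rg a (suc b)) f ≡ ∑ (rg a b) f + f b
∑-suc {a} {b} p f rewrite range-suc p = ∑-++ (rg a b) (b ∷ []) f ∙ cong (∑ (rg a b) f +_) (+0 _)

∑-nil : ∀ {a b} → b N.≤ a → ∀ f → ∑ (rg a b) f ≡ # 0
∑-nil p f rewrite range-nil p = refl

∈-range⁻ : ∀ {a b x} → x ∈ rg a b → a N.≤ x × x N.< b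
∈-range⁻ {a} {b} {x} = range-ind {a} (λ b → x ∈ rg a b → a N.≤ x × x N.< b)
 (λ b p m → case subst (x ∈_) (range-nil p) m of λ ()) step b
 where
 step : ∀ b → a N.≤ b → (x ∈ rg a b → a N.≤ x × x N.< b) → x ∈ rg a (suc b) → a N.≤ x × x N.< suc b
 step b p ih m with ∈-++⁻ (rg a b) (subst (x ∈_) (range-suc p) m)
 ... | inj₁ q = π₁ (ih q) , N.m<n⇒m<1+n (π₂ (ih q))
 ... | inj₂ (here refl) = p , N.≤-refl

∈-range⁺ : ∀ {a b x} → a N.≤ x → x N.< b → x ∈ rg a b
∈-range⁺ {a} {b} {x} p q = range-ind {a} (λ b → x N.< b → x ∈ rg a b)
 (λ b r s → ⊥-elim (N.<⇒≱ s (r ⨟ p))) step b q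
 where
 step : ∀ b → a N.≤ b → (x N.< b → x ∈ rg a b) → x N.< suc b → x ∈ rg a (suc b)
 step b r ih (s≤s s) with N.m≤n⇒m<n∨m≡n s
 ... | inj₁ l = subst (x ∈_) (sym (range-suc r)) (∈-++⁺ˡ (ih l))
 ... | inj₂ refl = subst (x ∈_) (sym (range-suc r)) (∈-++⁺ʳ (rg a x) (here refl))

∑-split : ∀ {a b} c → a N.≤ b → b N.≤ c → ∀ f → ∑ (rg a c) f ≡ ∑ (rg a b) f + ∑ (rg b c) f
∑-split {a} {b} c p q f = range-ind {b} (λ c → b N.≤ c → ∑ (rg a c) f ≡ ∑ (rg a b) f + ∑ (rg b c) f)
 base step c q
 where
 base : ∀ c → c N.≤ b → b N.≤ c → ∑ (rg a c) f ≡ ∑ (rg a b) f + ∑ (rg b c) f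
 base c r s with N.≤-antisym r s
 ... | refl = +0˘ _ ∙ cong (∑ (rg a c) f +_) (sym (∑-nil r f))
 step : ∀ c → b N.≤ c → (b N.≤ c → ∑ (rg a c) f ≡ ∑ (rg a b) f + ∑ (rg b c) f) → b N.≤ suc c → ∑ (rg a (suc c)) f ≡ ∑ (rg a b) f + ∑ (rg b (suc c)) f
 step c r ih _ = ∑-suc (p ⨟ r) f ∙ cong (_+ f c) (ih r) ∙ solve 3 (λ x y z → x :+ y :+ z := x :+ (y :+ z)) refl _ _ _ ∙ cong (∑ (rg a b) f +_) (sym (∑-suc r f))

∑-subrange : ∀ {a b c d} → c N.≤ a → b N.≤ d → ∀ {f} → (∀ x → # 0 ≤ f x) → ∑ (rg a b) f ≤ ∑ (rg c d) f
∑-subrange {a} {b} {c} {d} p q {f} h with N.≤-total a b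
... | inj₂ r = ∑-nil r f ≡⨾ (∑≥0 (rg c d) λ x _ → h x)
... | inj₁ r = lin (∑≥0 (rg c a) (λ x _ → h x) ⊕ ∑≥0 (rg b d) (λ x _ → h x))
   (solve 3 (λ x y z → x :+ y :+ z :+ (κ 0 :+ κ 0) := y :+ (x :+ z)) refl (∑ (rg c a) f) (∑ (rg a b) f) (∑ (rg b d) f)) ⨾
  ≡⇒≤ (sym (∑-split d (p ⨟ r) q f ∙ cong (_+ ∑ (rg b d) f) (∑-split b p r f)))

∑-shift : ∀ a b k f → ∑ (rg (k N.+ a) (k N.+ b)) f ≡ ∑ (rg a b) (λ x → f (k N.+ x))
∑-shift a b k f = range-ind {a} (λ b → ∑ (rg (k N.+ a) (k N.+ b)) f ≡ ∑ (rg a b) (λ x → f (k N.+ x)))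
 (λ b p → ∑-nil (N.+-monoʳ-≤ k p) f ∙ sym (∑-nil p _))
 (λ b p ih → cong (λ z → ∑ (rg (k N.+ a) z) f) (N.+-suc k b) ∙ ∑-suc (N.+-monoʳ-≤ k p) f ∙ cong (_+ f (k N.+ b)) ih ∙ sym (∑-suc p _)) b

#-suc : ∀ n → # (suc n) ≡ # 1 + # n
#-suc n = #-+ 1 n

Abs≤ : 𝔽 → 𝔽 → Set
Abs≤ a b = (- b ≤ a) × (a ≤ b)

Abs≤-+ : ∀ {a b c d} → Abs≤ a b → Abs≤ c d → Abs≤ (a + c) (b + d)
Abs≤-+ {a} {b} {c} {d} (p , q) (r , s) = lin (p ⊕ r) (solve 4 (λ a b c d → a :+ c :+ (:- b :+ :- d) := :- (b :+ d) :+ (a :+ c)) refl a b c d) , q ⊕ s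

Abs≤-neg : ∀ {a b} → Abs≤ a b → Abs≤ (- a) b
Abs≤-neg {a} {b} (p , q) = lin q (solve 2 (λ a b → :- a :+ a := :- b :+ b) refl a b) , lin p (solve 2 (λ a b → b :+ :- b := :- a :+ a) refl a b)

Abs≤-scale : ∀ {k a b} → # 0 ≤ k → Abs≤ a b → Abs≤ (k * a) (k * b)
Abs≤-scale {k} {a} {b} h (p , q) = solve 2 (λ k b → :- (k :* b) := k :* (:- b)) refl k b ≡⨾ scale h p , scale h q

Abs≤-weaken : ∀ {a b c} → b ≤ c → Abs≤ a b → Abs≤ a c
Abs≤-weaken {a} {b} {c} h (p , q) = lin h (solve 2 (λ b c → :- b :+ b := :- c :+ c) refl b c) ⨾ p , q ⨾ h

Abs≤-nonneg : ∀ {a b} → Abs≤ a b → # 0 ≤ b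
Abs≤-nonneg {a} {b} (p , q) with ≤-total (# 0) b
... | inj₁ r = r
... | inj₂ r = lin r (solve 1 (λ b → :- b :+ b := κ 0 :+ κ 0) refl b) ⨾ p ⨾ q

Abs≤-∑ : ∀ {A : Set} (xs : List A) {f g} → (∀ x → x ∈ xs → Abs≤ (f x) (g x)) → Abs≤ (∑ xs f) (∑ xs g)
Abs≤-∑ [] h = ≡⇒≤ (solve 0 (:- κ 0 := κ 0) refl) , ≤-refl
Abs≤-∑ (x ∷ xs) h = Abs≤-+ (h x (here refl)) (Abs≤-∑ xs λ y p → h y (there p))

Abs≤-0 : ∀ {b} → # 0 ≤ b → Abs≤ (# 0) b
Abs≤-0 {b} h = lin h (solve 1 (λ b → κ 0 :+ κ 0 := :- b :+ b) refl b) , h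

-- Operators on functions of the size of a divisor

-- The binary length. It rounds up, so that n < 2^(lg n), and a set of primes of total length x has
-- a product of at most 2^x. For p ≥ 2^V it exceeds log₂ p by a factor of at most (V + 1)/V.
lg : ℕ → ℕ
lg n = suc ⌊log₂ n ⌋

shift : ℕ → (ℕ → 𝔽) → ℕ → 𝔽
shift v F x = F (x N.+ v)

tilt : 𝔽 → ℕ → (ℕ → 𝔽) → ℕ → 𝔽
tilt k v F x = F x + k * F (x N.+ v)

-- Op c ps F x is the sum of (∏_{p ∈ D} c p) F (x + ∑_{p ∈ D} lg p) over all D ⊆ ps.
Op : (ℕ → 𝔽) → List ℕ → (ℕ → 𝔽) → ℕ → 𝔽
Op c [] F = F
Op c (p ∷ ps) F = tilt (c p) (lg p) (Op c ps F)

Antitone : (ℕ → 𝔽) → Set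
Antitone F = ∀ {x y} → x N.≤ y → F y ≤ F x

Supp : ℕ → (ℕ → 𝔽) → Set
Supp K F = ∀ {x} → K N.≤ x → F x ≡ # 0

tilt-ext : ∀ {F G : ℕ → 𝔽} k v → (∀ x → F x ≡ G x) → ∀ x → tilt k v F x ≡ tilt k v G x
tilt-ext k v h x = cong₂ (λ a b → a + k * b) (h x) (h (x N.+ v))

Op-ext : ∀ c ps {F G} → (∀ x → F x ≡ G x) → ∀ x → Op c ps F x ≡ Op c ps G x
Op-ext c [] h = h
Op-ext c (p ∷ ps) h = tilt-ext (c p) (lg p) (Op-ext c ps h)

Op-cong : ∀ {c c'} ps → (∀ p → p ∈ ps → c p ≡ c' p) → ∀ F x → Op c ps F x ≡ Op c' ps F x
Op-cong [] h F x = refl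
Op-cong (p ∷ ps) h F x rewrite h p (here refl) = tilt-ext _ (lg p) (Op-cong ps (λ q m → h q (there m)) F) x

+-swap : ∀ x u v → x N.+ u N.+ v ≡ x N.+ v N.+ u
+-swap x u v = N.+-assoc x u v ∙ cong (x N.+_) (N.+-comm u v) ∙ sym (N.+-assoc x v u)

Op-shift : ∀ c ps F v x → Op c ps (shift v F) x ≡ Op c ps F (x N.+ v)
Op-shift c [] F v x = refl
Op-shift c (p ∷ ps) F v x = cong₂ (λ a b → a + c p * b) (Op-shift c ps F v x)
 (Op-shift c ps F v (x N.+ lg p) ∙ cong (Op c ps F) (+-swap x (lg p) v))

Op-lin : ∀ c ps a b F G x → Op c ps (λ x → a * F x + b * G x) x ≡ a * Op c ps F x + b * Op c ps G x
Op-lin c [] a b F G x = refl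
Op-lin c (p ∷ ps) a b F G x = cong₂ (λ y z → y + c p * z) (Op-lin c ps a b F G x) (Op-lin c ps a b F G (x N.+ lg p)) ∙
 solve 7 (λ a b k f g f' g' → a :* f :+ b :* g :+ k :* (a :* f' :+ b :* g') := a :* (f :+ k :* f') :+ b :* (g :+ k :* g')) refl
   a b (c p) _ _ _ _

Op-tilt : ∀ c ps k v F x → Op c ps (tilt k v F) x ≡ tilt k v (Op c ps F) x
Op-tilt c ps k v F x = Op-ext c ps (λ x → solve 3 (λ a k b → a :+ k :* b := κ 1 :* a :+ k :* b) refl (F x) k (F (x N.+ v))) x ∙
 Op-lin c ps (# 1) k F (shift v F) x ∙ cong (λ z → # 1 * Op c ps F x + k * z) (Op-shift c ps F v x) ∙
  solve 3 (λ a k b → κ 1 :* a :+ k :* b := a :+ k :* b) refl (Op c ps F x) k _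

module _ {c : ℕ → 𝔽} where

 Op-mono : ∀ ps → (∀ p → p ∈ ps → # 0 ≤ c p) → ∀ {F G} → (∀ x → F x ≤ G x) → ∀ x → Op c ps F x ≤ Op c ps G x
 Op-mono [] hc h = h
 Op-mono (p ∷ ps) hc h x = Op-mono ps hc' h x ⊕ scale (hc p (here refl)) (Op-mono ps hc' h (x N.+ lg p))
  where hc' = λ q m → hc q (there m)

 Op-nonneg : ∀ ps → (∀ p → p ∈ ps → # 0 ≤ c p) → ∀ {F} → (∀ x → # 0 ≤ F x) → ∀ x → # 0 ≤ Op c ps F x
 Op-nonneg [] hc h = h
 Op-nonneg (p ∷ ps) hc h x = +≥0 (Op-nonneg ps hc' h x) (*≥0 (hc p (here refl)) (Op-nonneg ps hc' h (x N.+ lg p)))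
  where hc' = λ q m → hc q (there m)

 Op-antitone : ∀ ps → (∀ p → p ∈ ps → # 0 ≤ c p) → ∀ {F} → Antitone F → Antitone (Op c ps F)
 Op-antitone [] hc h = h
 Op-antitone (p ∷ ps) hc h q = Op-antitone ps hc' h q ⊕ scale (hc p (here refl)) (Op-antitone ps hc' h (N.+-monoˡ-≤ (lg p) q))
  where hc' = λ q m → hc q (there m)

 Op-supp : ∀ ps {K F} → Supp K F → Supp K (Op c ps F)
 Op-supp [] h = h
 Op-supp (p ∷ ps) h {x} q = cong₂ (λ a b → a + c p * b) (Op-supp ps h q) (Op-supp ps h (q ⨟ N.m≤m+n x (lg p))) ∙
  solve 1 (λ k → κ 0 :+ k :* κ 0 := κ 0) refl (c p)

-- The quadratic form of the sieve weights

lsum : List ℕ → ℕ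
lsum [] = 0
lsum (p ∷ D) = lg p N.+ lsum D

∏ : (ℕ → 𝔽) → List ℕ → 𝔽
∏ g [] = # 1
∏ g (p ∷ D) = g p * ∏ g D

-- The sum of c^|D| e(D) over D ⊆ ps with m + lsum D < K; `m` is the length used up by primes
-- treated earlier.
SumSub : ℕ → ℕ → List ℕ → (List ℕ → 𝔽) → ℕ → 𝔽
SumSub K c [] e m = 𝟙 (m N.<ᵇ K) * e []
SumSub K c (p ∷ ps) e m = SumSub K c ps e m + # c * SumSub K c ps (e ∘ (p ∷_)) (m N.+ lg p)

SumSub-nonneg : ∀ K c ps {e} m → (∀ D → # 0 ≤ e D) → # 0 ≤ SumSub K c ps e m
SumSub-nonneg K c [] m h = *≥0 (𝟙≥0 _) (h [])
SumSub-nonneg K c (p ∷ ps) m h = +≥0 (SumSub-nonneg K c ps m h) (*≥0 (#≥0 c) (SumSub-nonneg K c ps _ (λ D → h (p ∷ D))))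

-- The diagonalised form: over R ⊆ ps, sum ρ(R) times the square of the sum of δ(D) F(lsum R + lsum
-- D) over the D ⊆ ps disjoint from R.
Mq : (δ ρ : ℕ → 𝔽) → List ℕ → (ℕ → 𝔽) → 𝔽
Mq δ ρ [] F = F 0 * F 0
Mq δ ρ (p ∷ ps) F = Mq δ ρ ps (tilt (δ p) (lg p) F) + ρ p * Mq δ ρ ps (shift (lg p) F)

Mq-ext : ∀ δ ρ ps {F G} → (∀ x → F x ≡ G x) → Mq δ ρ ps F ≡ Mq δ ρ ps G
Mq-ext δ ρ [] h = cong₂ _*_ (h 0) (h 0)
Mq-ext δ ρ (p ∷ ps) h = cong₂ _+_ (Mq-ext δ ρ ps (tilt-ext (δ p) (lg p) h)) (cong (ρ p *_) (Mq-ext δ ρ ps λ x → h (x N.+ lg p)))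

-- When δ vanishes only D = ∅ is left inside each square.
Mq-diagonal : ∀ δ ρ ps → (∀ p → p ∈ ps → δ p ≡ # 0) → ∀ F → Mq δ ρ ps F ≡ Op ρ ps (λ x → F x * F x) 0
Mq-diagonal δ ρ [] h F = refl
Mq-diagonal δ ρ (p ∷ ps) h F with δ p | h p (here refl)
... | _ | refl = cong₂ (λ a b → a + ρ p * b)
  ((Mq-ext δ ρ ps λ x → solve 2 (λ a b → a :+ κ 0 :* b := a) refl (F x) _) ∙ Mq-diagonal δ ρ ps h' F)
  (Mq-diagonal δ ρ ps h' (shift (lg p) F) ∙ Op-shift ρ ps (λ x → F x * F x) (lg p) 0)
 where h' = λ q i → h q (there i)

module QuadraticForm (k t : ℕ → 𝔽) where

 -- Mn g is the mean value of the form when divisor D has density ∏_{p ∈ D} g p.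
 Mn : (ℕ → 𝔽) → List ℕ → (ℕ → 𝔽) → (ℕ → 𝔽) → 𝔽
 Mn g [] F G = F 0 * G 0
 Mn g (p ∷ ps) F G = Mn g ps F' G' - t p * g p * Mn g ps F' EG - t p * g p * Mn g ps EF G' + t p * t p * g p * Mn g ps EF EG
  where
  F' = tilt (k p) (lg p) F
  G' = tilt (k p) (lg p) G
  EF = shift (lg p) F
  EG = shift (lg p) G

 Mn-ext : ∀ g ps {F F' G G'} → (∀ x → F x ≡ F' x) → (∀ x → G x ≡ G' x) → Mn g ps F G ≡ Mn g ps F' G'
 Mn-ext g [] h j = cong₂ _*_ (h 0) (j 0)
 Mn-ext g (p ∷ ps) {F} {F'} {G} {G'} h j = cong₂ _+_ (cong₂ _-_ (cong₂ _-_ (Mn-ext g ps hF hG)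
   (cong (t p * g p *_) (Mn-ext g ps hF (λ x → j (x N.+ lg p)))))
   (cong (t p * g p *_) (Mn-ext g ps (λ x → h (x N.+ lg p)) hG)))
   (cong (t p * t p * g p *_) (Mn-ext g ps (λ x → h (x N.+ lg p)) (λ x → j (x N.+ lg p))))
  where
  hF = tilt-ext (k p) (lg p) h
  hG = tilt-ext (k p) (lg p) j

 private
  comb : 𝔽 → (ℕ → 𝔽) → (ℕ → 𝔽) → ℕ → 𝔽
  comb a F G x = F x + a * G x

  tilt-comb : ∀ b v a F G x → tilt b v (comb a F G) x ≡ comb a (tilt b v F) (tilt b v G) x
  tilt-comb b v a F G x = solve 6 (λ a b f f' g g' → f :+ a :* g :+ b :* (f' :+ a :* g') := f :+ b :* f' :+ a :* (g :+ b :* g')) refl a b _ _ _ _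

 Mn-linˡ : ∀ g ps a F G H → Mn g ps (λ x → F x + a * G x) H ≡ Mn g ps F H + a * Mn g ps G H
 Mn-linˡ g [] a F G H = solve 4 (λ a f g h → (f :+ a :* g) :* h := f :* h :+ a :* (g :* h)) refl a (F 0) (G 0) (H 0)
 Mn-linˡ g (p ∷ ps) a F G H = cong₂ _+_ (cong₂ _-_ (cong₂ _-_ (l₁ H') (cong (t p * g p *_) (l₁ EH)))
   (cong (t p * g p *_) (Mn-linˡ g ps a (shift v F) (shift v G) H'))) (cong (t p * t p * g p *_) (Mn-linˡ g ps a (shift v F) (shift v G) EH)) ∙
   solve 11 (λ a m n x y z w x' y' z' w' →
    (x :+ a :* x') :- m :* (y :+ a :* y') :- m :* (z :+ a :* z') :+ n :* (w :+ a :* w') :=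
    (x :- m :* y :- m :* z :+ n :* w) :+ a :* (x' :- m :* y' :- m :* z' :+ n :* w')) refl
    a (t p * g p) (t p * t p * g p) _ _ _ _ _ _ _ _
  where
  v = lg p
  H' = tilt (k p) v H
  EH = shift v H
  l₁ : ∀ J → Mn g ps (tilt (k p) v (comb a F G)) J ≡ Mn g ps (tilt (k p) v F) J + a * Mn g ps (tilt (k p) v G) J
  l₁ J = Mn-ext g ps (tilt-comb (k p) v a F G) (λ _ → refl) ∙ Mn-linˡ g ps a _ _ J

 Mn-comm : ∀ g ps F G → Mn g ps F G ≡ Mn g ps G F
 Mn-comm g [] F G = *-comm _ _
 Mn-comm g (p ∷ ps) F G = cong₂ _+_ (cong₂ _-_ (cong₂ _-_ (Mn-comm g ps _ _) (cong (t p * g p *_) (Mn-comm g ps _ _)))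
   (cong (t p * g p *_) (Mn-comm g ps _ _))) (cong (t p * t p * g p *_) (Mn-comm g ps _ _)) ∙
   solve 4 (λ x y z w → x :- y :- z :+ w := x :- z :- y :+ w) refl _ _ _ _

 Mn-linʳ : ∀ g ps a F G H → Mn g ps H (λ x → F x + a * G x) ≡ Mn g ps H F + a * Mn g ps H G
 Mn-linʳ g ps a F G H = Mn-comm g ps H _ ∙ Mn-linˡ g ps a F G H ∙ cong₂ (λ x y → x + a * y) (Mn-comm g ps F H) (Mn-comm g ps G H)

 -- Completing the square at each prime. With m = t g the two mixed terms are absorbed by replacing
 -- F' by F' - m EF, so δ is the mean k - t g of the factor k - t h; what is left over is t² g - m²
 -- = t² g (1 - g), its variance.
 Mn-diagonal : ∀ g δ ρ ps → (∀ p → p ∈ ps → δ p ≡ k p - t p * g p × ρ p ≡ t p * t p * g p * (# 1 - g p)) →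
        ∀ F → Mn g ps F F ≡ Mq δ ρ ps F
 Mn-diagonal g δ ρ [] h F = refl
 Mn-diagonal g δ ρ (p ∷ ps) h F with δ p | ρ p | h p (here refl)
 ... | _ | _ | refl , refl = begin
   Mn g ps F' F' - m * Mn g ps F' EF - m * Mn g ps EF F' + t p * t p * g p * Mn g ps EF EF
    ≡⟨ solve 6 (λ T q x y z w → x :- T :* q :* y :- T :* q :* z :+ T :* T :* q :* w :=
       (x :+ (:- (T :* q)) :* y :+ (:- (T :* q)) :* (z :+ (:- (T :* q)) :* w)) :+ T :* T :* q :* (κ 1 :- q) :* w) refl (t p) (g p) _ _ _ _ ⟩
   (Mn g ps F' F' + (- m) * Mn g ps F' EF + (- m) * (Mn g ps EF F' + (- m) * Mn g ps EF EF)) + r * Mn g ps EF EF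
    ≡⟨ cong (_+ r * Mn g ps EF EF) (sym (cong₂ (λ x y → x + (- m) * y) (Mn-linʳ g ps (- m) F' EF F') (Mn-linʳ g ps (- m) F' EF EF))) ⟩
   (Mn g ps F' F″ + (- m) * Mn g ps EF F″) + r * Mn g ps EF EF
    ≡⟨ cong (_+ r * Mn g ps EF EF) (sym (Mn-linˡ g ps (- m) F' EF F″)) ⟩
   Mn g ps F″ F″ + r * Mn g ps EF EF
    ≡⟨ cong₂ _+_ (Mn-ext g ps e e ∙ Mn-diagonal g δ ρ ps h' _) (cong (r *_) (Mn-diagonal g δ ρ ps h' _)) ⟩
   Mq δ ρ ps (tilt (k p - m) (lg p) F) + r * Mq δ ρ ps EF ∎
  where
  open ≡-Reasoning
  m = t p * g p
  r = t p * t p * g p * (# 1 - g p)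
  F' = tilt (k p) (lg p) F
  EF = shift (lg p) F
  F″ = λ x → F' x + (- m) * EF x
  h' = λ q i → h q (there i)
  e : ∀ x → F″ x ≡ tilt (k p - m) (lg p) F x
  e x = solve 4 (λ k m f f' → f :+ k :* f' :+ (:- m) :* f' := f :+ (k :- m) :* f') refl (k p) m _ _

 module Weights (h : ℕ → ℕ → 𝔽) where

  -- The sieve weight Λ(n), as the sum over D of F(lsum D) times the product of k - t h over D.
  -- Expanding these products and collecting the hits gives the usual form ∑ μ(d) λ(d).
  Lam : List ℕ → (ℕ → 𝔽) → ℕ → 𝔽
  Lam [] F n = F 0
  Lam (p ∷ ps) F n = Lam ps F n + (k p - t p * h p n) * Lam ps (shift (lg p) F) n

  Lam-lin : ∀ ps a F G n → Lam ps (λ x → F x + a * G x) n ≡ Lam ps F n + a * Lam ps G n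
  Lam-lin [] a F G n = refl
  Lam-lin (p ∷ ps) a F G n = cong₂ (λ x y → x + (k p - t p * h p n) * y) (Lam-lin ps a F G n) (Lam-lin ps a _ _ n) ∙
   solve 6 (λ a c f g f' g' → f :+ a :* g :+ c :* (f' :+ a :* g') := f :+ c :* f' :+ a :* (g :+ c :* g')) refl a _ _ _ _ _

  hits : List ℕ → ℕ → 𝔽
  hits D n = ∏ (λ p → h p n) D

  module _ {I : Set} (g : I → ℕ → 𝔽) (ns : List ℕ) (is : List I) where

   Form : List ℕ → (ℕ → 𝔽) → (ℕ → 𝔽) → (ℕ → 𝔽) → 𝔽
   Form ps F G w = ∑ ns λ n → w n * (Lam ps F n * Lam ps G n)

   -- Several multiplicative densities, indexed by `I`, are superposed because the density for n + h
   -- = q m depends on the smaller factor q.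
   Main : List ℕ → (ℕ → 𝔽) → (ℕ → 𝔽) → (I → 𝔽) → 𝔽
   Main ps F G X = ∑ is λ i → X i * Mn (g i) ps F G

   private
    -- Both factors at p are expanded. As h p n is 0 or 1, the three terms containing it carry the
    -- same weight w h, so they are again forms over the remaining primes.
    Form-step : ∀ p ps F G w → (∀ n → h p n * h p n ≡ h p n) → let F' = tilt (k p) (lg p) F ; G' = tilt (k p) (lg p) G ; w' = λ n → w n * h p n in
     Form (p ∷ ps) F G w ≡ Form ps F' G' w - t p * Form ps F' (shift (lg p) G) w' - t p * Form ps (shift (lg p) F) G' w'
       + t p * t p * Form ps (shift (lg p) F) (shift (lg p) G) w'
    Form-step p ps F G w idem = begin
     Form (p ∷ ps) F G w ≡⟨ ∑-ext ns pointwise ⟩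
     ∑ ns (λ n → A n + (- t p) * B n + ((- t p) * C n + (t p * t p) * D n)) ≡⟨ ∑-+ ns _ _ ⟩
     ∑ ns (λ n → A n + (- t p) * B n) + ∑ ns (λ n → (- t p) * C n + (t p * t p) * D n)
       ≡⟨ cong₂ _+_ (∑-+ ns A _ ∙ cong (∑ ns A +_) (∑-scale ns (- t p) B))
         (∑-+ ns _ _ ∙ cong₂ _+_ (∑-scale ns (- t p) C) (∑-scale ns (t p * t p) D)) ⟩
     ∑ ns A + (- t p) * ∑ ns B + ((- t p) * ∑ ns C + (t p * t p) * ∑ ns D)
       ≡⟨ solve 6 (λ t u a b c d → a :+ (:- t) :* b :+ ((:- t) :* c :+ u :* d) := a :- t :* b :- t :* c :+ u :* d) refl (t p) (t p * t p) _ _ _ _ ⟩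
     ∑ ns A - t p * ∑ ns B - t p * ∑ ns C + t p * t p * ∑ ns D ∎
     where
     open ≡-Reasoning
     v = lg p
     LF' = Lam ps (tilt (k p) v F)
     LG' = Lam ps (tilt (k p) v G)
     LEF = Lam ps (shift v F)
     LEG = Lam ps (shift v G)
     A B C D : ℕ → 𝔽
     A n = w n * (LF' n * LG' n)
     B n = w n * h p n * (LF' n * LEG n)
     C n = w n * h p n * (LEF n * LG' n)
     D n = w n * h p n * (LEF n * LEG n)
     factor : ∀ F n → Lam (p ∷ ps) F n ≡ Lam ps (tilt (k p) v F) n - t p * h p n * Lam ps (shift v F) n
     factor F n = solve 4 (λ a k m b → a :+ (k :- m) :* b := a :+ k :* b :- m :* b) refl (Lam ps F n) (k p) (t p * h p n) (Lam ps (shift v F) n) ∙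
       cong (_- t p * h p n * Lam ps (shift v F) n) (sym (Lam-lin ps (k p) F (shift v F) n))
     pointwise : ∀ n → w n * (Lam (p ∷ ps) F n * Lam (p ∷ ps) G n) ≡ A n + (- t p) * B n + ((- t p) * C n + (t p * t p) * D n)
     pointwise n = cong₂ (λ x y → w n * (x * y)) (factor F n) (factor G n) ∙
      solve 7 (λ w T H a b c d → w :* ((a :- T :* H :* c) :* (b :- T :* H :* d)) :=
        w :* (a :* b) :+ (:- T) :* (w :* H :* (a :* d)) :+ ((:- T) :* (w :* H :* (c :* b)) :+ (T :* T) :* (w :* (H :* H) :* (c :* d)))) refl
        (w n) (t p) (h p n) (LF' n) (LG' n) (LEF n) (LEG n) ∙
       cong (λ z → A n + (- t p) * B n + ((- t p) * C n + (t p * t p) * (w n * z * (LEF n * LEG n)))) (idem n)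

    Main-step : ∀ p ps F G X → let F' = tilt (k p) (lg p) F ; G' = tilt (k p) (lg p) G ; X' = λ i → X i * g i p in
     Main (p ∷ ps) F G X ≡ Main ps F' G' X - t p * Main ps F' (shift (lg p) G) X' - t p * Main ps (shift (lg p) F) G' X'
       + t p * t p * Main ps (shift (lg p) F) (shift (lg p) G) X'
    Main-step p ps F G X = begin
     Main (p ∷ ps) F G X ≡⟨ ∑-ext is (λ i → solve 7 (λ x T q a b c d → x :* (a :- T :* q :* b :- T :* q :* c :+ T :* T :* q :* d) :=
       x :* a :+ (:- T) :* (x :* q :* b) :+ ((:- T) :* (x :* q :* c) :+ (T :* T) :* (x :* q :* d))) refl (X i) (t p) (g i p) _ _ _ _) ⟩
     ∑ is (λ n → A n + (- t p) * B n + ((- t p) * C n + (t p * t p) * D n)) ≡⟨ ∑-+ is _ _ ⟩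
     ∑ is (λ n → A n + (- t p) * B n) + ∑ is (λ n → (- t p) * C n + (t p * t p) * D n)
       ≡⟨ cong₂ _+_ (∑-+ is A _ ∙ cong (∑ is A +_) (∑-scale is (- t p) B))
         (∑-+ is _ _ ∙ cong₂ _+_ (∑-scale is (- t p) C) (∑-scale is (t p * t p) D)) ⟩
     ∑ is A + (- t p) * ∑ is B + ((- t p) * ∑ is C + (t p * t p) * ∑ is D)
       ≡⟨ solve 6 (λ t u a b c d → a :+ (:- t) :* b :+ ((:- t) :* c :+ u :* d) := a :- t :* b :- t :* c :+ u :* d) refl (t p) (t p * t p) _ _ _ _ ⟩
     ∑ is A - t p * ∑ is B - t p * ∑ is C + t p * t p * ∑ is D ∎
     where
     open ≡-Reasoning
     v = lg p
     A B C D : I → 𝔽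
     A i = X i * Mn (g i) ps (tilt (k p) v F) (tilt (k p) v G)
     B i = X i * g i p * Mn (g i) ps (tilt (k p) v F) (shift v G)
     C i = X i * g i p * Mn (g i) ps (shift v F) (tilt (k p) v G)
     D i = X i * g i p * Mn (g i) ps (shift v F) (shift v G)

   -- Each shift of F by lg p shortens its support by lg p. The total shift made so far is `u`,
   -- which keeps `K` fixed through the induction.
   record Majorant (K u : ℕ) (F F̂ : ℕ → 𝔽) : Set where
    field
     bound : ∀ x → Abs≤ (F x) (F̂ x)
     anti : Antitone F̂
     supp : ∀ {x} → K N.≤ x N.+ u → F̂ x ≡ # 0

    nonneg : ∀ x → # 0 ≤ F̂ x
    nonneg x = Abs≤-nonneg (bound x)
   open Majorant

   private
    tiltM : ∀ {K u F F̂ p} → # 0 ≤ k p → Majorant K u F F̂ → Majorant K u (tilt (k p) (lg p) F) (tilt (k p) (lg p) F̂)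
    tiltM {p = p} hk M = record
     { bound = λ x → Abs≤-+ (bound M x) (Abs≤-scale hk (bound M (x N.+ lg p)))
     ; anti = λ q → anti M q ⊕ scale hk (anti M (N.+-monoˡ-≤ (lg p) q))
     ; supp = λ {x} q → trans (cong₂ (λ a b → a + k p * b) (supp M q) (supp M (q ⨟ N.+-monoˡ-≤ _ (N.m≤m+n x (lg p)))))
           (solve 1 (λ k → κ 0 :+ k :* κ 0 := κ 0) refl (k p)) }

    shiftM : ∀ {K u F F̂} v → Majorant K u F F̂ → Majorant K (v N.+ u) (shift v F) (shift v F̂)
    shiftM {u = u} v M = record
     { bound = λ x → bound M (x N.+ v)
     ; anti = λ q → anti M (N.+-monoˡ-≤ v q)
     ; supp = λ {x} q → supp M (q ⨟ reflexive (sym (N.+-assoc x v u))) }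

   -- Induction over the primes with the four forms of `Form-step`. The tilts are absorbed by
   -- applying `Op k` to the majorants, and a prime that enters D costs t + t + t² ≤ 8. Since the
   -- length of D is shared between the shifts `u` and `v`, only D of length below 2 K matter.
   Form-approx : ∀ K ps → (∀ p → p ∈ ps → # 0 ≤ k p × # 0 ≤ t p × t p ≤ # 2 × (∀ n → h p n * h p n ≡ h p n)) →
    ∀ {F F̂ G Ĝ u v m} w X e → Majorant K u F F̂ → Majorant K v G Ĝ → m N.≤ u N.+ v → (∀ D → # 0 ≤ e D) →
    (∀ D → D ⊆ ps → m N.+ lsum D N.< K N.+ K → Abs≤ (∑ ns (λ n → w n * hits D n) - ∑ is (λ i → X i * ∏ (g i) D)) (e D)) →
    Abs≤ (Form ps F G w - Main ps F G X) (Op k ps F̂ 0 * Op k ps Ĝ 0 * SumSub (K N.+ K) 8 ps e m)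
   Form-approx K [] hp {F} {F̂} {G} {Ĝ} {u} {v} {m} w X e MF MG m≤ e≥0 he with m N.<ᵇ (K N.+ K) in eq
   ... | true = subst₂ Abs≤ lhs (solve 2 (λ x y → x :* y := x :* (κ 1 :* y)) refl (F̂ 0 * Ĝ 0) (e []))
       (prodAbs (bound MF 0) (bound MG 0) (he [] [] (reflexive (cong suc (N.+-identityʳ m)) ⨟ N.<ᵇ⇒< m (K N.+ K) (subst T (sym eq) tt))))
    where
    lhs : F 0 * G 0 * (∑ ns (λ n → w n * # 1) - ∑ is (λ i → X i * # 1)) ≡ Form [] F G w - Main [] F G X
    lhs = solve 3 (λ f a b → f :* (a :- b) := a :* f :- b :* f) refl (F 0 * G 0) _ _ ∙
      cong₂ _-_ (sym (∑-scaleʳ ns (F 0 * G 0) _) ∙ (∑-ext ns λ n → solve 2 (λ a b → a :* κ 1 :* b := a :* b) refl (w n) (F 0 * G 0)))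
       (sym (∑-scaleʳ is (F 0 * G 0) _) ∙ (∑-ext is λ n → solve 2 (λ a b → a :* κ 1 :* b := a :* b) refl (X n) (F 0 * G 0)))
    mul : ∀ {a b c d} → Abs≤ a b → Abs≤ c d → Abs≤ (a * c) (b * d)
    mul {a} {b} {c} {d} p@(p₁ , p₂) q@(q₁ , q₂) with ≤-total (# 0) c
    ... | inj₁ r = Abs≤-weaken (scale (Abs≤-nonneg p) q₂) (subst₂ Abs≤ (solve 2 (λ a c → c :* a := a :* c) refl a c) (solve 2 (λ a c → c :* a := a :* c) refl b c) (Abs≤-scale r p))
    ... | inj₂ r = Abs≤-weaken (scale (Abs≤-nonneg p) (lin q₁ (solve 2 (λ c d → d :+ :- d := :- c :+ c) refl c d)))
       (subst₂ Abs≤ (solve 2 (λ a c → :- c :* (:- a) := a :* c) refl a c) (solve 2 (λ a c → (:- c) :* a := a :* (:- c)) refl b c)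
        (Abs≤-scale (lin r (solve 1 (λ c → :- c :+ c := κ 0 :+ κ 0) refl c)) (Abs≤-neg p)))
    prodAbs : ∀ {a b c d x y} → Abs≤ a b → Abs≤ c d → Abs≤ x y → Abs≤ (a * c * x) (b * d * y)
    prodAbs p q r = mul (mul p q) r
   -- Here u + v ≥ 2 K, so u ≥ K or v ≥ K; then F 0 or G 0 vanishes, and with it both sides of the
   -- comparison.
   ... | false = subst₂ Abs≤ (sym zeroL) refl (Abs≤-0 (≡⇒≤ (solve 2 (λ x y → κ 0 := x :* (κ 0 :* y)) refl _ (e []))))
    where
    big : K N.+ K N.≤ u N.+ v
    big = N.≮⇒≥ (λ l → subst T eq (N.<⇒<ᵇ l)) ⨟ m≤
    zero' : ∀ {K u F F̂} → Majorant K u F F̂ → K N.≤ u → F 0 ≡ # 0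
    zero' {K} {u} {F} M q = ≤-antisym (subst (F 0 ≤_) (supp M q) (π₂ (bound M 0)))
     ((solve 0 (κ 0 := :- κ 0) refl ∙ cong -_ (sym (supp M q))) ≡⨾ π₁ (bound M 0))
    FG : F 0 * G 0 ≡ # 0
    FG with K N.≤? u
    ... | yes q = cong (_* G 0) (zero' MF q) ∙ 0* _
    ... | no q = cong (F 0 *_) (zero' MG (N.+-cancelˡ-≤ K K v (big ⨟ N.+-monoˡ-≤ v (N.<⇒≤ (N.≰⇒> q))))) ∙ *0 _
    zeroL : Form [] F G w - Main [] F G X ≡ # 0
    zeroL = cong₂ _-_ (∑-zero ns λ n _ → cong (w n *_) FG ∙ *0 _)
      (∑-zero is λ n _ → cong (X n *_) FG ∙ *0 _) ∙ solve 0 (κ 0 :- κ 0 := κ 0) refl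
   Form-approx K (p ∷ ps) hp {F} {F̂} {G} {Ĝ} {u} {v} {m} w X e MF MG m≤ e≥0 he with hp p (here refl)
   ... | k≥0 , t≥0 , t≤2 , idem = subst₂ Abs≤ (sym lhs) refl (Abs≤-weaken final
       (Abs≤-+ (Abs≤-+ (Abs≤-+ T₁ (Abs≤-neg (Abs≤-scale t≥0 T₂))) (Abs≤-neg (Abs≤-scale t≥0 T₃))) (Abs≤-scale (*≥0 t≥0 t≥0) T₄)))
    where
    l = lg p
    F' = tilt (k p) l F
    G' = tilt (k p) l G
    EF = shift l F
    EG = shift l G
    w' = λ n → w n * h p n
    X' = λ i → X i * g i p
    e' = e ∘ (p ∷_)
    hp' = λ q i → hp q (there i)
    k≥ : ∀ q → q ∈ ps → # 0 ≤ k q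
    k≥ q i = π₁ (hp q (there i))
    A = Op k (p ∷ ps) F̂ 0
    B = Op k (p ∷ ps) Ĝ 0
    S₀ = SumSub (K N.+ K) 8 ps e m
    S₁ = SumSub (K N.+ K) 8 ps e' (m N.+ l)
    he' : ∀ D → D ⊆ ps → m N.+ l N.+ lsum D N.< K N.+ K → Abs≤ (∑ ns (λ n → w' n * hits D n) - ∑ is (λ i → X' i * ∏ (g i) D)) (e' D)
    he' D s q = subst₂ Abs≤ (cong₂ _-_ (∑-ext ns λ n → *-assoc˘ (w n) (h p n) _)
      (∑-ext is λ n → *-assoc˘ (X n) (g n p) _)) refl
      (he (p ∷ D) (refl ∷ s) (reflexive (cong suc (sym (N.+-assoc m l (lsum D)))) ⨟ q))
    m₂ : m N.+ l N.≤ u N.+ (l N.+ v)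
    m₂ = N.+-monoˡ-≤ l m≤ ⨟ reflexive (N.+-assoc u v l ∙ cong (u N.+_) (N.+-comm v l))
    m₃ : m N.+ l N.≤ l N.+ u N.+ v
    m₃ = N.+-monoˡ-≤ l m≤ ⨟ reflexive (N.+-comm (u N.+ v) l ∙ sym (N.+-assoc l u v))
    m₄ : m N.+ l N.≤ l N.+ u N.+ (l N.+ v)
    m₄ = m₃ ⨟ N.+-monoʳ-≤ (l N.+ u) (N.m≤n+m v l)
    Aeq : ∀ F̂ → Op k ps (tilt (k p) l F̂) 0 ≡ Op k (p ∷ ps) F̂ 0
    Aeq F̂ = Op-tilt k ps (k p) l F̂ 0
    A' = Op k ps (shift l F̂) 0
    B' = Op k ps (shift l Ĝ) 0
    A≥0 : # 0 ≤ A
    A≥0 = Op-nonneg (p ∷ ps) (λ q i → π₁ (hp q i)) (nonneg MF) 0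
    B≥0 : # 0 ≤ B
    B≥0 = Op-nonneg (p ∷ ps) (λ q i → π₁ (hp q i)) (nonneg MG) 0
    B'≥0 : # 0 ≤ B'
    B'≥0 = Op-nonneg ps k≥ (λ x → nonneg MG (x N.+ l)) 0
    S₀≥0 : # 0 ≤ S₀
    S₀≥0 = SumSub-nonneg _ 8 ps m e≥0
    S₁≥0 : # 0 ≤ S₁
    S₁≥0 = SumSub-nonneg _ 8 ps (m N.+ l) (λ D → e≥0 (p ∷ D))
    sh≤ : ∀ {F F̂ K u} → Majorant K u F F̂ → Op k ps (shift l F̂) 0 ≤ Op k (p ∷ ps) F̂ 0
    sh≤ {F̂ = F̂} M = Op-shift k ps F̂ l 0 ≡⨾ Op-antitone ps k≥ (anti M) z≤n ⨾
     lin (*≥0 k≥0 (Op-nonneg ps k≥ (nonneg M) l)) (solve 2 (λ a b → a :+ b :+ κ 0 := a :+ b) refl (Op k ps F̂ 0) (k p * Op k ps F̂ l))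
    T₁ : Abs≤ (Form ps F' G' w - Main ps F' G' X) (A * B * S₀)
    T₁ = subst₂ Abs≤ refl (cong₂ (λ a b → a * b * S₀) (Aeq F̂) (Aeq Ĝ))
      (Form-approx K ps hp' w X e (tiltM k≥0 MF) (tiltM k≥0 MG) m≤ e≥0 (λ D s → he D (p ∷ʳ s)))
    T₂ : Abs≤ (Form ps F' EG w' - Main ps F' EG X') (A * B * S₁)
    T₂ = Abs≤-weaken (scaleʳ S₁≥0 (*-mono B'≥0 A≥0 (≡⇒≤ (Aeq F̂)) (sh≤ MG)))
      (Form-approx K ps hp' w' X' e' (tiltM k≥0 MF) (shiftM l MG) m₂ (λ D → e≥0 (p ∷ D)) he')
    T₃ : Abs≤ (Form ps EF G' w' - Main ps EF G' X') (A * B * S₁)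
    T₃ = Abs≤-weaken (scaleʳ S₁≥0 (*-mono (subst (# 0 ≤_) (sym (Aeq Ĝ)) B≥0) A≥0 (sh≤ MF) (≡⇒≤ (Aeq Ĝ))))
      (Form-approx K ps hp' w' X' e' (shiftM l MF) (tiltM k≥0 MG) m₃ (λ D → e≥0 (p ∷ D)) he')
    T₄ : Abs≤ (Form ps EF EG w' - Main ps EF EG X') (A * B * S₁)
    T₄ = Abs≤-weaken (scaleʳ S₁≥0 (*-mono B'≥0 A≥0 (sh≤ MF) (sh≤ MG)))
      (Form-approx K ps hp' w' X' e' (shiftM l MF) (shiftM l MG) m₄ (λ D → e≥0 (p ∷ D)) he')
    lhs = cong₂ _-_ (Form-step p ps F G w idem) (Main-step p ps F G X) ∙
     solve 10 (λ t u a b c d a' b' c' d' → (a :- t :* b :- t :* c :+ u :* d) :- (a' :- t :* b' :- t :* c' :+ u :* d') :=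
       (a :- a') :+ :- (t :* (b :- b')) :+ :- (t :* (c :- c')) :+ u :* (d :- d')) refl (t p) (t p * t p) _ _ _ _ _ _ _ _
    final : A * B * S₀ + t p * (A * B * S₁) + t p * (A * B * S₁) + t p * t p * (A * B * S₁) ≤ A * B * (S₀ + # 8 * S₁)
    -- t ≤ 2 gives 2 + 2 + 2 · 2 = 8 for the three forms in which p belongs to D.
    final = lin (scale ABS≥0 (t≤2 ⊕ t≤2 ⊕ *-mono t≥0 (#≥0 2) t≤2 t≤2))
     (solve 4 (λ t a s s' → a :* (s :+ κ 8 :* s') :+ (a :* s') :* (t :+ t :+ t :* t) :=
       (a :* s :+ t :* (a :* s') :+ t :* (a :* s') :+ t :* t :* (a :* s')) :+ (a :* s') :* (κ 2 :+ κ 2 :+ κ 2 :* κ 2)) refl (t p) (A * B) S₀ S₁)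
     where
     ABS≥0 : # 0 ≤ A * B * S₁
     ABS≥0 = *≥0 (*≥0 A≥0 B≥0) S₁≥0

module _ {c c' d : ℕ → 𝔽} where

 -- For antitone F the surplus d(p) F(x + lg p) is at most d(p) F(x), so each prime costs a factor 1
 -- + d(p).
 Op-compare : ∀ ps → (∀ p → p ∈ ps → # 0 ≤ c' p × # 0 ≤ c p × # 0 ≤ d p × c p ≤ c' p + d p) → ∀ {F} → Antitone F → (∀ x → # 0 ≤ F x) →
        ∀ x → Op c ps F x ≤ ∏ (λ p → # 1 + d p) ps * Op c' ps F x
 Op-compare [] h aF nF x = ≡⇒≤ (1*˘ _)
 Op-compare (p ∷ ps) h {F} aF nF x with h p (here refl)
 ... | c'≥0 , c≥0 , d≥0 , c≤ = IH x ⊕ scale c≥0 (IH y) ⨾ ≤-refl {P * O x} ⊕ scaleʳ (*≥0 P≥0 (O≥0 y)) c≤ ⨾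
   lin (scale (*≥0 P≥0 d≥0) (O-anti (N.m≤m+n x (lg p))) ⊕ scale (*≥0 P≥0 d≥0) (*≥0 c'≥0 (O≥0 y)))
    (solve 5 (λ P d c' a b → (κ 1 :+ d) :* P :* (a :+ c' :* b) :+ (P :* d :* b :+ P :* d :* κ 0) :=
      P :* a :+ (c' :+ d) :* (P :* b) :+ (P :* d :* a :+ P :* d :* (c' :* b))) refl P (d p) (c' p) (O x) (O y))
  where
  y = x N.+ lg p
  P = ∏ (λ p → # 1 + d p) ps
  O = Op c' ps F
  h' = λ q i → h q (there i)
  IH = Op-compare ps h' aF nF
  c'≥ : ∀ q → q ∈ ps → # 0 ≤ c' q
  c'≥ q i = π₁ (h' q i)
  O≥0 = Op-nonneg ps c'≥ nF
  O-anti = Op-antitone ps c'≥ aF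
  P≥0 : # 0 ≤ P
  P≥0 = prod≥0 ps λ q i → +≥0 0≤1 (π₁ (π₂ (π₂ (h' q i))))
   where
   prod≥0 : ∀ ps → (∀ q → q ∈ ps → # 0 ≤ # 1 + d q) → # 0 ≤ ∏ (λ p → # 1 + d p) ps
   prod≥0 [] _ = 0≤1
   prod≥0 (q ∷ ps) j = *≥0 (j q (here refl)) (prod≥0 ps λ r i → j r (there i))

Op-compose : ∀ (c d : ℕ → 𝔽) ps F x → ∀ p → Op c (p ∷ ps) (Op d (p ∷ ps) F) x ≡
 tilt (c p) (lg p) (tilt (d p) (lg p) (Op c ps (Op d ps F))) x
Op-compose c d ps F x p = tilt-ext (c p) (lg p) (Op-tilt c ps (d p) (lg p) (Op d ps F)) x

module _ {c d : ℕ → 𝔽} where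

 -- The composition has the additional nonnegative term c d F(x + 2 lg p), in which p is used twice.
 Op-+-≤ : ∀ ps → (∀ p → p ∈ ps → # 0 ≤ c p × # 0 ≤ d p) → ∀ {F} → (∀ x → # 0 ≤ F x) →
      ∀ x → Op (λ p → c p + d p) ps F x ≤ Op c ps (Op d ps F) x
 Op-+-≤ [] h nF x = ≤-refl
 Op-+-≤ (p ∷ ps) h {F} nF x with h p (here refl)
 ... | c≥0 , d≥0 = IH x ⊕ scale (+≥0 c≥0 d≥0) (IH y) ⨾ lin (*≥0 (*≥0 c≥0 d≥0) (O≥0 (y N.+ lg p))) (solve 5 (λ a b e c d → (a :+ d :* b) :+ c :* (b :+ d :* e) :+ κ 0 :=
     a :+ (c :+ d) :* b :+ c :* d :* e) refl (O x) (O y) (O (y N.+ lg p)) (c p) (d p)) ⨾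
   ≡⇒≤ (sym (Op-compose c d ps F x p))
  where
  y = x N.+ lg p
  O = Op c ps (Op d ps F)
  h' = λ q i → h q (there i)
  IH = Op-+-≤ ps h' nF
  O≥0 = Op-nonneg ps (λ q i → π₁ (h' q i)) (Op-nonneg ps (λ q i → π₂ (h' q i)) nF)

 -- The term using p twice, c d F(x + 2 lg p), is moved up to c d F(x + lg p) by monotonicity.
 Op-∘-≤ : ∀ ps → (∀ p → p ∈ ps → # 0 ≤ c p × # 0 ≤ d p) → ∀ {F} → Antitone F →
      ∀ x → Op c ps (Op d ps F) x ≤ Op (λ p → c p + d p + c p * d p) ps F x
 Op-∘-≤ [] h aF x = ≤-refl
 Op-∘-≤ (p ∷ ps) h {F} aF x with h p (here refl)
 ... | c≥0 , d≥0 = Op-compose c d ps F x p ≡⨾ lin (scale (*≥0 c≥0 d≥0) (O-anti (N.m≤m+n y (lg p)))) (solve 5 (λ a b e c d →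
     a :+ (c :+ d :+ c :* d) :* b :+ c :* d :* e := (a :+ d :* b) :+ c :* (b :+ d :* e) :+ c :* d :* b) refl (O x) (O y) (O (y N.+ lg p)) (c p) (d p)) ⨾
   IH x ⊕ scale (+≥0 (+≥0 c≥0 d≥0) (*≥0 c≥0 d≥0)) (IH y)
  where
  y = x N.+ lg p
  O = Op c ps (Op d ps F)
  h' = λ q i → h q (there i)
  IH = Op-∘-≤ ps h' aF
  O-anti = Op-antitone ps (λ q i → π₁ (h' q i)) (Op-antitone ps (λ q i → π₂ (h' q i)) aF)

-- Linear functionals tested on initial segments

record Linear (Ψ : (ℕ → 𝔽) → 𝔽) : Set where
 field
  ext : ∀ {F G} → (∀ x → F x ≡ G x) → Ψ F ≡ Ψ G
  lin′ : ∀ a b F G → Ψ (λ x → a * F x + b * G x) ≡ a * Ψ F + b * Ψ G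
open Linear public

Op-linear : ∀ c ps x → Linear (λ F → Op c ps F x)
Op-linear c ps x = record { ext = λ h → Op-ext c ps h x ; lin′ = λ a b F G → Op-lin c ps a b F G x }

∑-linear : ∀ (xs : List ℕ) (v : ℕ → ℕ) → Linear (λ F → ∑ xs (λ i → F (v i)))
∑-linear xs v = record { ext = λ h → ∑-ext xs λ i → h (v i) ; lin′ = λ a b F G → trans (∑-+ xs _ _) (cong₂ _+_ (∑-scale xs a _) (∑-scale xs b _)) }

eval-linear : ∀ x → Linear (λ F → F x)
eval-linear x = record { ext = λ h → h x ; lin′ = λ a b F G → refl }

comb-linear : ∀ {Φ Ψ} m n → Linear Φ → Linear Ψ → Linear (λ F → m * Φ F + n * Ψ F)
comb-linear m n P Q = record { ext = λ h → cong₂ (λ a b → m * a + n * b) (ext P h) (ext Q h)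
 ; lin′ = λ a b F G → trans (cong₂ (λ x y → m * x + n * y) (lin′ P a b F G) (lin′ Q a b F G))
   (solve 8 (λ m n a b p q r s → m :* (a :* p :+ b :* q) :+ n :* (a :* r :+ b :* s) := a :* (m :* p :+ n :* r) :+ b :* (m :* q :+ n :* s)) refl m n a b _ _ _ _) }

ind : ℕ → ℕ → 𝔽
ind X x = 𝟙 (x N.<ᵇ X)

ind-true : ∀ {X x} → x N.< X → ind X x ≡ # 1
ind-true p = 𝟙-true (N.<⇒<ᵇ p)

ind-false : ∀ {X x} → X N.≤ x → ind X x ≡ # 0
ind-false {X} {x} p = 𝟙-false λ q → N.<⇒≱ (N.<ᵇ⇒< x X q) p

ind-antitone : ∀ X → Antitone (ind X)
ind-antitone X {x} {y} p = 𝟙-mono λ q → N.<⇒<ᵇ (N.≤-<-trans p (N.<ᵇ⇒< y X q))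

ind-supp : ∀ X → Supp X (ind X)
ind-supp X = ind-false

ind-nonneg : ∀ X x → # 0 ≤ ind X x
ind-nonneg X x = 𝟙≥0 _

ind-shift : ∀ X v x → ind X (x N.+ v) ≡ ind (X ∸ v) x
ind-shift X v x = 𝟙-cong (λ p → N.<⇒<ᵇ (N.m+n≤o⇒m≤o∸n (suc x) (N.<ᵇ⇒< (x N.+ v) X p)))
 (λ p → N.<⇒<ᵇ (lem (N.<ᵇ⇒< x (X ∸ v) p)))
 where
 lem : x N.< X ∸ v → x N.+ v N.< X
 lem q with N.≤-total v X
 ... | inj₁ r = N.+-monoˡ-≤ v q ⨟ reflexive (N.m∸n+n≡m r)
 ... | inj₂ r = ⊥-elim (N.n≮0 (subst (x N.<_) (N.m≤n⇒m∸n≡0 r) q))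

antitone-nonneg : ∀ {K F} → Antitone F → Supp K F → ∀ x → # 0 ≤ F x
antitone-nonneg {K} {F} a s x = subst (_≤ F x) (s (N.m≤m+n K x)) (a (N.m≤n+m x K))

-- An antitone function of finite support is a nonnegative combination of indicators of initial segments.
layer-cake : ∀ {Ψ} → Linear Ψ → ∀ K → (∀ X → X N.≤ K → # 0 ≤ Ψ (ind X)) → ∀ {F} → Antitone F → Supp K F → # 0 ≤ Ψ F
layer-cake {Ψ} L zero h {F} aF sF = ≡⇒≤ (sym ((ext L λ x → sF z≤n ∙ solve 1 (λ y → κ 0 := κ 0 :* y :+ κ 0 :* y) refl (F x)) ∙
  lin′ L (# 0) (# 0) F F ∙ solve 1 (λ y → κ 0 :* y :+ κ 0 :* y := κ 0) refl (Ψ F)))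
layer-cake {Ψ} L (suc K) h {F} aF sF = subst (# 0 ≤_) (sym eq) (+≥0 (*≥0 g≥0 (h (suc K) N.≤-refl))
  (*≥0 0≤1 (layer-cake L K (λ X q → h X (N.m≤n⇒m≤1+n q)) aF' sF')))
 where
 g = F K
 g≥0 : # 0 ≤ g
 g≥0 = antitone-nonneg aF sF K
 F' : ℕ → 𝔽
 F' x = (F x - g) * ind K x
 sF' : Supp K F'
 sF' {x} q = cong ((F x - g) *_) (ind-false q) ∙ *0 _
 below : ∀ {x} → x N.< K → F' x ≡ F x - g
 below {x} q = cong ((F x - g) *_) (ind-true q) ∙ *1 _
 aF' : Antitone F'
 aF' {x} {y} q with y N.<? K
 ... | yes r = subst₂ _≤_ (sym (below r)) (sym (below (N.≤-<-trans q r))) (aF q ⊕ ≤-refl)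
 ... | no r = subst (_≤ F' x) (sym (sF' (N.≮⇒≥ r))) F'≥0
  where
  F'≥0 : # 0 ≤ F' x
  F'≥0 with x N.<? K
  ... | yes s = subst (# 0 ≤_) (sym (below s)) (sub-nonneg (aF (N.<⇒≤ s)))
  ... | no s = ≡⇒≤ (sym (sF' (N.≮⇒≥ s)))
 decompose : ∀ x → F x ≡ g * ind (suc K) x + # 1 * F' x
 decompose x with N.<-cmp x K
 ... | Tri.tri< r _ _ = sym (cong₂ (λ a b → g * a + # 1 * b) (ind-true (N.m<n⇒m<1+n r)) (below r) ∙
     solve 2 (λ f g → g :* κ 1 :+ κ 1 :* (f :- g) := f) refl (F x) g)
 ... | Tri.tri≈ _ refl _ = sym (cong₂ (λ a b → g * a + # 1 * b) (ind-true {suc K} {K} N.≤-refl) (sF' N.≤-refl) ∙ solve 1 (λ g → g :* κ 1 :+ κ 1 :* κ 0 := g) refl g)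
 ... | Tri.tri> _ _ r = sF r ∙ sym (cong₂ (λ a b → g * a + # 1 * b) (ind-false r) (sF' (N.<⇒≤ r)) ∙ solve 1 (λ g → g :* κ 0 :+ κ 1 :* κ 0 := κ 0) refl g)
 eq : Ψ F ≡ g * Ψ (ind (suc K)) + # 1 * Ψ F'
 eq = ext L decompose ∙ lin′ L g (# 1) (ind (suc K)) F'

-- Power sums and iterates of the operators

^≥0 : ∀ {a} k → # 0 ≤ a → # 0 ≤ a ^ k
^≥0 zero h = 0≤1
^≥0 (suc k) h = *≥0 h (^≥0 k h)

^-mono : ∀ {a b} k → # 0 ≤ a → a ≤ b → a ^ k ≤ b ^ k
^-mono zero h p = ≤-refl
^-mono (suc k) h p = *-mono (^≥0 k h) (h ⨾ p) p (^-mono k h p)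

-- Only the first two binomial terms are kept. With b = 1 this compares a sum with an integral, with
-- b = B it absorbs the boundary term of `Op-upper`.
^-binomial : ∀ {a b} k → # 0 ≤ a → # 0 ≤ b → a ^ suc k + # (suc k) * (b * a ^ k) ≤ (a + b) ^ suc k
^-binomial {a} {b} zero ha hb = ≡⇒≤ (solve 2 (λ a b → a :* κ 1 :+ κ 1 :* (b :* κ 1) := (a :+ b) :* κ 1) refl a b)
^-binomial {a} {b} (suc k) ha hb = subst (λ n → a ^ suc (suc k) + n * (b * a ^ suc k) ≤ (a + b) ^ suc (suc k)) (sym (#-suc (suc k)))
 (lin (scale (+≥0 ha hb) (^-binomial k ha hb) ⊕ *≥0 (*≥0 (#≥0 (suc k)) (*≥0 hb hb)) (^≥0 k ha))
  (solve 5 (λ a b p n q → (a :+ b) :* q :+ ((a :+ b) :* (a :* p :+ n :* (b :* p)) :+ κ 0) :=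
    a :* (a :* p) :+ (κ 1 :+ n) :* (b :* (a :* p)) :+ ((a :+ b) :* q :+ n :* (b :* b) :* p)) refl a b (a ^ k) (# (suc k)) ((a + b) ^ suc k)))

^-difference : ∀ {a} k → # 0 ≤ a → (a + # 1) ^ suc k ≤ a ^ suc k + # (suc k) * (a + # 1) ^ k
^-difference {a} zero h = ≡⇒≤ (solve 1 (λ a → (a :+ κ 1) :* κ 1 := a :* κ 1 :+ κ 1 :* κ 1) refl a)
^-difference {a} (suc k) h = subst (λ n → (a + # 1) ^ suc (suc k) ≤ a ^ suc (suc k) + n * (a + # 1) ^ suc k) (sym (#-suc (suc k)))
 (lin (scale h (^-difference k h) ⊕ *≥0 (#≥0 (suc k)) (^≥0 k (+≥0 h 0≤1)))
  (solve 4 (λ a p q n → a :* (a :* p) :+ (κ 1 :+ n) :* ((a :+ κ 1) :* q) :+ (a :* ((a :+ κ 1) :* q) :+ κ 0) :=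
    (a :+ κ 1) :* ((a :+ κ 1) :* q) :+ (a :* (a :* p :+ n :* q) :+ n :* q)) refl a (a ^ k) ((a + # 1) ^ k) (# (suc k))))

∑-head : ∀ M f → ∑ (rg 0 (suc M)) f ≡ f 0 + ∑ (rg 0 M) (f ∘ suc)
∑-head M f = ∑-split (suc M) z≤n (s≤s z≤n) f ∙ cong₂ _+_ (∑-suc z≤n f ∙ cong (_+ f 0) (∑-nil {0} {0} z≤n f) ∙ 0+ (f 0)) (∑-shift 0 M 1 f)

-- The discrete integral of x^(k+1) over [0, z]; rounding the sum costs one unit of z, while the
-- lower bound `power-sum-≥` costs nothing.
power-sum-≤ : ∀ k M z → # (suc (suc k)) * ∑ (rg 0 M) (λ i → # (z ∸ i) ^ suc k) ≤ (# z + # 1) ^ suc (suc k)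
power-sum-≤ k zero z = (cong (# (suc (suc k)) *_) (∑-nil {0} {0} z≤n _) ∙ *0 _) ≡⨾ ^≥0 (suc (suc k)) (+≥0 (#≥0 z) 0≤1)
power-sum-≤ k (suc M) zero = ≡⇒≤ (cong (# (suc (suc k)) *_) (∑-zero (rg 0 (suc M)) λ i _ →
  cong (λ n → # n ^ suc k) (N.0∸n≡0 i) ∙ 0* (# 0 ^ k)) ∙ *0 _) ⨾
  ^≥0 (suc (suc k)) (+≥0 (#≥0 0) 0≤1)
power-sum-≤ k (suc M) (suc z) = ≡⇒≤ (cong (# (suc (suc k)) *_) (∑-head M _)) ⨾
 lin (power-sum-≤ k M z ⊕ ^-binomial (suc k) (#≥0 (suc z)) 0≤1)
  (cong (λ w → (# (suc z) + # 1) ^ suc (suc k) + (# (suc (suc k)) * ∑ (rg 0 M) (λ i → # (z ∸ i) ^ suc k) + (w ^ suc (suc k) + # (suc (suc k)) * (# 1 * w ^ suc k)))) (#-suc z ∙ solve 1 (λ z → κ 1 :+ z := z :+ κ 1) refl (# z)) ∙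
   solve 5 (λ A n S P Q → A :+ (n :* S :+ (P :+ n :* (κ 1 :* Q))) := n :* (Q :+ S) :+ (P :+ A)) refl
    ((# (suc z) + # 1) ^ suc (suc k)) (# (suc (suc k))) _ ((# z + # 1) ^ suc (suc k)) ((# z + # 1) ^ suc k) ∙
    cong (λ w → # (suc (suc k)) * (w ^ suc k + ∑ (rg 0 M) (λ i → # (z ∸ i) ^ suc k)) + ((# z + # 1) ^ suc (suc k) + (# (suc z) + # 1) ^ suc (suc k))) (sym (#-suc z ∙ solve 1 (λ z → κ 1 :+ z := z :+ κ 1) refl (# z))))

power-sum-≥ : ∀ k M z → z N.≤ M → # z ^ suc (suc k) ≤ # (suc (suc k)) * ∑ (rg 0 M) (λ i → # (z ∸ i) ^ suc k)
power-sum-≥ k M zero q = ≡⇒≤ (0* _) ⨾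
  *≥0 (#≥0 (suc (suc k))) (∑≥0 (rg 0 M) λ i _ → ^≥0 (suc k) (#≥0 (0 ∸ i)))
power-sum-≥ k (suc M) (suc z) (s≤s q) = subst (λ w → w ^ suc (suc k) ≤ # z ^ suc (suc k) + # (suc (suc k)) * w ^ suc k)
   (sym (#-suc z ∙ solve 1 (λ z → κ 1 :+ z := z :+ κ 1) refl (# z))) (^-difference (suc k) (#≥0 z)) ⨾
 lin (power-sum-≥ k M z q) (solve 4 (λ n Q S P → n :* (Q :+ S) :+ P := P :+ n :* Q :+ n :* S) refl (# (suc (suc k))) (# (suc z) ^ suc k) _ (# z ^ suc (suc k))) ⨾
  ≡⇒≤ (cong (# (suc (suc k)) *_) (sym (∑-head M _)))

OpN : (ℕ → 𝔽) → List ℕ → ℕ → (ℕ → 𝔽) → ℕ → 𝔽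
OpN c ps zero F = F
OpN c ps (suc k) F = Op c ps (OpN c ps k F)

OpN-linear : ∀ c ps k x → Linear (λ F → OpN c ps k F x)
OpN-linear c ps zero x = eval-linear x
OpN-linear c ps (suc k) x = record
 { ext = λ h → Op-ext c ps (λ y → ext (OpN-linear c ps k y) h) x
 ; lin′ = λ a b F G → trans (Op-ext c ps (λ y → lin′ (OpN-linear c ps k y) a b F G) x) (Op-lin c ps a b _ _ x) }

Op-scale : ∀ c ps a F x → Op c ps (λ x → a * F x) x ≡ a * Op c ps F x
Op-scale c ps a F x = Op-ext c ps (λ x → solve 2 (λ a f → a :* f := a :* f :+ κ 0 :* f) refl a (F x)) x ∙
 Op-lin c ps a (# 0) F F x ∙ solve 2 (λ a f → a :* f :+ κ 0 :* f := a :* f) refl a (Op c ps F x)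

fact : ℕ → ℕ
fact zero = 1
fact (suc n) = suc n N.* fact n

power-antitone : ∀ Y k → Antitone (λ x → # (Y ∸ x) ^ k)
power-antitone Y k {x} {y} p = ^-mono k (#≥0 (Y ∸ y)) (#-mono (N.∸-monoʳ-≤ Y p))

power-supp : ∀ Y k → Supp Y (λ x → # (Y ∸ x) ^ suc k)
power-supp Y k {x} p = cong (λ n → # n ^ suc k) (N.m≤n⇒m∸n≡0 p) ∙ 0* _

Antitone-shift : ∀ {F} v → Antitone F → Antitone (shift v F)
Antitone-shift v h p = h (N.+-monoˡ-≤ v p)

Supp-shift : ∀ {K F} v → Supp K F → Supp K (shift v F)
Supp-shift v h {x} p = h (p ⨟ N.m≤m+n x v)

Op-at : ∀ c ps F x → Op c ps F x ≡ Op c ps (shift x F) 0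
Op-at c ps F x = sym (Op-shift c ps F x 0)

Op-ind-at : ∀ c ps X x → Op c ps (ind X) x ≡ Op c ps (ind (X ∸ x)) 0
Op-ind-at c ps X x = Op-at c ps (ind X) x ∙ Op-ext c ps (ind-shift X x) 0

∑-ind : ∀ M X → X N.≤ M → ∑ (rg 0 M) (ind X) ≡ # X
∑-ind M X p = ∑-split M z≤n p (ind X) ∙ cong₂ _+_
  (∑-cong (rg 0 X) (λ x m → ind-true (π₂ (∈-range⁻ m))) ∙ count X)
  (∑-zero (rg X M) λ x m → ind-false (π₁ (∈-range⁻ m))) ∙ +0 (# X)
 where
 count : ∀ X → ∑ (rg 0 X) (λ _ → # 1) ≡ # X
 count zero = ∑-nil {0} {0} z≤n _
 count (suc X) = ∑-suc {0} {X} z≤n (λ _ → # 1) ∙ cong (_+ # 1) (count X) ∙ solve 1 (λ a → a :+ κ 1 := κ 1 :+ a) refl (# X) ∙ sym (#-suc X)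

module _ {c : ℕ → 𝔽} {ps : List ℕ} (c≥0 : ∀ p → p ∈ ps → # 0 ≤ c p) where

 -- By `layer-cake` it is enough to test initial segments [0, X), where the right-hand side is α (X
 -- + B).
 Op-upper : ∀ {α B} → (∀ X → Op c ps (ind X) 0 ≤ α * (# X + # B)) → # 0 ≤ α →
       ∀ M {F} → Antitone F → Supp M F → ∀ x → Op c ps F x ≤ α * (∑ (rg 0 M) (λ i → F (i N.+ x)) + # B * F x)
 Op-upper {α} {B} h α≥0 M {F} aF sF x = ≤-sub (layer-cake {Ψ} linΨ M ind≥0 (Antitone-shift x aF) (Supp-shift x sF) ⨾≡ eq)
  where
  Ψ : (ℕ → 𝔽) → 𝔽
  Ψ F = α * (# 1 * ∑ (rg 0 M) (λ i → F i) + # B * F 0) + (- # 1) * Op c ps F 0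
  linΨ : Linear Ψ
  linΨ = comb-linear α (- # 1) (comb-linear (# 1) (# B) (∑-linear (rg 0 M) id) (eval-linear 0)) (Op-linear c ps 0)
  ind≥0 : ∀ X → X N.≤ M → # 0 ≤ Ψ (ind X)
  -- For X = 0 the hypothesis still allows α B, which the bound does not; here the left-hand side
  -- vanishes by its support.
  ind≥0 zero q = ≡⇒≤ (sym (cong₂ (λ a b → α * (# 1 * a + # B * # 0) + (- # 1) * b) (∑-zero (rg 0 M) (λ x _ → ind-false {0} {x} z≤n)) (Op-supp ps (ind-supp 0) z≤n) ∙
    solve 2 (λ α B → α :* (κ 1 :* κ 0 :+ B :* κ 0) :+ (:- κ 1) :* κ 0 := κ 0) refl α (# B)))
  ind≥0 (suc X) q = lin (h (suc X)) (cong (λ s → α * (# 1 * s + # B * # 1) + (- # 1) * O + O) (∑-ind M (suc X) q) ∙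
    solve 4 (λ α B X O → α :* (κ 1 :* X :+ B :* κ 1) :+ (:- κ 1) :* O :+ O := κ 0 :+ α :* (X :+ B)) refl α (# B) (# (suc X)) O)
   where O = Op c ps (ind (suc X)) 0
  eq : Ψ (shift x F) ≡ α * (∑ (rg 0 M) (λ i → F (i N.+ x)) + # B * F x) - Op c ps F x
  eq = cong (λ o → α * (# 1 * ∑ (rg 0 M) (λ i → F (i N.+ x)) + # B * F x) + (- # 1) * o) (sym (Op-at c ps F x)) ∙
   solve 5 (λ α S B f O → α :* (κ 1 :* S :+ B :* f) :+ (:- κ 1) :* O := α :* (S :+ B :* f) :- O) refl α _ (# B) (F x) (Op c ps F x)

 -- Every application integrates once and contributes a factor α. The boundary term moves the edge X
 -- outwards by B and the passage from sum to integral by 1, whence the B + 1 per iteration.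
 OpN-upper : ∀ {α B} → (∀ X → Op c ps (ind X) 0 ≤ α * (# X + # B)) → # 0 ≤ α → ∀ k X x →
       # (fact (suc k)) * OpN c ps (suc k) (ind X) x ≤ α ^ suc k * # (X N.+ suc k N.* suc B ∸ x) ^ suc k
 OpN-upper {α} {B} h α≥0 zero X x with X ∸ x in eq
 ... | zero = ≡⇒≤ (cong (# 1 *_) (Op-supp ps (ind-supp X) (N.m∸n≡0⇒m≤n eq)) ∙ solve 0 (κ 1 :* κ 0 := κ 0) refl) ⨾
         *≥0 (^≥0 1 α≥0) (^≥0 1 (#≥0 (X N.+ 1 N.* suc B ∸ x)))
 ... | suc z = lin (h (suc z)) (cong (λ o → α * (# (suc z) + # B) + o) (cong (λ y → Op c ps (ind y) 0) (sym eq) ∙ sym (Op-ind-at c ps X x)) ∙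
          solve 2 (λ O a → a :+ O := κ 1 :* O :+ a) refl (Op c ps (ind X) x) (α * (# (suc z) + # B))) ⨾
   scale α≥0 (sym (#-+ (suc z) B) ≡⨾ #-mono le) ⨾
    ≡⇒≤ (solve 2 (λ a b → a :* b := a :* κ 1 :* (b :* κ 1)) refl α (# (X N.+ 1 N.* suc B ∸ x)))
  where
  x≤X : x N.≤ X
  x≤X = N.<⇒≤ (N.m∸n≢0⇒n<m λ r → case trans (sym eq) r of λ ())
  le : suc z N.+ B N.≤ X N.+ 1 N.* suc B ∸ x
  le = reflexive (cong (N._+ B) (sym eq)) ⨟ reflexive (sym (N.+-∸-comm B x≤X)) ⨟
     N.∸-monoˡ-≤ x (N.+-monoʳ-≤ X (N.n≤1+n B ⨟ reflexive (sym (N.*-identityˡ (suc B)))))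
 OpN-upper {α} {B} h α≥0 (suc k) X x = ≡⇒≤ (cong (_* Op c ps G x) (#-* (suc (suc k)) (fact (suc k))) ∙
    *-assoc (# (suc (suc k))) f₁ (Op c ps G x) ∙ cong (# (suc (suc k)) *_) (sym (Op-scale c ps f₁ G x))) ⨾
   scale (#≥0 (suc (suc k))) (Op-mono ps c≥0 (λ y → OpN-upper h α≥0 k X y) x ⨾≡ Op-scale c ps (α ^ suc k) g x) ⨾
    ≡⇒≤ (*-swap (# (suc (suc k))) (α ^ suc k) (Op c ps g x)) ⨾
     scale (^≥0 (suc k) α≥0) main ⨾ ≡⇒≤ (solve 3 (λ a p q → p :* (a :* q) := a :* p :* q) refl α (α ^ suc k) _)
  where
  f₁ = # (fact (suc k))
  G = OpN c ps (suc k) (ind X)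
  Y = X N.+ suc k N.* suc B
  g : ℕ → 𝔽
  g y = # (Y ∸ y) ^ suc k
  Y' = X N.+ suc (suc k) N.* suc B
  main : # (suc (suc k)) * Op c ps g x ≤ α * # (Y' ∸ x) ^ suc (suc k)
  main with N.≤-total Y x
  ... | inj₁ q = ≡⇒≤ (cong (# (suc (suc k)) *_) (Op-supp ps (power-supp Y k) q) ∙ *0 _) ⨾
           *≥0 α≥0 (^≥0 (suc (suc k)) (#≥0 (Y' ∸ x)))
  ... | inj₂ q = scale (#≥0 (suc (suc k))) (Op-upper h α≥0 Y (power-antitone Y (suc k)) (power-supp Y k) x) ⨾
     ≡⇒≤ (solve 5 (λ n α S B p → n :* (α :* (S :+ B :* p)) := α :* (n :* S :+ n :* (B :* p))) refl (# (suc (suc k))) α _ (# B) (# z ^ suc k)) ⨾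
      scale α≥0 (≤-trans (≡⇒≤ (cong (# (suc (suc k)) *_) (∑-ext (rg 0 Y) λ i → cong (λ w → # w ^ suc k) (cong (Y ∸_) (N.+-comm i x) ∙ sym (N.∸-+-assoc Y x i)))))
         (power-sum-≤ k Y z) ⊕ scale (#≥0 (suc (suc k))) (scale (#≥0 B) (^-mono (suc k) (#≥0 z) (lin 0≤1 (solve 1 (λ z → z :+ κ 1 :+ κ 0 := z :+ κ 1) refl (# z))))) ⨾
        ^-binomial (suc k) (+≥0 (#≥0 z) 0≤1) (#≥0 B) ⨾≡ cong (_^ suc (suc k)) eq)
   where
   z = Y ∸ x
   eq : # z + # 1 + # B ≡ # (Y' ∸ x)
   eq = cong (_+ # B) (sym (#-+ z 1)) ∙ sym (#-+ (z N.+ 1) B) ∙ cong #_ (N.+-assoc z 1 B ∙ sym (N.+-∸-comm (suc B) q) ∙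
       cong (_∸ x) (N.+-assoc X (suc k N.* suc B) (suc B) ∙ cong (X N.+_) (N.+-comm (suc k N.* suc B) (suc B))))

 Op-lower : ∀ {β B K} → (∀ X → X N.≤ K → β * # (X ∸ B) ≤ Op c ps (ind X) 0) →
       ∀ {F} → Antitone F → Supp K F → ∀ x → β * ∑ (rg 0 K) (λ i → F (i N.+ B N.+ x)) ≤ Op c ps F x
 Op-lower {β} {B} {K} h {F} aF sF x = ≤-sub (layer-cake {Ψ} linΨ K ind≥0 (Antitone-shift x aF) (Supp-shift x sF) ⨾≡ eq)
  where
  Ψ : (ℕ → 𝔽) → 𝔽
  Ψ F = # 1 * Op c ps F 0 + (- β) * ∑ (rg 0 K) (λ i → F (i N.+ B))
  linΨ : Linear Ψ
  linΨ = comb-linear (# 1) (- β) (Op-linear c ps 0) (∑-linear (rg 0 K) (N._+ B))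
  ind≥0 : ∀ X → X N.≤ K → # 0 ≤ Ψ (ind X)
  ind≥0 X q = lin (h X q) (cong (λ s → # 1 * O + (- β) * s + β * # (X ∸ B)) (∑-ext (rg 0 K) (ind-shift X B) ∙ ∑-ind K (X ∸ B) (N.m∸n≤m X B ⨟ q)) ∙
    solve 3 (λ β s O → κ 1 :* O :+ (:- β) :* s :+ β :* s := κ 0 :+ O) refl β (# (X ∸ B)) O)
   where O = Op c ps (ind X) 0
  eq : Ψ (shift x F) ≡ Op c ps F x - β * ∑ (rg 0 K) (λ i → F (i N.+ B N.+ x))
  eq = cong (λ o → # 1 * o + (- β) * ∑ (rg 0 K) (λ i → F (i N.+ B N.+ x))) (sym (Op-at c ps F x)) ∙
   solve 3 (λ o b s → κ 1 :* o :+ (:- b) :* s := o :- b :* s) refl (Op c ps F x) β _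

 -- The counterpart of `OpN-upper`: each iteration moves the edge inwards by B.
 OpN-lower : ∀ {β B K} → (∀ X → X N.≤ K → β * # (X ∸ B) ≤ Op c ps (ind X) 0) → # 0 ≤ β → ∀ k X x → X N.≤ K →
       β ^ suc k * # (X ∸ suc k N.* B ∸ x) ^ suc k ≤ # (fact (suc k)) * OpN c ps (suc k) (ind X) x
 OpN-lower {β} {B} {K} h β≥0 zero X x q = lin (h (X ∸ x) (N.m∸n≤m X x ⨟ q))
  (cong₂ (λ o y → # 1 * o + β * # y) (Op-ind-at c ps X x) (N.∸-+-assoc X x B ∙ cong (X ∸_) (N.+-comm x B ∙ cong (N._+ x) (sym (N.*-identityˡ B))) ∙ sym (N.∸-+-assoc X (1 N.* B) x)) ∙
   solve 3 (λ b y o → κ 1 :* o :+ b :* y := b :* κ 1 :* (y :* κ 1) :+ o) refl β _ _)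
 OpN-lower {β} {B} {K} h β≥0 (suc k) X x q = ≡⇒≤ (*-pull β (β ^ suc k) _) ⨾
   scale (^≥0 (suc k) β≥0) main ⨾ ≡⇒≤ (solve 3 (λ n a o → a :* (n :* o) := n :* (a :* o)) refl (# (suc (suc k))) (β ^ suc k) (Op c ps g x)) ⨾
    scale (#≥0 (suc (suc k))) (sym (Op-scale c ps (β ^ suc k) g x) ≡⨾ Op-mono ps c≥0 (λ y → OpN-lower {B = B} h β≥0 k X y q) x) ⨾
     ≡⇒≤ (sym (cong (_* Op c ps G x) (#-* (suc (suc k)) (fact (suc k))) ∙
      *-assoc (# (suc (suc k))) f₁ (Op c ps G x) ∙ cong (# (suc (suc k)) *_) (sym (Op-scale c ps f₁ G x))))
  where
  f₁ = # (fact (suc k))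
  G = OpN c ps (suc k) (ind X)
  Y = X ∸ suc k N.* B
  Y≤K : Y N.≤ K
  Y≤K = N.m∸n≤m X (suc k N.* B) ⨟ q
  g : ℕ → 𝔽
  g y = # (Y ∸ y) ^ suc k
  z = X ∸ suc (suc k) N.* B ∸ x
  z≤K : z N.≤ K
  z≤K = N.m∸n≤m (X ∸ suc (suc k) N.* B) x ⨟ N.m∸n≤m X (suc (suc k) N.* B) ⨟ q
  main : β * # z ^ suc (suc k) ≤ # (suc (suc k)) * Op c ps g x
  main = scale β≥0 (power-sum-≥ k K z z≤K) ⨾ ≡⇒≤ (*-swap β (# (suc (suc k))) _ ∙
    cong (λ s → # (suc (suc k)) * (β * s)) (∑-ext (rg 0 K) λ i → cong (λ w → # w ^ suc k) (idx i))) ⨾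
   scale (#≥0 (suc (suc k))) (Op-lower h (power-antitone Y (suc k)) (λ p → power-supp Y k (Y≤K ⨟ p)) x)
   where
   idx : ∀ i → z ∸ i ≡ Y ∸ (i N.+ B N.+ x)
   idx i = N.∸-+-assoc (X ∸ suc (suc k) N.* B) x i ∙ N.∸-+-assoc X (suc (suc k) N.* B) (x N.+ i) ∙ cong (X ∸_) (eqn i) ∙ sym (N.∸-+-assoc X (suc k N.* B) _)
    where
    eqn : ∀ i → suc (suc k) N.* B N.+ (x N.+ i) ≡ suc k N.* B N.+ (i N.+ B N.+ x)
    eqn i = cong (N._+ (x N.+ i)) (N.+-comm B (suc k N.* B)) ∙ N.+-assoc (suc k N.* B) B _ ∙ cong (suc k N.* B N.+_)
      (cong (B N.+_) (N.+-comm x i) ∙ sym (N.+-assoc B i x) ∙ cong (N._+ x) (N.+-comm B i))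

linear-∑ : ∀ {Ψ} → Linear Ψ → (xs : List ℕ) (a : ℕ → 𝔽) (F : ℕ → ℕ → 𝔽) → Ψ (λ x → ∑ xs (λ b → a b * F b x)) ≡ ∑ xs (λ b → a b * Ψ (F b))
linear-∑ {Ψ} L [] a F = ext L (λ x → solve 0 (κ 0 := κ 0 :* κ 0 :+ κ 0 :* κ 0) refl) ∙ lin′ L (# 0) (# 0) _ _ ∙ solve 1 (λ x → κ 0 :* x :+ κ 0 :* x := κ 0) refl (Ψ (λ _ → # 0))
linear-∑ {Ψ} L (b ∷ xs) a F = ext L (λ x → solve 2 (λ y z → y :+ z := y :+ κ 1 :* z) refl (a b * F b x) _) ∙
 lin′ L (a b) (# 1) (F b) _ ∙ solve 2 (λ y z → y :+ κ 1 :* z := y :+ z) refl (a b * Ψ (F b)) _ ∙ cong (a b * Ψ (F b) +_) (linear-∑ L xs a F)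

∑-telescope : ∀ (f : ℕ → 𝔽) {a b} → a N.≤ b → ∑ (rg a b) (λ i → f i - f (suc i)) ≡ f a - f b
∑-telescope f {a} {b} p = range-ind {a} (λ b → a N.≤ b → ∑ (rg a b) (λ i → f i - f (suc i)) ≡ f a - f b)
 (λ b q r → ∑-nil q _ ∙ solve 1 (λ x → κ 0 := x :- x) refl (f a) ∙ cong (λ z → f a - f z) (N.≤-antisym r q))
 (λ b q ih _ → ∑-suc q _ ∙ cong (_+ (f b - f (suc b))) (ih q) ∙ solve 3 (λ a b c → a :- b :+ (b :- c) := a :- c) refl (f a) (f b) (f (suc b))) b p

n<[1+n/L]L : ∀ n L .{{_ : NonZero L}} → n N.< suc (n N./ L) N.* L
n<[1+n/L]L n L = reflexive (cong suc (DM.m≡m%n+[m/n]*n n L)) ⨟ N.+-monoˡ-≤ (n N./ L N.* L) (DM.m%n<n n L)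

mL≤n⇒m≤n/L : ∀ {m n} L .{{_ : NonZero L}} → m N.* L N.≤ n → m N.≤ n N./ L
mL≤n⇒m≤n/L {m} L p = reflexive (sym (DM.m*n/n≡m m L)) ⨟ DM./-monoˡ-≤ L p

module Step (L : ℕ) .{{_ : NonZero L}} (G : ℕ) (f : ℕ → 𝔽) (f-supp : Supp G f) where

 step : ℕ → 𝔽
 step x = f (x N./ L)

 -- Summation by parts. It reduces estimates for step functions to initial segments whose ends are
 -- multiples of L, also for functionals bounded only there.
 step-decompose : ∀ x → step x ≡ ∑ (rg 0 G) (λ b → (f b - f (suc b)) * ind (suc b N.* L) x)
 step-decompose x = sym ((∑-ext (rg 0 G) λ b → cong ((f b - f (suc b)) *_) (𝟙-cong
    (λ p → N.<⇒<ᵇ {q} {suc b} (DM.m<n*o⇒m/o<n (N.<ᵇ⇒< x (suc b N.* L) p)))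
    (λ p → N.<⇒<ᵇ {x} {suc b N.* L} (n<[1+n/L]L x L ⨟ N.*-monoˡ-≤ L (N.<ᵇ⇒< q (suc b) p))))) ∙ rest)
  where
  q = x N./ L
  rest : ∑ (rg 0 G) (λ b → (f b - f (suc b)) * ind (suc b) q) ≡ f q
  rest with N.≤-total G q
  ... | inj₁ r = (∑-zero (rg 0 G) λ b m → cong ((f b - f (suc b)) *_) (ind-false (π₂ (∈-range⁻ m) ⨟ r)) ∙ *0 _) ∙ sym (f-supp r)
  ... | inj₂ r = ∑-split G z≤n r _ ∙ cong₂ _+_
     (∑-zero (rg 0 q) λ b m → cong ((f b - f (suc b)) *_) (ind-false (π₂ (∈-range⁻ m))) ∙ *0 _)
     ((∑-cong (rg q G) λ b m → cong ((f b - f (suc b)) *_) (ind-true (s≤s (π₁ (∈-range⁻ m)))) ∙ *1 _) ∙ ∑-telescope f r) ∙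
     cong (λ z → # 0 + (f q - z)) (f-supp N.≤-refl) ∙ solve 1 (λ a → κ 0 :+ (a :- κ 0) := a) refl (f q)

 step-linear : ∀ {Ψ} → Linear Ψ → Ψ step ≡ ∑ (rg 0 G) (λ b → (f b - f (suc b)) * Ψ (ind (suc b N.* L)))
 step-linear lΨ = ext lΨ step-decompose ∙ linear-∑ lΨ (rg 0 G) _ _

 step-antitone : Antitone f → Antitone step
 step-antitone h p = h (DM./-monoˡ-≤ L p)

 step-supp : Supp (G N.* L) step
 step-supp p = f-supp (mL≤n⇒m≤n/L L p)

-- A lower bound for the diagonalised form

sq : (ℕ → 𝔽) → ℕ → 𝔽
sq F x = F x * F x

module _ {δ ρ : ℕ → 𝔽} where

 slack : List ℕ → 𝔽
 slack ps = ∑ ps λ p → # 3 * (ρ p * δ p)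

 Mq-nonneg : ∀ ps → (∀ p → p ∈ ps → # 0 ≤ ρ p) → ∀ F → # 0 ≤ Mq δ ρ ps F
 Mq-nonneg [] h F = sq-nonneg (F 0)
 Mq-nonneg (p ∷ ps) h F = +≥0 (Mq-nonneg ps (λ q i → h q (there i)) _) (*≥0 (h p (here refl)) (Mq-nonneg ps (λ q i → h q (there i)) _))

 -- If the functions Op δ ps F were antitone, the slack would not be needed.
 Mq-lower : ∀ ps → (∀ p → p ∈ ps → # 0 ≤ δ p × δ p ≤ # 1 × # 0 ≤ ρ p) → ∀ {F χ Y} → # 0 ≤ Y → (∀ x → # 0 ≤ F x) → Antitone χ →
       (∀ x → # 0 ≤ χ x × χ x ≤ # 1) → (∀ x → Op δ ps F x ≤ Y * χ x) →
       Op ρ ps (sq (Op δ ps F)) 0 - slack ps * (Y * Y * Op ρ ps χ 0) ≤ Mq δ ρ ps F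
 Mq-lower [] h {F} {χ} {Y} Y≥0 nF aχ bχ le = ≡⇒≤ (solve 2 (λ a b → a :- κ 0 :* b := a) refl (F 0 * F 0) (Y * Y * χ 0))
 Mq-lower (p ∷ ps) h {F} {χ} {Y} Y≥0 nF aχ bχ le with h p (here refl)
 ... | δ≥0 , δ≤1 , ρ≥0 = lin (IH₁ ⊕ scale ρ≥0 IH₂ ⊕ scale ρ≥0 zy ⊕ scale (*≥0 (#≥0 3) (*≥0 ρ≥0 δ≥0)) (scale YY≥0 (sub-nonneg Oχ-anti) ⊕ scale YY≥0 (*≥0 ρ≥0 Oχl≥0)))
   (solve 12 (λ Z₀ Zl s YY χ₀ χl r d M₁ M₂ y₀ O →
     (M₁ :+ r :* M₂) :+ ((Z₀ :- s :* (YY :* χ₀)) :+ r :* (y₀ :- s :* (YY :* χl)) :+ r :* Zl :+ κ 3 :* (r :* d) :* (YY :* κ 0 :+ YY :* κ 0)) :=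
     (Z₀ :+ r :* Zl) :- (κ 3 :* (r :* d) :+ s) :* (YY :* (χ₀ :+ r :* χl)) :+ (M₁ :+ r :* M₂ :+ r :* (y₀ :+ κ 3 :* d :* (YY :* χl)) :+ κ 3 :* (r :* d) :* (YY :* (χ₀ :- χl) :+ YY :* (r :* χl))))
    refl (Op ρ ps (sq z) 0) (Op ρ ps (sq z) l) (slack ps) (Y * Y) (Op ρ ps χ 0) (Op ρ ps χ l) (ρ p) (δ p) M₁ M₂ (Op ρ ps (sq y) l) (# 0))
  where
  l = lg p
  h' = λ q i → h q (there i)
  δ≥ : ∀ q → q ∈ ps → # 0 ≤ δ q
  δ≥ q i = π₁ (h' q i)
  ρ≥ : ∀ q → q ∈ ps → # 0 ≤ ρ q
  ρ≥ q i = π₂ (π₂ (h' q i))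
  y = Op δ ps F
  z = Op δ (p ∷ ps) F
  M₁ = Mq δ ρ ps (tilt (δ p) l F)
  M₂ = Mq δ ρ ps (shift l F)
  YY≥0 : # 0 ≤ Y * Y
  YY≥0 = *≥0 Y≥0 Y≥0
  y≥0 = Op-nonneg ps δ≥ nF
  y≤ : ∀ x → y x ≤ Y * χ x
  y≤ x = lin (*≥0 δ≥0 (y≥0 (x N.+ l))) (solve 2 (λ a b → a :+ b :+ κ 0 := a :+ b) refl (y x) (δ p * y (x N.+ l))) ⨾ le x
  Oχl≥0 : # 0 ≤ Op ρ ps χ l
  Oχl≥0 = Op-nonneg ps ρ≥ (λ x → π₁ (bχ x)) l
  Oχ-anti : Op ρ ps χ l ≤ Op ρ ps χ 0
  Oχ-anti = Op-antitone ps ρ≥ aχ z≤n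
  IH₁ : Op ρ ps (sq z) 0 - slack ps * (Y * Y * Op ρ ps χ 0) ≤ M₁
  IH₁ = subst (λ w → w - slack ps * (Y * Y * Op ρ ps χ 0) ≤ M₁) (Op-ext ρ ps (λ x → cong₂ _*_ (Op-tilt δ ps (δ p) l F x) (Op-tilt δ ps (δ p) l F x)) 0)
    (Mq-lower ps h' Y≥0 (λ x → +≥0 (nF x) (*≥0 δ≥0 (nF (x N.+ l)))) aχ bχ (λ x → Op-tilt δ ps (δ p) l F x ≡⨾ le x))
  IH₂ : Op ρ ps (sq y) l - slack ps * (Y * Y * Op ρ ps χ l) ≤ M₂
  IH₂ = subst₂ (λ w w' → w - slack ps * (Y * Y * w') ≤ M₂)
    (Op-ext ρ ps (λ x → cong₂ _*_ (Op-shift δ ps F l x) (Op-shift δ ps F l x)) 0 ∙ Op-shift ρ ps (sq y) l 0) (Op-shift ρ ps χ l 0)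
    (Mq-lower ps h' Y≥0 (λ x → nF (x N.+ l)) (Antitone-shift l aχ) (λ x → bχ (x N.+ l)) (λ x → Op-shift δ ps F l x ≡⨾ y≤ (x N.+ l)))
  pointwise : ∀ x → sq z x ≤ sq y x + # 3 * δ p * (Y * Y * χ x)
  -- With a, b ≤ Y, b ≤ Y χ and δ ≤ 1, the excess 2 δ a b + δ² b² is at most 3 δ Y² χ: the origin of
  -- the 3 in `slack`.
  pointwise x = lin (scale (*≥0 (#≥0 2) δ≥0) yy' ⊕ scale δ≥0 (*-mono (*≥0 y'≥0 y'≥0) 0≤1 δ≤1 y'y'))
   (solve 5 (λ a b d Y c → (a :* a :+ κ 3 :* d :* (Y :* Y :* c)) :+ (κ 2 :* d :* (a :* b) :+ d :* (d :* (b :* b))) :=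
     (a :+ d :* b) :* (a :+ d :* b) :+ (κ 2 :* d :* (Y :* Y :* c) :+ d :* (κ 1 :* (Y :* Y :* c)))) refl (y x) y' (δ p) Y (χ x))
   where
   y' = y (x N.+ l)
   y'≥0 = y≥0 (x N.+ l)
   y≤Y : ∀ x → y x ≤ Y
   y≤Y x = y≤ x ⨾ scale Y≥0 (π₂ (bχ x)) ⨾ ≡⇒≤ (*1 Y)
   y'≤ : y' ≤ Y * χ x
   y'≤ = y≤ (x N.+ l) ⨾ scale Y≥0 (aχ (N.m≤m+n x l))
   yy' : y x * y' ≤ Y * Y * χ x
   yy' = *-mono y'≥0 Y≥0 (y≤Y x) y'≤ ⨾ ≡⇒≤ (solve 2 (λ a b → a :* (a :* b) := a :* a :* b) refl Y (χ x))
   y'y' : y' * y' ≤ Y * Y * χ x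
   y'y' = *-mono y'≥0 Y≥0 (y≤Y (x N.+ l)) y'≤ ⨾ ≡⇒≤ (solve 2 (λ a b → a :* (a :* b) := a :* a :* b) refl Y (χ x))
  zy : Op ρ ps (sq z) l ≤ Op ρ ps (sq y) l + # 3 * δ p * (Y * Y * Op ρ ps χ l)
  zy = Op-mono ps ρ≥ pointwise l ⨾ ≡⇒≤ (Op-ext ρ ps (λ x → solve 4 (λ a d Y c → a :+ κ 3 :* d :* (Y :* c) := κ 1 :* a :+ (κ 3 :* d :* Y) :* c) refl (sq y x) (δ p) (Y * Y) (χ x)) l ∙
   Op-lin ρ ps (# 1) _ (sq y) χ l ∙ solve 4 (λ a d Y c → κ 1 :* a :+ (κ 3 :* d :* Y) :* c := a :+ κ 3 :* d :* (Y :* c)) refl _ (δ p) (Y * Y) (Op ρ ps χ l))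

off : ℕ → (ℕ → 𝔽) → ℕ → 𝔽
off q c p = if p N.≡ᵇ q then # 0 else c p

off-≢ : ∀ {q p} c → p ≢ q → off q c p ≡ c p
off-≢ {q} {p} c h with p N.≡ᵇ q in eq
... | true = ⊥-elim (h (N.≡ᵇ⇒≡ p q (subst T (sym eq) tt)))
... | false = refl

off-≡ : ∀ q c → off q c q ≡ # 0
off-≡ q c with q N.≡ᵇ q in eq
... | true = refl
... | false = ⊥-elim (subst T eq (N.≡⇒≡ᵇ q q refl))

Mq-cong : ∀ {δ ρ δ' ρ'} ps → (∀ p → p ∈ ps → δ p ≡ δ' p × ρ p ≡ ρ' p) → ∀ F → Mq δ ρ ps F ≡ Mq δ' ρ' ps F
Mq-cong [] h F = refl
Mq-cong {δ} {ρ} {δ'} {ρ'} (p ∷ ps) h F = cong₂ _+_ (cong (λ d → Mq δ ρ ps (tilt d (lg p) F)) (π₁ (h p (here refl))) ∙ Mq-cong ps (λ q i → h q (there i)) _)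
 (cong₂ _*_ (π₂ (h p (here refl))) (Mq-cong ps (λ q i → h q (there i)) _))

-- A factor that is constantly -1 has no variance and merely takes the difference F(x) - F(x + lg
-- q). Shifts commute, so this difference can be taken before all other primes, after which q is
-- switched off.
Mq-off : ∀ q ps → Unique ps → q ∈ ps → ∀ {δ ρ δ' ρ'} → δ q ≡ - # 1 → ρ q ≡ # 0 → (∀ p → p ∈ ps → p ≢ q → δ p ≡ δ' p × ρ p ≡ ρ' p) →
     ∀ F → Mq δ ρ ps F ≡ Mq (off q δ') (off q ρ') ps (λ x → F x - F (x N.+ lg q))
Mq-off q (q ∷ ps) (q∉ ∷ _) (here refl) {δ} {ρ} {δ'} {ρ'} hδ hρ h F = cong₂ (λ d r → Mq δ ρ ps (tilt d (lg q) F) + r * Mq δ ρ ps (shift (lg q) F)) hδ hρ ∙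
 solve 2 (λ a b → a :+ κ 0 :* b := a) refl _ _ ∙ Mq-ext δ ρ ps (λ x → solve 2 (λ a b → a :+ (:- κ 1) :* b := a :- b) refl (F x) (F (x N.+ lg q))) ∙
 Mq-cong ps (λ p i → let p≢q = λ e → All.lookup q∉ i (sym e) in π₁ (h p (there i) p≢q) ∙ sym (off-≢ δ' p≢q) , π₂ (h p (there i) p≢q) ∙ sym (off-≢ ρ' p≢q)) _ ∙
 Mq-ext _ _ ps (λ x → solve 2 (λ a b → a := a :+ κ 0 :* b) refl _ _) ∙ solve 2 (λ a b → a := a :+ κ 0 :* b) refl _ _ ∙
  sym (cong₂ (λ d r → Mq (off q δ') (off q ρ') ps (tilt d (lg q) (λ x → F x - F (x N.+ lg q))) + r * Mq (off q δ') (off q ρ') ps (shift (lg q) (λ x → F x - F (x N.+ lg q)))) (off-≡ q δ') (off-≡ q ρ'))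
Mq-off q (p ∷ ps) (p∉ ∷ u) (there i) {δ} {ρ} {δ'} {ρ'} hδ hρ h F = cong₂ _+_
  (IH _ ∙ (Mq-ext _ _ ps λ x → cong (λ d → F x + δ p * F (x N.+ lg p) - (F (x N.+ lg q) + δ p * d)) (cong F (+-swap x (lg q) (lg p))) ∙
   solve 5 (λ a b c d k → a :+ k :* b :- (c :+ k :* d) := (a :- c) :+ k :* (b :- d)) refl _ _ _ _ (δ p) ∙ cong (λ d → F x - F (x N.+ lg q) + d * _) (π₁ hp ∙ sym (off-≢ δ' p≢q))))
  (cong₂ _*_ (π₂ hp ∙ sym (off-≢ ρ' p≢q)) (IH _ ∙ (Mq-ext _ _ ps λ x → cong (λ d → F (x N.+ lg p) - F d) (+-swap x (lg q) (lg p)))))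
 where
 p≢q : p ≢ q
 p≢q e = All.lookup p∉ i e
 hp = h p (here refl) p≢q
 IH = Mq-off q ps u i hδ hρ (λ r j → h r (there j))

module _ {c : ℕ → 𝔽} {ps : List ℕ} {K : ℕ} {b₁ b₂ S₁ S₂ : 𝔽} (b₁≤b₂ : b₁ ≤ b₂) (S₁≥0 : # 0 ≤ S₁) (S₂≥0 : # 0 ≤ S₂)
 (LB : ∀ X → X N.≤ K → b₁ * # X - S₁ ≤ Op c ps (ind X) 0) (UB : ∀ X → Op c ps (ind X) 0 ≤ b₂ * # X + S₂) where

 -- On a segment [0, X) with X ≥ v the difference is at least b₁ X - b₂ (X - v) - S₁ - S₂, that is
 -- b₁ v - (b₂ - b₁)(X - v) - S₁ - S₂. The discrepancy of the slopes is covered by (b₂ - b₁) K, and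
 -- `layer-cake` does the rest.
 diff-lower : ∀ {F} → Antitone F → Supp K F → ∀ v x →
  b₁ * ∑ (rg 0 v) (λ t → F (t N.+ x)) - ((b₂ - b₁) * # K + S₁ + S₂) * F x ≤ Op c ps F x - Op c ps F (x N.+ v)
 diff-lower {F} aF sF v x = ≤-sub (layer-cake {Ψ} linΨ K ind≥0 (Antitone-shift x aF) (Supp-shift x sF) ⨾≡ eq)
  where
  S = (b₂ - b₁) * # K + S₁ + S₂
  Ψ : (ℕ → 𝔽) → 𝔽
  Ψ F = # 1 * (# 1 * Op c ps F 0 + (- # 1) * Op c ps F v) + # 1 * ((- b₁) * ∑ (rg 0 v) (λ t → F t) + S * F 0)
  linΨ : Linear Ψ
  linΨ = comb-linear (# 1) (# 1) (comb-linear (# 1) (- # 1) (Op-linear c ps 0) (Op-linear c ps v)) (comb-linear (- b₁) S (∑-linear (rg 0 v) id) (eval-linear 0))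
  eq : Ψ (shift x F) ≡ Op c ps F x - Op c ps F (x N.+ v) - (b₁ * ∑ (rg 0 v) (λ t → F (t N.+ x)) - S * F x)
  eq = cong₂ (λ o o' → # 1 * (# 1 * o + (- # 1) * o') + # 1 * ((- b₁) * ∑ (rg 0 v) (λ t → F (t N.+ x)) + S * F x)) (sym (Op-at c ps F x))
      (Op-shift c ps F x v ∙ cong (Op c ps F) (N.+-comm v x)) ∙
   solve 6 (λ o o' b s S f → κ 1 :* (κ 1 :* o :+ (:- κ 1) :* o') :+ κ 1 :* ((:- b) :* s :+ S :* f) := o :- o' :- (b :* s :- S :* f)) refl _ _ b₁ _ S (F x)
  ind≥0 : ∀ X → X N.≤ K → # 0 ≤ Ψ (ind X)
  ind≥0 zero q = ≡⇒≤ (sym (cong₂ (λ o s → # 1 * (# 1 * Op c ps (ind 0) 0 + (- # 1) * o) + # 1 * ((- b₁) * s + S * # 0)) (Op-supp ps (ind-supp 0) z≤n) (∑-zero (rg 0 v) λ y _ → ind-false {0} {y} z≤n) ∙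
    cong (λ o → # 1 * (# 1 * o + (- # 1) * # 0) + # 1 * ((- b₁) * # 0 + S * # 0)) (Op-supp ps (ind-supp 0) z≤n) ∙
     solve 2 (λ b S → κ 1 :* (κ 1 :* κ 0 :+ (:- κ 1) :* κ 0) :+ κ 1 :* ((:- b) :* κ 0 :+ S :* κ 0) := κ 0) refl b₁ S))
  ind≥0 X@(suc _) q with N.≤-total X v
  ... | inj₁ r = lin (LB X q ⊕ *≥0 (sub-nonneg b₁≤b₂) (#≥0 K) ⊕ S₂≥0)
      (cong₂ (λ o s → # 1 * (# 1 * Op c ps (ind X) 0 + (- # 1) * o) + # 1 * ((- b₁) * s + S * # 1) + (b₁ * # X - S₁ + # 0 + # 0)) (Op-supp ps (ind-supp X) r) (∑-ind v X r) ∙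
       solve 6 (λ A b X S₁ S₂ D → κ 1 :* (κ 1 :* A :+ (:- κ 1) :* κ 0) :+ κ 1 :* ((:- b) :* X :+ (D :+ S₁ :+ S₂) :* κ 1) :+ (b :* X :- S₁ :+ κ 0 :+ κ 0) :=
         κ 0 :+ (A :+ D :+ S₂)) refl (Op c ps (ind X) 0) b₁ (# X) S₁ S₂ ((b₂ - b₁) * # K))
  ... | inj₂ r = lin (LB X q ⊕ UB (X ∸ v) ⊕ scale (sub-nonneg b₁≤b₂) (#-mono {X ∸ v} {K} (N.m∸n≤m X v ⨟ q)))
      (cong₂ (λ o s → # 1 * (# 1 * Op c ps (ind X) 0 + (- # 1) * o) + # 1 * ((- b₁) * s + S * # 1) + (b₁ * # X - S₁ + Op c ps (ind (X ∸ v)) 0 + (b₂ - b₁) * # (X ∸ v))) (Op-ind-at c ps X v)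
        ((∑-cong (rg 0 v) λ t m → ind-true (π₂ (∈-range⁻ m) ⨟ r)) ∙ sym (∑-cong (rg 0 v) λ t m → ind-true (π₂ (∈-range⁻ m))) ∙ ∑-ind v v N.≤-refl) ∙
       cong (λ X' → # 1 * (# 1 * Op c ps (ind X) 0 + (- # 1) * A') + # 1 * ((- b₁) * # v + S * # 1) + (b₁ * X' - S₁ + A' + (b₂ - b₁) * # (X ∸ v))) (cong #_ (sym (N.m∸n+n≡m r)) ∙ #-+ (X ∸ v) v) ∙
       solve 9 (λ A A' b b' S₁ S₂ K Y V → κ 1 :* (κ 1 :* A :+ (:- κ 1) :* A') :+ κ 1 :* ((:- b) :* V :+ ((b' :- b) :* K :+ S₁ :+ S₂) :* κ 1) :+ (b :* (Y :+ V) :- S₁ :+ A' :+ (b' :- b) :* Y) :=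
         κ 0 :+ (A :+ (b' :* Y :+ S₂) :+ (b' :- b) :* K)) refl (Op c ps (ind X) 0) A' b₁ b₂ S₁ S₂ (# K) (# (X ∸ v)) (# v))
   where A' = Op c ps (ind (X ∸ v)) 0

-- For t in the L-block number a, t + x lies at most a + 1 blocks beyond the block of x, because x
-- need not be at the start of its block; hence the index `suc t`.
window-sum : ∀ L .{{_ : NonZero L}} (f : ℕ → 𝔽) → Antitone f → ∀ a x →
 # L * ∑ (rg 0 a) (λ t → f (suc t N.+ x N./ L)) ≤ ∑ (rg 0 (a N.* L)) (λ t → f ((t N.+ x) N./ L))
window-sum L f af zero x = ≡⇒≤ (cong (# L *_) (∑-nil {0} {0} z≤n _) ∙ *0 (# L) ∙ sym (∑-nil {0} {0} z≤n _))
window-sum L f af (suc a) x = ≡⇒≤ (cong (# L *_) (∑-suc {0} {a} z≤n _) ∙ solve 3 (λ a b c → a :* (b :+ c) := a :* b :+ a :* c) refl (# L) _ _) ⨾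
 window-sum L f af a x ⊕ ≤-trans (≡⇒≤ (sym (∑-const (rg (a N.* L) (L N.+ a N.* L)) _ ∙ cong (λ n → # n * f (suc a N.+ x N./ L)) len)))
    (∑-mono (rg (a N.* L) (L N.+ a N.* L)) λ t m → af (le t (π₂ (∈-range⁻ m)))) ⨾
  ≡⇒≤ (sym (∑-split (L N.+ a N.* L) z≤n (N.m≤n+m (a N.* L) L) _))
 where
 len : length (rg (a N.* L) (L N.+ a N.* L)) ≡ L
 len = length-rg _ _ ∙ N.m+n∸n≡m L (a N.* L)
 le : ∀ t → t N.< L N.+ a N.* L → (t N.+ x) N./ L N.≤ suc a N.+ x N./ L
 le t q = N.<⇒≤pred (DM.m<n*o⇒m/o<n {n = suc (suc a N.+ x N./ L)} (N.+-mono-≤ q (N.<⇒≤ (n<[1+n/L]L x L)) ⨟ reflexive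
   (sym (N.*-distribʳ-+ L (suc a) (suc (x N./ L))) ∙ cong (N._* L) (N.+-suc (suc a) (x N./ L)))))

-- Reciprocals and harmonic sums

inv-unique : ∀ n {a} → 1 N.≤ n → # n * a ≡ # 1 → a ≡ inv n
inv-unique n {a} p e = begin
 a                    ≡⟨ 1*˘ a ⟩
 # 1 * a              ≡⟨ cong (_* a) (sym (#-inv n p)) ⟩
 # n * inv n * a      ≡⟨ *-swapʳ (# n) (inv n) a ⟩
 # n * a * inv n      ≡⟨ cong (_* inv n) e ⟩
 # 1 * inv n          ≡⟨ 1* _ ⟩
 inv n                ∎
 where open ≡-Reasoning

inv-* : ∀ m n → 1 N.≤ m → 1 N.≤ n → inv (m N.* n) ≡ inv m * inv n
inv-* m n p q = sym (inv-unique (m N.* n) (N.*-mono-≤ p q) (cong (_* (inv m * inv n)) (#-* m n) ∙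
 *-interchange (# m) (# n) (inv m) (inv n) ∙
  cong₂ _*_ (#-inv m p) (#-inv n q) ∙ solve 0 (κ 1 :* κ 1 := κ 1) refl))

inv-1 : inv 1 ≡ # 1
inv-1 = sym (inv-unique 1 N.≤-refl (solve 0 (κ 1 :* κ 1 := κ 1) refl))

inv-mono : ∀ {m n} → 1 N.≤ m → m N.≤ n → inv n ≤ inv m
inv-mono {m} {n} p q = subst₂ _≤_ (solve 3 (λ a b m → m :* (a :* b) := m :* a :* b) refl (inv m) (inv n) (# m) ∙ cong (_* inv n) (#-inv m p) ∙ 1* (inv n))
  (solve 3 (λ a b m → m :* (a :* b) := m :* b :* a) refl (inv m) (inv n) (# n) ∙ cong (_* inv m) (#-inv n (p ⨟ q)) ∙ 1* (inv m))
  (scaleʳ (*≥0 (inv-nonneg m) (inv-nonneg n)) (#-mono q))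

inv≤1 : ∀ n → 1 N.≤ n → inv n ≤ # 1
inv≤1 n p = subst (inv n ≤_) inv-1 (inv-mono N.≤-refl p)

abstract
 prime≥2 : ∀ {p} → Prime p → 2 N.≤ p
 prime≥2 {p} h = N.nonTrivial⇒n>1 p ⦃ prime⇒nonTrivial h ⦄

 prime≥1 : ∀ {p} → Prime p → 1 N.≤ p
 prime≥1 h = N.<⇒≤ (prime≥2 h)

prime∣prime : ∀ {p q} → Prime p → Prime q → p ∣ q → p ≡ q
prime∣prime {p} {q} hp hq d with prime⇒irreducible hq d
... | inj₁ refl = ⊥-elim (N.<⇒≱ (prime≥2 hp) N.≤-refl)
... | inj₂ e = e

prime-factor : ∀ n → 2 N.≤ n → ∃ λ p → Prime p × p ∣ n
prime-factor n@(suc _) h with factorise n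
... | record { factors = [] ; isFactorisation = e } = ⊥-elim (N.<⇒≱ h (reflexive e))
... | record { factors = p ∷ ps ; isFactorisation = e ; factorsPrime = hp ∷ _ } = p , hp , subst (p ∣_) (sym e) (∣.m∣m*n (product ps))

module _ {p : ℕ} (p≥1 : 1 N.≤ p) where
 private instance
  p≢0 : NonZero p
  p≢0 = N.>-nonZero p≥1

 quot : ℕ → ℕ
 quot X = X N./ p

 ∑-multiples : ∀ X (f : ℕ → 𝔽) → ∑ (rg 1 (suc X)) (λ n → 𝟙 ⌊ p ∣? n ⌋ * f n) ≡ ∑ (rg 1 (suc (quot X))) (λ m → f (p N.* m))
 ∑-multiples zero f = ∑-nil {1} {1} N.≤-refl _ ∙ sym (∑-nil {1} {suc (quot 0)} (s≤s (reflexive (DM.0/n≡0 p))) _)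
 ∑-multiples (suc X) f with p ∣? suc X in eq
 ... | yes (∣.divides k e) = begin
   ∑ (rg 1 (suc (suc X))) _           ≡⟨ ∑-suc {1} {suc X} (s≤s z≤n) _ ⟩
   ∑ (rg 1 (suc X)) _ + 𝟙 ⌊ p ∣? suc X ⌋ * f (suc X)
     ≡⟨ cong₂ _+_ (∑-multiples X f) (cong (λ d → 𝟙 ⌊ d ⌋ * f (suc X)) eq ∙ 1* _ ∙ cong f (e ∙ N.*-comm k p)) ⟩
   ∑ (rg 1 (suc (quot X))) _ + f (p N.* k)    ≡⟨ cong (λ z → ∑ (rg 1 (suc (quot X))) _ + f (p N.* z)) k≡ ⟩
   ∑ (rg 1 (suc (quot X))) _ + f (p N.* suc (quot X))   ≡⟨ sym (∑-suc {1} {suc (quot X)} (s≤s z≤n) _) ⟩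
   ∑ (rg 1 (suc (suc (quot X)))) _      ≡⟨ cong (λ z → ∑ (rg 1 (suc z)) _) (sym (cong (N._/ p) e ∙ DM.m*n/n≡m k p ∙ k≡)) ⟩
   ∑ (rg 1 (suc (quot (suc X)))) _ ∎
  where
  open ≡-Reasoning
  k≡ : k ≡ suc (quot X)
  k≡ = N.≤-antisym (N.*-cancelʳ-≤ k (suc (quot X)) p (reflexive (sym e) ⨟ n<[1+n/L]L X p))
    (N.*-cancelʳ-< p (quot X) k (s≤s (DM.m/n*n≤m X p) ⨟ reflexive e))
 ... | no h = ∑-suc {1} {suc X} (s≤s z≤n) _ ∙ cong₂ _+_ (∑-multiples X f) (cong (λ d → 𝟙 ⌊ d ⌋ * f (suc X)) eq ∙ 0* _) ∙
   +0 _ ∙ cong (λ z → ∑ (rg 1 (suc z)) _) (sym same)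
  where
  same : quot (suc X) ≡ quot X
  same = N.≤-antisym (N.<⇒≤pred (DM.m<n*o⇒m/o<n {n = suc (quot X)} (N.≤∧≢⇒< (n<[1+n/L]L X p) λ e → h (∣.divides (suc (quot X)) e)))) (DM./-monoˡ-≤ p (N.n≤1+n X))

free : List ℕ → ℕ → Bool
free [] n = true
free (p ∷ qs) n = not ⌊ p ∣? n ⌋ ∧ free qs n

free⁻ : ∀ qs {n p} → T (free qs n) → p ∈ qs → ¬ (p ∣ n)
free⁻ (p ∷ qs) {n} h (here refl) d with p ∣? n
... | no k = k d
free⁻ (q ∷ qs) {n} h (there i) d = free⁻ qs (π₂ (∧⁻ {not ⌊ q ∣? n ⌋} h)) i d

free⁺ : ∀ qs {n} → (∀ p → p ∈ qs → ¬ (p ∣ n)) → T (free qs n)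
free⁺ [] h = tt
free⁺ (p ∷ qs) {n} h with p ∣? n
... | yes d = h p (here refl) d
... | no _ = free⁺ qs λ q i → h q (there i)

free-* : ∀ qs {p} m → Prime p → p ∉ qs → (∀ q → q ∈ qs → Prime q) → 𝟙 (free qs (p N.* m)) ≡ 𝟙 (free qs m)
free-* qs {p} m hp p∉ hq = 𝟙-cong (λ t → free⁺ qs λ q i d → free⁻ qs t i (∣.∣n⇒∣m*n p d))
 (λ t → free⁺ qs λ q i d → [ (λ e → p∉ (subst (_∈ qs) (prime∣prime (hq q i) hp e) i)) , (λ e → free⁻ qs t i e) ]′ (euclidsLemma p m (hq q i) d))

H : ℕ → 𝔽
H X = ∑ (rg 1 (suc X)) inv

g : List ℕ → ℕ → 𝔽
g qs X = ∑ (rg 1 (suc X)) (λ n → 𝟙 (free qs n) * inv n)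

g-nonneg : ∀ qs X → # 0 ≤ g qs X
g-nonneg qs X = ∑≥0 (rg 1 (suc X)) λ n _ → *≥0 (𝟙≥0 _) (inv-nonneg n)

g-mono : ∀ qs {X Y} → X N.≤ Y → g qs X ≤ g qs Y
g-mono qs p = ∑-subrange {1} {_} {1} N.≤-refl (s≤s p) λ n → *≥0 (𝟙≥0 _) (inv-nonneg n)

-- Multiples n = p m are split off; m may be divisible by p again, so the last term still has
-- `g qs`.
g-step : ∀ {p} qs (hp : Prime p) → p ∉ qs → (∀ q → q ∈ qs → Prime q) → ∀ X → g qs X ≡ g (p ∷ qs) X + inv p * g qs (quot (prime≥1 hp) X)
g-step {p} qs hp p∉ hq X = begin
 g qs X ≡⟨ ∑-ext (rg 1 (suc X)) split ⟩
 ∑ (rg 1 (suc X)) (λ n → 𝟙 (free (p ∷ qs) n) * inv n + 𝟙 ⌊ p ∣? n ⌋ * (𝟙 (free qs n) * inv n)) ≡⟨ ∑-+ (rg 1 (suc X)) _ _ ⟩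
 g (p ∷ qs) X + ∑ (rg 1 (suc X)) (λ n → 𝟙 ⌊ p ∣? n ⌋ * (𝟙 (free qs n) * inv n))
  ≡⟨ cong (g (p ∷ qs) X +_) (∑-multiples (prime≥1 hp) X _ ∙ (∑-cong (rg 1 _) λ m i →
     cong₂ _*_ (free-* qs m hp p∉ hq) (inv-* p m (prime≥1 hp) (π₁ (∈-range⁻ i))) ∙ *-swap (𝟙 (free qs m)) (inv p) (inv m)) ∙
     ∑-scale (rg 1 _) (inv p) _) ⟩
 g (p ∷ qs) X + inv p * g qs (quot (prime≥1 hp) X) ∎
 where
 open ≡-Reasoning
 split : ∀ n → 𝟙 (free qs n) * inv n ≡ 𝟙 (free (p ∷ qs) n) * inv n + 𝟙 ⌊ p ∣? n ⌋ * (𝟙 (free qs n) * inv n)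
 split n with p ∣? n
 ... | yes _ = solve 2 (λ a i → a := κ 0 :* i :+ κ 1 :* a) refl (𝟙 (free qs n) * inv n) (inv n)
 ... | no _ = solve 1 (λ a → a := a :+ κ 0 :* a) refl (𝟙 (free qs n) * inv n)

2^_ : ℕ → ℕ
2^ x = 2 N.^ x
infix 9 2^_

2^≥1 : ∀ x → 1 N.≤ 2^ x
2^≥1 x = N.m^n>0 2 x

2^-mono : ∀ {x y} → x N.≤ y → 2^ x N.≤ 2^ y
2^-mono = N.^-monoʳ-≤ 2

double : ∀ n → 2 N.* n ≡ n N.+ n
double n = cong (n N.+_) (N.+-identityʳ n)

∑-pairs : ∀ {a b} → a N.≤ b → ∀ f → ∑ (rg (2 N.* a) (2 N.* b)) f ≡ ∑ (rg a b) (λ n → f (2 N.* n) + f (suc (2 N.* n)))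
∑-pairs {a} {b} p f = range-ind {a} (λ b → a N.≤ b → ∑ (rg (2 N.* a) (2 N.* b)) f ≡ ∑ (rg a b) (λ n → f (2 N.* n) + f (suc (2 N.* n))))
 (λ b q r → ∑-nil (N.*-monoʳ-≤ 2 q) f ∙ sym (∑-nil q _))
 (λ b q ih _ → cong (λ z → ∑ (rg (2 N.* a) z) f) (N.*-suc 2 b) ∙ ∑-suc (N.m≤n⇒m≤1+n (N.*-monoʳ-≤ 2 q)) f ∙
   cong (_+ f (suc (2 N.* b))) (∑-suc (N.*-monoʳ-≤ 2 q) f) ∙ cong (λ z → z + f (2 N.* b) + f (suc (2 N.* b))) (ih q) ∙
    solve 3 (λ a b c → a :+ b :+ c := a :+ (b :+ c)) refl _ _ _ ∙ sym (∑-suc q _)) b p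

inv-half : ∀ n → 1 N.≤ n → inv (2 N.* n) + inv (2 N.* n) ≡ inv n
inv-half n p = cong₂ _+_ (inv-* 2 n (s≤s z≤n) p) (inv-* 2 n (s≤s z≤n) p) ∙ solve 2 (λ a b → a :* b :+ a :* b := κ 2 :* a :* b) refl (inv 2) (inv n) ∙
 cong (_* inv n) (#-inv 2 (s≤s z≤n)) ∙ 1* (inv n)

-- Both sums tend to log 2, the first from above and the second from below.
dyadic dyadic′ : ℕ → 𝔽
dyadic s = ∑ (rg (2^ s) (2^ suc s)) inv
dyadic′ s = ∑ (rg (suc (2^ s)) (suc (2^ suc s))) inv

dyadic-suc : ∀ s → dyadic (suc s) ≤ dyadic s
dyadic-suc s = ∑-pairs (2^-mono (N.n≤1+n s)) inv ≡⨾ (∑-mono (rg (2^ s) (2^ suc s)) λ n m → let n≥1 = 2^≥1 s ⨟ π₁ (∈-range⁻ m) in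
 ≤-refl {inv (2 N.* n)} ⊕ inv-mono (n≥1 ⨟ N.m≤m+n n _) (N.n≤1+n (2 N.* n)) ⨾≡ inv-half n n≥1)

dyadic′-suc : ∀ s → dyadic′ s ≤ dyadic′ (suc s)
dyadic′-suc s = ∑-shift (2^ s) (2^ suc s) 1 inv ≡⨾ (∑-mono (rg (2^ s) (2^ suc s)) λ n m →
   sym (inv-half (suc n) (s≤s z≤n)) ≡⨾ subst (λ z → inv z + inv z ≤ inv (suc (2 N.* n)) + inv (suc (suc (2 N.* n)))) (sym (N.*-suc 2 n))
    (inv-mono (s≤s z≤n) (N.n≤1+n _) ⊕ ≤-refl)) ⨾
  sym (∑-pairs (2^-mono (N.n≤1+n s)) (inv ∘ suc)) ≡⨾ ≡⇒≤ (sym (∑-shift (2^ suc s) (2^ suc (suc s)) 1 inv))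

dyadic-anti : ∀ {s t} → s N.≤ t → dyadic t ≤ dyadic s
dyadic-anti {s} {t} p = subst (λ t → dyadic t ≤ dyadic s) (N.m∸n+n≡m p) (go (t ∸ s))
 where
 go : ∀ d → dyadic (d N.+ s) ≤ dyadic s
 go zero = ≤-refl
 go (suc d) = dyadic-suc (d N.+ s) ⨾ go d

dyadic′-mono : ∀ {s t} → s N.≤ t → dyadic′ s ≤ dyadic′ t
dyadic′-mono {s} {t} p = subst (λ t → dyadic′ s ≤ dyadic′ t) (N.m∸n+n≡m p) (go (t ∸ s))
 where
 go : ∀ d → dyadic′ s ≤ dyadic′ (d N.+ s)
 go zero = ≤-refl
 go (suc d) = go d ⨾ dyadic′-suc (d N.+ s)

dyadic-gap : ∀ s → dyadic s ≤ dyadic′ s + inv (2^ s)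
dyadic-gap s = lin (inv-nonneg (2^ suc s)) (cong (_+ # 0) refl ∙ solve 2 (λ a b → a :+ b :+ κ 0 := b :+ a) refl (dyadic′ s) (inv (2^ s)) ∙
 cong (_+ dyadic′ s) (sym (∑-suc (N.≤-refl {2^ s}) inv ∙ cong (_+ inv (2^ s)) (∑-nil (N.≤-refl {2^ s}) inv) ∙ 0+ _)) ∙
  sym (∑-split (suc (2^ suc s)) (N.n≤1+n (2^ s)) (s≤s (2^-mono (N.n≤1+n s))) inv) ∙ ∑-suc (2^-mono (N.n≤1+n s)) inv)

dyadic′-half : ∀ s → inv 2 ≤ dyadic′ s
dyadic′-half s = ≡⇒≤ (sym (∑-const (rg (suc (2^ s)) (suc (2^ suc s))) (inv (2^ suc s)) ∙ cong (λ n → # n * inv (2^ suc s)) len ∙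
   cong (# (2^ s) *_) (inv-* 2 (2^ s) (s≤s z≤n) (2^≥1 s)) ∙ *-rotate (# (2^ s)) (inv 2) (inv (2^ s)) ∙
    cong (_* inv 2) (#-inv (2^ s) (2^≥1 s)) ∙ 1* (inv 2))) ⨾
  (∑-mono (rg (suc (2^ s)) (suc (2^ suc s))) λ n m → inv-mono (s≤s z≤n ⨟ π₁ (∈-range⁻ m)) (N.≤-pred (π₂ (∈-range⁻ m))))
 where
 len : length (rg (suc (2^ s)) (suc (2^ suc s))) ≡ 2^ s
 len = length-rg _ _ ∙ cong (_∸ 2^ s) (double (2^ s)) ∙ N.m+n∸n≡m (2^ s) (2^ s)

∑-dyadic-≤ : ∀ {s a} → s N.≤ a → ∀ d → ∑ (rg (2^ a) (2^ (d N.+ a))) inv ≤ dyadic s * # d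
∑-dyadic-≤ {s} {a} p zero = ≡⇒≤ (∑-nil (N.≤-refl {2^ a}) inv ∙ *0˘ (dyadic s))
∑-dyadic-≤ {s} {a} p (suc d) = ≡⇒≤ (∑-split (2^ suc (d N.+ a)) (2^-mono (N.m≤n+m a d)) (2^-mono (N.n≤1+n (d N.+ a))) inv) ⨾
 ∑-dyadic-≤ p d ⊕ dyadic-anti (p ⨟ N.m≤n+m a d) ⨾ ≡⇒≤ (solve 2 (λ c d → c :* d :+ c := c :* (κ 1 :+ d)) refl (dyadic s) (# d) ∙ cong (dyadic s *_) (sym (#-suc d)))

∑-dyadic-≥ : ∀ {s a} → s N.≤ a → ∀ d → dyadic′ s * # d ≤ ∑ (rg (suc (2^ a)) (suc (2^ (d N.+ a)))) inv
∑-dyadic-≥ {s} {a} p zero = ≡⇒≤ (*0 (dyadic′ s) ∙ sym (∑-nil N.≤-refl inv))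
∑-dyadic-≥ {s} {a} p (suc d) = ≡⇒≤ (cong (dyadic′ s *_) (#-suc d) ∙ solve 2 (λ c d → c :* (κ 1 :+ d) := c :* d :+ c) refl (dyadic′ s) (# d)) ⨾
 ∑-dyadic-≥ p d ⊕ dyadic′-mono (p ⨟ N.m≤n+m a d) ⨾
  ≡⇒≤ (sym (∑-split (suc (2^ suc (d N.+ a))) (s≤s (2^-mono (N.m≤n+m a d))) (s≤s (2^-mono (N.n≤1+n (d N.+ a)))) inv))

dyadic-nonneg : ∀ s → # 0 ≤ dyadic s
dyadic-nonneg s = ∑≥0 (rg (2^ s) (2^ suc s)) λ n _ → inv-nonneg n

-- From 2^s on, each doubling adds at most `dyadic s`. The slope is a rational substitute for log 2
-- whose precision is governed by s.
H-upper : ∀ s → ∃ λ C → # 0 ≤ C × (∀ x → H (2^ x) ≤ dyadic s * # x + C)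
H-upper s = C , C≥0 , bound
 where
 C₀ = ∑ (rg 1 (2^ s)) inv
 C = C₀ + # 1
 C₀≥0 = ∑≥0 (rg 1 (2^ s)) (λ n _ → inv-nonneg n)
 C≥0 = +≥0 C₀≥0 0≤1
 part : ∀ x → ∑ (rg 1 (2^ x)) inv ≤ dyadic s * # x + C₀
 part x with N.≤-total x s
 ... | inj₁ q = lin (∑-subrange {1} {2^ x} {1} {2^ s} N.≤-refl (2^-mono q) inv-nonneg ⊕ *≥0 (dyadic-nonneg s) (#≥0 x))
     (solve 3 (λ a b c → a :+ b :+ (c :+ κ 0) := c :+ (b :+ a)) refl (dyadic s * # x) C₀ (∑ (rg 1 (2^ x)) inv))
 ... | inj₂ q = ∑-split (2^ x) (2^≥1 s) (2^-mono q) inv ≡⨾ lin (subst (λ z → ∑ (rg (2^ s) (2^ z)) inv ≤ dyadic s * # (x ∸ s)) (N.m∸n+n≡m q) (∑-dyadic-≤ N.≤-refl (x ∸ s))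
      ⊕ scale (dyadic-nonneg s) (#-mono (N.m∸n≤m x s)))
     (solve 5 (λ d x y C S → d :* x :+ C :+ (S :+ d :* y) := C :+ S :+ (d :* y :+ d :* x)) refl (dyadic s) (# x) (# (x ∸ s)) C₀ (∑ (rg (2^ s) (2^ x)) inv))
 bound : ∀ x → H (2^ x) ≤ dyadic s * # x + C
 bound x = ∑-suc (2^≥1 x) inv ≡⨾ part x ⊕ inv≤1 (2^ x) (2^≥1 x) ⨾ ≡⇒≤ (solve 3 (λ a b c → a :+ b :+ c := a :+ (b :+ c)) refl (dyadic s * # x) C₀ (# 1))

H-nonneg : ∀ X → # 0 ≤ H X
H-nonneg X = ∑≥0 (rg 1 (suc X)) λ n _ → inv-nonneg n

dyadic′-nonneg : ∀ s → # 0 ≤ dyadic′ s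
dyadic′-nonneg s = inv-nonneg 2 ⨾ dyadic′-half s

H-lower : ∀ s x → dyadic′ s * (# x - # s) ≤ H (2^ x)
H-lower s x with N.≤-total x s
... | inj₁ q = scale (dyadic′-nonneg s) (lin (#-mono q) (solve 2 (λ x s → κ 0 :+ x := x :- s :+ s) refl (# x) (# s))) ⨾ *0 (dyadic′ s) ≡⨾ H-nonneg (2^ x)
... | inj₂ q = ≡⇒≤ (cong (dyadic′ s *_) (cong (_- # s) (cong #_ (sym (N.m∸n+n≡m q)) ∙ #-+ (x ∸ s) s) ∙ solve 2 (λ a b → a :+ b :- b := a) refl (# (x ∸ s)) (# s))) ⨾
  subst (λ z → dyadic′ s * # (x ∸ s) ≤ ∑ (rg (suc (2^ s)) (suc (2^ z))) inv) (N.m∸n+n≡m q) (∑-dyadic-≥ N.≤-refl (x ∸ s)) ⨾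
   ∑-subrange (s≤s z≤n) N.≤-refl inv-nonneg

primes : ℕ → ℕ → List ℕ
primes a b = filter prime? (rg a b)

∈-primes⁻ : ∀ {a b p} → p ∈ primes a b → Prime p × a N.≤ p × p N.< b
∈-primes⁻ {a} {b} m with ∈-filter⁻ prime? {xs = rg a b} m
... | i , hp = hp , ∈-range⁻ i

∈-primes⁺ : ∀ {a b p} → Prime p → a N.≤ p → p N.< b → p ∈ primes a b
∈-primes⁺ hp q r = ∈-filter⁺ prime? (∈-range⁺ q r) hp

unique-primes : ∀ a b → Unique (primes a b)
unique-primes a b = Unique.filter⁺ prime? (unique-rg a b)

2^⌊log₂⌋≤ : ∀ n → 1 N.≤ n → 2^ ⌊log₂ n ⌋ N.≤ n
2^⌊log₂⌋≤ = <-rec _ go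
 where
 go : ∀ n → (∀ {m} → m N.< n → 1 N.≤ m → 2^ ⌊log₂ m ⌋ N.≤ m) → 1 N.≤ n → 2^ ⌊log₂ n ⌋ N.≤ n
 go (suc zero) ih p = N.≤-refl
 go n@(suc (suc k)) ih p = 2^-mono (N.m≤n+m∸n ⌊log₂ n ⌋ 1 ⨟ reflexive (cong suc (sym (⌊log₂⌊n/2⌋⌋≡⌊log₂n⌋∸1 n)))) ⨟
  N.*-monoʳ-≤ 2 (ih {N.⌊ n /2⌋} (N.⌊n/2⌋<n (suc k)) (s≤s z≤n)) ⨟
   reflexive (double N.⌊ n /2⌋) ⨟ N.+-monoʳ-≤ N.⌊ n /2⌋ (N.⌊n/2⌋≤⌈n/2⌉ n) ⨟ reflexive (N.⌊n/2⌋+⌈n/2⌉≡n n)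

n<2^lg : ∀ n → n N.< 2^ lg n
n<2^lg n with 2^ lg n N.≤? n
... | yes p = ⊥-elim (N.<⇒≱ (N.≤-refl {lg n}) (reflexive (sym (⌊log₂[2^n]⌋≡n (lg n))) ⨟ ⌊log₂⌋-mono-≤ p))
... | no p = N.≰⇒> p

lg-≤ : ∀ {n x} → 1 N.≤ n → n N.< 2^ x → lg n N.≤ x
lg-≤ {n} {x} p q = N.≰⇒> λ r → N.<⇒≱ q (2^-mono r ⨟ 2^⌊log₂⌋≤ n p)

lg-≥ : ∀ {n x} → 2^ x N.≤ n → x N.< lg n
lg-≥ {n} {x} p = s≤s (reflexive (sym (⌊log₂[2^n]⌋≡n x)) ⨟ ⌊log₂⌋-mono-≤ p)

-- Density of the integers without small prime factors

euler : List ℕ → 𝔽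
euler = ∏ (λ p → # 1 - inv p)

1-inv : ∀ {p} → 1 N.≤ p → # 0 ≤ # 1 - inv p × # 1 - inv p ≤ # 1
1-inv {p} h = sub-nonneg (inv≤1 p h) , lin (inv-nonneg p) (solve 1 (λ i → κ 1 :+ κ 0 := κ 1 :- i :+ i) refl (inv p))

euler-bounds : ∀ qs → (∀ q → q ∈ qs → Prime q) → # 0 ≤ euler qs × euler qs ≤ # 1
euler-bounds [] h = 0≤1 , ≤-refl
euler-bounds (p ∷ qs) h = *≥0 (π₁ b) (π₁ IH) , *-mono (π₁ IH) 0≤1 (π₂ b) (π₂ IH) ⨾ ≡⇒≤ (solve 0 (κ 1 :* κ 1 := κ 1) refl)
 where
 IH = euler-bounds qs (λ q i → h q (there i))
 b = 1-inv (prime≥1 (h p (here refl)))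

euler-pos : ∀ qs → (∀ q → q ∈ qs → Prime q) → # 0 < euler qs
euler-pos [] h = #-pos 1 N.≤-refl
euler-pos (p ∷ qs) h = *-pos (≰⇒> λ q → 0≢1 (*-mono' q ⨾ ≤-refl)) (euler-pos qs (λ q i → h q (there i)))
 where
 hp = h p (here refl)
 *-mono' : # 1 - inv p ≤ # 0 → # 1 ≤ # 0
 *-mono' q = lin (scale (#≥0 2) (q ⊕ inv-mono {2} {p} (s≤s z≤n) (prime≥2 hp)) ⊕ ≡⇒≤ (sym (#-inv 2 (s≤s z≤n))))
  (solve 2 (λ i j → κ 0 :+ (κ 2 :* (κ 1 :- i :+ i) :+ κ 1) := κ 1 :+ (κ 2 :* (κ 0 :+ j) :+ κ 2 :* j) :+ (κ 2 :- κ 4 :* j)) refl (inv p) (inv 2) `then` half)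
  where
  _`then`_ : ∀ {a b c : 𝔽} → a ≡ b + c → c ≡ # 0 → a ≡ b
  _`then`_ {b = b} refl refl = +0 b
  half : # 2 - # 4 * inv 2 ≡ # 0
  half = solve 1 (λ i → κ 2 :- κ 4 :* i := κ 2 :- κ 2 :* (κ 2 :* i)) refl (inv 2) ∙ cong (λ z → # 2 - # 2 * z) (#-inv 2 (s≤s z≤n)) ∙ solve 0 (κ 2 :- κ 2 :* κ 1 := κ 0) refl

H-quot : ∀ {p} (hp : 1 N.≤ p) X → # 0 ≤ H X - H (quot hp X) × H X - H (quot hp X) ≤ # p
H-quot {p} hp X = sub-nonneg (∑-subrange {1} {_} {1} N.≤-refl (s≤s Y≤X) inv-nonneg) , upper
 where
 instance
  p≢0 : NonZero p
  p≢0 = N.>-nonZero hp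
 Y = quot hp X
 Y≤X : Y N.≤ X
 Y≤X = DM.m/n≤m X p
 tail : ∑ (rg (suc Y) (suc X)) inv ≤ # p
 tail = (∑-mono (rg (suc Y) (suc X)) λ n m → inv-mono (s≤s z≤n) (π₁ (∈-range⁻ m))) ⨾
  ≡⇒≤ (∑-const (rg (suc Y) (suc X)) (inv (suc Y)) ∙ cong (λ n → # n * inv (suc Y)) (length-rg (suc Y) (suc X))) ⨾
   scaleʳ (inv-nonneg (suc Y)) (#-mono (N.m∸n≤m X Y ⨟ N.<⇒≤ (n<[1+n/L]L X p))) ⨾
    ≡⇒≤ (cong (_* inv (suc Y)) (#-* (suc Y) p) ∙ *-swapʳ (# (suc Y)) (# p) (inv (suc Y)) ∙
     cong (_* # p) (#-inv (suc Y) (s≤s z≤n)) ∙ 1* (# p))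
 upper : H X - H Y ≤ # p
 upper = (cong (_- H Y) (∑-split (suc X) (s≤s z≤n) (s≤s Y≤X) inv) ∙ solve 2 (λ a b → a :+ b :- a := b) refl (H Y) _) ≡⨾ tail

-- By `g-step` a further prime multiplies the main term by 1 - 1/p, because H(X) and H(X/p) differ
-- by at most p, which the factor 1/p reduces to 1. The crude growth of the constant is harmless,
-- since the list is fixed.
g-approx : ∀ qs → (∀ q → q ∈ qs → Prime q) → Unique qs → ∃ λ C → # 0 ≤ C × (∀ X → Abs≤ (g qs X - euler qs * H X) C)
g-approx [] h u = # 0 , ≤-refl , λ X → subst₂ Abs≤ (sym (cong (_- # 1 * H X) (∑-ext (rg 1 (suc X)) λ n → 1* (inv n)) ∙
  solve 1 (λ a → a :- κ 1 :* a := κ 0) refl (H X))) refl (Abs≤-0 ≤-refl)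
g-approx (p ∷ qs) h (p∉ ∷ u) with g-approx qs (λ q i → h q (there i)) u
... | C , C≥0 , hC = C + C + # 1 , +≥0 (+≥0 C≥0 C≥0) 0≤1 , bound
 where
 hp = h p (here refl)
 Y = quot (prime≥1 hp)
 E = euler qs
 E-b = euler-bounds qs (λ q i → h q (there i))
 scaleBack : ∀ {a b} → # 0 ≤ b → Abs≤ a b → Abs≤ (inv p * a) b
 scaleBack {a} {b} b≥0 q = Abs≤-weaken (scaleʳ b≥0 (inv≤1 p (prime≥1 hp)) ⨾≡ 1* b) (Abs≤-scale (inv-nonneg p) q)
 third : ∀ X → Abs≤ (E * inv p * (H X - H (Y X))) (# 1)
 third X = lin (*≥0 (*≥0 (π₁ E-b) (inv-nonneg p)) (π₁ (H-quot (prime≥1 hp) X)) ⊕ 0≤1) (solve 1 (λ z → z :+ (κ 0 :+ κ 0) := :- κ 1 :+ (z :+ κ 1)) refl (E * inv p * (H X - H (Y X)))) ,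
   *-mono (π₁ (H-quot (prime≥1 hp) X)) (inv-nonneg p) (scaleʳ (inv-nonneg p) (π₂ E-b) ⨾≡ 1* (inv p)) (π₂ (H-quot (prime≥1 hp) X)) ⨾
    ≡⇒≤ (*-comm (inv p) (# p) ∙ #-inv p (prime≥1 hp))
 bound : ∀ X → Abs≤ (g (p ∷ qs) X - (# 1 - inv p) * E * H X) (C + C + # 1)
 bound X = subst₂ Abs≤ (cong (λ z → z - E * H X + - (inv p * (g qs (Y X) - E * H (Y X))) + E * inv p * (H X - H (Y X))) (g-step qs hp (λ i → All.lookup p∉ i refl) (λ q i → h q (there i)) X) ∙
   solve 6 (λ a i b E h h' → a :+ i :* b :- E :* h :+ (:- (i :* (b :- E :* h'))) :+ E :* i :* (h :- h') := a :- (κ 1 :- i) :* E :* h) refl _ (inv p) (g qs (Y X)) E (H X) (H (Y X))) refl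
  (Abs≤-+ (Abs≤-+ (hC X) (Abs≤-neg (scaleBack C≥0 (hC (Y X))))) (third X))

-- Sums over squarefree integers composed of large primes

Disjoint : List ℕ → List ℕ → Set
Disjoint ps qs = ∀ {p} → p ∈ ps → p ∉ qs

g≥1 : ∀ qs → (∀ q → q ∈ qs → Prime q) → ∀ X → 1 N.≤ X → # 1 ≤ g qs X
g≥1 qs h X p = ≡⇒≤ (sym (cong₂ _*_ (𝟙-true (free⁺ qs λ q i d → N.<⇒≱ (prime≥2 (h q i)) (∣.∣⇒≤ d))) inv-1 ∙ solve 0 (κ 1 :* κ 1 := κ 1) refl)) ⨾
 ∑-term (rg 1 (suc X)) (λ n _ → *≥0 (𝟙≥0 (free qs n)) (inv-nonneg n)) (∈-range⁺ N.≤-refl (s≤s p))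

-- The sets D counted on the left have distinct products of at most 2^(X - x) that are free of `qs`.
-- The induction moves primes from `ps` to `qs` one at a time.
Op-inv-≤-g : ∀ ps qs → (∀ q → q ∈ ps → Prime q) → (∀ q → q ∈ qs → Prime q) → Unique ps → Disjoint ps qs →
       ∀ X x → x N.< X → Op inv ps (ind X) x ≤ g qs (2^ (X ∸ x))
Op-inv-≤-g [] qs hps hqs u d X x q = 𝟙≤1 _ ⨾ g≥1 qs hqs _ (2^≥1 (X ∸ x))
Op-inv-≤-g (p ∷ ps) qs hps hqs (p∉ ∷ u) d X x q = IH x q ⊕ second ⨾ ≡⇒≤ (sym (g-step qs hp (d (here refl)) hqs (2^ (X ∸ x))))
 where
 hp = hps p (here refl)
 instance
  p≢0 : NonZero p
  p≢0 = N.>-nonZero (prime≥1 hp)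
 hqs' : ∀ q → q ∈ p ∷ qs → Prime q
 hqs' q (here refl) = hp
 hqs' q (there i) = hqs q i
 d' : Disjoint ps (p ∷ qs)
 d' i (here refl) = All.lookup p∉ i refl
 d' i (there j) = d (there i) j
 IH = Op-inv-≤-g ps (p ∷ qs) (λ q i → hps q (there i)) hqs' u d' X
 g-drop : ∀ Y → g (p ∷ qs) Y ≤ g qs Y
 g-drop Y = ∑-mono (rg 1 (suc Y)) λ n _ → scaleʳ (inv-nonneg n) (𝟙-mono λ t → π₂ (∧⁻ {not ⌊ p ∣? n ⌋} t))
 second : inv p * Op inv ps (ind X) (x N.+ lg p) ≤ inv p * g qs (quot (prime≥1 hp) (2^ (X ∸ x)))
 second with x N.+ lg p N.<? X
 ... | no r = scale (inv-nonneg p) (Op-supp ps (ind-supp X) (N.≮⇒≥ r) ≡⨾ g-nonneg qs _)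
 ... | yes r = scale (inv-nonneg p) (IH (x N.+ lg p) r ⨾ g-drop _ ⨾ g-mono qs (mL≤n⇒m≤n/L p
    (N.*-monoʳ-≤ (2^ (X ∸ (x N.+ lg p))) (N.<⇒≤ (n<2^lg p)) ⨟
     reflexive (sym (N.^-distribˡ-+-* 2 (X ∸ (x N.+ lg p)) (lg p)) ∙ cong 2^_ (cong (N._+ lg p) (sym (N.∸-+-assoc X x (lg p))) ∙ N.m∸n+n≡m (N.m+n≤o⇒m≤o∸n (lg p) (reflexive (N.+-comm (lg p) x) ⨟ N.<⇒≤ r)))))))

-- ∑_{k ≥ 1} p^{-k} = 1 / (p - 1) accounts for all powers of p.
g-step-≤ : ∀ {p} qs (hp : Prime p) → p ∉ qs → (∀ q → q ∈ qs → Prime q) → ∀ Y → g qs Y ≤ g (p ∷ qs) Y + inv (p ∸ 1) * g (p ∷ qs) (quot (prime≥1 hp) Y)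
g-step-≤ {p} qs hp p∉ hqs = <-rec _ go
 where
 instance
  p≢0 : NonZero p
  p≢0 = N.>-nonZero (prime≥1 hp)
 Q = quot (prime≥1 hp)
 i' = inv (p ∸ 1)
 p-1≥1 : 1 N.≤ p ∸ 1
 p-1≥1 = N.∸-monoˡ-≤ 1 (prime≥2 hp)
 geom : inv p * (# 1 + i') ≡ i'
 geom = cong (λ z → inv p * (z + i')) (sym (#-inv (p ∸ 1) p-1≥1)) ∙ solve 3 (λ i n j → i :* (n :* j :+ j) := (κ 1 :+ n) :* i :* j) refl (inv p) (# (p ∸ 1)) i' ∙
  cong (λ z → z * inv p * i') (sym (#-suc (p ∸ 1)) ∙ cong #_ (N.m+[n∸m]≡n (prime≥1 hp))) ∙ cong (_* i') (#-inv p (prime≥1 hp)) ∙ 1* i'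
 go : ∀ Y → (∀ {Z} → Z N.< Y → g qs Z ≤ g (p ∷ qs) Z + i' * g (p ∷ qs) (Q Z)) → g qs Y ≤ g (p ∷ qs) Y + i' * g (p ∷ qs) (Q Y)
 go zero ih = ∑-nil (N.≤-refl {1}) _ ≡⨾ +≥0 (g-nonneg (p ∷ qs) 0) (*≥0 (inv-nonneg (p ∸ 1)) (g-nonneg (p ∷ qs) (Q 0)))
 go Y@(suc _) ih = g-step qs hp p∉ hqs Y ≡⨾ ≤-refl {g (p ∷ qs) Y} ⊕
   ≤-trans (scale (inv-nonneg p) (ih (DM.m/n<m Y p (prime≥2 hp)) ⨾ ≤-refl ⊕ scale (inv-nonneg (p ∸ 1)) (g-mono (p ∷ qs) (DM.m/n≤m (Q Y) p))))
    (≡⇒≤ (solve 3 (λ i j a → i :* (a :+ j :* a) := i :* (κ 1 :+ j) :* a) refl (inv p) i' (g (p ∷ qs) (Q Y)) ∙ cong (_* g (p ∷ qs) (Q Y)) geom))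

^-distribʳ-* : ∀ k m n → (m N.* n) N.^ k ≡ m N.^ k N.* n N.^ k
^-distribʳ-* zero m n = refl
^-distribʳ-* (suc k) m n = cong (m N.* n N.*_) (^-distribʳ-* k m n) ∙ N.[m*n]*[o*p]≡[m*o]*[n*p] m n (m N.^ k) (n N.^ k)

module _ (V : ℕ) where

 -- The squarefree sum recovers all integers once 1/p is replaced by 1/(p - 1). Binary lengths
 -- overestimate: the condition on q gives 2^(V lg q) ≤ q^(V+1), so an integer up to Y has length at
 -- most (V + 1)/V times log₂ Y; this is the exponent `suc V`. When no prime is left, only n = 1 is
 -- still free of `qs`.
 g-≤-Op : ∀ ps qs → (∀ q → q ∈ ps → Prime q × V N.* lg q N.≤ suc V N.* (lg q ∸ 1)) → (∀ q → q ∈ qs → Prime q) → Unique ps → Disjoint ps qs →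
      ∀ X x Y → (∀ r → Prime r → r N.≤ Y → r ∈ ps ⊎ r ∈ qs) → Y N.^ suc V N.* 2^ (V N.* x) N.< 2^ (V N.* X) →
      g qs Y ≤ Op (λ p → inv (p ∸ 1)) ps (ind X) x
 g-≤-Op [] qs hps hqs u d X x Y cover lt with x N.<? X
 ... | yes r = g≤1 ⨾ ≡⇒≤ (sym (ind-true r))
  where
  g≤1 : g qs Y ≤ # 1
  g≤1 with 1 N.≤? Y
  ... | no s = ∑-nil (N.≰⇒> s) _ ≡⨾ 0≤1
  ... | yes s = ∑-split (suc Y) (N.n≤1+n 1) (s≤s s) _ ≡⨾ ≡⇒≤ (cong₂ _+_ (∑-suc {1} {1} N.≤-refl _ ∙ cong (_+ 𝟙 (free qs 1) * inv 1) (∑-nil {1} N.≤-refl _))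
     (∑-zero (rg 2 (suc Y)) λ n m → cong (_* inv n) (𝟙-false (notfree n (∈-range⁻ m))) ∙ 0* (inv n)) ∙ solve 1 (λ a → κ 0 :+ a :+ κ 0 := a) refl _) ⨾
     *-mono (inv-nonneg 1) 0≤1 (𝟙≤1 (free qs 1)) (inv≤1 1 N.≤-refl) ⨾ ≡⇒≤ (solve 0 (κ 1 :* κ 1 := κ 1) refl)
   where
   notfree : ∀ n → 2 N.≤ n × n N.< suc Y → ¬ T (free qs n)
   notfree n (a , b) t with prime-factor n a
   ... | r , hr , dv with cover r hr (∣.∣⇒≤ ⦃ N.>-nonZero (N.<⇒≤ a) ⦄ dv ⨟ N.≤-pred b)
   ... | inj₂ j = free⁻ qs t j dv
 ... | no r = ∑-nil {1} (s≤s (reflexive (Y≡0 Y (N.≤-<-trans (N.*-monoʳ-≤ (Y N.^ suc V) (2^-mono (N.*-monoʳ-≤ V (N.≮⇒≥ r)))) lt)))) _ ≡⨾ ind-nonneg X x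
  where
  Y≡0 : ∀ Y → Y N.^ suc V N.* 2^ (V N.* X) N.< 2^ (V N.* X) → Y ≡ 0
  Y≡0 zero _ = refl
  Y≡0 Y@(suc _) l = ⊥-elim (N.<⇒≱ l (reflexive (sym (N.*-identityˡ _)) ⨟ N.*-monoˡ-≤ (2^ (V N.* X)) (N.m^n>0 Y (suc V))))
 g-≤-Op (p ∷ ps) qs hps hqs (p∉ ∷ u) d X x Y cover lt = g-step-≤ qs hp (d (here refl)) hqs Y ⨾
   IH x Y cover' lt ⊕ scale (inv-nonneg (p ∸ 1)) (IH (x N.+ lg p) (quot (prime≥1 hp) Y) (λ r hr le → cover' r hr (le ⨟ DM.m/n≤m Y p)) lt')
  where
  hp = π₁ (hps p (here refl))
  instance
   p≢0 : NonZero p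
   p≢0 = N.>-nonZero (prime≥1 hp)
  hqs' : ∀ q → q ∈ p ∷ qs → Prime q
  hqs' q (here refl) = hp
  hqs' q (there i) = hqs q i
  d' : Disjoint ps (p ∷ qs)
  d' i (here refl) = All.lookup p∉ i refl
  d' i (there j) = d (there i) j
  cover' : ∀ r → Prime r → r N.≤ Y → r ∈ ps ⊎ r ∈ p ∷ qs
  cover' r hr le with cover r hr le
  ... | inj₁ (here e) = inj₂ (here e)
  ... | inj₁ (there i) = inj₁ i
  ... | inj₂ j = inj₂ (there j)
  IH = g-≤-Op ps (p ∷ qs) (λ q i → hps q (there i)) hqs' u d' X
  Q = Y N./ p
  lt' : Q N.^ suc V N.* 2^ (V N.* (x N.+ lg p)) N.< 2^ (V N.* X)
  lt' = N.≤-<-trans (reflexive (cong (λ z → Q N.^ suc V N.* 2^ z) (N.*-distribˡ-+ V x (lg p)) ∙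
       cong (Q N.^ suc V N.*_) (N.^-distribˡ-+-* 2 (V N.* x) (V N.* lg p) ∙ N.*-comm (2^ (V N.* x)) (2^ (V N.* lg p))) ∙ sym (N.*-assoc (Q N.^ suc V) _ _)) ⨟
      N.*-monoˡ-≤ (2^ (V N.* x)) (N.*-monoʳ-≤ (Q N.^ suc V) pow ⨟ reflexive (sym (^-distribʳ-* (suc V) Q p)) ⨟ N.^-monoˡ-≤ (suc V) (DM.m/n*n≤m Y p))) lt
   where
   pow : 2^ (V N.* lg p) N.≤ p N.^ suc V
   pow = 2^-mono (π₂ (hps p (here refl))) ⨟ reflexive (cong 2^_ (N.*-comm (suc V) (lg p ∸ 1)) ∙ sym (N.^-*-assoc 2 (lg p ∸ 1) (suc V))) ⨟
     N.^-monoˡ-≤ (suc V) (2^⌊log₂⌋≤ p (prime≥1 hp))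

arch : ∀ x {y} → # 0 < y → ∃ λ n → x ≤ # n * y
arch x {y} h = π₁ an , (*1˘ x ∙ cong (x *_) (sym (π₂ (π₂ r))) ∙
  *-rotate x y (π₁ r)) ≡⨾ scaleʳ (<⇒≤ h) (π₂ an)
 where
 r = reciprocal h
 an = archimedean (x * π₁ r)

-- `κf` is chosen so that the mean κ - t · 5/p vanishes for the density 5/p; the variance is then κ
-- again. For the density 4/(p - 1) the mean is `δf` = 1/(p - 1) and the variance `ρf` = 4 p² / ((p
-- - 5)(p - 1)²).
κf tf δf ρf : ℕ → 𝔽
κf p = # 5 * inv (p ∸ 5)
tf p = # 1 + κf p
δf p = inv (p ∸ 1)
ρf p = (# 1 + κf p) * (# 4 * δf p * (# 1 + δf p))

-- One telescoping error of order 1/p² for all comparisons of coefficients; 2000 is generous.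
errf : ℕ → 𝔽
errf p = # 2000 * (inv p * δf p)

inv-diff : ∀ a p → a N.< p → inv (p ∸ a) ≡ inv p + # a * (inv p * inv (p ∸ a))
inv-diff a p h = begin
 m                           ≡⟨ 1*˘ m ⟩
 # 1 * m                     ≡⟨ cong (_* m) (sym (#-inv p (s≤s z≤n ⨟ h))) ⟩
 # p * i * m                 ≡⟨ cong (λ z → z * i * m) (cong #_ (sym (N.m∸n+n≡m (N.<⇒≤ h))) ∙ #-+ (p ∸ a) a) ⟩
 (# (p ∸ a) + # a) * i * m   ≡⟨ solve 4 (λ d a i m → (d :+ a) :* i :* m := d :* m :* i :+ a :* (i :* m)) refl (# (p ∸ a)) (# a) i m ⟩
 # (p ∸ a) * m * i + # a * (i * m) ≡⟨ cong (λ z → z * i + # a * (i * m)) (#-inv (p ∸ a) (N.m<n⇒0<n∸m h)) ⟩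
 # 1 * i + # a * (i * m)     ≡⟨ solve 2 (λ i z → κ 1 :* i :+ z := i :+ z) refl i _ ⟩
 i + # a * (i * m) ∎
 where
 open ≡-Reasoning
 i = inv p
 m = inv (p ∸ a)

module Coefficients (p : ℕ) (p≥ : 32 N.≤ p) where
 i j m : 𝔽
 i = inv p
 j = inv (p ∸ 1)
 m = inv (p ∸ 5)

 private
  ∸1 : 1 N.< p
  ∸1 = s≤s (s≤s z≤n) ⨟ p≥
  ∸5 : 5 N.< p
  ∸5 = s≤s (s≤s (s≤s (s≤s (s≤s (s≤s z≤n))))) ⨟ p≥

 i≥0 : # 0 ≤ i
 i≥0 = inv-nonneg p
 j≥0 : # 0 ≤ j
 j≥0 = inv-nonneg (p ∸ 1)
 m≥0 : # 0 ≤ m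
 m≥0 = inv-nonneg (p ∸ 5)

 j-eq : j ≡ i + i * j
 j-eq = inv-diff 1 p ∸1 ∙ solve 2 (λ i j → i :+ κ 1 :* (i :* j) := i :+ i :* j) refl i j

 m-eq : m ≡ i + # 5 * (i * m)
 m-eq = inv-diff 5 p ∸5

 mj-eq : m ≡ j + # 4 * (j * m)
 mj-eq = subst (λ z → inv z ≡ j + # 4 * (j * inv z)) (N.∸-+-assoc p 1 4 ∙ refl) (inv-diff 4 (p ∸ 1) (N.∸-monoˡ-≤ 1 ∸5))

 private
  small : ∀ k d → d N.+ k N.≤ 32 → 1 N.≤ k → # k * inv (p ∸ d) ≤ # 1
  small k d le k≥1 = scaleʳ (inv-nonneg (p ∸ d)) (#-mono (N.m+n≤o⇒m≤o∸n k (reflexive (N.+-comm k d) ⨟ le ⨟ p≥))) ⨾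
   ≡⇒≤ (#-inv (p ∸ d) (k≥1 ⨟ N.m+n≤o⇒m≤o∸n k (reflexive (N.+-comm k d) ⨟ le ⨟ p≥)))

 m-small : # 20 * m ≤ # 1
 m-small = small 20 5 (N.m≤m+n 25 7) (s≤s z≤n)

 j-small : # 20 * j ≤ # 1
 j-small = small 20 1 (N.m≤m+n 21 11) (s≤s z≤n)

 j≤2i : j ≤ # 2 * i
 j≤2i = lin (≡⇒≤ j-eq ⊕ scale i≥0 j-small ⊕ scale (#≥0 19) (*≥0 i≥0 j≥0))
   (solve 2 (λ i j → κ 2 :* i :+ (j :+ i :* (κ 20 :* j) :+ κ 19 :* κ 0) := j :+ (i :+ i :* j :+ i :* κ 1 :+ κ 19 :* (i :* j))) refl i j)

 m≤2j : m ≤ # 2 * j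
 m≤2j = lin (≡⇒≤ mj-eq ⊕ scale j≥0 m-small ⊕ scale (#≥0 16) (*≥0 j≥0 m≥0))
   (solve 2 (λ j m → κ 2 :* j :+ (m :+ j :* (κ 20 :* m) :+ κ 16 :* κ 0) := m :+ (j :+ κ 4 :* (j :* m) :+ j :* κ 1 :+ κ 16 :* (j :* m))) refl j m)

 κ≥0 : # 0 ≤ κf p
 κ≥0 = *≥0 (#≥0 5) m≥0

 t≥0 : # 0 ≤ tf p
 t≥0 = +≥0 0≤1 κ≥0

 t≤2 : tf p ≤ # 2
 t≤2 = lin (m-small ⊕ *≥0 (#≥0 15) m≥0) (solve 1 (λ m → κ 2 :+ (κ 20 :* m :+ κ 0) := κ 1 :+ κ 5 :* m :+ (κ 1 :+ κ 15 :* m)) refl m)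

 ij≥0 : # 0 ≤ i * j
 ij≥0 = *≥0 i≥0 j≥0

 err≥0 : # 0 ≤ errf p
 err≥0 = *≥0 (#≥0 2000) ij≥0

 κ-upper : κf p ≤ # 5 * i + errf p
 κ-upper = lin (≡⇒≤ (cong (# 5 *_) m-eq) ⊕ scale (#≥0 25) (scale i≥0 m≤2j) ⊕ scale (#≥0 1950) ij≥0)
  (solve 3 (λ i j m → κ 5 :* i :+ κ 2000 :* (i :* j) :+ (κ 5 :* m :+ κ 25 :* (i :* m) :+ κ 1950 :* κ 0) :=
    κ 5 :* m :+ (κ 5 :* (i :+ κ 5 :* (i :* m)) :+ κ 25 :* (i :* (κ 2 :* j)) :+ κ 1950 :* (i :* j))) refl i j m)

 -- the densities 5 / p, 4 / (p - 1) and 1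
 main-density : # 0 ≡ κf p - tf p * (# 5 * i) × κf p ≡ tf p * tf p * (# 5 * i) * (# 1 - # 5 * i)
 main-density = solve 1 (λ m → κ 0 := κ 5 :* (m :- m)) refl m ∙ cong (λ z → # 5 * (m - z)) m-eq ∙
    solve 2 (λ i m → κ 5 :* (m :- (i :+ κ 5 :* (i :* m))) := κ 5 :* m :- (κ 1 :+ κ 5 :* m) :* (κ 5 :* i)) refl i m
  , solve 1 (λ m → κ 5 :* m := κ 5 :* m :* (κ 1 :+ κ 5 :* (m :- m))) refl m ∙ cong₂ (λ z z' → # 5 * z * (# 1 + # 5 * (m - z'))) m-eq m-eq ∙
    solve 2 (λ i m → κ 5 :* (i :+ κ 5 :* (i :* m)) :* (κ 1 :+ κ 5 :* (m :- (i :+ κ 5 :* (i :* m)))) := (κ 1 :+ κ 5 :* m) :* (κ 1 :+ κ 5 :* m) :* (κ 5 :* i) :* (κ 1 :- κ 5 :* i)) refl i m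

 twin-density : δf p ≡ κf p - tf p * (# 4 * j) × ρf p ≡ tf p * tf p * (# 4 * j) * (# 1 - # 4 * j)
 twin-density = solve 2 (λ m j → j := j :+ κ 5 :* (m :- m)) refl m j ∙ cong (λ z → j + # 5 * (m - z)) mj-eq ∙
    solve 2 (λ j m → j :+ κ 5 :* (m :- (j :+ κ 4 :* (j :* m))) := κ 5 :* m :- (κ 1 :+ κ 5 :* m) :* (κ 4 :* j)) refl j m
  , solve 2 (λ j m → (κ 1 :+ κ 5 :* m) :* (κ 4 :* j :* (κ 1 :+ j)) := (κ 1 :+ κ 5 :* m) :* (κ 4 :* j :* (κ 1 :+ j :+ κ 5 :* (m :- m)))) refl j m ∙
     cong (λ z → (# 1 + # 5 * m) * (# 4 * j * (# 1 + j + # 5 * (m - z)))) mj-eq ∙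
    solve 2 (λ j m → (κ 1 :+ κ 5 :* m) :* (κ 4 :* j :* (κ 1 :+ j :+ κ 5 :* (m :- (j :+ κ 4 :* (j :* m))))) := (κ 1 :+ κ 5 :* m) :* (κ 1 :+ κ 5 :* m) :* (κ 4 :* j) :* (κ 1 :- κ 4 :* j)) refl j m

 sure-density : - # 1 ≡ κf p - tf p * # 1 × # 0 ≡ tf p * tf p * # 1 * (# 1 - # 1)
 sure-density = solve 1 (λ m → :- κ 1 := κ 5 :* m :- (κ 1 :+ κ 5 :* m) :* κ 1) refl m , solve 1 (λ t → κ 0 := t :* t :* κ 1 :* (κ 1 :- κ 1)) refl (tf p)

 δ≤1 : δf p ≤ # 1
 δ≤1 = inv≤1 (p ∸ 1) (N.m<n⇒0<n∸m ∸1)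

 δ≡ : δf p ≡ i + i * j
 δ≡ = j-eq

 ρ≥0 : # 0 ≤ ρf p
 ρ≥0 = *≥0 t≥0 (*≥0 (*≥0 (#≥0 4) j≥0) (+≥0 0≤1 j≥0))

 ρ-lower : # 4 * i ≤ ρf p
 ρ-lower = lin (≡⇒≤ (sym (cong (# 4 *_) j-eq)) ⊕ *≥0 (#≥0 4) ij≥0 ⊕ *≥0 (*≥0 (#≥0 4) j≥0) (+≥0 (+≥0 (*≥0 (#≥0 5) m≥0) j≥0) (*≥0 (*≥0 (#≥0 5) m≥0) j≥0)))
  (solve 3 (λ i j m → (κ 1 :+ κ 5 :* m) :* (κ 4 :* j :* (κ 1 :+ j)) :+ (κ 4 :* (i :+ i :* j) :+ κ 0 :+ κ 0) :=
    κ 4 :* i :+ (κ 4 :* j :+ κ 4 :* (i :* j) :+ κ 4 :* j :* (κ 5 :* m :+ j :+ κ 5 :* m :* j))) refl i j m)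

 ρ-upper : ρf p ≤ # 4 * i + errf p
 ρ-upper = lin (≡⇒≤ (cong (# 4 *_) j-eq) ⊕ scale (*≥0 (#≥0 4) j≥0) (scale (#≥0 5) m≤2j ⊕ scaleʳ j≥0 m-small)
    ⊕ scale (#≥0 48) (scaleʳ j≥0 j≤2i) ⊕ scale (#≥0 1900) ij≥0 ⊕ scale (*≥0 (#≥0 60) j≥0) (*≥0 m≥0 j≥0))
  (solve 3 (λ i j m → κ 4 :* i :+ κ 2000 :* (i :* j) :+ (κ 4 :* j :+ κ 4 :* j :* (κ 5 :* m :+ κ 20 :* m :* j) :+ κ 48 :* (j :* j) :+ κ 1900 :* κ 0 :+ κ 60 :* j :* κ 0) :=
    (κ 1 :+ κ 5 :* m) :* (κ 4 :* j :* (κ 1 :+ j)) :+ (κ 4 :* (i :+ i :* j) :+ κ 4 :* j :* (κ 5 :* (κ 2 :* j) :+ κ 1 :* j) :+ κ 48 :* (κ 2 :* i :* j) :+ κ 1900 :* (i :* j) :+ κ 60 :* j :* (m :* j))) refl i j m)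

 slack-upper : # 3 * (ρf p * δf p) ≤ errf p
 slack-upper = lin (scale (#≥0 3) (scaleʳ j≥0 (*-mono (*≥0 (*≥0 (#≥0 4) j≥0) (+≥0 0≤1 j≥0)) (#≥0 2) t≤2 (scale (*≥0 (#≥0 4) j≥0) (≤-refl {# 1} ⊕ δ≤1))))
    ⊕ scale (#≥0 48) (scaleʳ j≥0 j≤2i) ⊕ scale (#≥0 1904) ij≥0)
  (solve 3 (λ i j r → κ 2000 :* (i :* j) :+ (κ 3 :* (r :* j) :+ κ 48 :* (j :* j) :+ κ 1904 :* κ 0) :=
    κ 3 :* (r :* j) :+ (κ 3 :* (κ 2 :* (κ 4 :* j :* (κ 1 :+ κ 1)) :* j) :+ κ 48 :* (κ 2 :* i :* j) :+ κ 1904 :* (i :* j))) refl i j (ρf p))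

-- Comparison with powers of Op inv

prod-nonneg : ∀ ps {x} → (∀ p → p ∈ ps → # 0 ≤ x p) → # 0 ≤ ∏ x ps
prod-nonneg [] h = 0≤1
prod-nonneg (p ∷ ps) h = *≥0 (h p (here refl)) (prod-nonneg ps λ q i → h q (there i))

prod-upper : ∀ ps {x} → (∀ p → p ∈ ps → # 0 ≤ x p) → # 2 * ∑ ps x ≤ # 1 → ∏ (λ p → # 1 + x p) ps ≤ # 1 + # 2 * ∑ ps x
prod-upper [] h _ = ≡⇒≤ (solve 0 (κ 1 := κ 1 :+ κ 2 :* κ 0) refl)
prod-upper (p ∷ ps) {x} h small = scale (+≥0 0≤1 xp≥0) (prod-upper ps (λ q i → h q (there i)) small') ⨾
  lin (scale xp≥0 small') (solve 2 (λ x s → κ 1 :+ κ 2 :* (x :+ s) :+ x :* (κ 2 :* s) := (κ 1 :+ x) :* (κ 1 :+ κ 2 :* s) :+ x :* κ 1) refl (x p) (∑ ps x))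
 where
 xp≥0 = h p (here refl)
 small' : # 2 * ∑ ps x ≤ # 1
 small' = lin (scale (#≥0 2) xp≥0) (solve 2 (λ x s → κ 2 :* (x :+ s) :+ κ 2 :* κ 0 := κ 2 :* s :+ κ 2 :* x) refl (x p) (∑ ps x)) ⨾ small

∑-primes-≤ : ∀ a b {f} → (∀ n → # 0 ≤ f n) → ∑ (primes a b) f ≤ ∑ (rg a b) f
∑-primes-≤ a b {f} h = ∑-filter prime? (rg a b) f ≡⨾ (∑-mono (rg a b) λ n _ →
  if-𝟙 ⌊ prime? n ⌋ (f n) ≡⨾ scaleʳ (h n) (𝟙≤1 _) ⨾≡ 1* (f n))

∑-err : ∀ a b → 2 N.≤ a → ∑ (primes a b) errf ≤ # 2000 * inv (a ∸ 1)
∑-err a b a≥2 = ∑-primes-≤ a b (λ n → *≥0 (#≥0 2000) (*≥0 (inv-nonneg n) (inv-nonneg (n ∸ 1)))) ⨾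
 ∑-scale (rg a b) (# 2000) _ ≡⨾ scale (#≥0 2000) ((∑-cong (rg a b) λ n m → diff n (a≥2 ⨟ π₁ (∈-range⁻ m))) ≡⨾ tele)
 where
 diff : ∀ n → 2 N.≤ n → inv n * inv (n ∸ 1) ≡ inv (n ∸ 1) - inv (suc n ∸ 1)
 diff n h = solve 2 (λ i j → i :* j := i :+ κ 1 :* (i :* j) :- i) refl (inv n) (inv (n ∸ 1)) ∙ cong (_- inv n) (sym (inv-diff 1 n h))
 tele : ∑ (rg a b) (λ n → inv (n ∸ 1) - inv (suc n ∸ 1)) ≤ inv (a ∸ 1)
 tele with N.≤-total a b
 ... | inj₁ q = ∑-telescope (λ n → inv (n ∸ 1)) q ≡⨾ lin (inv-nonneg (b ∸ 1)) (solve 2 (λ a b → a :+ κ 0 := a :- b :+ b) refl (inv (a ∸ 1)) (inv (b ∸ 1)))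
 ... | inj₂ q = ∑-nil q _ ≡⨾ inv-nonneg (a ∸ 1)

Op-zero : ∀ ps F x → Op (λ _ → # 0) ps F x ≡ F x
Op-zero [] F x = refl
Op-zero (p ∷ ps) F x = cong₂ (λ a b → a + # 0 * b) (Op-zero ps F x) (Op-zero ps F (x N.+ lg p)) ∙ solve 2 (λ a b → a :+ κ 0 :* b := a) refl (F x) (F (x N.+ lg p))

OpN-mono : ∀ {c} ps k → (∀ p → p ∈ ps → # 0 ≤ c p) → ∀ {F G} → (∀ x → F x ≤ G x) → ∀ x → OpN c ps k F x ≤ OpN c ps k G x
OpN-mono ps zero h nF = nF
OpN-mono ps (suc k) h nF = Op-mono ps h (OpN-mono ps k h nF)

Op-multiple : ∀ {c} ps → (∀ p → p ∈ ps → # 0 ≤ c p) → ∀ k {F} → (∀ x → # 0 ≤ F x) → ∀ x → Op (λ p → # k * c p) ps F x ≤ OpN c ps k F x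
Op-multiple {c} ps h zero {F} nF x = ≡⇒≤ (Op-cong ps (λ p _ → 0* (c p)) F x ∙ Op-zero ps F x)
Op-multiple {c} ps h (suc k) {F} nF x = ≡⇒≤ (Op-cong ps (λ p _ → cong (_* c p) (#-suc k) ∙ solve 2 (λ a k → (κ 1 :+ k) :* a := a :+ k :* a) refl (c p) (# k)) F x) ⨾
 Op-+-≤ ps (λ p i → h p i , *≥0 (#≥0 k) (h p i)) nF x ⨾ Op-mono ps h (Op-multiple ps h k nF) x

-- Merges the iterates one by one with `Op-∘-≤`. The product c · l b that appears at each merger,
-- together with the difference c - b, is charged to D.
OpN-≤-Op : ∀ {c b D : ℕ → 𝔽} ps k → (∀ p → p ∈ ps → # 0 ≤ c p × # 0 ≤ b p × # 0 ≤ D p) →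
      (∀ p → p ∈ ps → ∀ l → l N.< k → c p + # l * b p + c p * (# l * b p) ≤ # (suc l) * b p + D p) →
      ∀ {F} → Antitone F → (∀ x → # 0 ≤ F x) → ∀ x → OpN c ps k F x ≤ ∏ (λ p → # 1 + D p) ps ^ k * Op (λ p → # k * b p) ps F x
OpN-≤-Op {c} {b} {D} ps zero h s {F} aF nF x = ≡⇒≤ (sym (cong (# 1 *_) (Op-cong ps (λ p _ → 0* (b p)) F x ∙ Op-zero ps F x) ∙
  1* (F x)))
OpN-≤-Op {c} {b} {D} ps (suc k) h s {F} aF nF x = Op-mono ps (λ p i → π₁ (h p i)) (OpN-≤-Op ps k h (λ p i l q → s p i l (N.m<n⇒m<1+n q)) aF nF) x ⨾
 Op-scale c ps (Pd ^ k) _ x ≡⨾ scale (^≥0 k Pd≥0) (Op-∘-≤ ps (λ p i → π₁ (h p i) , kb≥0 k p i) aF x ⨾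
   Op-compare ps (λ p i → kb≥0 (suc k) p i , +≥0 (+≥0 (π₁ (h p i)) (kb≥0 k p i)) (*≥0 (π₁ (h p i)) (kb≥0 k p i)) , π₂ (π₂ (h p i)) , s p i k N.≤-refl) aF nF x) ⨾
   ≡⇒≤ (*-swapˡ (Pd ^ k) Pd _)
 where
 Pd = ∏ (λ p → # 1 + D p) ps
 Pd≥0 : # 0 ≤ Pd
 Pd≥0 = prod-nonneg ps λ p i → +≥0 0≤1 (π₂ (π₂ (h p i)))
 kb≥0 : ∀ k p → p ∈ ps → # 0 ≤ # k * b p
 kb≥0 k p i = *≥0 (#≥0 k) (π₁ (π₂ (h p i)))

off-nonneg : ∀ q c p → # 0 ≤ c p → # 0 ≤ off q c p
off-nonneg q c p h with p N.≡ᵇ q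
... | true = ≤-refl
... | false = h

off-≤ : ∀ q c p → # 0 ≤ c p → off q c p ≤ c p
off-≤ q c p h with p N.≡ᵇ q
... | true = h
... | false = ≤-refl

on : ℕ → (ℕ → 𝔽) → ℕ → 𝔽
on q c p = if p N.≡ᵇ q then c p else # 0

on-nonneg : ∀ q c p → # 0 ≤ c p → # 0 ≤ on q c p
on-nonneg q c p h with p N.≡ᵇ q
... | true = h
... | false = ≤-refl

off-on : ∀ q c p → c p ≤ off q c p + on q c p
off-on q c p with p N.≡ᵇ q
... | true = ≡⇒≤ (0+˘ (c p))
... | false = ≡⇒≤ (+0˘ (c p))

prod-on : ∀ q c ps → Unique ps → # 0 ≤ c q → ∏ (λ p → # 1 + on q c p) ps ≤ # 1 + c q
prod-on q c [] u h = lin h (solve 1 (λ a → κ 1 :+ a :+ κ 0 := κ 1 :+ a) refl (c q))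
prod-on q c (p ∷ ps) (p∉ ∷ u) h with p N.≟ q
... | yes refl = cong₂ _*_ (cong (# 1 +_) on-q) (prod-one ps λ r i e → All.lookup p∉ i (sym e)) ≡⨾ ≡⇒≤ (solve 1 (λ a → (κ 1 :+ a) :* κ 1 := κ 1 :+ a) refl (c q))
 where
 on-q : on q c q ≡ c q
 on-q with q N.≡ᵇ q in eq
 ... | true = refl
 ... | false = ⊥-elim (subst T eq (N.≡⇒≡ᵇ q q refl))
 prod-one : ∀ ps → (∀ r → r ∈ ps → r ≢ q) → ∏ (λ p → # 1 + on q c p) ps ≡ # 1
 prod-one [] _ = refl
 prod-one (r ∷ ps) h = cong₂ _*_ (cong (# 1 +_) (on-r (h r (here refl)))) (prod-one ps λ s i → h s (there i)) ∙ solve 0 ((κ 1 :+ κ 0) :* κ 1 := κ 1) refl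
  where
  on-r : r ≢ q → on q c r ≡ # 0
  on-r ne with r N.≡ᵇ q in eq
  ... | true = ⊥-elim (ne (N.≡ᵇ⇒≡ r q (subst T (sym eq) tt)))
  ... | false = refl
... | no ne = (cong (λ z → (# 1 + z) * ∏ (λ p → # 1 + on q c p) ps) on-p ∙ solve 1 (λ a → (κ 1 :+ κ 0) :* a := a) refl (∏ (λ p → # 1 + on q c p) ps)) ≡⨾ prod-on q c ps u h
 where
 on-p : on q c p ≡ # 0
 on-p with p N.≡ᵇ q in eq
 ... | true = ⊥-elim (ne (N.≡ᵇ⇒≡ p q (subst T (sym eq) tt)))
 ... | false = refl

module Comparison (V : ℕ) (V≥5 : 5 N.≤ V) (E : 𝔽) (E≥ : # 1 + # 4000 * inv (2^ V ∸ 1) ≤ E) (E≤2 : E ≤ # 2) (K : ℕ) where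

 ps : List ℕ
 ps = primes (2^ V) (2^ K)

 ps≥32 : ∀ p → p ∈ ps → 32 N.≤ p
 ps≥32 p i = 2^-mono V≥5 ⨟ π₁ (π₂ (∈-primes⁻ i))

 module C p (i : p ∈ ps) = Coefficients p (ps≥32 p i)

 S : 𝔽
 S = # 2000 * inv (2^ V ∸ 1)

 2^V≥2 : 2 N.≤ 2^ V
 2^V≥2 = s≤s (s≤s z≤n) ⨟ 2^-mono {1} {V} (s≤s z≤n ⨟ V≥5)

 ∑err≤ : ∑ ps errf ≤ S
 ∑err≤ = ∑-err (2^ V) (2^ K) 2^V≥2

 E-err : ∏ (λ p → # 1 + errf p) ps ≤ E
 E-err = prod-upper ps (λ p i → C.err≥0 p i) (lin (scale (#≥0 2) ∑err≤ ⊕ E≥ ⊕ E≤2)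
    (solve 3 (λ s z E → κ 1 :+ (κ 2 :* s :+ (κ 1 :+ κ 4000 :* z) :+ E) := κ 2 :* s :+ (κ 2 :* (κ 2000 :* z) :+ E :+ κ 2)) refl (∑ ps errf) (inv (2^ V ∸ 1)) E)) ⨾
  lin (scale (#≥0 2) ∑err≤ ⊕ E≥) (solve 3 (λ s z E → E :+ (κ 2 :* s :+ (κ 1 :+ κ 4000 :* z)) := κ 1 :+ κ 2 :* s :+ (κ 2 :* (κ 2000 :* z) :+ E)) refl (∑ ps errf) (inv (2^ V ∸ 1)) E)

 E≥1 : # 1 ≤ E
 E≥1 = lin (*≥0 (#≥0 4000) (inv-nonneg (2^ V ∸ 1))) (solve 1 (λ a → κ 1 :+ a :+ κ 0 := κ 1 :+ a) refl _) ⨾ E≥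

 E≥0 : # 0 ≤ E
 E≥0 = 0≤1 ⨾ E≥1

 inv≥ : ∀ p → p ∈ ps → # 0 ≤ inv p
 inv≥ p _ = inv-nonneg p

 upper-κ : ∀ {F} → Antitone F → (∀ x → # 0 ≤ F x) → ∀ x → Op κf ps F x ≤ E * OpN inv ps 5 F x
 upper-κ aF nF x = Op-compare ps (λ p i → *≥0 (#≥0 5) (inv-nonneg p) , C.κ≥0 p i , C.err≥0 p i , C.κ-upper p i) aF nF x ⨾
  *-mono (Op-nonneg ps (λ p i → *≥0 (#≥0 5) (inv-nonneg p)) nF x) E≥0 E-err (Op-multiple ps inv≥ 5 nF x)

 upper-ρ : ∀ {F} → Antitone F → (∀ x → # 0 ≤ F x) → ∀ x → Op ρf ps F x ≤ E * OpN inv ps 4 F x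
 upper-ρ aF nF x = Op-compare ps (λ p i → *≥0 (#≥0 4) (inv-nonneg p) , C.ρ≥0 p i , C.err≥0 p i , C.ρ-upper p i) aF nF x ⨾
  *-mono (Op-nonneg ps (λ p i → *≥0 (#≥0 4) (inv-nonneg p)) nF x) E≥0 E-err (Op-multiple ps inv≥ 4 nF x)

 upper-δ : ∀ {F} → Antitone F → (∀ x → # 0 ≤ F x) → ∀ x → Op δf ps F x ≤ E * Op inv ps F x
 upper-δ aF nF x = Op-compare ps (λ p i → inv-nonneg p , C.j≥0 p i , C.err≥0 p i ,
    C.δ≡ p i ≡⨾ ≤-refl ⊕ lin (scale (#≥0 1999) (C.ij≥0 p i)) (solve 1 (λ z → κ 2000 :* z :+ κ 1999 :* κ 0 := z :+ κ 1999 :* z) refl (inv p * δf p))) aF nF x ⨾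
  scaleʳ (Op-nonneg ps inv≥ nF x) E-err

 off-c≥0 : ∀ q p → p ∈ ps → # 0 ≤ off q δf p
 off-c≥0 q p i = off-nonneg q δf p (C.j≥0 p i)

 off-ρ≥0 : ∀ q p → p ∈ ps → # 0 ≤ off q ρf p
 off-ρ≥0 q p i = off-nonneg q ρf p (C.ρ≥0 p i)

 Op-mono-c : ∀ {c c'} → (∀ p → p ∈ ps → # 0 ≤ c p × c p ≤ c' p) → ∀ {F} → Antitone F → (∀ x → # 0 ≤ F x) → ∀ x → Op c ps F x ≤ Op c' ps F x
 Op-mono-c {c} {c'} h {F} aF nF x = (Op-compare {d = λ _ → # 0} ps (λ p i → π₁ (h p i) ⨾ π₂ (h p i) , π₁ (h p i) , ≤-refl ,
    π₂ (h p i) ⨾≡ +0˘ _) aF nF x) ⨾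
   ≡⇒≤ (cong (_* Op c' ps F x) (one ps) ∙ 1* _)
  where
  one : ∀ qs → ∏ (λ _ → # 1 + # 0) qs ≡ # 1
  one [] = refl
  one (q ∷ qs) = cong ((# 1 + # 0) *_) (one qs) ∙ solve 0 ((κ 1 :+ κ 0) :* κ 1 := κ 1) refl

 -- Since δ = 1/p + 1/(p (p - 1)), four iterates of δ are four iterates of 1/p up to summable
 -- errors, and 4/p ≤ ρ. Lower bounds are known for δ, which explains the starting point.
 lower-off : ∀ q {F} → Antitone F → (∀ x → # 0 ≤ F x) → ∀ x → OpN (off q δf) ps 4 F x ≤ E ^ 4 * Op (off q ρf) ps F x
 lower-off q {F} aF nF x = OpN-≤-Op {b = off q inv} {D = errf} ps 4 (λ p i → off-c≥0 q p i , off-nonneg q inv p (inv-nonneg p) , C.err≥0 p i) chain aF nF x ⨾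
   *-mono (Op-nonneg ps (λ p i → *≥0 (#≥0 4) (off-nonneg q inv p (inv-nonneg p))) nF x) (^≥0 4 E≥0)
    (^-mono 4 (prod-nonneg ps λ p i → +≥0 0≤1 (C.err≥0 p i)) E-err)
    (Op-mono-c (λ p i → *≥0 (#≥0 4) (off-nonneg q inv p (inv-nonneg p)) , 4off p i) aF nF x)
  where
  4off : ∀ p → p ∈ ps → # 4 * off q inv p ≤ off q ρf p
  4off p i with p N.≡ᵇ q
  ... | true = ≡⇒≤ (solve 0 (κ 4 :* κ 0 := κ 0) refl)
  ... | false = C.ρ-lower p i
  chain : ∀ p → p ∈ ps → ∀ l → l N.< 4 → off q δf p + # l * off q inv p + off q δf p * (# l * off q inv p) ≤ # (suc l) * off q inv p + errf p
  chain p i l l<4 with p N.≡ᵇ q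
  ... | true = lin (C.err≥0 p i) (solve 3 (λ l l' e → l' :* κ 0 :+ e :+ κ 0 := κ 0 :+ l :* κ 0 :+ κ 0 :* (l :* κ 0) :+ e) refl (# l) (# (suc l)) (errf p))
  ... | false = lin (≡⇒≤ (C.δ≡ p i) ⊕ scaleʳ (C.ij≥0 p i) (#-mono {l} {4} (N.<⇒≤ l<4)) ⊕ scale (#≥0 1995) (C.ij≥0 p i))
     (cong (λ z → z * inv p + errf p + (δf p + # l * (inv p * δf p) + # 1995 * # 0)) (#-suc l) ∙
      solve 3 (λ l i j → (κ 1 :+ l) :* i :+ κ 2000 :* (i :* j) :+ (j :+ l :* (i :* j) :+ κ 1995 :* κ 0) :=
       (j :+ l :* i :+ j :* (l :* i)) :+ (i :+ i :* j :+ κ 4 :* (i :* j) :+ κ 1995 :* (i :* j))) refl (# l) (inv p) (δf p))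

 off-δ-upper : ∀ q {F} → Antitone F → (∀ x → # 0 ≤ F x) → ∀ x → Op (off q δf) ps F x ≤ E * Op inv ps F x
 off-δ-upper q aF nF x = Op-mono-c (λ p i → off-c≥0 q p i , off-≤ q δf p (C.j≥0 p i)) aF nF x ⨾ upper-δ aF nF x

 -- `Op-compare` with an error concentrated at q, so the product of the costs has the single factor
 -- 1 + δ(q).
 off-δ-lower : ∀ q {F} → Antitone F → (∀ x → # 0 ≤ F x) → ∀ x → Op δf ps F x ≤ (# 1 + δf q) * Op (off q δf) ps F x
 off-δ-lower q aF nF x = Op-compare {d = on q δf} ps (λ p i → off-c≥0 q p i , C.j≥0 p i , on-nonneg q δf p (C.j≥0 p i) , off-on q δf p) aF nF x ⨾
   scaleʳ (Op-nonneg ps (off-c≥0 q) nF x) (prod-on q δf ps (unique-primes _ _) (inv-nonneg (q ∸ 1)))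

 off-ρ-upper : ∀ q {F} → Antitone F → (∀ x → # 0 ≤ F x) → ∀ x → Op (off q ρf) ps F x ≤ E * OpN inv ps 4 F x
 off-ρ-upper q aF nF x = Op-mono-c (λ p i → off-ρ≥0 q p i , off-≤ q ρf p (C.ρ≥0 p i)) aF nF x ⨾ upper-ρ aF nF x

 off-slack : ∀ q → slack {off q δf} {off q ρf} ps ≤ S
 off-slack q = (∑-mono ps λ p i → lem p i ⨾ C.slack-upper p i) ⨾ ∑err≤
  where
  lem : ∀ p → p ∈ ps → # 3 * (off q ρf p * off q δf p) ≤ # 3 * (ρf p * δf p)
  lem p i = scale (#≥0 3) (*-mono (off-c≥0 q p i) (C.ρ≥0 p i) (off-≤ q ρf p (C.ρ≥0 p i)) (off-≤ q δf p (C.j≥0 p i)))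

-- One-dimensional sums over the sieving primes

module Dimension1 (V : ℕ) (V≥1 : 1 N.≤ V) where

 ws : List ℕ
 ws = primes 0 (2^ V)

 -- `α` and `β₀` are the upper and lower slopes of X ↦ ∑ 1/d over products d of sieving primes of
 -- length below X. Both approximate P log 2; the factor V/(V + 1) in `β₀` is the loss by binary
 -- lengths.
 P c₁ c₂ α β₀ : 𝔽
 P = euler ws
 c₁ = dyadic′ V
 c₂ = dyadic V
 α = P * c₂
 β₀ = P * c₁ * (# V * inv (suc V))

 sieving : ℕ → List ℕ
 sieving K = primes (2^ V) (2^ K)

 ws-prime : ∀ p → p ∈ ws → Prime p
 ws-prime p i = π₁ (∈-primes⁻ i)

 ps-prime : ∀ K p → p ∈ sieving K → Prime p
 ps-prime K p i = π₁ (∈-primes⁻ i)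

 disjoint : ∀ K → Disjoint (sieving K) ws
 disjoint K i j = N.<⇒≱ (π₂ (π₂ (∈-primes⁻ j))) (π₁ (π₂ (∈-primes⁻ i)))

 P≥0 : # 0 ≤ P
 P≥0 = π₁ (euler-bounds ws ws-prime)

 P>0 : # 0 < P
 P>0 = euler-pos ws ws-prime

 c₁>0 : # 0 < c₁
 c₁>0 = <-≤-trans (inv-pos 2 (s≤s z≤n)) (dyadic′-half V)

 c₂≥½ : inv 2 ≤ c₂
 c₂≥½ = ≡⇒≤ (sym (∑-const (rg (2^ V) (2^ suc V)) (inv (2^ suc V)) ∙ cong (λ n → # n * inv (2^ suc V)) len ∙
   cong (# (2^ V) *_) (inv-* 2 (2^ V) (s≤s z≤n) (2^≥1 V)) ∙ *-rotate (# (2^ V)) (inv 2) (inv (2^ V)) ∙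
    cong (_* inv 2) (#-inv (2^ V) (2^≥1 V)) ∙ 1* (inv 2))) ⨾
  (∑-mono (rg (2^ V) (2^ suc V)) λ n m → inv-mono (2^≥1 V ⨟ π₁ (∈-range⁻ m)) (N.<⇒≤ (π₂ (∈-range⁻ m))))
  where
  len : length (rg (2^ V) (2^ suc V)) ≡ 2^ V
  len = length-rg _ _ ∙ cong (_∸ 2^ V) (double (2^ V)) ∙ N.m+n∸n≡m (2^ V) (2^ V)

 α>0 : # 0 < α
 α>0 = *-pos P>0 (<-≤-trans (inv-pos 2 (s≤s z≤n)) c₂≥½)

 α≥0 : # 0 ≤ α
 α≥0 = <⇒≤ α>0

 private
  Hu = H-upper V
  C₂ = π₁ Hu
  ga = g-approx ws ws-prime (unique-primes 0 (2^ V))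
  C = π₁ ga
  C≥0 = π₁ (π₂ ga)
  Bu = arch (P * C₂ + C) α>0

 B : ℕ
 B = π₁ Bu

 Op-inv-upper : ∀ K X → Op inv (sieving K) (ind X) 0 ≤ α * (# X + # B)
 Op-inv-upper K zero = Op-supp (sieving K) (ind-supp 0) z≤n ≡⨾ *≥0 α≥0 (+≥0 (#≥0 0) (#≥0 B))
 Op-inv-upper K X@(suc _) = Op-inv-≤-g (sieving K) ws (ps-prime K) ws-prime (unique-primes _ _) (disjoint K) X 0 (s≤s z≤n) ⨾
  lin (π₂ (π₂ (π₂ ga) (2^ X)) ⊕ scale P≥0 (π₂ (π₂ Hu) X) ⊕ π₂ Bu)
   (solve 8 (λ g P h c x C₂ k C → P :* c :* (x :+ k) :+ (g :- P :* h :+ P :* h :+ (P :* C₂ :+ C)) := g :+ (C :+ P :* (c :* x :+ C₂) :+ k :* (P :* c))) refl (g ws (2^ X)) P (H (2^ X)) c₂ (# X) C₂ (# B) C)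

 S₀ : 𝔽
 S₀ = P * c₁ * # (suc V) + C

 S₀≥0 : # 0 ≤ S₀
 S₀≥0 = +≥0 (*≥0 (*≥0 P≥0 (<⇒≤ c₁>0)) (#≥0 (suc V))) C≥0

 Op-δ-lower : ∀ K X → X N.≤ K → β₀ * # X - S₀ ≤ Op δf (sieving K) (ind X) 0
 Op-δ-lower K X X≤K with V N.* X in eq
 ... | zero = lin S₀≥0 (solve 1 (λ s → κ 0 :+ κ 0 := κ 0 :- s :+ s) refl S₀ ∙ cong (λ z → z - S₀ + S₀) (sym βX)) ⨾
    Op-nonneg (sieving K) (λ p _ → inv-nonneg (p ∸ 1)) (ind-nonneg X) 0
  where
  βX : β₀ * # X ≡ # 0
  βX = solve 4 (λ a v i x → a :* (v :* i) :* x := a :* i :* (v :* x)) refl (P * c₁) (# V) (inv (suc V)) (# X) ∙ cong (P * c₁ * inv (suc V) *_) (sym (#-* V X) ∙ cong #_ eq) ∙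
    *0 _
 ... | suc n = main ⨾ g-≤-Op V (sieving K) ws (λ q i → ps-prime K q i , lg-cond q i) ws-prime (unique-primes _ _) (disjoint K) X 0 (2^ y) cover lt
  where
  -- As n = V X - 1, this is the largest y with (V + 1) y < V X, the condition of `g-≤-Op` for Y =
  -- 2^y.
  y = n N./ suc V
  lg-cond : ∀ q → q ∈ sieving K → V N.* lg q N.≤ suc V N.* (lg q ∸ 1)
  lg-cond q i = reflexive (N.*-suc V (lg q ∸ 1)) ⨟ N.+-monoˡ-≤ (V N.* (lg q ∸ 1)) (N.≤-pred (lg-≥ {q} {V} (π₁ (π₂ (∈-primes⁻ i)))))
  y<VX : y N.* suc V N.< V N.* X
  y<VX = s≤s (DM.m/n*n≤m n (suc V)) ⨟ reflexive (sym eq)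
  y<X : y N.< X
  y<X = N.*-cancelʳ-< (suc V) y X (N.<-≤-trans y<VX (N.*-monoˡ-≤ X (N.n≤1+n V) ⨟ reflexive (N.*-comm (suc V) X)))
  cover : ∀ r → Prime r → r N.≤ 2^ y → r ∈ sieving K ⊎ r ∈ ws
  cover r hr le with r N.<? 2^ V
  ... | yes q = inj₂ (∈-primes⁺ hr z≤n q)
  ... | no q = inj₁ (∈-primes⁺ hr (N.≮⇒≥ q) (N.≤-<-trans le (N.<-≤-trans (N.^-monoʳ-< 2 (s≤s (s≤s z≤n)) y<X) (2^-mono X≤K))))
  lt : (2^ y) N.^ suc V N.* 2^ (V N.* 0) N.< 2^ (V N.* X)
  lt = N.≤-<-trans (reflexive (cong₂ N._*_ (N.^-*-assoc 2 y (suc V)) (cong 2^_ (N.*-zeroʳ V)) ∙ N.*-identityʳ _)) (N.^-monoʳ-< 2 (s≤s (s≤s z≤n)) y<VX)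
  le₁ : # V * # X ≤ (# y + # 1) * # (suc V)
  le₁ = sym (#-* V X) ≡⨾ #-mono (reflexive eq ⨟ n<[1+n/L]L n (suc V)) ⨾ ≡⇒≤ (#-* (suc y) (suc V) ∙
    cong (_* # (suc V)) (#-suc y ∙ solve 1 (λ y → κ 1 :+ y := y :+ κ 1) refl (# y)))
  le₂ : # V * inv (suc V) * # X ≤ # y + # 1
  le₂ = *-pull (# V) (inv (suc V)) (# X) ≡⨾ scale (inv-nonneg (suc V)) le₁ ⨾
    ≡⇒≤ (solve 3 (λ i y n → i :* (y :* n) := n :* i :* y) refl (inv (suc V)) (# y + # 1) (# (suc V)) ∙ cong (_* (# y + # 1)) (#-inv (suc V) (s≤s z≤n)) ∙ 1* _)
  main : β₀ * # X - S₀ ≤ g ws (2^ y)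
  main = lin (π₁ (π₂ (π₂ ga) (2^ y)) ⊕ scale P≥0 (H-lower V y) ⊕ scale (*≥0 P≥0 (<⇒≤ c₁>0)) le₂)
   (solve 8 (λ g P c C y v i x → g :+ (:- C :+ P :* (c :* (y :- v)) :+ P :* c :* (v :* i :* x)) :=
      P :* c :* (v :* i) :* x :- (P :* c :* (κ 1 :+ v) :+ C) :+ (g :+ P :* c :* (y :+ κ 1))) refl (g ws (2^ y)) P c₁ C (# y) (# V) (inv (suc V)) (# X) ∙
     cong (λ z → P * c₁ * (# V * inv (suc V)) * # X - (P * c₁ * z + C) + (g ws (2^ y) + P * c₁ * (# y + # 1))) (sym (#-suc V)) ∙
      solve 6 (λ b g P c h y → b :+ (g :+ P :* c :* (y :+ κ 1)) := b :+ (g :- P :* h :+ P :* h :+ P :* c :* (y :+ κ 1))) refl (β₀ * # X - S₀) (g ws (2^ y)) P c₁ (H (2^ y)) (# y))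

-- The two sums over divisors, for weights that are step functions with blocks of length L

^-distrib : ∀ a b k → (a * b) ^ k ≡ a ^ k * b ^ k
^-distrib a b zero = solve 0 (κ 1 := κ 1 :* κ 1) refl
^-distrib a b (suc k) = cong (a * b *_) (^-distrib a b k) ∙ *-interchange a b (a ^ k) (b ^ k)

n<2^n : ∀ n → n N.< 2^ n
n<2^n zero = s≤s z≤n
n<2^n (suc n) = s≤s (n<2^n n) ⨟ N.+-monoˡ-≤ (2^ n) (2^≥1 n) ⨟ reflexive (sym (double (2^ n)))

bernoulli : ∀ {e} k → # 0 ≤ e → e ≤ # 1 → # 1 - # k * e ≤ (# 1 - e) ^ k
bernoulli {e} zero h h' = ≡⇒≤ (solve 1 (λ e → κ 1 :- κ 0 :* e := κ 1) refl e)
bernoulli {e} (suc k) h h' = subst (λ z → # 1 - z * e ≤ (# 1 - e) ^ suc k) (sym (#-suc k)) (lin (scale (sub-nonneg h') (bernoulli k h h') ⊕ scale (#≥0 k) (sq-nonneg e))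
 (solve 3 (λ e p k → (κ 1 :- e) :* p :+ ((κ 1 :- e) :* (κ 1 :- k :* e) :+ k :* κ 0) := κ 1 :- (κ 1 :+ k) :* e :+ ((κ 1 :- e) :* p :+ k :* (e :* e))) refl e ((# 1 - e) ^ k) (# k)))

module Estimate (V : ℕ) (V≥ : 4004 N.≤ V) (G : ℕ) (G≥1 : 1 N.≤ G) (fN : ℕ → ℕ) (f-anti : ∀ {b c} → b N.≤ c → fN c N.≤ fN b)
 (f-supp : ∀ {b} → G N.≤ b → fN b ≡ 0) where

 V≥1 : 1 N.≤ V
 V≥1 = s≤s z≤n ⨟ V≥
 V≥5 : 5 N.≤ V
 V≥5 = N.m≤m+n 5 3999 ⨟ V≥

 open Dimension1 V V≥1 public

 -- The precision is e = (4000 + 4)/V: the part 4000/V dominates the coefficient errors required by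
 -- `Comparison`, the part 4/V the gap between `α` and `b°`.
 i e E f₀ : 𝔽
 i = inv V
 e = # 4004 * i
 E = # 1 + e
 f₀ = # (fN 0)

 i≥0 : # 0 ≤ i
 i≥0 = inv-nonneg V
 e≥0 : # 0 ≤ e
 e≥0 = *≥0 (#≥0 4004) i≥0
 e≤1 : e ≤ # 1
 e≤1 = scaleʳ i≥0 (#-mono V≥) ⨾ ≡⇒≤ (#-inv V V≥1)
 E≥0 : # 0 ≤ E
 E≥0 = +≥0 0≤1 e≥0
 f₀≥0 : # 0 ≤ f₀
 f₀≥0 = #≥0 (fN 0)

 δ-max : 𝔽
 δ-max = inv (2^ V ∸ 1)

 V≤ : V N.≤ 2^ V ∸ 1
 V≤ = N.≤-pred (n<2^n V ⨟ reflexive (sym (N.m+[n∸m]≡n (2^≥1 V))))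

 δ-max≤i : δ-max ≤ i
 δ-max≤i = inv-mono V≥1 V≤

 i≤ : # 4 * i ≤ # 1
 i≤ = scaleʳ i≥0 (#-mono {4} {4004} (N.m≤m+n 4 4000)) ⨾ e≤1

 -- The lower slope after one prime q ≥ 2^V has been switched off, which costs at most a factor 1 +
 -- 1/V.
 b° : 𝔽
 b° = β₀ * (# 1 - i)

 private
  1-i≥0 : # 0 ≤ # 1 - i
  1-i≥0 = lin (i≤ ⊕ scale (#≥0 3) i≥0) (solve 1 (λ i → κ 1 :- i :+ (κ 4 :* i :+ κ 3 :* κ 0) := κ 0 :+ (κ 1 :+ κ 3 :* i)) refl i)
  1-2i≥0 : # 0 ≤ # 1 - # 2 * i
  1-2i≥0 = lin (i≤ ⊕ scale (#≥0 2) i≥0) (solve 1 (λ i → κ 1 :- κ 2 :* i :+ (κ 4 :* i :+ κ 2 :* κ 0) := κ 0 :+ (κ 1 :+ κ 2 :* i)) refl i)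

  c₁≥ : c₂ * (# 1 - # 2 * i) ≤ c₁
  c₁≥ = lin (dyadic-gap V ⊕ inv-mono V≥1 (N.<⇒≤ (n<2^n V)) ⊕ scale (*≥0 (#≥0 2) i≥0) c₂≥½ ⊕ scale i≥0 (≡⇒≤ (sym (#-inv 2 (s≤s z≤n)))))
   (solve 5 (λ a b i z h → a :+ (b :+ z :+ κ 2 :* i :* h :+ i :* κ 1) := b :* (κ 1 :- κ 2 :* i) :+ (a :+ z :+ i :+ κ 2 :* i :* b :+ i :* (κ 2 :* h))) refl c₁ c₂ i (inv (2^ V)) (inv 2))

  V/V+1 : # 1 - i ≤ # V * inv (suc V)
  V/V+1 = lin (inv-mono V≥1 (N.n≤1+n V)) (solve 2 (λ i j → κ 1 :- j :+ j := κ 1 :- i :+ i) refl i (inv (suc V))) ⨾ ≡⇒≤ (sym (solve 2 (λ v j → v :* j := (κ 1 :+ v) :* j :- j) refl (# V) (inv (suc V)) ∙ cong (λ z → z * inv (suc V) - inv (suc V)) (sym (#-suc V)) ∙ cong (_- inv (suc V)) (#-inv (suc V) (s≤s z≤n))))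

  cubic : # 1 - # 4 * i ≤ (# 1 - # 2 * i) * (# 1 - i) * (# 1 - i)
  cubic = lin (scale (#≥0 3) (sq-nonneg i) ⊕ scale (sq-nonneg i) (scale (#≥0 2) 1-i≥0))
   (solve 1 (λ i → (κ 1 :- κ 2 :* i) :* (κ 1 :- i) :* (κ 1 :- i) :+ (κ 3 :* κ 0 :+ i :* i :* (κ 2 :* κ 0)) := κ 1 :- κ 4 :* i :+ (κ 3 :* (i :* i) :+ i :* i :* (κ 2 :* (κ 1 :- i)))) refl i)

 -- Three losses: 1 - 2/V between the two approximations of log 2, 1 - 1/V for the binary lengths,
 -- and 1 - 1/V for the missing prime; together at most 4/V.
 b°≥ : α * (# 1 - e) ≤ b°
 b°≥ = scale α≥0 (lin (cubic ⊕ scale (#≥0 4000) i≥0)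
    (solve 2 (λ i q → q :+ (κ 1 :- κ 4 :* i :+ κ 4000 :* κ 0) := κ 1 :- κ 4004 :* i :+ (q :+ κ 4000 :* i)) refl i ((# 1 - # 2 * i) * (# 1 - i) * (# 1 - i)))) ⨾
   ≡⇒≤ (solve 3 (λ P c i → P :* c :* ((κ 1 :- κ 2 :* i) :* (κ 1 :- i) :* (κ 1 :- i)) := P :* (c :* (κ 1 :- κ 2 :* i)) :* (κ 1 :- i) :* (κ 1 :- i)) refl P c₂ i) ⨾
    scaleʳ 1-i≥0 (*-mono 1-i≥0 (*≥0 P≥0 (<⇒≤ c₁>0)) (scale P≥0 c₁≥) V/V+1)

 private
  i>0 : # 0 < i
  i>0 = inv-pos V V≥1

  1-i>0 : # 0 < # 1 - i
  1-i>0 = <-≤-trans (*-pos (#-pos 3 (s≤s z≤n)) i>0) (lin i≤ (solve 1 (λ i → κ 1 :- i :+ κ 4 :* i := κ 3 :* i :+ κ 1) refl i))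

 β₀>0 : # 0 < β₀
 β₀>0 = *-pos (*-pos P>0 c₁>0) (*-pos (#-pos V V≥1) (inv-pos (suc V) (s≤s z≤n)))

 b°>0 : # 0 < b°
 b°>0 = *-pos β₀>0 1-i>0

 b°≥0 : # 0 ≤ b°
 b°≥0 = <⇒≤ b°>0

 b°≤α : b° ≤ α
 b°≤α = scale (<⇒≤ β₀>0) 1-i≤1 ⨾ *1 β₀ ≡⨾ *-mono (*≥0 (#≥0 V) (inv-nonneg (suc V))) α≥0 (scale P≥0 c₁≤c₂) V/V+1≤1 `then` ≡⇒≤ (*1 α)
  where
  _`then`_ : ∀ {a b c : 𝔽} → a ≤ b → b ≤ c → a ≤ c
  _`then`_ = ≤-trans
  1-i≤1 : # 1 - i ≤ # 1
  1-i≤1 = lin i≥0 (solve 1 (λ i → κ 1 :+ κ 0 := κ 1 :- i :+ i) refl i)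
  V/V+1≤1 : # V * inv (suc V) ≤ # 1
  V/V+1≤1 = scaleʳ (inv-nonneg (suc V)) (#-mono (N.n≤1+n V)) ⨾ ≡⇒≤ (#-inv (suc V) (s≤s z≤n))
  c₁≤c₂ : c₁ ≤ c₂
  c₁≤c₂ = ∑-shift (2^ V) (2^ suc V) 1 inv ≡⨾ (∑-mono (rg (2^ V) (2^ suc V)) λ n m → inv-mono (2^≥1 V ⨟ π₁ (∈-range⁻ m)) (N.n≤1+n n))

 B' : ℕ
 B' = π₁ (arch S₀ b°>0)

 f : ℕ → 𝔽
 f b = # (fN b)

 f-antitone : Antitone f
 f-antitone p = #-mono (f-anti p)

 f-Supp : Supp G f
 f-Supp p = cong #_ (f-supp p)

 -- The integral of f² against d(b^5), summed by parts; the plain sum is about α^5 L^5 D / 5!.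
 D : 𝔽
 D = ∑ (rg 0 G) (λ b → (sq f b - sq f (suc b)) * # (suc b) ^ 5)

 wN : ℕ → ℕ → ℕ
 wN zero b = 0
 wN (suc a) b = wN a b N.+ fN (suc a N.+ b)

 -- The integral of f over a window of `a` blocks. One unit is given up in order to pay for the
 -- error term of `diff-lower`; f takes large integer values, so this loss is relatively small.
 u : ℕ → ℕ → 𝔽
 u a b = # (wN a b ∸ 1)

 wN-anti : ∀ a {b c} → b N.≤ c → wN a c N.≤ wN a b
 wN-anti zero p = z≤n
 wN-anti (suc a) p = N.+-mono-≤ (wN-anti a p) (f-anti (N.+-monoʳ-≤ (suc a) p))

 wN-supp : ∀ a {b} → G N.≤ b → wN a b ≡ 0
 wN-supp zero p = refl
 wN-supp (suc a) {b} p = cong₂ N._+_ (wN-supp a p) (f-supp (p ⨟ N.m≤n+m b (suc a)))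

 wN-∑ : ∀ a b → # (wN a b) ≡ ∑ (rg 0 a) (λ t → f (suc t N.+ b))
 wN-∑ zero b = sym (∑-nil {0} {0} z≤n _)
 wN-∑ (suc a) b = #-+ (wN a b) _ ∙ cong (_+ f (suc a N.+ b)) (wN-∑ a b) ∙ sym (∑-suc {0} {a} z≤n _)

 -- The integral of u² against d(b^4): the form attached to a smaller factor q of about `a` blocks
 -- is about α^6 L^6 Nn(a) / 4!.
 Nn : ℕ → 𝔽
 Nn a = ∑ (rg 0 G) (λ b → (sq (u a) b - sq (u a) (suc b)) * # (suc b) ^ 4)

 sq-antitone : ∀ {F} → Antitone F → (∀ x → # 0 ≤ F x) → Antitone (sq F)
 sq-antitone aF nF {x} {y} p = *-mono (nF y) (nF x) (aF p) (aF p)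

 sq-supp : ∀ {K F} → Supp K F → Supp K (sq F)
 sq-supp sF {x} p = cong (λ z → z * z) (sF p) ∙ solve 0 (κ 0 :* κ 0 := κ 0) refl

 u-antitone : ∀ a → Antitone (u a)
 u-antitone a p = #-mono (N.∸-monoˡ-≤ 1 (wN-anti a p))

 u-supp : ∀ a → Supp G (u a)
 u-supp a p = cong (λ z → # (z ∸ 1)) (wN-supp a p)

 module AtLength (L : ℕ) (L≥1 : 1 N.≤ L) (hL₁ : # 5 * # (suc B) ≤ e * # L) (hL₂ : # 4 * # B' ≤ e * # L)
  (hL₃ : # 4 * ((S₀ + E * (α * # B)) * f₀) ≤ α * # L) (he : # 8 * e * # G * f₀ ≤ # 1) (e≤½ : # 2 * e ≤ # 1) where

  instance
   L≢0 : NonZero L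
   L≢0 = N.>-nonZero L≥1

  K : ℕ
  K = G N.* L

  E≥ : # 1 + # 4000 * inv (2^ V ∸ 1) ≤ E
  E≥ = lin (scale (#≥0 4000) δ-max≤i ⊕ scale (#≥0 4) i≥0) (solve 2 (λ i d → κ 1 :+ κ 4004 :* i :+ (κ 4000 :* d :+ κ 4 :* κ 0) := κ 1 :+ κ 4000 :* d :+ (κ 4000 :* i :+ κ 4 :* i)) refl i δ-max)

  E≤2 : E ≤ # 2
  E≤2 = lin e≤1 (solve 1 (λ e → κ 2 :+ e := κ 1 :+ e :+ κ 1) refl e)

  open Comparison V V≥5 E E≥ E≤2 K hiding (E≥0)

  F : ℕ → 𝔽
  F x = f (x N./ L)

  F-antitone : Antitone F
  F-antitone = Step.step-antitone L G f f-Supp f-antitone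

  F-supp : Supp K F
  F-supp = Step.step-supp L G f f-Supp

  F-nonneg : ∀ x → # 0 ≤ F x
  F-nonneg x = #≥0 (fN (x N./ L))

  #L≥0 : # 0 ≤ # L
  #L≥0 = #≥0 L

  UB : ∀ X → Op inv ps (ind X) 0 ≤ α * (# X + # B)
  UB = Op-inv-upper K

  diff≥0 : ∀ {h} → Antitone h → ∀ b → # 0 ≤ h b - h (suc b)
  diff≥0 a b = sub-nonneg (a (N.n≤1+n b))

  -- E^6 = E · E^5: one factor for replacing κ by five iterates of 1/p, and one for each power of an
  -- edge moved by 5 (B + 1) ≤ e L.
  M₁-upper : # 120 * Op κf ps (sq F) 0 ≤ E ^ 6 * (α ^ 5 * # L ^ 5 * D)
  M₁-upper = scale (#≥0 120) (upper-κ (sq-antitone F-antitone F-nonneg) (λ x → sq-nonneg (F x)) 0) ⨾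
   *-swap (# 120) E _ ≡⨾ scale E≥0 main ⨾ ≡⇒≤ (*-assoc˘ E (E ^ 5) (α ^ 5 * # L ^ 5 * D))
   where
   open Step L G (sq f) (sq-supp f-Supp)
   d : ℕ → 𝔽
   d b = sq f b - sq f (suc b)
   each : ∀ b → # 120 * OpN inv ps 5 (ind (suc b N.* L)) 0 ≤ E ^ 5 * (α ^ 5 * # L ^ 5 * # (suc b) ^ 5)
   each b = OpN-upper inv≥ UB α≥0 4 (suc b N.* L) 0 ⨾ scale (^≥0 5 α≥0) (^-mono 5 (#≥0 (suc b N.* L N.+ 5 N.* suc B ∸ 0)) le) ⨾ ≡⇒≤
     (cong (α ^ 5 *_) (^-distrib E (# (suc b) * # L) 5 ∙ cong (E ^ 5 *_) (^-distrib (# (suc b)) (# L) 5)) ∙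
      solve 4 (λ a E b l → a :* (E :* (b :* l)) := E :* (a :* l :* b)) refl (α ^ 5) (E ^ 5) (# (suc b) ^ 5) (# L ^ 5))
    where
    le : # (suc b N.* L N.+ 5 N.* suc B) ≤ E * (# (suc b) * # L)
    le = (#-+ (suc b N.* L) _ ∙ cong₂ _+_ (#-* (suc b) L) (#-* 5 (suc B))) ≡⨾ ≤-refl ⊕ ≤-trans hL₁ (≡⇒≤ (1*˘ (e * # L)) ⨾
       scaleʳ (*≥0 e≥0 #L≥0) (#-mono {1} {suc b} (s≤s z≤n))) ⨾
      ≡⇒≤ (solve 3 (λ b l e → b :* l :+ b :* (e :* l) := (κ 1 :+ e) :* (b :* l)) refl (# (suc b)) (# L) e)
   main : # 120 * OpN inv ps 5 step 0 ≤ E ^ 5 * (α ^ 5 * # L ^ 5 * D)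
   main = ≡⇒≤ (cong (# 120 *_) (step-linear (OpN-linear inv ps 5 0)) ∙ sym (∑-scale (rg 0 G) (# 120) _)) ⨾
    (∑-mono (rg 0 G) λ b _ → ≡⇒≤ (*-swap (# 120) (d b) _) ⨾
       scale (diff≥0 (sq-antitone f-antitone (λ x → #≥0 (fN x))) b) (each b) ⨾≡ solve 4 (λ d E A b → d :* (E :* (A :* b)) := E :* A :* (d :* b)) refl (d b) (E ^ 5) (α ^ 5 * # L ^ 5) (# (suc b) ^ 5)) ⨾
     ≡⇒≤ (∑-scale (rg 0 G) (E ^ 5 * (α ^ 5 * # L ^ 5)) _ ∙ *-assoc (E ^ 5) (α ^ 5 * # L ^ 5) D)

  module AtPrime (q : ℕ) (q≥ : 2^ V N.≤ q) (a : ℕ) (a≤ : a N.* L N.≤ lg q) where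

   δ° ρ° : ℕ → 𝔽
   δ° = off q δf
   ρ° = off q ρf

   O : (ℕ → 𝔽) → ℕ → 𝔽
   O = Op δ° ps

   δ°≥0 : ∀ p → p ∈ ps → # 0 ≤ δ° p
   δ°≥0 = off-c≥0 q

   ρ°≥0 : ∀ p → p ∈ ps → # 0 ≤ ρ° p
   ρ°≥0 = off-ρ≥0 q

   v : ℕ
   v = lg q

   LB° : ∀ X → X N.≤ K → b° * # X - S₀ ≤ O (ind X) 0
   LB° X X≤K = lin (scale 1-i≥0′ chain ⊕ *≥0 i≥0 S₀≥0 ⊕ *≥0 (*≥0 i≥0 i≥0) o≥0)
     (solve 5 (λ o b x s i → o :+ ((κ 1 :- i) :* (b :* x :- s) :+ κ 0 :+ κ 0) := b :* (κ 1 :- i) :* x :- s :+ ((κ 1 :- i) :* ((κ 1 :+ i) :* o) :+ i :* s :+ i :* i :* o)) refl o β₀ (# X) S₀ i)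
    where
    o = O (ind X) 0
    o≥0 : # 0 ≤ o
    o≥0 = Op-nonneg ps δ°≥0 (ind-nonneg X) 0
    1-i≥0′ : # 0 ≤ # 1 - i
    1-i≥0′ = sub-nonneg (inv≤1 V V≥1)
    chain : β₀ * # X - S₀ ≤ (# 1 + i) * o
    chain = Op-δ-lower K X X≤K ⨾ off-δ-lower q (ind-antitone X) (ind-nonneg X) 0 ⨾
     scaleʳ o≥0 (≤-refl {# 1} ⊕ ≤-trans (inv-mono (V≥1 ⨟ V≤) (N.∸-monoˡ-≤ 1 q≥)) δ-max≤i)

   UB° : ∀ X → O (ind X) 0 ≤ E * α * # X + E * (α * # B)
   UB° X = off-δ-upper q (ind-antitone X) (ind-nonneg X) 0 ⨾ scale E≥0 (UB X) ⨾
    ≡⇒≤ (solve 4 (λ E a x b → E :* (a :* (x :+ b)) := E :* a :* x :+ E :* (a :* b)) refl E α (# X) (# B))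

   b°≤Eα : b° ≤ E * α
   b°≤Eα = lin (b°≤α ⊕ *≥0 e≥0 α≥0) (solve 3 (λ e a b → (κ 1 :+ e) :* a :+ (b :+ κ 0) := b :+ (a :+ e :* a)) refl e α b°)

   S₂ Sd : 𝔽
   S₂ = E * (α * # B)
   Sd = (E * α - b°) * # K + S₀ + S₂

   S₂≥0 : # 0 ≤ S₂
   S₂≥0 = *≥0 E≥0 (*≥0 α≥0 (#≥0 B))

   α≤2b° : α ≤ # 2 * b°
   α≤2b° = lin (scale (#≥0 2) b°≥ ⊕ scale α≥0 e≤½) (solve 3 (λ a b e → κ 2 :* b :+ (κ 2 :* (a :* (κ 1 :- e)) :+ a :* (κ 2 :* e)) := a :+ (κ 2 :* b :+ a :* κ 1)) refl α b° e)

   -- The slopes differ by at most 2 e α, so their share is 2 e α G L f₀ ≤ α L / 4 by `he`. The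
   -- constants S₀ and S₂ contribute at most α L / 4 by `hL₃`, and α ≤ 2 b°.
   Sd-small : Sd * f₀ ≤ b° * # L
   Sd-small = scale-cancel (#-pos 4 (s≤s z≤n)) (lin (hL₃ ⊕ scale (*≥0 α≥0 #L≥0) he ⊕ scale (*≥0 (*≥0 (#≥0 4) (*≥0 (#≥0 G) #L≥0)) f₀≥0) b°≥ ⊕ scale (#≥0 2) (scaleʳ #L≥0 α≤2b°))
    (solve 7 (λ b L S a e G f → κ 4 :* (b :* L) :+ (κ 4 :* (S :* f) :+ a :* L :* (κ 8 :* e :* G :* f) :+ κ 4 :* (G :* L) :* f :* (a :* (κ 1 :- e)) :+ κ 2 :* (a :* L)) :=
         κ 4 :* ((((κ 1 :+ e) :* a :- b) :* (G :* L) :+ S) :* f) :+ (a :* L :+ a :* L :* κ 1 :+ κ 4 :* (G :* L) :* f :* b :+ κ 2 :* (κ 2 :* b :* L))) refl b° (# L) (S₀ + S₂) α e (# G) f₀ ∙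
      cong (λ k → # 4 * (((E * α - b°) * k + (S₀ + S₂)) * f₀) + R) (sym (#-* G L)) ∙ cong (λ z → # 4 * (z * f₀) + R) (solve 3 (λ a b c → a :+ (b :+ c) := a :+ b :+ c) refl ((E * α - b°) * # K) S₀ S₂)))
    where
    R = α * # L + α * # L * # 1 + # 4 * (# G * # L) * f₀ * b° + # 2 * (# 2 * b° * # L)

   F₁ : ℕ → 𝔽
   F₁ x = F x - F (x N.+ v)

   F₁≥0 : ∀ x → # 0 ≤ F₁ x
   F₁≥0 x = sub-nonneg (F-antitone (N.m≤m+n x v))

   z : ℕ → 𝔽
   z = O F₁

   z≥0 : ∀ x → # 0 ≤ z x
   z≥0 = Op-nonneg ps δ°≥0 F₁≥0

   z-eq : ∀ x → z x ≡ O F x - O F (x N.+ v)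
   z-eq x = Op-ext δ° ps (λ y → solve 2 (λ a b → a :- b := κ 1 :* a :+ (:- κ 1) :* b) refl (F y) (F (y N.+ v))) x ∙
    Op-lin δ° ps (# 1) (- # 1) F (shift v F) x ∙ cong (λ w → # 1 * O F x + (- # 1) * w) (Op-shift δ° ps F v x) ∙
     solve 2 (λ a b → κ 1 :* a :+ (:- κ 1) :* b := a :- b) refl (O F x) (O F (x N.+ v))

   Sd≥0 : # 0 ≤ Sd
   Sd≥0 = +≥0 (+≥0 (*≥0 (sub-nonneg b°≤Eα) (#≥0 K)) S₀≥0) S₂≥0

   -- By `diff-lower`, z(x) is at least b° times the sum of F over the lg q ≥ a L places from x on,
   -- minus Sd F(x). The sum is at least L times the window sum `wN`, and the error is at most b° L,
   -- which is the unit subtracted in `u`.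
   z-lower : ∀ x → b° * # L * u a (x N./ L) ≤ z x
   z-lower x = by-cases (wN a (x N./ L)) refl
    where
    Σ′ = ∑ (rg 0 v) (λ t → F (t N.+ x))
    by-cases : ∀ n → wN a (x N./ L) ≡ n → b° * # L * # (n ∸ 1) ≤ z x
    by-cases zero _ = *0 (b° * # L) ≡⨾ z≥0 x
    by-cases (suc n) eq = lin (scale b°≥0 window ⊕ diff-lower {δ°} {ps} {K} b°≤Eα S₀≥0 S₂≥0 LB° UB° F-antitone F-supp v x ⊕ ≤-trans (scale Sd≥0 (#-mono (f-anti z≤n))) Sd-small)
       (solve 7 (λ b l n s o S f → o :+ (b :* (l :* (κ 1 :+ n)) :+ (b :* s :- S :* f) :+ S :* f) := b :* l :* n :+ (b :* s :+ o :+ b :* l)) refl b° (# L) (# n) Σ′ (O F x - O F (x N.+ v)) Sd (F x)) ⨾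
      ≡⇒≤ (sym (z-eq x))
     where
     window : # L * (# 1 + # n) ≤ Σ′
     window = ≡⇒≤ (cong (# L *_) (sym (#-suc n) ∙ cong #_ (sym eq) ∙ wN-∑ a (x N./ L))) ⨾
      window-sum L f f-antitone a x ⨾ ∑-subrange {0} {a N.* L} {0} {v} z≤n a≤ (λ t → F-nonneg (t N.+ x))

   K≥L : L N.≤ K
   K≥L = reflexive (sym (N.*-identityˡ L)) ⨟ N.*-monoˡ-≤ L G≥1

   5B≤eK : # 5 * # (suc B) ≤ e * # K
   5B≤eK = hL₁ ⨾ scale e≥0 (#-mono K≥L)

   Y : 𝔽
   Y = f₀ * (E * (α * (# K + # B)))

   Y≥0 : # 0 ≤ Y
   Y≥0 = *≥0 f₀≥0 (*≥0 E≥0 (*≥0 α≥0 (+≥0 (#≥0 K) (#≥0 B))))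

   F₁≤ : ∀ x → F₁ x ≤ f₀ * ind K x
   F₁≤ x = [ below , beyond ]′ (N.<-≤-connex x K)
    where
    below : x N.< K → F₁ x ≤ f₀ * ind K x
    below s = lin (F-nonneg (x N.+ v)) (solve 2 (λ a b → a :+ κ 0 := a :- b :+ b) refl (F x) (F (x N.+ v))) ⨾ #-mono (f-anti z≤n) ⨾ ≡⇒≤ (*1˘ f₀ ∙ cong (f₀ *_) (sym (ind-true s)))
    beyond : K N.≤ x → F₁ x ≤ f₀ * ind K x
    beyond s = (cong₂ _-_ (F-supp s) (F-supp (s ⨟ N.m≤m+n x v)) ∙ solve 0 (κ 0 :- κ 0 := κ 0) refl) ≡⨾ *≥0 f₀≥0 (ind-nonneg K x)

   z-max : ∀ x → z x ≤ Y
   z-max x = Op-mono ps δ°≥0 F₁≤ x ⨾ Op-scale δ° ps f₀ (ind K) x ≡⨾ scale f₀≥0 (Op-antitone ps δ°≥0 (ind-antitone K) z≤n ⨾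
       off-δ-upper q (ind-antitone K) (ind-nonneg K) 0 ⨾ scale E≥0 (UB K))

   z-supp : Supp K z
   z-supp = Op-supp ps (λ {y} p → cong₂ _-_ (F-supp p) (F-supp (p ⨟ N.m≤m+n y v)) ∙ solve 0 (κ 0 :- κ 0 := κ 0) refl)

   z-upper : ∀ x → z x ≤ Y * ind K x
   z-upper x = [ below , beyond ]′ (N.<-≤-connex x K)
    where
    below : x N.< K → z x ≤ Y * ind K x
    below r = z-max x ⨾ ≡⇒≤ (*1˘ Y ∙ cong (Y *_) (sym (ind-true r)))
    beyond : K N.≤ x → z x ≤ Y * ind K x
    beyond r = z-supp r ≡⨾ *≥0 Y≥0 (ind-nonneg K x)

   Y≤ : Y ≤ f₀ * E ^ 2 * (α * # K)
   Y≤ = scale f₀≥0 (scale E≥0 (scale α≥0 B≤)) ⨾ ≡⇒≤ (solve 4 (λ f E a k → f :* (E :* (a :* (E :* k))) := f :* (E :* (E :* κ 1)) :* (a :* k)) refl f₀ E α (# K))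
    where
    B≤ : # K + # B ≤ E * # K
    B≤ = lin (5B≤eK ⊕ scale (#≥0 4) (#≥0 B) ⊕ #≥0 5) (cong (λ b → E * # K + (# 5 * b + # 4 * # 0 + # 0)) (#-suc B) ∙
     solve 3 (λ e k b → (κ 1 :+ e) :* k :+ (κ 5 :* (κ 1 :+ b) :+ κ 4 :* κ 0 :+ κ 0) := k :+ b :+ (e :* k :+ κ 4 :* b :+ κ 5)) refl e (# K) (# B))

   χ-sum : # 24 * Op ρ° ps (ind K) 0 ≤ E ^ 5 * (α ^ 4 * # K ^ 4)
   χ-sum = scale (#≥0 24) (off-ρ-upper q (ind-antitone K) (ind-nonneg K) 0) ⨾ ≡⇒≤ (*-swap (# 24) E _) ⨾
    scale E≥0 (OpN-upper inv≥ UB α≥0 3 K 0 ⨾ scale (^≥0 4 α≥0) (^-mono 4 (#≥0 _) le)) ⨾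
     ≡⇒≤ (cong (λ w → E * (α ^ 4 * w)) (^-distrib E (# K) 4) ∙ solve 4 (λ E a p k → E :* (a :* (p :* k)) := E :* p :* (a :* k)) refl E (α ^ 4) (E ^ 4) (# K ^ 4))
    where
    le : # (K N.+ 4 N.* suc B) ≤ E * # K
    le = (#-+ K _ ∙ cong (# K +_) (#-* 4 (suc B))) ≡⨾ lin (5B≤eK ⊕ #≥0 (suc B)) (solve 3 (λ e k b → (κ 1 :+ e) :* k :+ (κ 5 :* b :+ κ 0) := k :+ κ 4 :* b :+ (e :* k :+ b)) refl e (# K) (# (suc B)))

   slack≤e : slack {δ°} {ρ°} ps ≤ e
   slack≤e = off-slack q ⨾ scale (#≥0 2000) δ-max≤i ⨾ scaleʳ i≥0 (#-mono {2000} {4004} (N.m≤m+n 2000 2004))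

   error : 𝔽
   error = e * (f₀ * f₀ * E ^ 9 * (α ^ 6 * # K ^ 6))

   error-bound : # 24 * (slack {δ°} {ρ°} ps * (Y * Y * Op ρ° ps (ind K) 0)) ≤ error
   error-bound = ≡⇒≤ (solve 4 (λ c s y o → c :* (s :* (y :* o)) := s :* (y :* (c :* o))) refl (# 24) _ (Y * Y) _) ⨾
    *-mono (*≥0 (*≥0 Y≥0 Y≥0) (*≥0 (#≥0 24) χ≥0)) e≥0 slack≤e
      (*-mono (*≥0 (#≥0 24) χ≥0) (*≥0 W≥0 W≥0) (*-mono Y≥0 W≥0 Y≤ Y≤) χ-sum) ⨾
     ≡⇒≤ (solve 8 (λ e f E E5 a k a4 k4 → e :* (f :* (E :* (E :* κ 1)) :* (a :* k) :* (f :* (E :* (E :* κ 1)) :* (a :* k)) :* (E5 :* (a4 :* k4))) :=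
       e :* (f :* f :* (E :* (E :* (E :* (E :* E5)))) :* (a :* (a :* a4) :* (k :* (k :* k4))))) refl e f₀ E (E ^ 5) α (# K) (α ^ 4) (# K ^ 4))
    where
    W≥0 : # 0 ≤ f₀ * E ^ 2 * (α * # K)
    W≥0 = *≥0 (*≥0 f₀≥0 (^≥0 2 E≥0)) (*≥0 α≥0 (#≥0 K))
    χ≥0 : # 0 ≤ Op ρ° ps (ind K) 0
    χ≥0 = Op-nonneg ps ρ°≥0 (ind-nonneg K) 0

   LB∸ : ∀ X → X N.≤ K → b° * # (X ∸ B') ≤ O (ind X) 0
   LB∸ X X≤K = [ above , below ]′ (N.≤-total B' X)
    where
    above : B' N.≤ X → b° * # (X ∸ B') ≤ O (ind X) 0
    above r = lin (π₂ (arch S₀ b°>0)) (cong (λ x → b° * x - S₀ + S₀) (cong #_ (sym (N.m∸n+n≡m r)) ∙ #-+ (X ∸ B') B') ∙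
       solve 4 (λ b x y s → b :* (x :+ y) :- s :+ s := b :* x :+ y :* b) refl b° (# (X ∸ B')) (# B') S₀) ⨾ LB° X X≤K
    below : X N.≤ B' → b° * # (X ∸ B') ≤ O (ind X) 0
    below r = (cong (λ y → b° * # y) (N.m≤n⇒m∸n≡0 r) ∙ *0 b°) ≡⨾ Op-nonneg ps δ°≥0 (ind-nonneg X) 0

   u² : ℕ → 𝔽
   u² = sq (u a)

   1-e≥0 : # 0 ≤ # 1 - e
   1-e≥0 = sub-nonneg e≤1

   step-lower : b° ^ 4 * ((# 1 - e) ^ 4 * # L ^ 4 * Nn a) ≤ # 24 * OpN δ° ps 4 (λ x → u² (x N./ L)) 0
   step-lower = ≡⇒≤ (solve 4 (λ b c l n → b :* (c :* l :* n) := b :* (c :* l) :* n) refl (b° ^ 4) ((# 1 - e) ^ 4) (# L ^ 4) (Nn a) ∙ sym (∑-scale (rg 0 G) (b° ^ 4 * ((# 1 - e) ^ 4 * # L ^ 4)) _)) ⨾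
    (∑-mono (rg 0 G) λ b m → ≡⇒≤ (solve 5 (λ B c l d k → B :* (c :* l) :* (d :* k) := d :* (B :* (c :* (k :* l)))) refl (b° ^ 4) ((# 1 - e) ^ 4) (# L ^ 4) (d b) (# (suc b) ^ 4)) ⨾
       scale (diff≥0 (sq-antitone (u-antitone a) (λ x → #≥0 (wN a x ∸ 1))) b) (each b (π₂ (∈-range⁻ m))) ⨾≡ *-swap (d b) (# 24) (OpN δ° ps 4 (ind (suc b N.* L)) 0)) ⨾
     ≡⇒≤ (∑-scale (rg 0 G) (# 24) _ ∙ cong (# 24 *_) (sym (step-linear (OpN-linear δ° ps 4 0))))
    where
    open Step L G u² (sq-supp (u-supp a))
    d : ℕ → 𝔽
    d b = u² b - u² (suc b)
    each : ∀ b → b N.< G → b° ^ 4 * ((# 1 - e) ^ 4 * (# (suc b) ^ 4 * # L ^ 4)) ≤ # 24 * OpN δ° ps 4 (ind (suc b N.* L)) 0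
    each b b<G = scale (^≥0 4 b°≥0) (≡⇒≤ (cong ((# 1 - e) ^ 4 *_) (sym (^-distrib (# (suc b)) (# L) 4)) ∙ sym (^-distrib (# 1 - e) (# (suc b) * # L) 4)) ⨾
       ^-mono 4 (*≥0 1-e≥0 (*≥0 (#≥0 (suc b)) #L≥0)) le) ⨾ OpN-lower δ°≥0 {B = B'} LB∸ b°≥0 3 (suc b N.* L) 0 (N.*-monoˡ-≤ L b<G)
     where
     n-∸ : ∀ m n → # m - # n ≤ # (m ∸ n)
     n-∸ m n = lin (#-mono (N.m≤n+m∸n m n) ⨾≡ #-+ n (m ∸ n)) (solve 3 (λ m n k → k :+ m := m :- n :+ (n :+ k)) refl (# m) (# n) (# (m ∸ n)))
     le : (# 1 - e) * (# (suc b) * # L) ≤ # (suc b N.* L ∸ 4 N.* B')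
     le = lin (hL₂ ⊕ scaleʳ (*≥0 e≥0 #L≥0) (#-mono {1} {suc b} (s≤s z≤n))) (cong₂ (λ x y → x - y + (# 4 * # B' + # 1 * (e * # L))) (#-* (suc b) L) (#-* 4 B') ∙
         solve 4 (λ b l e B → b :* l :- κ 4 :* B :+ (κ 4 :* B :+ κ 1 :* (e :* l)) := (κ 1 :- e) :* (b :* l) :+ (e :* l :+ b :* (e :* l))) refl (# (suc b)) (# L) e (# B')) ⨾
        n-∸ (suc b N.* L) (4 N.* B')

   main-lower : b° ^ 6 * ((# 1 - e) ^ 4 * # L ^ 6 * Nn a) ≤ E ^ 4 * (# 24 * Op ρ° ps (sq z) 0)
   main-lower = ≡⇒≤ (solve 6 (λ b c l n b4 l4 → b :* (b :* b4) :* (c :* (l :* (l :* l4)) :* n) := b :* l :* (b :* l) :* (b4 :* (c :* l4 :* n)))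
       refl b° ((# 1 - e) ^ 4) (# L) (Nn a) (b° ^ 4) (# L ^ 4)) ⨾
    scale bl≥0 step-lower ⨾ scale bl≥0 (scale (#≥0 24) (lower-off q {λ x → u² (x N./ L)} (Step.step-antitone L G u² (sq-supp (u-supp a)) (sq-antitone (u-antitone a) (λ x → #≥0 (wN a x ∸ 1)))) (λ x → sq-nonneg (u a (x N./ L))) 0)) ⨾
     ≡⇒≤ (solve 4 (λ s c E o → s :* (c :* (E :* o)) := E :* (c :* (s :* o))) refl (bl * bl) (# 24) (E ^ 4) (Op ρ° ps (λ x → u² (x N./ L)) 0)) ⨾
      scale (^≥0 4 E≥0) (scale (#≥0 24) (sym (Op-scale ρ° ps (bl * bl) _ 0) ≡⨾ Op-mono ps ρ°≥0 (λ x → ≡⇒≤ (solve 2 (λ a b → a :* a :* (b :* b) := a :* b :* (a :* b)) refl bl (u a (x N./ L))) ⨾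
        *-mono (*≥0 bl₁≥0 (#≥0 _)) (z≥0 x) (z-lower x) (z-lower x)) 0))
    where
    bl = b° * # L
    bl₁≥0 : # 0 ≤ bl
    bl₁≥0 = *≥0 b°≥0 #L≥0
    bl≥0 : # 0 ≤ bl * bl
    bl≥0 = *≥0 bl₁≥0 bl₁≥0

   Nn≥0 : # 0 ≤ Nn a
   Nn≥0 = ∑≥0 (rg 0 G) λ b _ → *≥0 (diff≥0 (sq-antitone (u-antitone a) (λ x → #≥0 (wN a x ∸ 1))) b) (^≥0 4 (#≥0 (suc b)))

   -- Of the ten factors 1 - e, six come from b° (two in z², four in the iterates of δ) and four
   -- from the shifted edges. In the slack term, E^13 is E^4 from `lower-off` times E^9 from
   -- `error-bound`.
   M₂-lower : α ^ 6 * # L ^ 6 * ((# 1 - e) ^ 10 * Nn a - e * (f₀ * f₀ * E ^ 13 * # G ^ 6)) ≤ # 24 * E ^ 4 * Mq δ° ρ° ps F₁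
   M₂-lower = lin (scale (*≥0 (^≥0 4 E≥0) (#≥0 24)) (Mq-lower {δ°} {ρ°} ps (λ p i → δ°≥0 p i , off-≤ q δf p (C.j≥0 p i) ⨾ C.δ≤1 p i , ρ°≥0 p i) Y≥0 F₁≥0 (ind-antitone K) (λ x → ind-nonneg K x , 𝟙≤1 _) z-upper)
      ⊕ main-lower ⊕ scale (^≥0 4 E≥0) error-bound ⊕ scaleʳ (*≥0 (*≥0 (^≥0 4 1-e≥0) (^≥0 6 #L≥0)) Nn≥0) b°⁶)
    (solve 9 (λ c E4 M Z s b6 m er a6 → c :* E4 :* M :+ (E4 :* c :* (Z :- s) :+ b6 :* m :+ E4 :* (c :* s) :+ a6 :* m) :=
       (a6 :* m :- E4 :* er) :+ (E4 :* c :* M :+ E4 :* (c :* Z) :+ E4 :* er :+ b6 :* m)) refl (# 24) (E ^ 4) (Mq δ° ρ° ps F₁) (Op ρ° ps (sq z) 0) (slack {δ°} {ρ°} ps * (Y * Y * Op ρ° ps (ind K) 0))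
        (b° ^ 6) ((# 1 - e) ^ 4 * # L ^ 6 * Nn a) error (α ^ 6 * (# 1 - e) ^ 6) ∙
     cong (_+ (E ^ 4 * # 24 * Mq δ° ρ° ps F₁ + E ^ 4 * (# 24 * Op ρ° ps (sq z) 0) + E ^ 4 * error + b° ^ 6 * ((# 1 - e) ^ 4 * # L ^ 6 * Nn a))) final)
    where
    b°⁶ : α ^ 6 * (# 1 - e) ^ 6 ≤ b° ^ 6
    b°⁶ = sym (^-distrib α (# 1 - e) 6) ≡⨾ ^-mono 6 (*≥0 α≥0 1-e≥0) b°≥
    final : α ^ 6 * (# 1 - e) ^ 6 * ((# 1 - e) ^ 4 * # L ^ 6 * Nn a) - E ^ 4 * error ≡ α ^ 6 * # L ^ 6 * ((# 1 - e) ^ 10 * Nn a - e * (f₀ * f₀ * E ^ 13 * # G ^ 6))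
    final = cong (λ w → α ^ 6 * (# 1 - e) ^ 6 * ((# 1 - e) ^ 4 * # L ^ 6 * Nn a) - E ^ 4 * (e * (f₀ * f₀ * E ^ 9 * (α ^ 6 * w)))) (cong (_^ 6) (#-* G L) ∙ ^-distrib (# G) (# L) 6) ∙
     solve 10 (λ a6 x6 x4 l n E4 E9 e h g → a6 :* x6 :* (x4 :* l :* n) :- E4 :* (e :* (h :* E9 :* (a6 :* (g :* l)))) := a6 :* l :* (x6 :* x4 :* n :- e :* h :* (E4 :* E9 :* g)))
       refl (α ^ 6) ((# 1 - e) ^ 6) ((# 1 - e) ^ 4) (# L ^ 6) (Nn a) (E ^ 4) (E ^ 9) e (f₀ * f₀) (# G ^ 6) ∙
      cong₂ (λ x y → α ^ 6 * # L ^ 6 * (x * Nn a - y)) (pow (# 1 - e) 6 4) (cong (λ w → e * (f₀ * f₀) * (w * # G ^ 6)) (pow E 4 9) ∙ solve 4 (λ e f p g → e :* f :* (p :* g) := e :* (f :* p :* g)) refl e (f₀ * f₀) (E ^ 13) (# G ^ 6))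
     where
     pow : ∀ x m n → x ^ m * x ^ n ≡ x ^ (m N.+ n)
     pow x zero n = 1* (x ^ n)
     pow x (suc m) n = *-assoc x (x ^ m) (x ^ n) ∙ cong (x *_) (pow x m n)

-- Mertens' theorem in logarithmic scale

lo : ℕ → ℕ
lo n = ⌊log₂ n ⌋

-- Rounding down is superadditive, and it becomes subadditive once one factor is rounded up. These
-- two facts replace the additivity of the logarithm in the two halves of Mertens' theorem.
lo-sub : ∀ m n → 1 N.≤ m → 1 N.≤ n → lo (m N.* n) N.≤ lg m N.+ lo n
lo-sub m n p q = N.≤-pred (lg-≤ (N.*-mono-≤ p q) (N.<-≤-trans (N.*-mono-< (n<2^lg m) (n<2^lg n))
  (reflexive (sym (N.^-distribˡ-+-* 2 (lg m) (lg n)) ∙ cong 2^_ (N.+-suc (lg m) (lo n))))))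

lo-super : ∀ m n → 1 N.≤ m → 1 N.≤ n → lo m N.+ lo n N.≤ lo (m N.* n)
lo-super m n p q = N.≤-pred (lg-≥ {m N.* n} (reflexive (N.^-distribˡ-+-* 2 (lo m) (lo n)) ⨟ N.*-mono-≤ (2^⌊log₂⌋≤ m p) (2^⌊log₂⌋≤ n q)))

∑-log-prime-factors : ∀ ps n → 1 N.≤ n → (∀ p → p ∈ ps → Prime p) → Unique ps → ∑ ps (λ p → 𝟙 ⌊ p ∣? n ⌋ * # (lo p)) ≤ # (lo n)
∑-log-prime-factors [] n n≥1 h u = #≥0 (lo n)
∑-log-prime-factors (p ∷ ps) n n≥1 h (p∉ ∷ u) with p ∣? n
... | no _ = solve 2 (λ a b → κ 0 :* a :+ b := b) refl (# (lo p)) _ ≡⨾ ∑-log-prime-factors ps n n≥1 (λ q i → h q (there i)) u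
... | yes (∣.divides m e) = divisible
 where
 hp = h p (here refl)
 m≥1 : 1 N.≤ m
 m≥1 = N.n≢0⇒n>0 λ { refl → N.<⇒≱ n≥1 (reflexive e) }
 drop : ∀ q → q ∈ ps → 𝟙 ⌊ q ∣? n ⌋ * # (lo q) ≤ 𝟙 ⌊ q ∣? m ⌋ * # (lo q)
 drop q i = scaleʳ (#≥0 (lo q)) (𝟙-mono λ t → ⌊⌋⁺ ([ id , (λ d → ⊥-elim (All.lookup p∉ i (sym (prime∣prime (h q (there i)) hp d)))) ]′ (euclidsLemma m p (h q (there i)) (subst (q ∣_) e (⌊⌋⁻ {d = q ∣? n} t)))))
 divisible : # 1 * # (lo p) + ∑ ps (λ p → 𝟙 ⌊ p ∣? n ⌋ * # (lo p)) ≤ # (lo n)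
 divisible = ≡⇒≤ (1* (# (lo p))) ⊕ ≤-trans (∑-mono ps drop) (∑-log-prime-factors ps m m≥1 (λ q i → h q (there i)) u) ⨾
  sym (#-+ (lo p) (lo m)) ≡⨾ #-mono (lo-super p m (prime≥1 hp) m≥1 ⨟ reflexive (cong lo (N.*-comm p m ∙ sym e)))

count-multiples : ∀ {p} (p≥1 : 1 N.≤ p) N → ∑ (rg 1 (suc N)) (λ n → 𝟙 ⌊ p ∣? n ⌋) ≡ # (quot p≥1 N)
count-multiples {p} p≥1 N = (∑-ext (rg 1 (suc N)) λ n → *1˘ (𝟙 ⌊ p ∣? n ⌋)) ∙ ∑-multiples p≥1 N (λ _ → # 1) ∙
 ∑-const (rg 1 (suc (quot p≥1 N))) (# 1) ∙ cong (λ n → # n * # 1) (length-rg 1 (suc (quot p≥1 N))) ∙ *1 _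

quot-upper : ∀ {p} (p≥1 : 1 N.≤ p) N → # (quot p≥1 N) ≤ # N * inv p
quot-upper {p} p≥1 N = ≡⇒≤ (*1˘ (# Q) ∙ cong (# Q *_) (sym (#-inv p p≥1)) ∙ *-assoc˘ (# Q) (# p) (inv p) ∙ cong (_* inv p) (sym (#-* Q p))) ⨾
  scaleʳ (inv-nonneg p) (#-mono (DM.m/n*n≤m N p ⦃ N.>-nonZero p≥1 ⦄))
 where Q = quot p≥1 N

quot-lower : ∀ {p} (p≥1 : 1 N.≤ p) N → # N * inv p ≤ # (quot p≥1 N) + # 1
quot-lower {p} p≥1 N = scaleʳ (inv-nonneg p) (#-mono (N.<⇒≤ (n<[1+n/L]L N p ⦃ N.>-nonZero p≥1 ⦄))) ⨾ ≡⇒≤ (cong (_* inv p) (#-* (suc Q) p) ∙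
  *-assoc (# (suc Q)) (# p) (inv p) ∙ cong₂ _*_ (#-suc Q) (#-inv p p≥1) ∙ solve 1 (λ a → (κ 1 :+ a) :* κ 1 := a :+ κ 1) refl (# Q))
 where Q = quot p≥1 N

-- The pairs p | n ≤ N are counted in two ways. With N = 2^(x+s) instead of 2^x, the rounding errors
-- of N/p sum to at most x 2^x = x N / 2^s, so the trivial bound for ∑ log p suffices and
-- Chebyshev's is avoided.
mertens-upper : ∀ s x → ∑ (primes 0 (2^ x)) (λ p → # (lo p) * inv p) ≤ # (x N.+ s) + # x * inv (2^ s)
mertens-upper s x = scale-cancel (#-pos N (2^≥1 (x N.+ s))) (sym (∑-scale ps (# N) _) ≡⨾ ∑-mono ps each ⨾
  ∑-+ ps _ _ ≡⨾ first ⊕ second ⨾ ≡⇒≤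
   (cong (λ z → # N * # (x N.+ s) + z) eqn ∙ solve 3 (λ a b c → a :* b :+ a :* c := a :* (b :+ c)) refl (# N) (# (x N.+ s)) (# x * inv (2^ s))))
 where
 N = 2^ (x N.+ s)
 ps = primes 0 (2^ x)
 hps : ∀ p → p ∈ ps → Prime p
 hps p i = π₁ (∈-primes⁻ i)
 c : ℕ → 𝔽
 c p = ∑ (rg 1 (suc N)) (λ n → 𝟙 ⌊ p ∣? n ⌋)
 each : ∀ p → p ∈ ps → # N * (# (lo p) * inv p) ≤ # (lo p) * c p + # (lo p)
 each p i = *-swap (# N) (# (lo p)) (inv p) ≡⨾ scale (#≥0 (lo p)) (quot-lower (prime≥1 (hps p i)) N) ⨾
  ≡⇒≤ (cong (λ z → # (lo p) * (z + # 1)) (sym (count-multiples (prime≥1 (hps p i)) N)) ∙ solve 2 (λ a b → a :* (b :+ κ 1) := a :* b :+ a) refl (# (lo p)) (c p))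
 first : ∑ ps (λ p → # (lo p) * c p) ≤ # N * # (x N.+ s)
 first = ((∑-ext ps λ p → sym (∑-scale (rg 1 (suc N)) (# (lo p)) _)) ∙ ∑-swap ps (rg 1 (suc N)) _) ≡⨾ (∑-mono (rg 1 (suc N)) λ n m →
   (∑-ext ps λ p → *-comm (# (lo p)) (𝟙 ⌊ p ∣? n ⌋)) ≡⨾ ∑-log-prime-factors ps n (π₁ (∈-range⁻ m)) hps (unique-primes 0 (2^ x)) ⨾
    #-mono (⌊log₂⌋-mono-≤ (N.≤-pred (π₂ (∈-range⁻ m))) ⨟ reflexive (⌊log₂[2^n]⌋≡n (x N.+ s)))) ⨾
   ≡⇒≤ (∑-const (rg 1 (suc N)) _ ∙ cong (λ n → # n * # (x N.+ s)) (length-rg 1 (suc N)))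
 second : ∑ ps (λ p → # (lo p)) ≤ # (2^ x) * # x
 second = (∑-mono ps λ p i → #-mono (N.<⇒≤ (lg-≤ (prime≥1 (hps p i)) (π₂ (π₂ (∈-primes⁻ i)))))) ⨾ ∑-primes-≤ 0 (2^ x) (λ _ → #≥0 x) ⨾
   ≡⇒≤ (∑-const (rg 0 (2^ x)) (# x) ∙ cong (λ n → # n * # x) (length-rg 0 (2^ x)))
 eqn : # (2^ x) * # x ≡ # N * (# x * inv (2^ s))
 eqn = sym (cong (_* (# x * inv (2^ s))) (cong #_ (N.^-distribˡ-+-* 2 x s) ∙ #-* (2^ x) (2^ s)) ∙ *-interchange (# (2^ x)) (# (2^ s)) (# x) (inv (2^ s)) ∙
   cong (# (2^ x) * # x *_) (#-inv (2^ s) (2^≥1 s)) ∙ *1 (# (2^ x) * # x))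

-- The p-adic valuation of n, cut off at x; for n < 2^x nothing is lost.
v : ℕ → ℕ → ℕ → 𝔽
v x p n = ∑ (rg 1 (suc x)) (λ k → 𝟙 ⌊ (p N.^ k) ∣? n ⌋)

v-mono : ∀ x p r m → v x p m ≤ v x p (r N.* m)
v-mono x p r m = ∑-mono (rg 1 (suc x)) λ k _ → 𝟙-mono λ t → ⌊⌋⁺ (∣.∣n⇒∣m*n r (⌊⌋⁻ {d = (p N.^ k) ∣? m} t))

v-self : ∀ x r m → 1 N.≤ r → 1 N.≤ m → m N.< 2^ x → 2 N.≤ r → # 1 + v x r m ≤ v x r (r N.* m)
v-self zero r m r≥1 m≥1 lt r≥2 = ⊥-elim (N.<⇒≱ lt m≥1)
v-self (suc x) r m r≥1 m≥1 lt r≥2 = ≤-refl {# 1} ⊕ ≤-trans (≡⇒≤ (∑-suc (s≤s z≤n) _ ∙ cong (∑ (rg 1 (suc x)) (λ k → 𝟙 ⌊ (r N.^ k) ∣? m ⌋) +_) top))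
   (≡⇒≤ (+0 _)) ⨾
  ≡⇒≤ (sym (𝟙-true {⌊ (r N.^ 1) ∣? (r N.* m) ⌋} (⌊⌋⁺ (subst (_∣ r N.* m) (sym (N.*-identityʳ r)) (∣.m∣m*n m))))) ⊕
    ≤-trans (∑-mono (rg 1 (suc x)) λ k _ → 𝟙-mono λ t → ⌊⌋⁺ (∣.*-monoʳ-∣ r (⌊⌋⁻ {d = (r N.^ k) ∣? m} t))) (≡⇒≤ (sym (∑-shift 1 (suc x) 1 (λ k → 𝟙 ⌊ (r N.^ k) ∣? (r N.* m) ⌋)))) ⨾
   ≡⇒≤ (sym (∑-split {1} {2} (suc (suc x)) (s≤s z≤n) (s≤s (s≤s z≤n)) _ ∙ cong (_+ ∑ (rg 2 (suc (suc x))) (λ k → 𝟙 ⌊ (r N.^ k) ∣? (r N.* m) ⌋)) (∑-suc {1} {1} N.≤-refl _ ∙ cong (_+ 𝟙 ⌊ (r N.^ 1) ∣? (r N.* m) ⌋) (∑-nil {1} {1} N.≤-refl _) ∙ 0+ (𝟙 ⌊ (r N.^ 1) ∣? (r N.* m) ⌋))))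
 where
 top : 𝟙 ⌊ (r N.^ suc x) ∣? m ⌋ ≡ # 0
 top = 𝟙-false λ t → N.<⇒≱ lt (N.^-monoˡ-≤ (suc x) r≥2 ⨟ ∣.∣⇒≤ ⦃ N.>-nonZero m≥1 ⦄ (⌊⌋⁻ {d = (r N.^ suc x) ∣? m} t))

-- Strong induction removing a prime factor r: by `lo-sub` the left side drops by at most lg r, and
-- the valuation at r drops by at least one.
lo-≤-valuations : ∀ x n → 1 N.≤ n → n N.< 2^ x → # (lo n) ≤ ∑ (primes 0 (2^ x)) (λ p → # (lg p) * v x p n)
lo-≤-valuations x = <-rec _ go
 where
 ps = primes 0 (2^ x)
 S : ℕ → 𝔽
 S n = ∑ ps (λ p → # (lg p) * v x p n)
 v≥0 : ∀ p n → # 0 ≤ v x p n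
 v≥0 p n = ∑≥0 (rg 1 (suc x)) λ k _ → 𝟙≥0 _
 go : ∀ n → (∀ {m} → m N.< n → 1 N.≤ m → m N.< 2^ x → # (lo m) ≤ S m) → 1 N.≤ n → n N.< 2^ x → # (lo n) ≤ S n
 go (suc zero) ih p q = ∑≥0 ps λ p _ → *≥0 (#≥0 (lg p)) (v≥0 p 1)
 go n@(suc (suc _)) ih p q = composite (prime-factor n (s≤s (s≤s z≤n)))
  where
  composite : (∃ λ r → Prime r × r ∣ n) → # (lo n) ≤ S n
  composite (r , hr , ∣.divides m e) = #-mono (reflexive (cong lo e′) ⨟ lo-sub r m (prime≥1 hr) m≥1) ⨾ ≡⇒≤ (#-+ (lg r) (lo m)) ⨾
     ≤-refl {# (lg r)} ⊕ ih m<n m≥1 m< ⨾ split ⨾ ≡⇒≤ (cong S (sym e′))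
   where
   e′ : n ≡ r N.* m
   e′ = e ∙ N.*-comm m r
   m≥1 : 1 N.≤ m
   m≥1 = N.n≢0⇒n>0 λ z → N.<⇒≱ p (reflexive (e ∙ cong (N._* r) z))
   m<n : m N.< n
   m<n = N.<-≤-trans (s≤s (reflexive (sym (N.*-identityʳ m))) ⨟ N.*-monoʳ-< m ⦃ N.>-nonZero m≥1 ⦄ (prime≥2 hr)) (reflexive (sym e))
   m< : m N.< 2^ x
   m< = N.<-trans m<n q
   r∈ : r ∈ ps
   r∈ = ∈-primes⁺ hr z≤n (N.≤-<-trans (∣.∣⇒≤ (∣.divides m e)) q)
   pick : ∀ qs → Unique qs → r ∈ qs → (∀ q → q ∈ qs → Prime q) → # (lg r) + ∑ qs (λ p → # (lg p) * v x p m) ≤ ∑ qs (λ p → # (lg p) * v x p (r N.* m))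
   pick (q ∷ qs) (q∉ ∷ u) (here refl) h = lin (scale (#≥0 (lg r)) (v-self x r m (prime≥1 hr) m≥1 m< (prime≥2 hr)) ⊕ ∑-mono qs (λ p _ → scale (#≥0 (lg p)) (v-mono x p r m)))
     (solve 5 (λ l v v' s s' → l :* v' :+ s' :+ (l :* (κ 1 :+ v) :+ s) := l :+ (l :* v :+ s) :+ (l :* v' :+ s')) refl (# (lg r)) (v x r m) (v x r (r N.* m)) (∑ qs (λ p → # (lg p) * v x p m)) (∑ qs (λ p → # (lg p) * v x p (r N.* m))))
   pick (q ∷ qs) (q∉ ∷ u) (there i) h = lin (scale (#≥0 (lg q)) (v-mono x q r m) ⊕ pick qs u i (λ q j → h q (there j)))
     (solve 6 (λ l lq v v' s s' → lq :* v' :+ s' :+ (lq :* v :+ (l :+ s)) := l :+ (lq :* v :+ s) :+ (lq :* v' :+ s')) refl (# (lg r)) (# (lg q)) (v x q m) (v x q (r N.* m)) (∑ qs (λ p → # (lg p) * v x p m)) (∑ qs (λ p → # (lg p) * v x p (r N.* m))))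
   split : # (lg r) + S m ≤ S (r N.* m)
   split = pick ps (unique-primes 0 (2^ x)) r∈ (λ q i → π₁ (∈-primes⁻ i))

geometric : ∀ {p} → Prime p → ∀ x → ∑ (rg 1 (suc x)) (λ k → inv (p N.^ k)) ≤ inv (p ∸ 1)
geometric {p} hp x = exact x ≡⨾ lin (*≥0 (inv-nonneg (p ∸ 1)) (inv-nonneg (p N.^ x))) (solve 2 (λ a b → a :+ κ 0 := a :- b :+ b) refl j (j * inv (p N.^ x)))
 where
 j = inv (p ∸ 1)
 pk≥1 : ∀ k → 1 N.≤ p N.^ k
 pk≥1 k = N.m^n>0 p ⦃ prime⇒nonZero hp ⦄ k
 exact : ∀ x → ∑ (rg 1 (suc x)) (λ k → inv (p N.^ k)) ≡ j - j * inv (p N.^ x)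
 exact zero = ∑-nil {1} {1} N.≤-refl _ ∙ solve 1 (λ j → κ 0 := j :- j :* κ 1) refl j ∙ cong (λ z → j - j * z) (sym inv-1)
 exact (suc x) = ∑-suc {1} {suc x} (s≤s z≤n) _ ∙ cong₂ _+_ (exact x) (inv-* p (p N.^ x) (prime≥1 hp) (pk≥1 x)) ∙
   solve 3 (λ j i y → j :- j :* y :+ i :* y := j :- (j :- i) :* y) refl j (inv p) (inv (p N.^ x)) ∙ cong (λ z → j - (z - inv p) * inv (p N.^ x)) (inv-diff 1 p (prime≥2 hp)) ∙
    solve 3 (λ j i y → j :- (i :+ κ 1 :* (i :* j) :- i) :* y := j :- j :* (i :* y)) refl j (inv p) (inv (p N.^ x)) ∙ cong (λ z → j - j * z) (sym (inv-* p (p N.^ x) (prime≥1 hp) (pk≥1 x)))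

∑-lo-lower : ∀ x → (# x - # 2) * # (2^ x) ≤ ∑ (rg 1 (2^ x)) (λ n → # (lo n))
∑-lo-lower zero = lin (#≥0 2) (solve 0 (κ 0 :+ κ 0 := (κ 0 :- κ 2) :* κ 1 :+ κ 2) refl) ⨾ (∑≥0 (rg 1 (2^ 0)) λ n _ → #≥0 (lo n))
∑-lo-lower (suc x) = lin (∑-lo-lower x ⊕ block) (solve 4 (λ S Z x p → S :+ Z :+ ((x :- κ 2) :* p :+ p :* x) := (κ 1 :+ x :- κ 2) :* (κ 2 :* p) :+ (S :+ Z)) refl Sₓ Z (# x) (# (2^ x)) ∙
    cong₂ (λ y z → (y - # 2) * z + (Sₓ + Z)) (sym (#-suc x)) (sym (#-* 2 (2^ x)))) ⨾
  ≡⇒≤ (sym (∑-split (2^ suc x) (2^≥1 x) (2^-mono (N.n≤1+n x)) (λ n → # (lo n))))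
 where
 Sₓ Z : 𝔽
 Sₓ = ∑ (rg 1 (2^ x)) (λ n → # (lo n))
 Z = ∑ (rg (2^ x) (2^ suc x)) (λ n → # (lo n))
 block : # (2^ x) * # x ≤ Z
 block = ≡⇒≤ (sym (∑-const (rg (2^ x) (2^ suc x)) (# x) ∙ cong (λ n → # n * # x) (length-rg _ _ ∙ cong (_∸ 2^ x) (double (2^ x)) ∙ N.m+n∸n≡m (2^ x) (2^ x)))) ⨾
  (∑-mono (rg (2^ x) (2^ suc x)) λ n m → #-mono (N.≤-pred (lg-≥ {n} (π₁ (∈-range⁻ m)))))

-- The size of log N!, that is ∑ lo n, is at least (x - 2) 2^x. Summed over n, the valuation at p is
-- at most N (1/p + 1/p² + ...) ≤ N/(p - 1).
mertens-lower : ∀ x → # x - # 2 ≤ ∑ (primes 0 (2^ x)) (λ p → # (lg p) * inv (p ∸ 1))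
mertens-lower x = scale-cancel (#-pos N (2^≥1 x)) (*-comm (# N) (# x - # 2) ≡⨾ ∑-lo-lower x ⨾ (∑-mono (rg 1 N) λ n m → lo-≤-valuations x n (π₁ (∈-range⁻ m)) (π₂ (∈-range⁻ m))) ⨾
  ∑-swap (rg 1 N) ps _ ≡⨾ ∑-mono ps each ⨾≡ ∑-scale ps (# N) _)
 where
 N = 2^ x
 ps = primes 0 N
 each : ∀ p → p ∈ ps → ∑ (rg 1 N) (λ n → # (lg p) * v x p n) ≤ # N * (# (lg p) * inv (p ∸ 1))
 each p i = ∑-scale (rg 1 N) (# (lg p)) _ ≡⨾ scale (#≥0 (lg p)) (∑-swap (rg 1 N) (rg 1 (suc x)) _ ≡⨾ (∑-mono (rg 1 (suc x)) λ k _ →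
    ∑-subrange {1} {N} {1} {suc N} N.≤-refl (N.n≤1+n N) (λ _ → 𝟙≥0 _) ⨾ count-multiples (pk≥1 k) N ≡⨾ quot-upper (pk≥1 k) N) ⨾
     ∑-scale (rg 1 (suc x)) (# N) _ ≡⨾ scale (#≥0 N) (geometric hp x)) ⨾
    ≡⇒≤ (*-swap (# (lg p)) (# N) (inv (p ∸ 1)))
  where
  hp = π₁ (∈-primes⁻ i)
  pk≥1 : ∀ k → 1 N.≤ p N.^ k
  pk≥1 k = N.m^n>0 p ⦃ prime⇒nonZero hp ⦄ k

∑-primes : ∀ a b f → ∑ (primes a b) f ≡ ∑ (rg a b) (λ n → 𝟙 ⌊ prime? n ⌋ * f n)
∑-primes a b f = ∑-filter prime? (rg a b) f ∙ (∑-ext (rg a b) λ n → if-𝟙 ⌊ prime? n ⌋ (f n))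

∑-primes-sub : ∀ {a b c d} → c N.≤ a → b N.≤ d → ∀ {f} → (∀ n → # 0 ≤ f n) → ∑ (primes a b) f ≤ ∑ (primes c d) f
∑-primes-sub {a} {b} {c} {d} p q {f} h = ∑-primes a b f ≡⨾ ∑-subrange p q (λ n → *≥0 (𝟙≥0 _) (h n)) ⨾ ≡⇒≤ (sym (∑-primes c d f))

∑-primes-split : ∀ {a b} c → a N.≤ b → b N.≤ c → ∀ f → ∑ (primes a c) f ≡ ∑ (primes a b) f + ∑ (primes b c) f
∑-primes-split {a} {b} c p q f = ∑-primes a c f ∙ ∑-split c p q _ ∙ cong₂ _+_ (sym (∑-primes a b f)) (sym (∑-primes b c f))

∑-support : ∀ {a b c d} {f g : ℕ → 𝔽} → (∀ n → n ∈ rg a b → f n ≤ 𝟙 ((c N.≤ᵇ n) ∧ (n N.<ᵇ d)) * g n) → (∀ n → # 0 ≤ g n) → ∑ (rg a b) f ≤ ∑ (rg c d) g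
∑-support {a} {b} {c} {d} {f} {g} h g≥0 = ∑-mono (rg a b) h ⨾ ∑-subrange {a} {b} {0} {b N.+ (c N.+ d)} z≤n (N.m≤m+n b _) (λ n → *≥0 (𝟙≥0 _) (g≥0 n)) ⨾ whole
 where
 r : ℕ → 𝔽
 r n = 𝟙 ((c N.≤ᵇ n) ∧ (n N.<ᵇ d)) * g n
 M = b N.+ (c N.+ d)
 off′ : ∀ n → ¬ (c N.≤ n × n N.< d) → r n ≡ # 0
 off′ n k = cong (_* g n) (𝟙-false λ t → k (N.≤ᵇ⇒≤ c n (π₁ (∧⁻ {c N.≤ᵇ n} t)) , N.<ᵇ⇒< n d (π₂ (∧⁻ {c N.≤ᵇ n} t)))) ∙ 0* (g n)
 r≤g : ∀ n → r n ≤ g n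
 r≤g n = scaleʳ (g≥0 n) (𝟙≤1 _) ⨾ ≡⇒≤ (1* (g n))
 split : c N.≤ d → ∑ (rg 0 M) r ≤ ∑ (rg c d) g
 split q = ≡⇒≤ (∑-split {0} {c} M z≤n (N.m≤m+n c d ⨟ N.m≤n+m _ b) r ∙ cong (∑ (rg 0 c) r +_) (∑-split {c} {d} M q (N.m≤n+m d c ⨟ N.m≤n+m _ b) r)) ⨾
  ≡⇒≤ (∑-zero (rg 0 c) λ n m → off′ n λ k → N.<⇒≱ (π₂ (∈-range⁻ m)) (π₁ k)) ⊕ (∑-mono (rg c d) (λ n _ → r≤g n) ⊕ ≡⇒≤ (∑-zero (rg d M) λ n m → off′ n λ k → N.<⇒≱ (π₂ k) (π₁ (∈-range⁻ m)))) ⨾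
   ≡⇒≤ (solve 1 (λ a → κ 0 :+ (a :+ κ 0) := a) refl _)
 whole : ∑ (rg 0 M) r ≤ ∑ (rg c d) g
 whole = [ split , (λ q → (∑-zero (rg 0 M) λ n _ → off′ n λ k → N.<⇒≱ (N.<-≤-trans (π₂ k) q) (π₁ k)) ≡⨾ (∑≥0 (rg c d) λ n _ → g≥0 n)) ]′ (N.≤-total c d)

module Mertens (V : ℕ) (V≥2 : 2 N.≤ V) where

 private
  i : 𝔽
  i = inv V
  V≥1 : 1 N.≤ V
  V≥1 = s≤s z≤n ⨟ V≥2
  i≥0 : # 0 ≤ i
  i≥0 = inv-nonneg V
  i≤1 : i ≤ # 1
  i≤1 = inv≤1 V V≥1

  V≤ : V N.≤ 2^ V ∸ 1
  V≤ = N.≤-pred (n<2^n V ⨟ reflexive (sym (N.m+[n∸m]≡n (2^≥1 V))))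

  w : ℕ → 𝔽
  w p = # (lg p) * inv p

  w≥0 : ∀ p → # 0 ≤ w p
  w≥0 p = *≥0 (#≥0 (lg p)) (inv-nonneg p)

 U : ℕ → ℕ → 𝔽
 U x y = ∑ (primes (2^ x) (2^ y)) w

 C₃ : 𝔽
 C₃ = # 2 + ∑ (primes 0 (2^ V)) (λ p → # (lg p) * inv (p ∸ 1)) + # 4 * # V

 U-upper : ∀ x → U V x ≤ (# 1 + i) * ((# 1 + i) * # x + # V)
 U-upper x = ∑-mono (primes (2^ V) (2^ x)) each ⨾ ∑-scale (primes (2^ V) (2^ x)) (# 1 + i) _ ≡⨾ scale (+≥0 0≤1 i≥0)
   (∑-primes-sub {2^ V} {2^ x} {0} {2^ x} z≤n N.≤-refl (λ n → *≥0 (#≥0 (lo n)) (inv-nonneg n)) ⨾ mertens-upper V x ⨾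
    ≡⇒≤ (#-+ x V) ⊕ scale (#≥0 x) (inv-mono V≥1 (N.<⇒≤ (n<2^n V))) ⨾≡ solve 3 (λ x v i → x :+ v :+ x :* i := (κ 1 :+ i) :* x :+ v) refl (# x) (# V) i)
  where
  each : ∀ p → p ∈ primes (2^ V) (2^ x) → w p ≤ (# 1 + i) * (# (lo p) * inv p)
  each p m = scaleʳ (inv-nonneg p) (lin (scale i≥0 (#-mono (N.≤-pred (lg-≥ {p} {V} (π₁ (π₂ (∈-primes⁻ m))))))) (cong (λ z → (# 1 + i) * # (lo p) + z) (*-comm i (# V) ∙ #-inv V V≥1) ∙
     solve 2 (λ i l → (κ 1 :+ i) :* l :+ κ 1 := κ 1 :+ l :+ i :* l) refl i (# (lo p)) ∙ cong (_+ i * # (lo p)) (sym (#-suc (lo p))))) ⨾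
    ≡⇒≤ (*-assoc (# 1 + i) (# (lo p)) (inv p))

 U-lower : ∀ x → V N.≤ x → # x - # 2 - ∑ (primes 0 (2^ V)) (λ p → # (lg p) * inv (p ∸ 1)) ≤ (# 1 + i) * U V x
 U-lower x V≤x = lin (mertens-lower x ⊕ ≡⇒≤ (∑-primes-split {0} {2^ V} (2^ x) z≤n (2^-mono V≤x) _) ⊕ ∑-mono (primes (2^ V) (2^ x)) each ⊕ ≡⇒≤ (∑-scale (primes (2^ V) (2^ x)) (# 1 + i) w))
   (solve 6 (λ u t a b c x → u :+ (x :- κ 2 :+ t :+ b :+ c) := x :- κ 2 :- a :+ (t :+ (a :+ b) :+ c :+ u)) refl ((# 1 + i) * U V x) (∑ (primes 0 (2^ x)) (λ p → # (lg p) * inv (p ∸ 1))) (∑ (primes 0 (2^ V)) (λ p → # (lg p) * inv (p ∸ 1)))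
    (∑ (primes (2^ V) (2^ x)) (λ p → # (lg p) * inv (p ∸ 1))) (∑ (primes (2^ V) (2^ x)) (λ p → (# 1 + i) * w p)) (# x))
  where
  each : ∀ p → p ∈ primes (2^ V) (2^ x) → # (lg p) * inv (p ∸ 1) ≤ (# 1 + i) * w p
  each p m = scale (#≥0 (lg p)) (lin (≡⇒≤ (inv-diff 1 p (prime≥2 (π₁ (∈-primes⁻ m)))) ⊕ scale (inv-nonneg p) (inv-mono V≥1 (V≤ ⨟ N.∸-monoˡ-≤ 1 (π₁ (π₂ (∈-primes⁻ m))))))
     (solve 3 (λ a j i → (κ 1 :+ i) :* a :+ (j :+ a :* j) := j :+ (a :+ κ 1 :* (a :* j) :+ a :* i)) refl (inv p) (inv (p ∸ 1)) i)) ⨾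
    ≡⇒≤ (solve 3 (λ l i a → l :* ((κ 1 :+ i) :* a) := (κ 1 :+ i) :* (l :* a)) refl (# (lg p)) i (inv p))

 -- The difference of `U-lower` at y and `U-upper` at x. Passing between `lg` and `lo`, or between
 -- 1/p and 1/(p - 1), costs 1 + 1/V for p ≥ 2^V; then (1 + i)³ ≤ 1 + 7 i, and (1 + i)² ≤ 4 explains
 -- the 4 V in `C₃`.
 mertens : ∀ {x y} → V N.≤ x → x N.≤ y → # y - (# 1 + # 7 * i) * # x - C₃ ≤ (# 1 + i) * U x y
 mertens {x} {y} V≤x x≤y = lin (U-lower y (V≤x ⨟ x≤y) ⊕ ≡⇒≤ (cong ((# 1 + i) *_) (∑-primes-split {2^ V} {2^ x} (2^ y) (2^-mono V≤x) (2^-mono x≤y) w)) ⊕ scale (+≥0 0≤1 i≥0) (U-upper x)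
    ⊕ scaleʳ (#≥0 x) cube ⊕ scaleʳ (#≥0 V) square)
   (solve 8 (λ i x y v c u u₁ u₂ → (κ 1 :+ i) :* u₂ :+ (y :- κ 2 :- c :+ (κ 1 :+ i) :* u :+ (κ 1 :+ i) :* u₁ :+ (κ 1 :+ i) :* (κ 1 :+ i) :* (κ 1 :+ i) :* x :+ (κ 1 :+ i) :* (κ 1 :+ i) :* v) :=
    y :- (κ 1 :+ κ 7 :* i) :* x :- (κ 2 :+ c :+ κ 4 :* v) :+ ((κ 1 :+ i) :* u :+ (κ 1 :+ i) :* (u₁ :+ u₂) :+ (κ 1 :+ i) :* ((κ 1 :+ i) :* ((κ 1 :+ i) :* x :+ v)) :+ (κ 1 :+ κ 7 :* i) :* x :+ κ 4 :* v))
    refl i (# x) (# y) (# V) (∑ (primes 0 (2^ V)) (λ p → # (lg p) * inv (p ∸ 1))) (U V y) (U V x) (U x y))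
  where
  square : (# 1 + i) * (# 1 + i) ≤ # 4
  square = *-mono (+≥0 0≤1 i≥0) (#≥0 2) le le ⨾ ≡⇒≤ (solve 0 (κ 2 :* κ 2 := κ 4) refl)
   where
   le : # 1 + i ≤ # 2
   le = lin i≤1 (solve 1 (λ i → κ 2 :+ i := κ 1 :+ i :+ κ 1) refl i)
  cube : (# 1 + i) * (# 1 + i) * (# 1 + i) ≤ # 1 + # 7 * i
  cube = lin (scale i≥0 i≤1 ⊕ scale (scale3 i≥0) i≤1 ⊕ scale (*≥0 i≥0 i≥0) i≤1) (solve 1 (λ i → κ 1 :+ κ 7 :* i :+ (i :* i :+ κ 3 :* i :* i :+ i :* i :* i) := (κ 1 :+ i) :* (κ 1 :+ i) :* (κ 1 :+ i) :+ (i :* κ 1 :+ κ 3 :* i :* κ 1 :+ i :* i :* κ 1)) refl i)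
   where
   scale3 : # 0 ≤ i → # 0 ≤ # 3 * i
   scale3 = *≥0 (#≥0 3)

 reciprocals : ∀ {x y} z → y N.≤ z → V N.≤ x → x N.≤ y → # y - (# 1 + # 7 * i) * # x - C₃ ≤ (# 1 + i) * (# z * ∑ (primes (2^ x) (2^ y)) inv)
 reciprocals {x} {y} z y≤z V≤x x≤y = mertens V≤x x≤y ⨾ scale (+≥0 0≤1 i≥0) ((∑-mono (primes (2^ x) (2^ y)) λ p m →
   scaleʳ (inv-nonneg p) (#-mono (lg-≤ (prime≥1 (π₁ (∈-primes⁻ m))) (π₂ (π₂ (∈-primes⁻ m))) ⨟ y≤z))) ⨾≡ ∑-scale (primes (2^ x) (2^ y)) (# z) inv)

 module Mass (G L : ℕ) (G≥1 : 1 N.≤ G) (L≥ : V N.≤ L) (hC : C₃ + # 2 ≤ i * # G * # L) where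

  N₁ N₂ : ℕ
  N₁ = 2^ (suc (2 N.* G) N.* L)
  N₂ = 2^ (suc (suc (2 N.* G)) N.* L)

  -- Equals 1/(N (N + 1)), the telescoping version of 1/N².
  weight : ℕ → 𝔽
  weight N = inv N - inv (suc N)

  weight≥0 : ∀ N → 1 N.≤ N → # 0 ≤ weight N
  weight≥0 N h = sub-nonneg (inv-mono h (N.n≤1+n N))

  X : ℕ → ℕ → 𝔽
  X p N = ∑ (primes (suc (N N./ suc (p ∸ 1))) (suc (2 N.* N N./ suc (p ∸ 1)))) (λ _ → # 1)

  -- 30 = 1 + 28 + 1 in `partners`: the constant `C₃`, the term 7 i x with x ≤ 4 G L, and a reserve.
  -- In `block-reciprocals` it is 1 + 7 + 22.
  η : 𝔽
  η = # 30 * i * # G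

  η-bound : # 30 * i ≤ η
  η-bound = *1˘ (# 30 * i) ≡⨾ scale (*≥0 (#≥0 30) i≥0) (#-mono G≥1)

  -- The N with N < m ≤ 2 N run from ⌈m/2⌉ to m - 1 and all lie in the range. The weights telescope
  -- to 1/⌈m/2⌉ - 1/m, which is 1/m up to the rounding of m/2. This is how counts of products turn
  -- into reciprocals.
  N-sum : ∀ m → 2 N.* N₁ N.≤ m → m N.≤ N₂ → inv m * (# 1 - # 2 * i) ≤ ∑ (rg N₁ N₂) (λ N → weight N * 𝟙 ((N N.<ᵇ m) ∧ (m N.≤ᵇ 2 N.* N)))
  N-sum m lo≤ ≤hi = lin (scale (inv-nonneg m) (scale (#≥0 2) inv-m≤i) ⊕ inv-h) (solve 3 (λ a b i → b :- a :+ (a :* (κ 2 :* a) :+ κ 2 :* a) := a :* (κ 1 :- κ 2 :* i) :+ (a :* (κ 2 :* i) :+ (b :+ κ 2 :* (a :* a)))) refl (inv m) (inv h) i) ⨾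
   sym (∑-telescope inv h≤m) ≡⨾ (∑-mono (rg h m) λ N k → ≡⇒≤ (*1˘ (weight N) ∙ cong (weight N *_) (sym (𝟙-true (∧⁺ (N.<⇒<ᵇ (π₂ (∈-range⁻ k))) (N.≤⇒≤ᵇ (m≤2h ⨟ N.*-monoʳ-≤ 2 (π₁ (∈-range⁻ k))))))))) ⨾
    subrange′
   where
   h = N.⌈ m /2⌉
   m≥1 : 1 N.≤ m
   m≥1 = 2^≥1 (suc (2 N.* G) N.* L) ⨟ N.m≤m+n N₁ _ ⨟ lo≤
   N₁≤h : N₁ N.≤ h
   N₁≤h = reflexive (N.n≡⌈n+n/2⌉ N₁ ∙ cong N.⌈_/2⌉ (sym (double N₁))) ⨟ N.⌈n/2⌉-mono lo≤
   h≥1 : 1 N.≤ h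
   h≥1 = 2^≥1 (suc (2 N.* G) N.* L) ⨟ N₁≤h
   h≤m : h N.≤ m
   h≤m = N.⌈n/2⌉≤n m
   m≤2h : m N.≤ 2 N.* h
   m≤2h = reflexive (sym (N.⌊n/2⌋+⌈n/2⌉≡n m)) ⨟ N.+-monoˡ-≤ h (N.⌊n/2⌋≤⌈n/2⌉ m) ⨟ reflexive (sym (double h))
   2h≤ : 2 N.* h N.≤ suc m
   2h≤ = reflexive (double h) ⨟ N.+-monoʳ-≤ h (N.⌈n/2⌉-mono (N.n≤1+n m) ⨟ reflexive refl) ⨟ lem
    where
    lem : h N.+ N.⌈ suc m /2⌉ N.≤ suc m
    lem = reflexive (N.⌊n/2⌋+⌈n/2⌉≡n (suc m))
   inv-h : # 2 * inv m ≤ inv h + # 2 * (inv m * inv m)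
   inv-h = lin (≤-trans (≡⇒≤ (sym inv-half′)) half ⊕ diff) (solve 3 (λ a b s → b :+ κ 2 :* (a :* a) :+ (κ 2 :* s :+ κ 2 :* a) := κ 2 :* a :+ (b :+ (κ 2 :* s :+ κ 2 :* (a :* a)))) refl (inv m) (inv h) (inv (suc m)))
    where
    inv-half′ : inv (suc m) + inv (suc m) ≡ # 2 * inv (suc m)
    inv-half′ = solve 1 (λ a → a :+ a := κ 2 :* a) refl (inv (suc m))
    half : inv (suc m) + inv (suc m) ≤ inv h
    half = inv-mono {2 N.* h} {suc m} (h≥1 ⨟ N.m≤m+n h _) 2h≤ ⊕ inv-mono {2 N.* h} {suc m} (h≥1 ⨟ N.m≤m+n h _) 2h≤ ⨾ ≡⇒≤ (inv-half h h≥1)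
    diff : # 2 * inv m ≤ # 2 * inv (suc m) + # 2 * (inv m * inv m)
    diff = scale (#≥0 2) (lin (≡⇒≤ (inv-diff 1 (suc m) (s≤s m≥1)) ⊕ scaleʳ (inv-nonneg m) (inv-mono m≥1 (N.n≤1+n m))) (solve 2 (λ a s → s :+ a :* a :+ (a :+ s :* a) := a :+ (s :+ κ 1 :* (s :* a) :+ a :* a)) refl (inv m) (inv (suc m)))) ⨾
      ≡⇒≤ (solve 2 (λ a b → κ 2 :* (a :+ b) := κ 2 :* a :+ κ 2 :* b) refl (inv (suc m)) (inv m * inv m))
   inv-m≤i : inv m ≤ i
   inv-m≤i = inv-mono V≥1 (L≥ ⨟ N.m≤m+n L _ ⨟ N.<⇒≤ (n<2^n _) ⨟ N.m≤m+n N₁ _ ⨟ lo≤)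
   r : ℕ → 𝔽
   r N = weight N * 𝟙 ((N N.<ᵇ m) ∧ (m N.≤ᵇ 2 N.* N))
   r≥0 : ∀ N → 1 N.≤ N → # 0 ≤ r N
   r≥0 N h = *≥0 (weight≥0 N h) (𝟙≥0 ((N N.<ᵇ m) ∧ (m N.≤ᵇ 2 N.* N)))
   subrange′ : ∑ (rg h m) r ≤ ∑ (rg N₁ N₂) r
   subrange′ = lin (∑≥0 (rg N₁ h) (λ N k → r≥0 N (2^≥1 (suc (2 N.* G) N.* L) ⨟ π₁ (∈-range⁻ k))) ⊕ ∑≥0 (rg m N₂) (λ N k → r≥0 N (m≥1 ⨟ π₁ (∈-range⁻ k))))
      (solve 3 (λ a b c → a :+ (b :+ c) :+ (κ 0 :+ κ 0) := b :+ (a :+ c)) refl (∑ (rg N₁ h) r) (∑ (rg h m) r) (∑ (rg m N₂) r)) ⨾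
     ≡⇒≤ (sym (∑-split {N₁} {h} N₂ N₁≤h (h≤m ⨟ ≤hi) r ∙ cong (∑ (rg N₁ h) r +_) (∑-split {h} {m} N₂ h≤m ≤hi r)))

  module _ (a : ℕ) (a≥1 : 1 N.≤ a) (a<G : a N.< G) (η≤1 : η ≤ # 1) where

   private
    #L≥0 : # 0 ≤ # L
    #L≥0 = #≥0 L
    L>0 : # 0 < # L
    L>0 = #-pos L (V≥1 ⨟ L≥)
    1-η≥0 : # 0 ≤ # 1 - η
    1-η≥0 = sub-nonneg η≤1
    1-2i≥0 : # 0 ≤ # 1 - # 2 * i
    1-2i≥0 = lin (η≤1 ⊕ η-bound ⊕ *≥0 (#≥0 28) i≥0) (solve 2 (λ i e → κ 1 :- κ 2 :* i :+ (e :+ κ 30 :* i :+ κ 0) := κ 0 :+ (κ 1 :+ e :+ κ 28 :* i)) refl i η)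
    1+i≥0 : # 0 ≤ # 1 + i
    1+i≥0 = +≥0 0≤1 i≥0
    Z : ℕ
    Z = suc (suc (2 N.* G))

   -- Mertens gives ∑ (lg p)/p of about L over the block; dividing by the largest length (a + 1) L
   -- replaces log((a + 1)/a) by the lower bound 1/(a + 1).
   block-reciprocals : # 1 - η ≤ (# 1 + i) * (# (suc a) * ∑ (primes (2^ (a N.* L)) (2^ (suc a N.* L))) inv)
   block-reciprocals = scale-cancel L>0 (lin (reciprocals (suc a N.* L) N.≤-refl (L≥ ⨟ reflexive (sym (N.*-identityˡ L)) ⨟ N.*-monoˡ-≤ L a≥1) (N.m≤n+m (a N.* L) L)
       ⊕ hC ⊕ scale (*≥0 (#≥0 7) (*≥0 i≥0 #L≥0)) (#-mono (N.<⇒≤ a<G)) ⊕ #≥0 2 ⊕ scale (#≥0 22) (*≥0 i≥0 (*≥0 (#≥0 G) #L≥0)))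
      (cong₂ (λ y x → (# 1 + i) * (# (suc a N.* L) * S) + (y - (# 1 + # 7 * i) * x - C₃ + (C₃ + # 2) + # 7 * (i * # L) * # a + # 0 + # 22 * # 0)) (#-+ L (a N.* L) ∙ cong (# L +_) (#-* a L)) (#-* a L) ∙
       solve 6 (λ t i L a G c → t :+ (L :+ a :* L :- (κ 1 :+ κ 7 :* i) :* (a :* L) :- c :+ (c :+ κ 2) :+ κ 7 :* (i :* L) :* a :+ κ 0 :+ κ 22 :* κ 0) :=
         L :* (κ 1 :- κ 30 :* i :* G) :+ (t :+ i :* G :* L :+ κ 7 :* (i :* L) :* G :+ κ 2 :+ κ 22 :* (i :* (G :* L)))) refl ((# 1 + i) * (# (suc a N.* L) * S)) i (# L) (# a) (# G) C₃) ⨾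
     ≡⇒≤ (cong (λ z → (# 1 + i) * (z * S)) (#-* (suc a) L) ∙ solve 4 (λ e a l s → e :* (a :* l :* s) := l :* (e :* (a :* s))) refl (# 1 + i) (# (suc a)) (# L) S))
    where
    S = ∑ (primes (2^ (a N.* L)) (2^ (suc a N.* L))) inv

   -- The partners of p fill an interval of L - 2 binary lengths, all at most (Z - a) L, so their
   -- reciprocals sum to about 1/(Z - a). `N-sum` converts each product p p₂ into 1/(p p₂).
   E₂mass : ∀ p → p ∈ primes (2^ (a N.* L)) (2^ (suc a N.* L)) →
        inv p * ((# 1 - # 2 * i) * (# 1 - η)) ≤ (# 1 + i) * (# (Z ∸ a) * ∑ (rg N₁ N₂) (λ N → weight N * X p N))
   E₂mass zero m = ⊥-elim (N.<⇒≱ (prime≥1 (π₁ (∈-primes⁻ m))) z≤n)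
   E₂mass p@(suc _) m = *-assoc˘ (inv p) (# 1 - # 2 * i) (# 1 - η) ≡⨾ scale (*≥0 (inv-nonneg p) 1-2i≥0) partners ⨾
     solve 5 (λ j k e z s → j :* k :* (e :* (z :* s)) := e :* (z :* (j :* k :* s))) refl (inv p) (# 1 - # 2 * i) (# 1 + i) (# (Z ∸ a)) S₂ ≡⨾ scale 1+i≥0 (scale (#≥0 (Z ∸ a)) swap)
    where
    hp : Prime p
    hp = π₁ (∈-primes⁻ m)
    n = lg p
    aL<n : a N.* L N.< n
    aL<n = lg-≥ {p} (π₁ (π₂ (∈-primes⁻ m)))
    n≤ : n N.≤ suc a N.* L
    n≤ = lg-≤ {p} (s≤s z≤n) (π₂ (π₂ (∈-primes⁻ m)))
    n≤GL : n N.≤ G N.* L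
    n≤GL = n≤ ⨟ N.*-monoˡ-≤ L a<G
    A = suc (2 N.* G) N.* L
    -- p ≥ 2^(n-1) and p₂ ≥ 2^x give p p₂ ≥ 2^(A+1) = 2 N₁, which is why 2 is added; p < 2^n and p₂
    -- < 2^y give p p₂ ≤ N₂.
    x y : ℕ
    x = A N.+ 2 ∸ n
    y = L N.+ A ∸ n
    n≤A : n N.≤ A
    n≤A = n≤GL ⨟ N.*-monoˡ-≤ L (N.m≤m+n G _ ⨟ N.n≤1+n _)
    n+L≤A : n N.+ L N.≤ A
    n+L≤A = N.+-monoˡ-≤ L n≤GL ⨟ reflexive (N.+-comm (G N.* L) L) ⨟ N.*-monoˡ-≤ L (s≤s (N.m≤m+n G _))
    L≤x : L N.≤ x
    L≤x = N.m+n≤o⇒m≤o∸n L (reflexive (N.+-comm L n) ⨟ n+L≤A ⨟ N.m≤m+n A 2)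
    x≤y : x N.≤ y
    x≤y = N.∸-monoˡ-≤ n (reflexive (N.+-comm A 2) ⨟ N.+-monoˡ-≤ A (V≥2 ⨟ L≥))
    #x : # x ≡ # A + # 2 - # n
    #x = solve 2 (λ a b → a := a :+ b :- b) refl (# x) (# n) ∙ cong (_- # n) (sym (#-+ x n) ∙ cong #_ (N.m∸n+n≡m (n≤A ⨟ N.m≤m+n A 2)) ∙ #-+ A 2)
    #y : # y ≡ # L + # A - # n
    #y = solve 2 (λ a b → a := a :+ b :- b) refl (# y) (# n) ∙ cong (_- # n) (sym (#-+ y n) ∙ cong #_ (N.m∸n+n≡m (n≤A ⨟ N.m≤n+m A L)) ∙ #-+ L A)
    y≤z : y N.≤ (Z ∸ a) N.* L
    y≤z = N.∸-monoʳ-≤ (L N.+ A) (N.<⇒≤ aL<n) ⨟ reflexive (sym (N.*-distribʳ-∸ L Z a))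
    x≤4GL : # x ≤ # 4 * (# G * # L)
    x≤4GL = #-mono (x≤y ⨟ N.m∸n≤m _ n ⨟ N.*-monoˡ-≤ L (Z≤ G G≥1) ⨟ reflexive (N.*-assoc 4 G L)) ⨾ ≡⇒≤ (#-* 4 (G N.* L) ∙ cong (# 4 *_) (#-* G L))
     where
     Z≤ : ∀ G → 1 N.≤ G → suc (suc (2 N.* G)) N.≤ 4 N.* G
     Z≤ G h = N.+-monoˡ-≤ (2 N.* G) (N.*-monoʳ-≤ 2 h) ⨟ reflexive (sym (N.*-distribʳ-+ G 2 2))
    ps₂ = primes (2^ x) (2^ y)
    S₂ = ∑ ps₂ inv
    partners : # 1 - η ≤ (# 1 + i) * (# (Z ∸ a) * S₂)
    partners = scale-cancel L>0 (lin (reciprocals ((Z ∸ a) N.* L) y≤z (L≥ ⨟ L≤x) x≤y ⊕ hC ⊕ scale (*≥0 (#≥0 7) i≥0) x≤4GL ⊕ *≥0 i≥0 (*≥0 (#≥0 G) #L≥0))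
       (cong (λ y → t + (y - (# 1 + # 7 * i) * # x - C₃ + (C₃ + # 2) + # 7 * i * # x + # 0)) #y ∙
        cong (λ x → t + (# L + # A - # n - (# 1 + # 7 * i) * x - C₃ + (C₃ + # 2) + # 7 * i * x + # 0)) #x ∙
        solve 7 (λ t i L A n G c → t :+ (L :+ A :- n :- (κ 1 :+ κ 7 :* i) :* (A :+ κ 2 :- n) :- c :+ (c :+ κ 2) :+ κ 7 :* i :* (A :+ κ 2 :- n) :+ κ 0) :=
          L :* (κ 1 :- κ 30 :* i :* G) :+ (t :+ i :* G :* L :+ κ 7 :* i :* (κ 4 :* (G :* L)) :+ i :* (G :* L))) refl t i (# L) (# A) (# n) (# G) C₃) ⨾
     ≡⇒≤ (cong (λ z → (# 1 + i) * (z * S₂)) (#-* (Z ∸ a) L) ∙ solve 4 (λ e a l s → e :* (a :* l :* s) := l :* (e :* (a :* s))) refl (# 1 + i) (# (Z ∸ a)) (# L) S₂))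
     where
     t = (# 1 + i) * (# ((Z ∸ a) N.* L) * S₂)
    cond : ℕ → ℕ → 𝔽
    cond N p₂ = 𝟙 ((N N.<ᵇ p N.* p₂) ∧ (p N.* p₂ N.≤ᵇ 2 N.* N))
    counted : ∀ N → ∑ ps₂ (cond N) ≤ X p N
    counted N = ∑-primes (2^ x) (2^ y) (cond N) ≡⨾ (∑-support {c = suc (N N./ p)} {d = suc (2 N.* N N./ p)} {g = λ n → 𝟙 ⌊ prime? n ⌋ * # 1} (λ n _ →
       solve 2 (λ a b → a :* b := b :* (a :* κ 1)) refl (𝟙 ⌊ prime? n ⌋) (cond N n) ≡⨾ scaleʳ (*≥0 (𝟙≥0 _) 0≤1) (𝟙-mono λ t →
        ∧⁺ (N.≤⇒≤ᵇ (DM.m<n*o⇒m/o<n {N} {n} {p} (N.<ᵇ⇒< N (p N.* n) (π₁ (∧⁻ {N N.<ᵇ p N.* n} t)) ⨟ reflexive (N.*-comm p n))))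
          (N.<⇒<ᵇ (s≤s (mL≤n⇒m≤n/L {n} p (reflexive (N.*-comm n p) ⨟ N.≤ᵇ⇒≤ (p N.* n) (2 N.* N) (π₂ (∧⁻ {N N.<ᵇ p N.* n} t)))))))) (λ n → *≥0 (𝟙≥0 _) 0≤1)) ⨾
      ≡⇒≤ (sym (∑-primes (suc (N N./ p)) (suc (2 N.* N N./ p)) (λ _ → # 1)))
    swap : inv p * (# 1 - # 2 * i) * S₂ ≤ ∑ (rg N₁ N₂) (λ N → weight N * X p N)
    swap = sym (∑-scale ps₂ (inv p * (# 1 - # 2 * i)) inv) ≡⨾ (∑-mono ps₂ λ p₂ k → (*-swapʳ (inv p) (# 1 - # 2 * i) (inv p₂) ∙
        cong (_* (# 1 - # 2 * i)) (sym (inv-* p p₂ (s≤s z≤n) (prime≥1 (π₁ (∈-primes⁻ k)))))) ≡⨾ N-sum (p N.* p₂) (lower p₂ (π₁ (π₂ (∈-primes⁻ k)))) (upper p₂ (π₂ (π₂ (∈-primes⁻ k))))) ⨾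
      ∑-swap ps₂ (rg N₁ N₂) (λ p₂ N → weight N * cond N p₂) ≡⨾ (∑-mono (rg N₁ N₂) λ N k → ∑-scale ps₂ (weight N) (cond N) ≡⨾ scale (weight≥0 N (2^≥1 A ⨟ π₁ (∈-range⁻ k))) (counted N))
     where
     lower : ∀ p₂ → 2^ x N.≤ p₂ → 2 N.* N₁ N.≤ p N.* p₂
     lower p₂ h = 2^-mono {suc A} {lo p N.+ x} le ⨟ reflexive (N.^-distribˡ-+-* 2 (lo p) x) ⨟ N.*-mono-≤ (2^⌊log₂⌋≤ p (s≤s z≤n)) h
      where
      le : suc A N.≤ lo p N.+ x
      le = N.≤-pred (reflexive (N.+-comm 2 A ∙ sym (N.m∸n+n≡m (n≤A ⨟ N.m≤m+n A 2)) ∙ N.+-comm x n))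
     upper : ∀ p₂ → p₂ N.< 2^ y → p N.* p₂ N.≤ N₂
     upper p₂ h = N.*-mono-≤ (N.<⇒≤ (n<2^lg p)) (N.<⇒≤ h) ⨟ reflexive (sym (N.^-distribˡ-+-* 2 n y) ∙ cong 2^_ (N.+-comm n y ∙ N.m∸n+n≡m (n≤A ⨟ N.m≤n+m A L)))

   block-mass : (# 1 - η) ^ 2 * (# 1 - # 2 * i) ≤ (# 1 + i) ^ 2 * (# (suc a) * # (Z ∸ a) * ∑ (primes (2^ (a N.* L)) (2^ (suc a N.* L))) (λ p → ∑ (rg N₁ N₂) (λ N → weight N * X p N)))
   block-mass = solve 2 (λ e k → e :* (e :* κ 1) :* k := k :* e :* e) refl (# 1 - η) (# 1 - # 2 * i) ≡⨾ scale (*≥0 1-2i≥0 1-η≥0) block-reciprocals ⨾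
    ≡⇒≤ (solve 4 (λ k e a s → k :* (e :* (a :* s)) := e :* (a :* (s :* k))) refl ((# 1 - # 2 * i) * (# 1 - η)) (# 1 + i) (# (suc a)) (∑ ps inv) ∙ cong (λ z → (# 1 + i) * (# (suc a) * z)) (sym (∑-scaleʳ ps _ inv))) ⨾
     scale 1+i≥0 (scale (#≥0 (suc a)) (∑-mono ps E₂mass ⨾≡ ∑-scale ps (# 1 + i) _ ∙ cong ((# 1 + i) *_) (∑-scale ps (# (Z ∸ a)) _))) ⨾
      ≡⇒≤ (solve 4 (λ e a z s → e :* (a :* (e :* (z :* s))) := e :* (e :* κ 1) :* (a :* z :* s)) refl (# 1 + i) (# (suc a)) (# (Z ∸ a)) (∑ ps (λ p → ∑ (rg N₁ N₂) (λ N → weight N * X p N))))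
    where
    ps = primes (2^ (a N.* L)) (2^ (suc a N.* L))

-- Residue classes

infixl 7 _mod_

suc-pred′ : ∀ {q} → 1 N.≤ q → suc (q ∸ 1) ≡ q
suc-pred′ = N.m+[n∸m]≡n

%-∣ : ∀ Q .{{_ : NonZero Q}} m n → m N.% Q ≡ n N.% Q → Q ∣ n ∸ m
%-∣ Q m n e = ∣.divides (n N./ Q ∸ m N./ Q) (cong₂ _∸_ (DM.m≡m%n+[m/n]*n n Q) (DM.m≡m%n+[m/n]*n m Q ∙ cong (N._+ m N./ Q N.* Q) e) ∙
  N.[m+n]∸[m+o]≡n∸o (n N.% Q) (n N./ Q N.* Q) (m N./ Q N.* Q) ∙ sym (N.*-distribʳ-∸ Q (n N./ Q) (m N./ Q)))

abstract
 -- The modulus `suc (q ∸ 1)` is the one in the definitions of `π♭AP` and `πβAP`; `mod-def` is the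
 -- bridge to them.
 _mod_ : ℕ → ℕ → ℕ
 n mod q = n N.% suc (q ∸ 1)

 mod-def : ∀ q n → n mod q ≡ n N.% suc (q ∸ 1)
 mod-def q n = refl

 mod-< : ∀ q n → 1 N.≤ q → n mod q N.< q
 mod-< q n q≥1 = N.<-≤-trans (DM.m%n<n n (suc (q ∸ 1))) (reflexive (suc-pred′ q≥1))

 mod-add : ∀ q m k → 1 N.≤ q → (m N.+ k N.* q) mod q ≡ m mod q
 mod-add q m k q≥1 = cong (λ z → (m N.+ k N.* z) mod q) (sym (suc-pred′ q≥1)) ∙ DM.[m+kn]%n≡m%n m k (suc (q ∸ 1))

 mod-∣ : ∀ q {m n} → 1 N.≤ q → m mod q ≡ n mod q → q ∣ N.∣ m - n ∣
 mod-∣ q {m} {n} q≥1 e = subst (_∣ N.∣ m - n ∣) (suc-pred′ q≥1) (by-order (N.≤-total m n))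
  where
  by-order : m N.≤ n ⊎ n N.≤ m → suc (q ∸ 1) ∣ N.∣ m - n ∣
  by-order (inj₁ le) = subst (suc (q ∸ 1) ∣_) (sym (N.m≤n⇒∣m-n∣≡n∸m le)) (%-∣ (suc (q ∸ 1)) m n e)
  by-order (inj₂ le) = subst (suc (q ∸ 1) ∣_) (sym (N.m≤n⇒∣m-n∣≡n∸m le) ∙ N.∣-∣-comm n m) (%-∣ (suc (q ∸ 1)) n m (sym e))

 ∣-mod : ∀ q {m n} → 1 N.≤ q → q ∣ N.∣ m - n ∣ → m mod q ≡ n mod q
 ∣-mod q {m} {n} q≥1 d = [ (λ le → sym (go m n le (subst (q ∣_) (N.m≤n⇒∣m-n∣≡n∸m le) d))) , (λ le → go n m le (subst (q ∣_) (N.∣-∣-comm m n ∙ N.m≤n⇒∣m-n∣≡n∸m le) d)) ]′ (N.≤-total m n)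
  where
  go : ∀ m n → m N.≤ n → q ∣ n ∸ m → n mod q ≡ m mod q
  go m n le (∣.divides k e) = cong (_mod q) (sym (N.m+[n∸m]≡n le) ∙ cong (m N.+_) e) ∙ mod-add q m k q≥1

 mod-idem : ∀ q n → (n mod q) mod q ≡ n mod q
 mod-idem q n = DM.m%n%n≡m%n n (suc (q ∸ 1))

 mod-+ : ∀ q {a b} c → a mod q ≡ b mod q → (a N.+ c) mod q ≡ (b N.+ c) mod q
 mod-+ q {a} {b} c e = DM.%-distribˡ-+ a c (suc (q ∸ 1)) ∙ cong (λ z → (z N.+ c mod q) mod q) e ∙ sym (DM.%-distribˡ-+ b c (suc (q ∸ 1)))

 mod-* : ∀ q {a b} c → a mod q ≡ b mod q → (c N.* a) mod q ≡ (c N.* b) mod q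
 mod-* q {a} {b} c e = DM.%-distribˡ-* c a (suc (q ∸ 1)) ∙ cong (λ z → (c mod q N.* z) mod q) e ∙ sym (DM.%-distribˡ-* c b (suc (q ∸ 1)))

 mod-zero : ∀ q {n} → 1 N.≤ q → q ∣ n → n mod q ≡ 0
 mod-zero q {n} q≥1 d = ∣.n∣m⇒m%n≡0 n (suc (q ∸ 1)) (subst (_∣ n) (sym (suc-pred′ q≥1)) d)

 mod-zero⁻ : ∀ q {n} → 1 N.≤ q → n mod q ≡ 0 → q ∣ n
 mod-zero⁻ q {n} q≥1 e = subst (_∣ n) (suc-pred′ q≥1) (∣.m%n≡0⇒n∣m n (suc (q ∸ 1)) e)

cong? : ℕ → ℕ → ℕ → Bool
cong? q a n = (n mod q) N.≡ᵇ (a mod q)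

cong?⁻ : ∀ q {a n} → T (cong? q a n) → n mod q ≡ a mod q
cong?⁻ q {a} {n} = N.≡ᵇ⇒≡ (n mod q) (a mod q)

cong?⁺ : ∀ q {a n} → n mod q ≡ a mod q → T (cong? q a n)
cong?⁺ q {a} {n} = N.≡⇒≡ᵇ (n mod q) (a mod q)

mod-product : ∀ p q {m n} → 1 N.≤ p → 1 N.≤ q → m mod (p N.* q) ≡ n mod (p N.* q) → m mod p ≡ n mod p × m mod q ≡ n mod q
mod-product p q p≥1 q≥1 e = ∣-mod p p≥1 (∣.∣-trans (∣.m∣m*n q) d) , ∣-mod q q≥1 (∣.∣-trans (∣.n∣m*n p) d)
 where d = mod-∣ (p N.* q) (N.*-mono-≤ p≥1 q≥1) e

coprime-product : ∀ {p q n} → Cop.Coprime p q → p ∣ n → q ∣ n → p N.* q ∣ n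
coprime-product {p} {q} {n} c (∣.divides k e) d = subst (p N.* q ∣_) (N.*-comm p k ∙ sym e) (∣.*-monoʳ-∣ p (Cop.coprime-divisor (Cop.sym c) (subst (q ∣_) (e ∙ N.*-comm k p) d)))

prime-coprime : ∀ {p q} → Prime p → ¬ (p ∣ q) → Cop.Coprime q p
prime-coprime {p} {q} hp h {i} (d , e) with prime⇒irreducible hp e
... | inj₁ i≡1 = i≡1
... | inj₂ refl = ⊥-elim (h d)

private
 negate : ∀ r x y q → 1 N.+ x N.* q ≡ suc y N.* (2 N.+ r) → x N.* (1 N.+ r) N.* q ≡ 1 N.+ (y N.* (1 N.+ r) N.+ r) N.* (2 N.+ r)
 negate r x y q e = N.+-cancelʳ-≡ (1 N.+ r) _ _ (solveℕ 3 (λ x r q → x ⊛ (conℕ 1 ⊞ r) ⊛ q ⊞ (conℕ 1 ⊞ r) ≗ (conℕ 1 ⊞ x ⊛ q) ⊛ (conℕ 1 ⊞ r)) refl x r q ∙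
  cong (N._* (1 N.+ r)) e ∙
   solveℕ 2 (λ y r → (conℕ 1 ⊞ y) ⊛ (conℕ 2 ⊞ r) ⊛ (conℕ 1 ⊞ r) ≗ conℕ 1 ⊞ (y ⊛ (conℕ 1 ⊞ r) ⊞ r) ⊛ (conℕ 2 ⊞ r) ⊞ (conℕ 1 ⊞ r)) refl y r)

 crt-identity : ∀ a r s k → a N.+ (r N.+ s N.* a) N.* (1 N.+ k N.* (1 N.+ s)) ≡ r N.+ (a N.+ k N.* (r N.+ s N.* a)) N.* (1 N.+ s)
 crt-identity = solveℕ 4 (λ a r s k → a ⊞ (r ⊞ s ⊛ a) ⊛ (conℕ 1 ⊞ k ⊛ (conℕ 1 ⊞ s)) ≗ r ⊞ (a ⊞ k ⊛ (r ⊞ s ⊛ a)) ⊛ (conℕ 1 ⊞ s)) refl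

 -- A Bézout identity with the wrong sign, 1 + x q = y p, is multiplied by p - 1: then x (p - 1) q ≡
 -- -(p - 1) ≡ 1 modulo p.
 invert′ : ∀ {q} r → GCD.Bézout.Identity 1 q (2 N.+ r) → ∃ λ u → ∃ λ k → u N.* q ≡ 1 N.+ k N.* (2 N.+ r)
 invert′ r (GCD.Bézout.Identity.+- x y e) = x , y , sym e
 invert′ r (GCD.Bézout.Identity.-+ x zero e) = ⊥-elim (N.1+n≢0 e)
 invert′ {q} r (GCD.Bézout.Identity.-+ x (suc y) e) = x N.* (1 N.+ r) , y N.* (1 N.+ r) N.+ r , negate r x y q e

invert : ∀ {q p} → 2 N.≤ p → Cop.Coprime q p → ∃ λ u → ∃ λ k → u N.* q ≡ 1 N.+ k N.* p
invert {p = suc zero} (s≤s ()) _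
invert {q} {suc (suc r)} _ c = invert′ r (Cop.coprime-Bézout c)

chinese : ∀ {q p} → 1 N.≤ q → 2 N.≤ p → Cop.Coprime q p → ∀ a r → ∃ λ c → c mod q ≡ a mod q × c mod p ≡ r mod p
chinese {q} {p} q≥1 p≥2 cop a r = c , mod-add q a (t N.* u) q≥1 , cong (_mod p) eq ∙ mod-add p r (a N.+ k N.* t) (N.<⇒≤ p≥2)
 where
 ui = invert p≥2 cop
 u = π₁ ui
 k = π₁ (π₂ ui)
 -- t ≡ r - a modulo p without subtraction, so a + t u q is ≡ a modulo q and ≡ r modulo p.
 t = r N.+ (p ∸ 1) N.* a
 c = a N.+ t N.* u N.* q
 eq : c ≡ r N.+ (a N.+ k N.* t) N.* p
 eq = cong (a N.+_) (N.*-assoc t u q ∙ cong (t N.*_) (π₂ (π₂ ui))) ∙ cong (λ z → a N.+ t N.* (1 N.+ k N.* z)) (sym p-eq) ∙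
   crt-identity a r (p ∸ 1) k ∙
    cong (λ z → r N.+ (a N.+ k N.* t) N.* z) p-eq
  where
  p-eq : 1 N.+ (p ∸ 1) ≡ p
  p-eq = N.m+[n∸m]≡n (N.<⇒≤ p≥2)

cong?-∧ : ∀ {q p} → 1 N.≤ q → 2 N.≤ p → Cop.Coprime q p → ∀ {a r c} → c mod q ≡ a mod q → c mod p ≡ r mod p →
     ∀ n → 𝟙 (cong? q a n) * 𝟙 (cong? p r n) ≡ 𝟙 (cong? (q N.* p) c n)
cong?-∧ {q} {p} q≥1 p≥2 cop {a} {r} {c} ca cr n = sym (𝟙-∧ (cong? q a n) (cong? p r n)) ∙ 𝟙-cong to from
 where
 p≥1 = N.<⇒≤ p≥2
 to : T (cong? q a n ∧ cong? p r n) → T (cong? (q N.* p) c n)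
 to t = cong?⁺ (q N.* p) {c} {n} (∣-mod (q N.* p) {n} {c} (N.*-mono-≤ q≥1 p≥1) (coprime-product cop
   (mod-∣ q {n} {c} q≥1 (cong?⁻ q {a} {n} (π₁ (∧⁻ {cong? q a n} t)) ∙ sym ca)) (mod-∣ p {n} {c} p≥1 (cong?⁻ p {r} {n} (π₂ (∧⁻ {cong? q a n} t)) ∙ sym cr))))
 from : T (cong? (q N.* p) c n) → T (cong? q a n ∧ cong? p r n)
 from t = let e = mod-product q p {n} {c} q≥1 p≥1 (cong?⁻ (q N.* p) {c} {n} t) in ∧⁺ (cong?⁺ q {a} {n} (π₁ e ∙ ca)) (cong?⁺ p {r} {n} (π₂ e ∙ cr))

Π : List ℕ → ℕ
Π [] = 1
Π (p ∷ D) = p N.* Π D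

prime∣Π : ∀ {p} D → Prime p → (∀ q → q ∈ D → Prime q) → p ∣ Π D → p ∈ D
prime∣Π [] hp h d = ⊥-elim (N.<⇒≱ (prime≥2 hp) (∣.∣⇒≤ d))
prime∣Π (q ∷ D) hp h d with euclidsLemma q (Π D) hp d
... | inj₁ e = here (prime∣prime hp (h q (here refl)) e)
... | inj₂ e = there (prime∣Π D hp (λ r i → h r (there i)) e)

-- Conditions modulo the primes of D split a residue class modulo q into k^|D| classes modulo q ∏ D.
module Splitting (ns : List ℕ) (w : ℕ → 𝔽) (R : ℕ → List ℕ) (k : ℕ) (Good : ℕ → ℕ → Set) where

 hit : ℕ → ℕ → 𝔽
 hit p n = ∑ (R p) λ r → 𝟙 (cong? p r n)

 split : ∀ D q a → 1 N.≤ q → Good q a → (∀ p → p ∈ D → Prime p × ¬ (p ∣ q) × length (R p) ≡ k) → Unique D →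
     (∀ q a c p r → p ∈ D → r ∈ R p → Good q a → c mod q ≡ a mod q → c mod p ≡ r mod p → Good (q N.* p) c) →
     ∀ {Y e} → (∀ c → Good (q N.* Π D) c → Abs≤ (∑ ns (λ n → w n * 𝟙 (cong? (q N.* Π D) c n)) - Y) e) →
     Abs≤ (∑ ns (λ n → w n * 𝟙 (cong? q a n) * ∏ (λ p → hit p n) D) - # k ^ length D * Y) (# k ^ length D * e)
 split [] q a q≥1 good hD u clos {Y} {e} h = subst₂ Abs≤ (cong₂ _-_ (cong (λ z → ∑ ns (λ n → w n * 𝟙 (cong? z a n))) (N.*-identityʳ q) ∙ (∑-ext ns λ n → *1˘ (w n * 𝟙 (cong? q a n))))
   (1*˘ Y)) (1*˘ e) (h a (subst (λ z → Good z a) (sym (N.*-identityʳ q)) good))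
 split (p ∷ D) q a q≥1 good hD (p∉ ∷ u) clos {Y} {e} h = subst₂ Abs≤ (sym lhs) rhs (Abs≤-∑ (R p) each)
  where
  hp = π₁ (hD p (here refl))
  cop = prime-coprime hp (π₁ (π₂ (hD p (here refl))))
  crt = chinese q≥1 (prime≥2 hp) cop a
  c : ℕ → ℕ
  c r = π₁ (crt r)
  Z : ℕ → 𝔽
  Z r = ∑ ns (λ n → w n * 𝟙 (cong? (q N.* p) (c r) n) * ∏ (λ p → hit p n) D)
  each : ∀ r → r ∈ R p → Abs≤ (Z r - # k ^ length D * Y) (# k ^ length D * e)
  each r i = split D (q N.* p) (c r) (N.*-mono-≤ q≥1 (prime≥1 hp)) (clos q a (c r) p r (here refl) i good (π₁ (π₂ (crt r))) (π₂ (π₂ (crt r))))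
   (λ s j → π₁ (hD s (there j)) , (λ d → [ π₁ (π₂ (hD s (there j))) , (λ d → All.lookup p∉ j (sym (prime∣prime (π₁ (hD s (there j))) hp d))) ]′ (euclidsLemma q p (π₁ (hD s (there j))) d)) , π₂ (π₂ (hD s (there j)))) u
   (λ q a c s r j → clos q a c s r (there j))
   (λ c g → subst (λ z → Abs≤ (∑ ns (λ n → w n * 𝟙 (cong? z c n)) - Y) e) (sym (N.*-assoc q p (Π D))) (h c (subst (λ z → Good z c) (N.*-assoc q p (Π D)) g)))
  lhs : ∑ ns (λ n → w n * 𝟙 (cong? q a n) * (hit p n * ∏ (λ p → hit p n) D)) - # k ^ suc (length D) * Y ≡ ∑ (R p) (λ r → Z r - # k ^ length D * Y)
  lhs = sym ((∑-ext (R p) λ r → solve 3 (λ z k y → z :- k :* y := z :+ (:- k) :* y) refl (Z r) (# k ^ length D) Y) ∙ ∑-+ (R p) Z _ ∙ cong₂ _+_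
    (∑-swap (R p) ns _ ∙ (∑-ext ns λ n → (∑-ext (R p) λ r → cong (λ z → w n * z * ∏ (λ p → hit p n) D) (sym (cong?-∧ q≥1 (prime≥2 hp) cop (π₁ (π₂ (crt r))) (π₂ (π₂ (crt r))) n)) ∙
       solve 4 (λ a b c d → a :* (b :* c) :* d := a :* b :* d :* c) refl (w n) (𝟙 (cong? q a n)) (𝟙 (cong? p r n)) (∏ (λ p → hit p n) D)) ∙
      ∑-scale (R p) (w n * 𝟙 (cong? q a n) * ∏ (λ p → hit p n) D) _ ∙ solve 3 (λ a d h → a :* d :* h := a :* (h :* d)) refl (w n * 𝟙 (cong? q a n)) (∏ (λ p → hit p n) D) (hit p n)))
    (∑-const (R p) _ ∙ cong (λ l → # l * ((- # k ^ length D) * Y)) (π₂ (π₂ (hD p (here refl)))) ∙ solve 3 (λ k l y → k :* ((:- l) :* y) := :- (k :* l :* y)) refl (# k) (# k ^ length D) Y))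
  rhs : ∑ (R p) (λ _ → # k ^ length D * e) ≡ # k ^ suc (length D) * e
  rhs = ∑-const (R p) _ ∙ cong (λ l → # l * (# k ^ length D * e)) (π₂ (π₂ (hD p (here refl)))) ∙ *-assoc˘ (# k) (# k ^ length D) e

coprime⁻ : ∀ {a b} → T (coprime a b) → Cop.Coprime a b
coprime⁻ {a} {b} t = Cop.gcd≡1⇒coprime (N.≡ᵇ⇒≡ (gcd a b) 1 t)

coprime⁺ : ∀ {a b} → Cop.Coprime a b → T (coprime a b)
coprime⁺ {a} {b} c = N.≡⇒≡ᵇ (gcd a b) 1 (Cop.coprime⇒gcd≡1 c)

coprime-*ˡ : ∀ {a b c} → Cop.Coprime a c → Cop.Coprime b c → Cop.Coprime (a N.* b) c
coprime-*ˡ {a} {b} {c} ha hb {i} (d , e) = hb (Cop.coprime-divisor (λ {j} jd → ha (π₂ jd , ∣.∣-trans (π₁ jd) e)) d , e)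

coprime-mod : ∀ {q a c} → 1 N.≤ q → c mod q ≡ a mod q → Cop.Coprime a q → Cop.Coprime c q
coprime-mod {q} {a} {c} q≥1 e h {i} (ic , iq) = h (ia , iq)
 where
 i≥1 : 1 N.≤ i
 i≥1 = N.n≢0⇒n>0 λ { refl → N.<⇒≱ q≥1 (reflexive (∣.0∣⇒≡0 iq)) }
 ia : i ∣ a
 ia = mod-zero⁻ i i≥1 (sym (∣-mod i {c} {a} i≥1 (∣.∣-trans iq (mod-∣ q {c} {a} q≥1 e))) ∙ mod-zero i i≥1 ic)

#φ : ∀ q → # (φ q) ≡ ∑ (rg 1 (suc q)) (λ a → 𝟙 (coprime a q))
#φ q = length-filterᵇ (λ a → coprime a q) (range 1 (suc q)) ∙ cong (λ l → ∑ l (λ a → 𝟙 (coprime a q))) (sym (rg≡range 1 (suc q)))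

-- Coprimality to q has period q, which gives p φ(q) residues up to q p. The multiples p b among
-- them correspond to the b ≤ q prime to q and are removed.
φ-* : ∀ q p → 1 N.≤ q → Prime p → ¬ (p ∣ q) → # (φ (q N.* p)) ≡ # (φ q) * (# p - # 1)
φ-* q p q≥1 hp p∤q = #φ (q N.* p) ∙ ∑-ext (rg 1 (suc (q N.* p))) pointwise ∙ (∑-ext (rg 1 (suc (q N.* p))) λ a → solve 2 (λ x y → x :- y := x :+ (:- κ 1) :* y) refl _ _) ∙
   ∑-+ (rg 1 (suc (q N.* p))) _ _ ∙ cong₂ _+_ refl (∑-scale (rg 1 (suc (q N.* p))) (- # 1) _) ∙
  cong₂ (λ x y → x + (- # 1) * y) (cong (λ z → ∑ (rg 1 (suc z)) f) (N.*-comm q p) ∙ periodic p) multiples ∙ solve 2 (λ a b → b :* a :+ (:- κ 1) :* a := a :* (b :- κ 1)) refl (# (φ q)) (# p)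
 where
 p≥1 = prime≥1 hp
 cop : Cop.Coprime p q
 cop {i} (d , e) with prime⇒irreducible hp d
 ... | inj₁ x = x
 ... | inj₂ refl = ⊥-elim (p∤q e)
 f : ℕ → 𝔽
 f a = 𝟙 (coprime a q)
 pointwise : ∀ a → 𝟙 (coprime a (q N.* p)) ≡ f a - 𝟙 ⌊ p ∣? a ⌋ * f a
 pointwise a with p ∣? a
 ... | yes d = (𝟙-false λ t → N.<⇒≱ (prime≥2 hp) (reflexive (coprime⁻ {a} {q N.* p} t (d , ∣.n∣m*n q)))) ∙ solve 1 (λ x → κ 0 := x :- κ 1 :* x) refl (f a)
 ... | no h = 𝟙-cong (λ t → coprime⁺ {a} {q} λ { (x , y) → coprime⁻ {a} {q N.* p} t (x , ∣.∣m⇒∣m*n p y) })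
   (λ t → coprime⁺ {a} {q N.* p} (λ ij → Cop.sym (coprime-*ˡ {q} {p} {a} (Cop.sym (coprime⁻ {a} {q} t)) (Cop.sym (prime-coprime hp h))) ij)) ∙ solve 1 (λ x → x := x :- κ 0 :* x) refl (f a)
 shift-f : ∀ k a → f (k N.* q N.+ a) ≡ f a
 shift-f k a = 𝟙-cong (λ t → coprime⁺ {a} {q} (coprime-mod q≥1 (sym e) (coprime⁻ {k N.* q N.+ a} {q} t))) (λ t → coprime⁺ {k N.* q N.+ a} {q} (coprime-mod q≥1 e (coprime⁻ {a} {q} t)))
  where
  e : (k N.* q N.+ a) mod q ≡ a mod q
  e = cong (_mod q) (N.+-comm (k N.* q) a) ∙ mod-add q a k q≥1
 periodic : ∀ k → ∑ (rg 1 (suc (k N.* q))) f ≡ # k * # (φ q)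
 periodic zero = ∑-nil {1} {1} N.≤-refl f ∙ 0*˘ (# (φ q))
 periodic (suc k) = cong (λ z → ∑ (rg 1 (suc z)) f) (N.+-comm q (k N.* q)) ∙ ∑-split {1} {suc (k N.* q)} (suc (k N.* q N.+ q)) (s≤s z≤n) (s≤s (N.m≤m+n (k N.* q) q)) f ∙
   cong₂ _+_ (periodic k) (cong₂ (λ x y → ∑ (rg x y) f) (sym (N.+-comm (k N.* q) 1)) (sym (N.+-suc (k N.* q) q)) ∙ ∑-shift 1 (suc q) (k N.* q) f ∙ ∑-ext (rg 1 (suc q)) (shift-f k) ∙ sym (#φ q)) ∙
    solve 2 (λ k a → k :* a :+ a := (κ 1 :+ k) :* a) refl (# k) (# (φ q)) ∙ cong (_* # (φ q)) (sym (#-suc k))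
 multiples : ∑ (rg 1 (suc (q N.* p))) (λ a → 𝟙 ⌊ p ∣? a ⌋ * f a) ≡ # (φ q)
 multiples = ∑-multiples p≥1 (q N.* p) f ∙ cong (λ z → ∑ (rg 1 (suc z)) (λ m → f (p N.* m))) (DM.m*n/n≡m q p ⦃ N.>-nonZero p≥1 ⦄) ∙ (∑-ext (rg 1 (suc q)) λ b → 𝟙-cong
   (λ t → coprime⁺ {b} {q} λ { (x , y) → coprime⁻ {p N.* b} {q} t (∣.∣n⇒∣m*n p x , y) }) (λ t → coprime⁺ {p N.* b} {q} (coprime-*ˡ cop (coprime⁻ {b} {q} t)))) ∙ sym (#φ q)

φ-1 : # (φ 1) ≡ # 1
φ-1 = refl

φ-Π : ∀ D q → 1 N.≤ q → (∀ p → p ∈ D → Prime p × ¬ (p ∣ q)) → Unique D → # (φ (q N.* Π D)) ≡ # (φ q) * ∏ (λ p → # p - # 1) D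
φ-Π [] q q≥1 h u = cong (λ z → # (φ z)) (N.*-identityʳ q) ∙ *1˘ (# (φ q))
φ-Π (p ∷ D) q q≥1 h (p∉ ∷ u) = cong (λ z → # (φ z)) (sym (N.*-assoc q p (Π D))) ∙ φ-Π D (q N.* p) (N.*-mono-≤ q≥1 (prime≥1 hp)) (λ s j → π₁ (h s (there j)) ,
   (λ d → [ π₂ (h s (there j)) , (λ d → All.lookup p∉ j (sym (prime∣prime (π₁ (h s (there j))) hp d))) ]′ (euclidsLemma q p (π₁ (h s (there j))) d))) u ∙
  cong (_* ∏ (λ p → # p - # 1) D) (φ-* q p q≥1 hp (π₂ (h p (here refl)))) ∙ *-assoc (# (φ q)) (# p - # 1) _
 where hp = π₁ (h p (here refl))

∑-single : ∀ q r → r N.< q → ∑ (rg 0 q) (λ n → 𝟙 (n N.≡ᵇ r)) ≡ # 1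
∑-single q r r<q = ∑-split {0} {r} q z≤n (N.<⇒≤ r<q) _ ∙ cong₂ _+_ (∑-zero (rg 0 r) λ n m → 𝟙-false λ t → N.<⇒≢ (π₂ (∈-range⁻ m)) (N.≡ᵇ⇒≡ n r t))
  (∑-split {r} {suc r} q (N.n≤1+n r) r<q _ ∙ cong₂ _+_ (∑-suc {r} {r} N.≤-refl _ ∙ cong₂ _+_ (∑-nil {r} {r} N.≤-refl _) (𝟙-true (N.≡⇒≡ᵇ r r refl)))
   (∑-zero (rg (suc r) q) λ n m → 𝟙-false λ t → N.<⇒≢ (π₁ (∈-range⁻ m)) (sym (N.≡ᵇ⇒≡ n r t)))) ∙
 solve 0 (κ 0 :+ (κ 0 :+ κ 1 :+ κ 0) := κ 1) refl

∑-nested : ∀ a k l f → ∑ (rg a (a N.+ (k N.+ l))) f ≡ ∑ (rg a (a N.+ k)) f + ∑ (rg (a N.+ k) (a N.+ k N.+ l)) f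
∑-nested a k l f = ∑-split {a} {a N.+ k} (a N.+ (k N.+ l)) (N.m≤m+n a k) (N.+-monoʳ-≤ a (N.m≤m+n k l)) f ∙ cong (λ z → ∑ (rg a (a N.+ k)) f + ∑ (rg (a N.+ k) z) f) (sym (N.+-assoc a k l))

module _ {q : ℕ} (q≥1 : 1 N.≤ q) (a : ℕ) where

 private
  f : ℕ → 𝔽
  f n = 𝟙 (cong? q a n)

 -- Sliding the window by one step exchanges b for b + q, which lies in the same class.
 complete-residues : ∀ b → ∑ (rg b (b N.+ q)) f ≡ # 1
 complete-residues zero = (∑-cong (rg 0 q) λ n m → cong (λ z → 𝟙 (z N.≡ᵇ a mod q)) (small n (π₂ (∈-range⁻ m)))) ∙ ∑-single q (a mod q) (mod-< q a q≥1)
  where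
  abstract
   small : ∀ n → n N.< q → n mod q ≡ n
   small n n<q = DM.m<n⇒m%n≡m (N.<-≤-trans n<q (reflexive (sym (suc-pred′ q≥1)))) `after` mod-def q n
    where
    _`after`_ : ∀ {x y z : ℕ} → y ≡ z → x ≡ y → x ≡ z
    p `after` r = r ∙ p
 complete-residues (suc b) = solve 2 (λ x y → x := y :+ x :- y) refl _ (f b) ∙ cong (_- f b) e ∙ cong (λ z → z + f (b N.+ q) - f b) (complete-residues b) ∙ cong (λ z → # 1 + z - f b) per ∙ solve 1 (λ x → κ 1 :+ x :- x := κ 1) refl (f b)
  where
  per : f (b N.+ q) ≡ f b
  per = cong (λ z → 𝟙 (z N.≡ᵇ a mod q)) (cong (λ z → (b N.+ z) mod q) (sym (N.+-identityʳ q)) ∙ mod-add q b 1 q≥1)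
  e : f b + ∑ (rg (suc b) (suc (b N.+ q))) f ≡ ∑ (rg b (b N.+ q)) f + f (b N.+ q)
  e = cong (_+ ∑ (rg (suc b) (suc (b N.+ q))) f) (sym (∑-suc {b} {b} N.≤-refl f ∙ cong (_+ f b) (∑-nil {b} {b} N.≤-refl f) ∙ 0+ (f b))) ∙
    sym (∑-split {b} {suc b} (suc (b N.+ q)) (N.n≤1+n b) (s≤s (N.m≤m+n b q)) f) ∙ ∑-suc {b} {b N.+ q} (N.m≤m+n b q) f

 private
  multiple : ∀ b k → ∑ (rg b (b N.+ k N.* q)) f ≡ # k
  multiple b zero = cong (λ z → ∑ (rg b z) f) (N.+-identityʳ b) ∙ ∑-nil {b} N.≤-refl f
  multiple b (suc k) = ∑-nested b q (k N.* q) f ∙ cong₂ _+_ (complete-residues b) (multiple (b N.+ q) k) ∙ sym (#-suc k)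

 class-count : ∀ b N → Abs≤ (∑ (rg b (b N.+ N)) f - # N * inv q) (# 1)
 class-count b N = lin (quot-lower q≥1 N ⊕ rest≥0) (solve 3 (λ k r n → k :+ r :- n :+ (n :+ κ 0) := :- κ 1 :+ (k :+ κ 1 :+ r)) refl (# k) rest (# N * inv q)) ⨾ ≡⇒≤ (sym eq′) ,
   eq′ ≡⨾ lin (quot-upper q≥1 N ⊕ rest≤1) (solve 3 (λ k r n → κ 1 :+ (k :+ r) := k :+ r :- n :+ (n :+ κ 1)) refl (# k) rest (# N * inv q))
  where
  k = quot q≥1 N
  r = N ∸ k N.* q
  instance
   q≢0 : NonZero q
   q≢0 = N.>-nonZero q≥1
  kq≤N : k N.* q N.≤ N
  kq≤N = DM.m/n*n≤m N q
  rest = ∑ (rg (b N.+ k N.* q) (b N.+ k N.* q N.+ r)) f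
  s′ = ∑ (rg b (b N.+ N)) f
  rest≥0 : # 0 ≤ rest
  rest≥0 = ∑≥0 (rg (b N.+ k N.* q) (b N.+ k N.* q N.+ r)) λ n _ → 𝟙≥0 _
  r<q : r N.< q
  r<q = N.m<n+o⇒m∸n<o N (k N.* q) (N.<-≤-trans (n<[1+n/L]L N q) (reflexive (N.+-comm q (k N.* q))))
  rest≤1 : rest ≤ # 1
  rest≤1 = ∑-subrange {b N.+ k N.* q} {b N.+ k N.* q N.+ r} {b N.+ k N.* q} {b N.+ k N.* q N.+ q} N.≤-refl (N.+-monoʳ-≤ (b N.+ k N.* q) (N.<⇒≤ r<q)) (λ n → 𝟙≥0 _) ⨾ ≡⇒≤ (complete-residues (b N.+ k N.* q))
  eq : s′ ≡ # k + rest
  eq = cong (λ z → ∑ (rg b (b N.+ z)) f) (sym (N.m+[n∸m]≡n kq≤N)) ∙ ∑-nested b (k N.* q) r f ∙ cong (_+ rest) (multiple b k)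
  eq′ : s′ - # N * inv q ≡ # k + rest - # N * inv q
  eq′ = cong (_- # N * inv q) eq

-- Weighted sums over sets of primes

SubSum : ℕ → List ℕ → (List ℕ → 𝔽) → 𝔽
SubSum c [] e = e []
SubSum c (p ∷ ps) e = SubSum c ps e + # c * SubSum c ps (e ∘ (p ∷_))

SubSum-mono : ∀ c ps {e e'} → (∀ D → D ⊆ ps → e D ≤ e' D) → SubSum c ps e ≤ SubSum c ps e'
SubSum-mono c [] h = h [] []
SubSum-mono c (p ∷ ps) h = SubSum-mono c ps (λ D s → h D (p ∷ʳ s)) ⊕ scale (#≥0 c) (SubSum-mono c ps λ D s → h (p ∷ D) (refl ∷ s))

SubSum-cong : ∀ c ps {e e'} → (∀ D → D ⊆ ps → e D ≡ e' D) → SubSum c ps e ≡ SubSum c ps e'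
SubSum-cong c ps h = ≤-antisym (SubSum-mono c ps λ D s → ≡⇒≤ (h D s)) (SubSum-mono c ps λ D s → ≡⇒≤ (sym (h D s)))

SubSum-+ : ∀ c ps e e' → SubSum c ps (λ D → e D + e' D) ≡ SubSum c ps e + SubSum c ps e'
SubSum-+ c [] e e' = refl
SubSum-+ c (p ∷ ps) e e' = cong₂ (λ x y → x + # c * y) (SubSum-+ c ps e e') (SubSum-+ c ps _ _) ∙ solve 5 (λ a b c d k → a :+ b :+ k :* (c :+ d) := a :+ k :* c :+ (b :+ k :* d)) refl _ _ _ _ (# c)

SubSum-scale : ∀ c ps k e → SubSum c ps (λ D → k * e D) ≡ k * SubSum c ps e
SubSum-scale c [] k e = refl
SubSum-scale c (p ∷ ps) k e = cong₂ (λ x y → x + # c * y) (SubSum-scale c ps k e) (SubSum-scale c ps k _) ∙ solve 4 (λ k a c b → k :* a :+ c :* (k :* b) := k :* (a :+ c :* b)) refl k _ (# c) _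

SubSum-nonneg : ∀ c ps {e} → (∀ D → D ⊆ ps → # 0 ≤ e D) → # 0 ≤ SubSum c ps e
SubSum-nonneg c [] h = h [] []
SubSum-nonneg c (p ∷ ps) h = +≥0 (SubSum-nonneg c ps λ D s → h D (p ∷ʳ s)) (*≥0 (#≥0 c) (SubSum-nonneg c ps λ D s → h (p ∷ D) (refl ∷ s)))

SubSum-∑ : ∀ {A : Set} c ps (xs : List A) (e : A → List ℕ → 𝔽) → SubSum c ps (λ D → ∑ xs (λ x → e x D)) ≡ ∑ xs (λ x → SubSum c ps (e x))
SubSum-∑ c ps [] e = zero′ c ps
 where
 zero′ : ∀ c ps → SubSum c ps (λ _ → # 0) ≡ # 0
 zero′ c [] = refl
 zero′ c (p ∷ ps) = cong₂ (λ x y → x + # c * y) (zero′ c ps) (zero′ c ps) ∙ solve 1 (λ c → κ 0 :+ c :* κ 0 := κ 0) refl (# c)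
SubSum-∑ c ps (x ∷ xs) e = SubSum-+ c ps (e x) _ ∙ cong (SubSum c ps (e x) +_) (SubSum-∑ c ps xs e)

-- Merges the k residue classes per prime with the cost c per prime of the expansion of Λ².
SubSum-power : ∀ c k ps e → SubSum c ps (λ D → # k ^ length D * e D) ≡ SubSum (c N.* k) ps e
SubSum-power c k [] e = 1* (e [])
SubSum-power c k (p ∷ ps) e = cong₂ _+_ (SubSum-power c k ps e) (cong (# c *_) ((SubSum-cong c ps λ D _ → *-assoc (# k) (# k ^ length D) (e (p ∷ D))) ∙
  SubSum-scale c ps (# k) _ ∙ cong (# k *_) (SubSum-power c k ps (e ∘ (p ∷_)))) ∙ *-assoc˘ (# c) (# k) _ ∙ cong (_* SubSum (c N.* k) ps (e ∘ (p ∷_))) (sym (#-* c k)))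

SumSub-SubSum : ∀ K c ps e m → SumSub K c ps e m ≡ SubSum c ps (λ D → 𝟙 (m N.+ lsum D N.<ᵇ K) * e D)
SumSub-SubSum K c [] e m = cong (λ z → 𝟙 (z N.<ᵇ K) * e []) (sym (N.+-identityʳ m))
SumSub-SubSum K c (p ∷ ps) e m = cong₂ (λ x y → x + # c * y) (SumSub-SubSum K c ps e m) (SumSub-SubSum K c ps (e ∘ (p ∷_)) (m N.+ lg p) ∙ (SubSum-cong c ps λ D _ → cong (λ z → 𝟙 (z N.<ᵇ K) * e (p ∷ D)) (N.+-assoc m (lg p) (lsum D))))

-- Multiplicative summands turn a sum over sets into `Op`, for which the one-dimensional estimates
-- are available.
SubSum-Op : ∀ K c ps g m → SubSum c ps (λ D → 𝟙 (m N.+ lsum D N.<ᵇ K) * ∏ g D) ≡ Op (λ p → # c * g p) ps (ind K) m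
SubSum-Op K c [] g m = cong (λ z → 𝟙 (z N.<ᵇ K) * # 1) (N.+-identityʳ m) ∙ *1 (ind K m)
SubSum-Op K c (p ∷ ps) g m = cong₂ _+_ (SubSum-Op K c ps g m) (cong (# c *_) ((SubSum-cong c ps λ D _ → cong (λ z → 𝟙 (z N.<ᵇ K) * (g p * ∏ g D)) (sym (N.+-assoc m (lg p) (lsum D))) ∙
  *-swap _ (g p) (∏ g D)) ∙ SubSum-scale c ps (g p) _ ∙ cong (g p *_) (SubSum-Op K c ps g (m N.+ lg p))) ∙
  *-assoc˘ (# c) (g p) _)

-- x c^|D| ≤ S + (x c^|D|)² / S
SubSum-split : ∀ {S} → # 0 < S → ∀ c ps {e} → (∀ D → D ⊆ ps → # 0 ≤ e D) → ∀ {x} → # 0 ≤ x → S * (x * SubSum c ps e) ≤ S * S * SubSum 1 ps e + x * x * SubSum (c N.* c) ps e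
SubSum-split {S} S>0 c [] {e} h {x} x≥0 = lin (scaleʳ (h [] []) quad) (solve 3 (λ s x e → s :* s :* e :+ x :* x :* e :+ κ 0 :* e := s :* (x :* e) :+ (s :* s :+ x :* x :- s :* x) :* e) refl S x (e [])) ⨾ ≤-refl
 where
 quad : # 0 ≤ S * S + x * x - S * x
 quad = lin (+≥0 (sq-nonneg (S - x)) (*≥0 (<⇒≤ S>0) x≥0)) (solve 2 (λ s x → s :* s :+ x :* x :- s :* x :+ κ 0 := κ 0 :+ ((s :- x) :* (s :- x) :+ s :* x)) refl S x)
SubSum-split {S} S>0 c (p ∷ ps) {e} h {x} x≥0 = lin (SubSum-split S>0 c ps (λ D s → h D (p ∷ʳ s)) x≥0 ⊕ SubSum-split S>0 c ps (λ D s → h (p ∷ D) (refl ∷ s)) (*≥0 x≥0 (#≥0 c)))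
 (cong (λ z → S * S * (a₁ + # 1 * b₁) + x * x * (a₂ + z * b₂) + (S * (x * a) + S * (x * # c * b))) (#-* c c) ∙
  solve 9 (λ S x c a b a₁ b₁ a₂ b₂ → S :* S :* (a₁ :+ κ 1 :* b₁) :+ x :* x :* (a₂ :+ c :* c :* b₂) :+ (S :* (x :* a) :+ S :* (x :* c :* b)) :=
    S :* (x :* (a :+ c :* b)) :+ (S :* S :* a₁ :+ x :* x :* a₂ :+ (S :* S :* b₁ :+ x :* c :* (x :* c) :* b₂))) refl S x (# c) a b a₁ b₁ a₂ b₂)
 where
 a = SubSum c ps e
 b = SubSum c ps (e ∘ (p ∷_))
 a₁ = SubSum 1 ps e
 b₁ = SubSum 1 ps (e ∘ (p ∷_))
 a₂ = SubSum (c N.* c) ps e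
 b₂ = SubSum (c N.* c) ps (e ∘ (p ∷_))

∑-dilate : ∀ {p} → 1 N.≤ p → ∀ X (f : ℕ → 𝔽) → (∀ n → # 0 ≤ f n) → (∀ n → X N.< n → f n ≡ # 0) → ∑ (rg 1 (suc X)) (λ m → f (p N.* m)) ≤ ∑ (rg 1 (suc X)) (λ n → 𝟙 ⌊ p ∣? n ⌋ * f n)
∑-dilate {p} p≥1 X f f≥0 fX = ∑-split {1} {suc Q} (suc X) (s≤s z≤n) (s≤s (DM.m/n≤m X p)) _ ≡⨾ ≡⇒≤ (cong (∑ (rg 1 (suc Q)) (λ m → f (p N.* m)) +_) (∑-zero (rg (suc Q) (suc X)) λ m i → fX (p N.* m) (big m (π₁ (∈-range⁻ i))))) ⨾
  ≡⇒≤ (+0 _ ∙ sym (∑-multiples p≥1 X f))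
 where
 instance
  p≢0 : NonZero p
  p≢0 = N.>-nonZero p≥1
 Q = quot p≥1 X
 big : ∀ m → suc Q N.≤ m → X N.< p N.* m
 big m q = N.<-≤-trans (n<[1+n/L]L X p) (N.*-monoˡ-≤ p q ⨟ reflexive (N.*-comm m p))

-- Unique factorisation in disguise: the sets without p have products prime to p, those with p have
-- multiples of p, so nothing is counted twice.
∑-sublists : ∀ ps X (f : ℕ → 𝔽) → (∀ p → p ∈ ps → Prime p) → Unique ps → (∀ n → # 0 ≤ f n) → (∀ n → X N.< n → f n ≡ # 0) → SubSum 1 ps (f ∘ Π) ≤ ∑ (rg 1 (suc X)) f
∑-sublists [] X f h u f≥0 fX with 1 N.≤? X
... | yes q = ∑-term (rg 1 (suc X)) (λ n _ → f≥0 n) (∈-range⁺ N.≤-refl (s≤s q))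
... | no q = fX 1 (N.≰⇒> q) ≡⨾ (∑≥0 (rg 1 (suc X)) λ n _ → f≥0 n)
∑-sublists (p ∷ ps) X f h (p∉ ∷ u) f≥0 fX = ≤-trans (≡⇒≤ (SubSum-cong 1 ps without)) (∑-sublists ps X f₁ h' u f₁≥0 (λ n q → cong (𝟙 (not ⌊ p ∣? n ⌋) *_) (fX n q) ∙ *0 _))
   ⊕ ≤-trans (≡⇒≤ (1* _)) (∑-sublists ps X (λ q → f (p N.* q)) h' u (λ n → f≥0 (p N.* n)) (λ n q → fX (p N.* n) (N.<-≤-trans q (reflexive (sym (N.*-identityˡ n)) ⨟ N.*-monoˡ-≤ n (prime≥1 hp)))) ⨾
     ∑-dilate (prime≥1 hp) X f f≥0 fX) ⨾
  ≡⇒≤ (sym (∑-+ (rg 1 (suc X)) _ _) ∙ (∑-ext (rg 1 (suc X)) λ n → both ⌊ p ∣? n ⌋ (f n)))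
 where
 hp = h p (here refl)
 h' = λ q i → h q (there i)
 f₁ : ℕ → 𝔽
 f₁ n = 𝟙 (not ⌊ p ∣? n ⌋) * f n
 f₁≥0 : ∀ n → # 0 ≤ f₁ n
 f₁≥0 n = *≥0 (𝟙≥0 (not ⌊ p ∣? n ⌋)) (f≥0 n)
 both : ∀ b x → 𝟙 (not b) * x + 𝟙 b * x ≡ x
 both true x = solve 1 (λ x → κ 0 :* x :+ κ 1 :* x := x) refl x
 both false x = solve 1 (λ x → κ 1 :* x :+ κ 0 :* x := x) refl x
 without : ∀ D → D ⊆ ps → f (Π D) ≡ f₁ (Π D)
 without D s = 1*˘ (f (Π D)) ∙ cong (_* f (Π D)) (sym (𝟙-true (not-true (p ∣? Π D) λ d → All.lookup p∉ (Sublist.lookup s (prime∣Π D hp (λ q i → h' q (Sublist.lookup s i)) d)) refl)))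
  where
  not-true : ∀ {P : Set} (d : Dec P) → ¬ P → T (not ⌊ d ⌋)
  not-true (yes x) h = h x
  not-true (no _) h = tt

-- The Bombieri–Vinogradov sums

any-false : ∀ {A : Set} (P : A → Bool) xs → (∀ x → x ∈ xs → ¬ T (P x)) → T (not (any P xs))
any-false P [] h = tt
any-false P (x ∷ xs) h with P x in eq
... | true = ⊥-elim (h x (here refl) (subst T (sym eq) tt))
... | false = any-false P xs λ y i → h y (there i)

squarefree-Π : ∀ Q → (∀ p → p ∈ Q → Prime p) → Unique Q → ∀ {r} → Prime r → ¬ (r N.* r ∣ Π Q)
squarefree-Π [] h u hr d = N.<⇒≱ (prime≥2 hr) (N.m≤m*n _ _ ⦃ prime⇒nonZero hr ⦄ ⨟ ∣.∣⇒≤ d)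
squarefree-Π (p ∷ Q) h (p∉ ∷ u) {r} hr d with r N.≟ p
... | yes refl = All.lookup p∉ (prime∣Π Q hr (λ q i → h q (there i)) (∣.*-cancelˡ-∣ r ⦃ prime⇒nonZero hr ⦄ d)) refl
... | no r≢p = squarefree-Π Q (λ q i → h q (there i)) u hr (Cop.coprime-divisor (λ {i} → Cop.sym (coprime-*ˡ {r} {r} {p} c c) {i} ∘ λ { (x , y) → y , x }) d)
 where
 c : Cop.Coprime r p
 c = prime-coprime (h p (here refl)) λ e → r≢p (sym (prime∣prime (h p (here refl)) hr e))

μ²-Π : ∀ Q → (∀ p → p ∈ Q → Prime p) → Unique Q → T (μ² (Π Q))
μ²-Π Q h u = any-false _ (range 2 (suc (Π Q))) λ d i t → let hd = π₁ (∈-range⁻ (subst (d ∈_) (sym (rg≡range 2 (suc (Π Q)))) i)) ; pf = prime-factor d hd in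
 squarefree-Π Q h u (π₁ (π₂ pf)) (∣.∣-trans (∣.*-pres-∣ (π₂ (π₂ pf)) (π₂ (π₂ pf))) (⌊⌋⁻ {d = (d N.* d) ∣? Π Q} t))

Π-++ : ∀ A B → Π (A ++ B) ≡ Π A N.* Π B
Π-++ [] B = sym (N.+-identityʳ (Π B))
Π-++ (a ∷ A) B = cong (a N.*_) (Π-++ A B) ∙ sym (N.*-assoc a (Π A) (Π B))

Π≥1 : ∀ D → (∀ p → p ∈ D → Prime p) → 1 N.≤ Π D
Π≥1 [] h = N.≤-refl
Π≥1 (p ∷ D) h = N.*-mono-≤ (prime≥1 (h p (here refl))) (Π≥1 D λ q i → h q (there i))

Unique-⊆ : ∀ {D ps : List ℕ} → D ⊆ ps → Unique ps → Unique D
Unique-⊆ [] u = []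
Unique-⊆ (_ ∷ʳ s) (_ ∷ u) = Unique-⊆ s u
Unique-⊆ (refl ∷ s) (p∉ ∷ u) = All.tabulate (λ i → All.lookup p∉ (Sublist.lookup s i)) ∷ Unique-⊆ s u

module _ {D : ℕ → ℕ → ℚᵘ.ℚᵘ} where

 candidates : ℕ → List ℚᵘ.ℚᵘ
 candidates q = map (λ a → if coprime a q then ℚᵘ.∣ D q a ∣ else ℚᵘ.0ℚᵘ) (range 0 q)

 maxℚ-upper : ∀ xs {x} → x ∈ xs → x ℚᵘ.≤ maxℚ xs
 maxℚ-upper (x ∷ xs) (here refl) = ℚᵘ.p≤p⊔q x (maxℚ xs)
 maxℚ-upper (y ∷ xs) (there i) = ℚᵘ.≤-trans (maxℚ-upper xs i) (ℚᵘ.p≤q⊔p y (maxℚ xs))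

 maxℚ-least : ∀ xs {b} → # 0 ≤ b → (∀ x → x ∈ xs → fromℚᵘ x ≤ b) → fromℚᵘ (maxℚ xs) ≤ b
 maxℚ-least [] h k = fromℚᵘ-ℕ 0 ≡⨾ h
 maxℚ-least (x ∷ xs) {b} h k with ℚᵘ.≤-total x (maxℚ xs)
 ... | inj₁ p = fromℚᵘ-mono (ℚᵘ.≤-reflexive (ℚᵘ.p≤q⇒p⊔q≃q p)) ⨾ (maxℚ-least xs h λ y i → k y (there i))
 ... | inj₂ p = fromℚᵘ-mono (ℚᵘ.≤-reflexive (ℚᵘ.p≥q⇒p⊔q≃p p)) ⨾ k x (here refl)

 err : ℕ → 𝔽
 err q = fromℚᵘ (maxℚ (candidates q))

 abs-bound : ∀ x → Abs≤ (fromℚᵘ x) (fromℚᵘ ℚᵘ.∣ x ∣)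
 abs-bound x = by-sign (ℚᵘ.∣p∣≡p∨∣p∣≡-p x)
  where
  a = fromℚᵘ x
  ∣a∣≥0 : # 0 ≤ fromℚᵘ ℚᵘ.∣ x ∣
  ∣a∣≥0 = sym (fromℚᵘ-ℕ 0) ≡⨾ fromℚᵘ-mono (ℚᵘ.0≤∣p∣ x)
  by-sign : ℚᵘ.∣ x ∣ ≡ x ⊎ ℚᵘ.∣ x ∣ ≡ ℚᵘ.- x → Abs≤ a (fromℚᵘ ℚᵘ.∣ x ∣)
  by-sign (inj₁ e) = subst (λ z → Abs≤ a z) (sym (cong fromℚᵘ e)) (lin (subst (# 0 ≤_) (cong fromℚᵘ e) ∣a∣≥0 ⊕ subst (# 0 ≤_) (cong fromℚᵘ e) ∣a∣≥0) (solve 1 (λ a → a :+ (κ 0 :+ κ 0) := :- a :+ (a :+ a)) refl a) , ≤-refl)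
  by-sign (inj₂ e) = subst (λ z → Abs≤ a z) (sym e′) (≡⇒≤ (solve 1 (λ a → :- (:- a) := a) refl a) , lin (subst (# 0 ≤_) e′ ∣a∣≥0 ⊕ subst (# 0 ≤_) e′ ∣a∣≥0) (solve 1 (λ a → :- a :+ (κ 0 :+ κ 0) := a :+ (:- a :+ :- a)) refl a))
   where
   e′ : fromℚᵘ ℚᵘ.∣ x ∣ ≡ - a
   e′ = cong fromℚᵘ e ∙ fromℚᵘ-neg x

 abs-least : ∀ {x b} → Abs≤ (fromℚᵘ x) b → fromℚᵘ ℚᵘ.∣ x ∣ ≤ b
 abs-least {x} {b} (p , q) with ℚᵘ.∣p∣≡p∨∣p∣≡-p x
 ... | inj₁ e = cong fromℚᵘ e ≡⨾ q
 ... | inj₂ e = (cong fromℚᵘ e ∙ fromℚᵘ-neg x) ≡⨾ lin p (solve 2 (λ x b → b :+ (:- b) := :- x :+ x) refl (fromℚᵘ x) b)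

 err≥0 : ∀ q → # 0 ≤ err q
 err≥0 q = go (candidates q)
  where
  go : ∀ xs → # 0 ≤ fromℚᵘ (maxℚ xs)
  go [] = ≡⇒≤ (sym (fromℚᵘ-ℕ 0))
  go (x ∷ xs) = go xs ⨾ fromℚᵘ-mono (ℚᵘ.p≤q⊔p x (maxℚ xs))

 err-bound : ∀ q a → a N.< q → T (coprime a q) → Abs≤ (fromℚᵘ (D q a)) (err q)
 err-bound q a a<q t = Abs≤-weaken (fromℚᵘ-mono (maxℚ-upper (candidates q) (subst (_∈ candidates q) (if-true t) (∈-map⁺ _ (subst (a ∈_) (rg≡range 0 q) (∈-range⁺ z≤n a<q)))))) (abs-bound (D q a))
  where
  if-true : ∀ {b} {x y : ℚᵘ.ℚᵘ} → T b → (if b then x else y) ≡ x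
  if-true {true} _ = refl

 err-least : ∀ q {b} → # 0 ≤ b → (∀ a → Abs≤ (fromℚᵘ (D q a)) b) → err q ≤ b
 err-least q {b} b≥0 h = maxℚ-least (candidates q) b≥0 λ x i → let m = ∈-map⁻ _ i in subst (λ z → fromℚᵘ z ≤ b) (sym (π₂ (π₂ m))) (either (coprime (π₁ m) q) (π₁ m))
  where
  either : ∀ c a → fromℚᵘ (if c then ℚᵘ.∣ D q a ∣ else ℚᵘ.0ℚᵘ) ≤ b
  either true a = abs-least (h a)
  either false a = fromℚᵘ-ℕ 0 ≡⨾ b≥0

 bvSum-∑ : ∀ k N → fromℚᵘ (bvSum k N D) ≡ ∑ (rg 1 (suc N)) (λ q → 𝟙 (inLevel k N q ∧ μ² q) * err q)
 bvSum-∑ k N = sums _ (range 1 (suc N)) ∙ (∑-ext (range 1 (suc N)) λ q → if-fromℚᵘ (inLevel k N q ∧ μ² q) (maxℚ (candidates q))) ∙ cong (λ l → ∑ l (λ q → 𝟙 (inLevel k N q ∧ μ² q) * err q)) (sym (rg≡range 1 (suc N)))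
  where
  sums : ∀ (t : ℕ → ℚᵘ.ℚᵘ) xs → fromℚᵘ (sumℚ (map t xs)) ≡ ∑ xs (fromℚᵘ ∘ t)
  sums t [] = fromℚᵘ-ℕ 0
  sums t (x ∷ xs) = fromℚᵘ-+ (t x) (sumℚ (map t xs)) ∙ cong (fromℚᵘ (t x) +_) (sums t xs)
  if-fromℚᵘ : ∀ b x → fromℚᵘ (if b then x else ℚᵘ.0ℚᵘ) ≡ 𝟙 b * fromℚᵘ x
  if-fromℚᵘ true x = 1*˘ (fromℚᵘ x)
  if-fromℚᵘ false x = fromℚᵘ-ℕ 0 ∙ 0*˘ (fromℚᵘ x)

saves : ∀ {D : ℕ → ℕ → ℕ → ℚᵘ.ℚᵘ} {k} → SavesAllLogs (λ N → bvSum k N (D N)) → ∀ A → Σ ℕ λ C → Σ ℕ λ N₀ → ∀ N → N₀ N.≤ N →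
    ∑ (rg 1 (suc N)) (λ q → 𝟙 (inLevel k N q ∧ μ² q) * err {D N} q) * # (⌊log₂ N ⌋ N.^ A) ≤ # (C N.* N)
saves {D} {k} s A = π₁ (s A) , π₁ (π₂ (s A)) , λ N h → ≡⇒≤ (cong (_* # (⌊log₂ N ⌋ N.^ A)) (sym (bvSum-∑ {D N} k N)) ∙ cong (fromℚᵘ (bvSum k N (D N)) *_) (sym (fromℚᵘ-ℕ _)) ∙ sym (fromℚᵘ-* (bvSum k N (D N)) _)) ⨾
  fromℚᵘ-mono (π₂ (π₂ (s A)) N h) ⨾ ≡⇒≤ (fromℚᵘ-ℕ _)

countIn-∑ : ∀ a b P → # (countIn a b P) ≡ ∑ (rg a b) (𝟙 ∘ P)
countIn-∑ a b P = length-filterᵇ P (range a b) ∙ cong (λ l → ∑ l (𝟙 ∘ P)) (sym (rg≡range a b))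

φ≥1 : ∀ q → 1 N.≤ q → 1 N.≤ φ q
φ≥1 q h = #-cancel-≤ (sym (𝟙-true {coprime 1 q} (coprime⁺ {1} {q} (Cop.1-coprimeTo q))) ≡⨾ ∑-term (rg 1 (suc q)) (λ a _ → 𝟙≥0 _) (∈-range⁺ N.≤-refl (s≤s h)) ⨾≡ sym (#φ q))

inv-≤ : ∀ n {x} → 1 N.≤ n → # 1 ≤ # n * x → inv n ≤ x
inv-≤ n {x} h p = *1˘ (inv n) ≡⨾ scale (inv-nonneg n) p ⨾ ≡⇒≤ (*-swapˡ (inv n) (# n) x ∙ cong (_* x) (#-inv n h) ∙ 1* x)

-- 2/p dominates both 1/p and 1/(p - 1), so one product bounds 1/q as well as 1/φ(q).
2inv : ℕ → 𝔽
2inv p = # 2 * inv p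

prod-≥1 : ∀ D {f : ℕ → 𝔽} → (∀ p → p ∈ D → # 1 ≤ f p) → # 1 ≤ ∏ f D
prod-≥1 [] h = ≤-refl
prod-≥1 (p ∷ D) h = solve 0 (κ 1 := κ 1 :* κ 1) refl ≡⨾ *-mono 0≤1 (0≤1 ⨾ h p (here refl)) (h p (here refl)) (prod-≥1 D λ q i → h q (there i))

prod-* : ∀ D (f g : ℕ → 𝔽) → ∏ f D * ∏ g D ≡ ∏ (λ p → f p * g p) D
prod-* [] f g = solve 0 (κ 1 :* κ 1 := κ 1) refl
prod-* (p ∷ D) f g = *-interchange (f p) _ (g p) _ ∙ cong (f p * g p *_) (prod-* D f g)

#Π : ∀ D → # (Π D) ≡ ∏ #_ D
#Π [] = refl
#Π (p ∷ D) = #-* p (Π D) ∙ cong (# p *_) (#Π D)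

module _ {W : ℕ} (W≥1 : 1 N.≤ W) (D : List ℕ) (hD : ∀ p → p ∈ D → Prime p × ¬ (p ∣ W)) (uD : Unique D) where

 WΠ≥1 : 1 N.≤ W N.* Π D
 WΠ≥1 = N.*-mono-≤ W≥1 (Π≥1 D λ p i → π₁ (hD p i))

 inv-WΠ : inv (W N.* Π D) ≤ ∏ 2inv D
 inv-WΠ = inv-≤ (W N.* Π D) WΠ≥1 ((prod-≥1 D {λ p → # p * 2inv p} (λ p i → #-mono {1} {2} (s≤s z≤n) ⨾≡ solve 0 (κ 2 := κ 2 :* κ 1) refl ∙ cong (# 2 *_) (sym (#-inv p (prime≥1 (π₁ (hD p i))))) ∙ solve 2 (λ p i → κ 2 :* (p :* i) := p :* (κ 2 :* i)) refl (# p) (inv p))) ⨾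
   (sym (prod-* D #_ 2inv) ∙ cong (_* ∏ 2inv D) (sym (#Π D))) ≡⨾ scaleʳ (prod-nonneg D λ p _ → *≥0 (#≥0 2) (inv-nonneg p)) (#-mono (N.m≤n*m (Π D) W ⦃ N.>-nonZero W≥1 ⦄)))

 inv-φWΠ : inv (φ (W N.* Π D)) ≤ ∏ 2inv D
 inv-φWΠ = inv-≤ (φ (W N.* Π D)) (φ≥1 _ WΠ≥1) ((prod-≥1 D {λ p → (# p - # 1) * 2inv p} (λ p i → lin (scale (#≥0 2) (inv-mono {2} {p} (s≤s z≤n) (prime≥2 (π₁ (hD p i)))) ⊕ ≡⇒≤ (#-inv 2 (s≤s z≤n)))
      (solve 2 (λ i h → κ 2 :- κ 2 :* i :+ (κ 2 :* i :+ κ 2 :* h) := κ 1 :+ (κ 2 :* h :+ κ 1)) refl (inv p) (inv 2)) ⨾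
     ≡⇒≤ (solve 1 (λ i → κ 2 :- κ 2 :* i := κ 2 :* κ 1 :- κ 2 :* i) refl (inv p) ∙ cong (λ z → # 2 * z - # 2 * inv p) (sym (#-inv p (prime≥1 (π₁ (hD p i))))) ∙ solve 2 (λ p i → κ 2 :* (p :* i) :- κ 2 :* i := (p :- κ 1) :* (κ 2 :* i)) refl (# p) (inv p)))) ⨾
   sym (prod-* D (λ p → # p - # 1) 2inv) ≡⨾ scaleʳ (prod-nonneg D λ p _ → *≥0 (#≥0 2) (inv-nonneg p)) (1*˘ _ ≡⨾ scaleʳ (0≤1 ⨾ (prod-≥1 D λ p i → p-1≥1 p (π₁ (hD p i)))) (#-mono (φ≥1 W W≥1)) ⨾≡ sym (φ-Π D W W≥1 hD uD)))
  where
  p-1≥1 : ∀ p → Prime p → # 1 ≤ # p - # 1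
  p-1≥1 p hp = lin (#-mono (prime≥2 hp)) (solve 1 (λ p → p :- κ 1 :+ κ 2 := κ 1 :+ p) refl (# p))

 -- A class modulo q ≤ N has at most N/q + 1 ≤ 2 N/q members in the interval, and the expected value
 -- is at most N/φ(q); that makes three times N ∏ 2/p.
 err-trivial : ∀ {E : ℕ → ℕ → ℚᵘ.ℚᵘ} N b (P : ℕ → 𝔽) Y → let q = W N.* Π D in q N.≤ N → Y N.≤ N → (∀ n → # 0 ≤ P n) → (∀ n → P n ≤ # 1) →
        (∀ a → fromℚᵘ (E q a) ≡ ∑ (rg b (b N.+ N)) (λ n → P n * 𝟙 (cong? q a n)) - # Y * inv (φ q)) → err {E} q ≤ # 3 * # N * ∏ 2inv D
 err-trivial {E} N b P Y q≤N Y≤N P≥0 P≤1 eq = err-least {E} q total≥0 bound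
  where
  q = W N.* Π D
  X = ∏ 2inv D
  X≥0 : # 0 ≤ X
  X≥0 = prod-nonneg D λ p _ → *≥0 (#≥0 2) (inv-nonneg p)
  NX≥0 : # 0 ≤ # N * X
  NX≥0 = *≥0 (#≥0 N) X≥0
  total≥0 : # 0 ≤ # 3 * # N * X
  total≥0 = *≥0 (*≥0 (#≥0 3) (#≥0 N)) X≥0
  main≤ : # Y * inv (φ q) ≤ # N * X
  main≤ = *-mono (inv-nonneg (φ q)) (#≥0 N) (#-mono Y≤N) inv-φWΠ
  one≤ : # 1 ≤ # N * X
  one≤ = sym (#-inv q WΠ≥1) ≡⨾ *-mono (inv-nonneg q) (#≥0 N) (#-mono q≤N) inv-WΠ
  module _ (a : ℕ) where
   Z = ∑ (rg b (b N.+ N)) (λ n → P n * 𝟙 (cong? q a n))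
   Z≥0 : # 0 ≤ Z
   Z≥0 = ∑≥0 (rg b (b N.+ N)) λ n _ → *≥0 (P≥0 n) (𝟙≥0 _)
   Z≤ : Z ≤ # N * X + # N * X
   Z≤ = (∑-mono (rg b (b N.+ N)) λ n _ → scaleʳ (𝟙≥0 _) (P≤1 n) ⨾≡ 1* (𝟙 (cong? q a n))) ⨾
     lin (π₂ (class-count WΠ≥1 a b N) ⊕ scale (#≥0 N) inv-WΠ ⊕ one≤) (solve 3 (λ s n x → x :+ x :+ (s :- n :+ n :+ κ 1) := s :+ (κ 1 :+ x :+ x)) refl (∑ (rg b (b N.+ N)) (λ n → 𝟙 (cong? q a n))) (# N * inv q) (# N * X))
   bound : Abs≤ (fromℚᵘ (E q a)) (# 3 * # N * X)
   bound = subst (λ z → Abs≤ z (# 3 * # N * X)) (sym (eq a))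
    ( lin (Z≥0 ⊕ main≤ ⊕ scale (#≥0 2) NX≥0) (solve 4 (λ z y n x → z :- y :+ (κ 0 :+ y :+ κ 2 :* κ 0) := :- (κ 3 :* n :* x) :+ (z :+ n :* x :+ κ 2 :* (n :* x))) refl Z (# Y * inv (φ q)) (# N) X)
    , lin (Z≤ ⊕ *≥0 (#≥0 Y) (inv-nonneg (φ q)) ⊕ NX≥0) (solve 4 (λ z y n x → κ 3 :* n :* x :+ (z :+ κ 0 :+ κ 0) := z :- y :+ (n :* x :+ n :* x :+ y :+ n :* x)) refl Z (# Y * inv (φ q)) (# N) X))

-- The hypothesis of Bombieri-Vinogradov type controls ∑ e(q) only without the weight c^|D|. From S
-- c^|D| ≤ S² + c^(2|D|), the first part is covered by that hypothesis, since the W ∏ D are distinct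
-- squarefree moduli within the level, and the second by the trivial bound for e, which loses a
-- fixed power of the logarithm.
bv-total : ∀ {ws ps : List ℕ} → (∀ p → p ∈ ws ++ ps → Prime p) → Unique (ws ++ ps) → ∀ k N {e : ℕ → 𝔽} → (∀ q → # 0 ≤ e q) → ∀ {Sb Tb} →
 ∑ (rg 1 (suc N)) (λ q → 𝟙 (inLevel k N q ∧ μ² q) * e q) ≤ Sb → # 0 ≤ Tb → ∀ K m →
 (∀ D → D ⊆ ps → m N.+ lsum D N.< K → T (inLevel k N (Π ws N.* Π D)) × Π ws N.* Π D N.≤ N × e (Π ws N.* Π D) ≤ Tb * ∏ 2inv D) →
 ∀ {S} → # 0 < S → ∀ c → S * SumSub K c ps (λ D → e (Π ws N.* Π D)) m ≤ S * S * Sb + Tb * Op (λ p → # (c N.* c) * 2inv p) ps (ind K) m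
bv-total {ws} {ps} hp u k N {e} e≥0 {Sb} {Tb} hS Tb≥0 K m h {S} S>0 c = ≡⇒≤ (cong (S *_) (SumSub-SubSum K c ps _ m) ∙ solve 2 (λ s x → s :* x := s :* (κ 1 :* x)) refl S _) ⨾
 SubSum-split S>0 c ps (λ D _ → *≥0 (𝟙≥0 _) (e≥0 _)) 0≤1 ⨾ scale (*≥0 (<⇒≤ S>0) (<⇒≤ S>0)) first ⊕ second
 where
 W = Π ws
 W≥1 : 1 N.≤ W
 W≥1 = Π≥1 ws λ p i → hp p (∈-++⁺ˡ i)
 F : ℕ → 𝔽
 F q = 𝟙 (q N.≤ᵇ N) * (𝟙 (inLevel k N q ∧ μ² q) * e q)
 F≥0 : ∀ q → # 0 ≤ F q
 F≥0 q = *≥0 (𝟙≥0 _) (*≥0 (𝟙≥0 (inLevel k N q ∧ μ² q)) (e≥0 q))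
 F-beyond : ∀ q → N N.< q → F q ≡ # 0
 F-beyond q l = cong (_* (𝟙 (inLevel k N q ∧ μ² q) * e q)) (𝟙-false λ t → N.<⇒≱ l (N.≤ᵇ⇒≤ q N t)) ∙ 0* (𝟙 (inLevel k N q ∧ μ² q) * e q)
 prefix : ∀ D → D ⊆ ps → (ws ++ D) ⊆ (ws ++ ps)
 prefix D s = Sublist-++ ws s
  where
  Sublist-++ : ∀ ws {D ps : List ℕ} → D ⊆ ps → (ws ++ D) ⊆ (ws ++ ps)
  Sublist-++ [] s = s
  Sublist-++ (w ∷ ws) s = refl ∷ Sublist-++ ws s
 guard : ∀ D → {x y : 𝔽} → (m N.+ lsum D N.< K → x ≤ y) → # 0 ≤ y → 𝟙 (m N.+ lsum D N.<ᵇ K) * x ≤ y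
 guard D {x} {y} f y≥0 with m N.+ lsum D N.<ᵇ K in eq
 ... | true = 1* x ≡⨾ f (N.<ᵇ⇒< _ K (subst T (sym eq) tt))
 ... | false = 0* x ≡⨾ y≥0
 step₁ : ∀ D → D ⊆ ps → 𝟙 (m N.+ lsum D N.<ᵇ K) * e (W N.* Π D) ≤ F (W N.* Π D)
 step₁ D s = guard D (λ l → ≡⇒≤ (sym (cong₂ (λ x y → x * (y * e (W N.* Π D))) (𝟙-true (N.≤⇒≤ᵇ (π₁ (π₂ (h D s l))))) (𝟙-true (∧⁺ (π₁ (h D s l)) (subst (T ∘ μ²) (Π-++ ws D)
   (μ²-Π (ws ++ D) (λ p i → hp p (Sublist.lookup (prefix D s) i)) (Unique-⊆ (prefix D s) u))))) ∙ solve 1 (λ a → κ 1 :* (κ 1 :* a) := a) refl (e (W N.* Π D))))) (F≥0 _)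
 first : SubSum 1 ps (λ D → 𝟙 (m N.+ lsum D N.<ᵇ K) * e (W N.* Π D)) ≤ Sb
 first = SubSum-mono 1 ps step₁ ⨾ ∑-sublists ps N (λ q → F (W N.* q)) (λ p i → hp p (∈-++⁺ʳ ws i)) (Unique-⊆ (drop-prefix ws) u) (λ q → F≥0 (W N.* q)) (λ q l → F-beyond (W N.* q) (N.<-≤-trans l (N.m≤n*m q W ⦃ N.>-nonZero W≥1 ⦄))) ⨾
   ∑-dilate W≥1 N F F≥0 F-beyond ⨾ (∑-mono (rg 1 (suc N)) λ q _ → absorb (𝟙 ⌊ W ∣? q ⌋) (F q) (𝟙≤1 _) (F≥0 q) ⨾ absorb (𝟙 (q N.≤ᵇ N)) _ (𝟙≤1 _) (*≥0 (𝟙≥0 (inLevel k N q ∧ μ² q)) (e≥0 q))) ⨾ hS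
  where
  absorb : ∀ a b → a ≤ # 1 → # 0 ≤ b → a * b ≤ b
  absorb a b p q = scaleʳ q p ⨾ ≡⇒≤ (1* b)
  drop-prefix : ∀ ws {ps : List ℕ} → ps ⊆ (ws ++ ps)
  drop-prefix [] = ⊆-refl
  drop-prefix (w ∷ ws) = w ∷ʳ drop-prefix ws
 second : # 1 * # 1 * SubSum (c N.* c) ps (λ D → 𝟙 (m N.+ lsum D N.<ᵇ K) * e (W N.* Π D)) ≤ Tb * Op (λ p → # (c N.* c) * 2inv p) ps (ind K) m
 second = solve 1 (λ a → κ 1 :* κ 1 :* a := a) refl _ ≡⨾ (SubSum-mono (c N.* c) ps λ D s → step₂ D s) ⨾
   ≡⇒≤ (SubSum-scale (c N.* c) ps Tb _ ∙ cong (Tb *_) (SubSum-Op K (c N.* c) ps 2inv m))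
  where
  step₂ : ∀ D → D ⊆ ps → 𝟙 (m N.+ lsum D N.<ᵇ K) * e (W N.* Π D) ≤ Tb * (𝟙 (m N.+ lsum D N.<ᵇ K) * ∏ 2inv D)
  step₂ D s = ≡⇒≤ (cong (_* e (W N.* Π D)) (sym (𝟙-idem (m N.+ lsum D N.<ᵇ K))) ∙ solve 2 (λ a b → a :* a :* b := a :* (a :* b)) refl (𝟙 (m N.+ lsum D N.<ᵇ K)) (e (W N.* Π D))) ⨾
     scale (𝟙≥0 (m N.+ lsum D N.<ᵇ K)) (guard D (λ l → π₂ (π₂ (h D s l))) (*≥0 Tb≥0 (prod-nonneg D λ p _ → *≥0 (#≥0 2) (inv-nonneg p)))) ⨾
    ≡⇒≤ (*-swap (𝟙 (m N.+ lsum D N.<ᵇ K)) Tb (∏ 2inv D))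

∑-multiples-between : ∀ {p} (p≥1 : 1 N.≤ p) N M → N N.≤ M → (f : ℕ → 𝔽) → ∑ (rg (suc N) (suc M)) (λ n → 𝟙 ⌊ p ∣? n ⌋ * f n) ≡ ∑ (rg (suc (quot p≥1 N)) (suc (quot p≥1 M))) (λ m → f (p N.* m))
∑-multiples-between {p} p≥1 N M N≤M f = cancel (∑-split {1} {suc N} (suc M) (s≤s z≤n) (s≤s N≤M) _) ∙ cong₂ _-_ (∑-multiples p≥1 M f) (∑-multiples p≥1 N f) ∙
  sym (cancel (∑-split {1} {suc (quot p≥1 N)} (suc (quot p≥1 M)) (s≤s z≤n) (s≤s (DM./-monoˡ-≤ p ⦃ N.>-nonZero p≥1 ⦄ N≤M)) (λ m → f (p N.* m))))
 where
 cancel : ∀ {a b c : 𝔽} → a ≡ b + c → c ≡ a - b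
 cancel {b = b} {c} refl = solve 2 (λ b c → c := b :+ c :- b) refl b c

∑-unique : ∀ xs → Unique xs → (f : ℕ → 𝔽) → ∀ {x} → x ∈ xs → (∀ y → y ∈ xs → y ≢ x → f y ≡ # 0) → ∑ xs f ≡ f x
∑-unique (x ∷ xs) (x∉ ∷ u) f (here refl) h = cong (f x +_) (∑-zero xs λ y i → h y (there i) λ e → All.lookup x∉ i (sym e)) ∙ +0 (f x)
∑-unique (y ∷ xs) (y∉ ∷ u) f {x} (there i) h = cong₂ _+_ (h y (here refl) (All.lookup y∉ i)) (∑-unique xs u f i λ z j → h z (there j)) ∙ 0+ (f x)

any⁻ : ∀ {A : Set} (P : A → Bool) xs → T (any P xs) → ∃ λ x → x ∈ xs × T (P x)
any⁻ P (x ∷ xs) t with P x in eq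
... | true = x , here refl , subst T (sym eq) tt
... | false = let y , i , s = any⁻ P xs t in y , there i , s

any⁺ : ∀ {A : Set} (P : A → Bool) xs {x} → x ∈ xs → T (P x) → T (any P xs)
any⁺ P (x ∷ xs) (here refl) t with P x
... | true = tt
any⁺ P (y ∷ xs) (there i) t with P y
... | true = tt
... | false = any⁺ P xs i t

div-mul : ∀ {p} m → 1 N.≤ p → (p N.* m) N./ suc (p ∸ 1) ≡ m
div-mul {suc p} m _ = cong (N._/ suc p) (N.*-comm (suc p) m) ∙ DM.m*n/n≡m m (suc p)

div-quot : ∀ {p} (p≥1 : 1 N.≤ p) N → quot p≥1 N ≡ N N./ suc (p ∸ 1)
div-quot {suc p} p≥1 N = refl

-- Products of two primes, arranged by the smaller factor

module SemiPrimes (ei ej N : ℕ) where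

 smallFactor : ℕ → Bool
 smallFactor p = isPrime p ∧ (N N.^ ei N.<ᵇ p N.^ ej) ∧ (p N.^ 2 N.≤ᵇ N)

 facs₁ : List ℕ
 facs₁ = filter (λ p → Bool.T? (smallFactor p)) (rg 1 (suc N))

 facs₂ : ℕ → List ℕ
 facs₂ p = primes (suc (N N./ suc (p ∸ 1))) (suc (2 N.* N N./ suc (p ∸ 1)))

 unique-facs₁ : Unique facs₁
 unique-facs₁ = Unique.filter⁺ (λ p → Bool.T? (smallFactor p)) (unique-rg 1 (suc N))

 facs₁⁻ : ∀ {p} → p ∈ facs₁ → Prime p × N N.^ ei N.< p N.^ ej × p N.* p N.≤ N
 facs₁⁻ {p} i = let t = π₂ (∈-filter⁻ (λ p → Bool.T? (smallFactor p)) {xs = rg 1 (suc N)} i) ; t₂ = π₂ (∧⁻ {isPrime p} t) in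
  ⌊⌋⁻ {d = prime? p} (π₁ (∧⁻ {isPrime p} t)) , N.<ᵇ⇒< (N N.^ ei) (p N.^ ej) (π₁ (∧⁻ {N N.^ ei N.<ᵇ p N.^ ej} t₂)) ,
  reflexive (cong (p N.*_) (sym (N.*-identityʳ p))) ⨟ N.≤ᵇ⇒≤ (p N.^ 2) N (π₂ (∧⁻ {N N.^ ei N.<ᵇ p N.^ ej} t₂))

 facs₁⁺ : ∀ {p} → Prime p → N N.^ ei N.< p N.^ ej → p N.* p N.≤ N → p ∈ facs₁
 facs₁⁺ {p} hp lo hi = ∈-filter⁺ (λ p → Bool.T? (smallFactor p)) (∈-range⁺ (prime≥1 hp) (s≤s (N.m≤m*n p p ⦃ prime⇒nonZero hp ⦄ ⨟ hi)))
  (∧⁺ {isPrime p} (⌊⌋⁺ hp) (∧⁺ {N N.^ ei N.<ᵇ p N.^ ej} (N.<⇒<ᵇ lo) (N.≤⇒≤ᵇ (reflexive (cong (p N.*_) (N.*-identityʳ p)) ⨟ hi))))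

 cofactor : ∀ {p n} → Prime p → p ∣ n → p N.* (n N./ suc (p ∸ 1)) ≡ n
 cofactor {p} {n} hp (∣.divides k e) = cong (p N.*_) (cong (N._/ suc (p ∸ 1)) (e ∙ N.*-comm k p) ∙ div-mul k (prime≥1 hp)) ∙ N.*-comm p k ∙ sym e

 -- The condition on the larger factor in `β` is therefore automatic, and the square root of N
 -- separates the two factors.
 large : ∀ {p m} → p N.* p N.≤ N → N N.< p N.* m → N N.< m N.* m
 large {p} {m} pp l = N.≰⇒> λ mm → N.<⇒≱ l ([ (λ q → N.*-monoˡ-≤ m q ⨟ mm) , (λ q → N.*-monoʳ-≤ p q ⨟ pp) ]′ (N.≤-total p m))

 pair : ℕ → ℕ → Bool
 pair n p = ⌊ p ∣? n ⌋ ∧ isPrime (n N./ suc (p ∸ 1))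

 β⁻ : ∀ n → T (β ei ej N n) → ∃ λ p → p ∈ facs₁ × T (pair n p)
 β⁻ n t = let p , i , s = any⁻ _ (range 1 (suc n)) t ; s₁ = ∧⁻ {isPrime p} s ; s₂ = ∧⁻ {⌊ p ∣? n ⌋} (π₂ s₁) ; s₃ = ∧⁻ {isPrime (n N./ suc (p ∸ 1))} (π₂ s₂) ; s₄ = ∧⁻ {N N.^ ei N.<ᵇ p N.^ ej} (π₂ s₃) ; s₅ = ∧⁻ {p N.^ 2 N.≤ᵇ N} (π₂ s₄) in
  p , facs₁⁺ (⌊⌋⁻ {d = prime? p} (π₁ s₁)) (N.<ᵇ⇒< (N N.^ ei) (p N.^ ej) (π₁ s₄)) (reflexive (cong (p N.*_) (sym (N.*-identityʳ p))) ⨟ N.≤ᵇ⇒≤ (p N.^ 2) N (π₁ s₅)) , ∧⁺ {⌊ p ∣? n ⌋} (π₁ s₂) (π₁ s₃)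

 β⁺ : ∀ n p → N N.< n → p ∈ facs₁ → T (pair n p) → T (β ei ej N n)
 β⁺ n p N<n i t = any⁺ _ (range 1 (suc n)) (subst (p ∈_) (rg≡range 1 (suc n)) (∈-range⁺ (prime≥1 hp) (s≤s (∣.∣⇒≤ ⦃ N.>-nonZero (N.≤-<-trans z≤n N<n) ⦄ d))))
   (∧⁺ {isPrime p} (⌊⌋⁺ hp) (∧⁺ {⌊ p ∣? n ⌋} (π₁ (∧⁻ {⌊ p ∣? n ⌋} t)) (∧⁺ {isPrime m} (π₂ (∧⁻ {⌊ p ∣? n ⌋} t)) (∧⁺ {N N.^ ei N.<ᵇ p N.^ ej} (N.<⇒<ᵇ (π₁ (π₂ (facs₁⁻ i))))
    (∧⁺ {p N.^ 2 N.≤ᵇ N} (N.≤⇒≤ᵇ (reflexive (cong (p N.*_) (N.*-identityʳ p)) ⨟ π₂ (π₂ (facs₁⁻ i)))) (N.<⇒<ᵇ (N.<-≤-trans (large {p} (π₂ (π₂ (facs₁⁻ i))) (N.<-≤-trans N<n (reflexive (sym (cofactor hp d))))) (reflexive (cong (m N.*_) (sym (N.*-identityʳ m)))))))))))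
  where
  hp = π₁ (facs₁⁻ i)
  d = ⌊⌋⁻ {d = p ∣? n} (π₁ (∧⁻ {⌊ p ∣? n ⌋} t))
  m = n N./ suc (p ∸ 1)

 pair-unique : ∀ n p q → N N.< n → p ∈ facs₁ → q ∈ facs₁ → T (pair n p) → T (pair n q) → q ≡ p
 pair-unique n p q N<n i j t s = [ prime∣prime hq hp , (λ d → ⊥-elim (N.<⇒≱ (large {p} (π₂ (π₂ (facs₁⁻ i))) (N.<-≤-trans N<n (reflexive (sym eq)))) (subst (λ z → z N.* z N.≤ N) (prime∣prime hq hm d) (π₂ (π₂ (facs₁⁻ j)))))) ]′
   (euclidsLemma p m hq (subst (q ∣_) (sym eq) (⌊⌋⁻ {d = q ∣? n} (π₁ (∧⁻ {⌊ q ∣? n ⌋} s)))))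
  where
  hp = π₁ (facs₁⁻ i)
  hq = π₁ (facs₁⁻ j)
  m = n N./ suc (p ∸ 1)
  hm : Prime m
  hm = ⌊⌋⁻ {d = prime? m} (π₂ (∧⁻ {⌊ p ∣? n ⌋} t))
  eq = cofactor hp (⌊⌋⁻ {d = p ∣? n} (π₁ (∧⁻ {⌊ p ∣? n ⌋} t)))

 β-∑ : ∀ n → N N.< n → 𝟙 (β ei ej N n) ≡ ∑ facs₁ (λ p → 𝟙 (pair n p))
 β-∑ n N<n with β ei ej N n in eq
 ... | true = let p , i , t = β⁻ n (subst T (sym eq) tt) in sym (∑-unique facs₁ unique-facs₁ (λ p → 𝟙 (pair n p)) i (λ q j ne → 𝟙-false λ s → ne (pair-unique n p q N<n i j t s)) ∙ 𝟙-true t)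
 ... | false = sym (∑-zero facs₁ λ p i → 𝟙-false λ t → subst T eq (β⁺ n p N<n i t))

 -- The existential in `β` becomes a sum because n > N has at most one admissible smaller factor.
 β-pairs : ∀ (ψ : ℕ → 𝔽) → ∑ (rg (suc N) (suc (2 N.* N))) (λ n → 𝟙 (β ei ej N n) * ψ n) ≡ ∑ facs₁ (λ p → ∑ (facs₂ p) (λ m → ψ (p N.* m)))
 β-pairs ψ = (∑-cong (rg (suc N) (suc (2 N.* N))) λ n m → cong (_* ψ n) (β-∑ n (π₁ (∈-range⁻ m))) ∙ sym (∑-scaleʳ facs₁ (ψ n) _)) ∙
  ∑-swap (rg (suc N) (suc (2 N.* N))) facs₁ _ ∙ (∑-cong facs₁ λ p i → per p (prime≥1 (π₁ (facs₁⁻ i))))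
  where
  per : ∀ p → 1 N.≤ p → ∑ (rg (suc N) (suc (2 N.* N))) (λ n → 𝟙 (pair n p) * ψ n) ≡ ∑ (facs₂ p) (λ m → ψ (p N.* m))
  per p p≥1 = (∑-ext (rg (suc N) (suc (2 N.* N))) λ n → cong (_* ψ n) (𝟙-∧ ⌊ p ∣? n ⌋ (isPrime (n N./ suc (p ∸ 1)))) ∙ *-assoc (𝟙 ⌊ p ∣? n ⌋) (𝟙 (isPrime (n N./ suc (p ∸ 1)))) (ψ n)) ∙
   ∑-multiples-between p≥1 N (2 N.* N) (N.m≤m+n N _) (λ n → 𝟙 (isPrime (n N./ suc (p ∸ 1))) * ψ n) ∙
    cong₂ (λ x y → ∑ (rg (suc x) (suc y)) (λ m → 𝟙 (isPrime ((p N.* m) N./ suc (p ∸ 1))) * ψ (p N.* m))) (div-quot p≥1 N) (div-quot p≥1 (2 N.* N)) ∙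
     (∑-ext (rg (suc (N N./ suc (p ∸ 1))) (suc (2 N.* N N./ suc (p ∸ 1)))) λ m → cong (λ z → 𝟙 (isPrime z) * ψ (p N.* m)) (div-mul m p≥1)) ∙ sym (∑-primes _ _ (λ m → ψ (p N.* m)))

 facs₂⁻ : ∀ {p m} → p ∈ facs₁ → m ∈ facs₂ p → Prime m × N N.< m N.* m × N N.< p N.* m
 facs₂⁻ {p} {m} i j = hm , large {p} (π₂ (π₂ (facs₁⁻ i))) l , l
  where
  hp = π₁ (facs₁⁻ i)
  hm = π₁ (∈-primes⁻ j)
  l : N N.< p N.* m
  l = N.<-≤-trans (n<[1+n/L]L N (suc (p ∸ 1))) (N.*-monoˡ-≤ (suc (p ∸ 1)) (π₁ (π₂ (∈-primes⁻ j))) ⨟ reflexive (cong (m N.*_) (suc-pred′ (prime≥1 hp)) ∙ N.*-comm m p))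

mem : ℕ → List ℕ → Bool
mem p [] = false
mem p (q ∷ D) = (p N.≡ᵇ q) ∨ mem p D

rem : ℕ → List ℕ → List ℕ
rem p [] = []
rem p (q ∷ D) = if p N.≡ᵇ q then D else q ∷ rem p D

mem⁻ : ∀ p D → T (mem p D) → p ∈ D
mem⁻ p (q ∷ D) t with p N.≡ᵇ q in eq
... | true = here (N.≡ᵇ⇒≡ p q (subst T (sym eq) tt))
... | false = there (mem⁻ p D t)

mem⁺ : ∀ {p} D → p ∈ D → T (mem p D)
mem⁺ {p} (q ∷ D) (here refl) with q N.≡ᵇ q in eq
... | true = tt
... | false = ⊥-elim (subst T eq (N.≡⇒≡ᵇ q q refl))
mem⁺ {p} (q ∷ D) (there i) with p N.≡ᵇ q
... | true = tt
... | false = mem⁺ D i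

rem-⊆ : ∀ p D → rem p D ⊆ D
rem-⊆ p [] = []
rem-⊆ p (q ∷ D) with p N.≡ᵇ q
... | true = q ∷ʳ ⊆-refl
... | false = refl ∷ rem-⊆ p D

rem-prod : ∀ {p} D (f : ℕ → 𝔽) → p ∈ D → ∏ f D ≡ f p * ∏ f (rem p D)
rem-prod {p} (q ∷ D) f i with p N.≡ᵇ q in eq
... | true = cong (λ z → f z * ∏ f D) (sym (N.≡ᵇ⇒≡ p q (subst T (sym eq) tt)))
rem-prod {p} (q ∷ D) f (here refl) | false = ⊥-elim (subst T eq (N.≡⇒≡ᵇ q q refl))
rem-prod {p} (q ∷ D) f (there i) | false = cong (f q *_) (rem-prod D f i) ∙ *-swap (f q) (f p) _

rem-lsum : ∀ {p} D → p ∈ D → lsum D ≡ lg p N.+ lsum (rem p D)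
rem-lsum {p} (q ∷ D) i with p N.≡ᵇ q in eq
... | true = cong (λ z → lg z N.+ lsum D) (sym (N.≡ᵇ⇒≡ p q (subst T (sym eq) tt)))
rem-lsum {p} (q ∷ D) (here refl) | false = ⊥-elim (subst T eq (N.≡⇒≡ᵇ q q refl))
rem-lsum {p} (q ∷ D) (there i) | false = cong (lg q N.+_) (rem-lsum D i) ∙ sym (N.+-assoc (lg q) (lg p) _) ∙ cong (N._+ lsum (rem p D)) (N.+-comm (lg q) (lg p)) ∙ N.+-assoc (lg p) (lg q) _

rem-∉ : ∀ p D → Unique D → p ∉ rem p D
rem-∉ p (q ∷ D) (q∉ ∷ u) i with p N.≡ᵇ q in eq
... | true = All.lookup q∉ i (sym (N.≡ᵇ⇒≡ p q (subst T (sym eq) tt)))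
rem-∉ p (q ∷ D) (q∉ ∷ u) (here refl) | false = subst T eq (N.≡⇒≡ᵇ q q refl)
rem-∉ p (q ∷ D) (q∉ ∷ u) (there i) | false = rem-∉ p D u i

-- Removing p is injective on the sets that contain it and takes away one factor c.
SubSum-rem : ∀ c ps p → Unique ps → ∀ {F : List ℕ → 𝔽} → (∀ D → # 0 ≤ F D) → SubSum c ps (λ D → 𝟙 (mem p D) * F (rem p D)) ≤ # c * SubSum c ps F
SubSum-rem c [] p u {F} h = 0* (F []) ≡⨾ *≥0 (#≥0 c) (h [])
SubSum-rem c (q ∷ ps) p (q∉ ∷ u) {F} h with p N.≡ᵇ q in eq
... | true = ≡⇒≤ (SubSum-zero ⊹ cong (# c *_) (SubSum-cong c ps λ D _ → 1* (F D))) ⨾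
   lin (*≥0 (#≥0 c) (*≥0 (#≥0 c) (SubSum-nonneg c ps λ D _ → h (q ∷ D)))) (solve 3 (λ c a b → c :* (a :+ c :* b) :+ (κ 0) := (κ 0 :+ c :* a) :+ c :* (c :* b)) refl (# c) (SubSum c ps F) (SubSum c ps (F ∘ (q ∷_))))
 where
 _⊹_ : ∀ {a b a' b' : 𝔽} → a ≡ a' → b ≡ b' → a + b ≡ a' + b'
 refl ⊹ refl = refl
 SubSum-zero : SubSum c ps (λ D → 𝟙 (mem p D) * F (rem p D)) ≡ # 0
 SubSum-zero = (SubSum-cong c ps λ D s → cong (_* F (rem p D)) (𝟙-false λ t → All.lookup q∉ (Sublist.lookup s (mem⁻ p D t)) (sym (N.≡ᵇ⇒≡ p q (subst T (sym eq) tt)))) ∙ solve 1 (λ a → κ 0 :* a := κ 0 :* κ 0) refl (F (rem p D))) ∙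
   SubSum-scale c ps (# 0) (λ _ → # 0) ∙ 0* _
... | false = SubSum-rem c ps p u h ⊕ scale (#≥0 c) (SubSum-rem c ps p u λ D → h (q ∷ D)) ⨾ ≡⇒≤ (solve 3 (λ c a b → c :* a :+ c :* (c :* b) := c :* (a :+ c :* b)) refl (# c) (SubSum c ps F) (SubSum c ps (F ∘ (q ∷_))))

-- Counting in residue classes determined by the five linear forms

H₅ : List ℕ
H₅ = 0 ∷ 2 ∷ 6 ∷ 8 ∷ 12 ∷ []

H₅≤12 : ∀ {h} → h ∈ H₅ → h N.≤ 12
H₅≤12 (here refl) = z≤n
H₅≤12 (there (here refl)) = N.m≤m+n 2 10
H₅≤12 (there (there (here refl))) = N.m≤m+n 6 6
H₅≤12 (there (there (there (here refl)))) = N.m≤m+n 8 4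
H₅≤12 (there (there (there (there (here refl))))) = N.≤-refl

others : ℕ → List ℕ
others h = filterᵇ (λ h' → not (h' N.≡ᵇ h)) H₅

H₅-split : ∀ {h} → h ∈ H₅ → (f : ℕ → 𝔽) → ∑ H₅ f ≡ ∑ (others h) f + f h
H₅-split (here refl) f = solve 5 (λ a b c d e → a :+ (b :+ (c :+ (d :+ (e :+ κ 0)))) := b :+ (c :+ (d :+ (e :+ κ 0))) :+ a) refl (f 0) (f 2) (f 6) (f 8) (f 12)
H₅-split (there (here refl)) f = solve 5 (λ a b c d e → a :+ (b :+ (c :+ (d :+ (e :+ κ 0)))) := a :+ (c :+ (d :+ (e :+ κ 0))) :+ b) refl (f 0) (f 2) (f 6) (f 8) (f 12)
H₅-split (there (there (here refl))) f = solve 5 (λ a b c d e → a :+ (b :+ (c :+ (d :+ (e :+ κ 0)))) := a :+ (b :+ (d :+ (e :+ κ 0))) :+ c) refl (f 0) (f 2) (f 6) (f 8) (f 12)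
H₅-split (there (there (there (here refl)))) f = solve 5 (λ a b c d e → a :+ (b :+ (c :+ (d :+ (e :+ κ 0)))) := a :+ (b :+ (c :+ (e :+ κ 0))) :+ d) refl (f 0) (f 2) (f 6) (f 8) (f 12)
H₅-split (there (there (there (there (here refl))))) f = solve 5 (λ a b c d e → a :+ (b :+ (c :+ (d :+ (e :+ κ 0)))) := a :+ (b :+ (c :+ (d :+ κ 0))) :+ e) refl (f 0) (f 2) (f 6) (f 8) (f 12)

others⁻ : ∀ {h h'} → h ∈ H₅ → h' ∈ others h → h' ∈ H₅ × h' ≢ h
others⁻ {h} {h'} _ i = let m = ∈-filter⁻ (λ x → Bool.T? (not (x N.≡ᵇ h))) {xs = H₅} i in π₁ m , λ { refl → not-self h' (π₂ m) }
 where
 not-self : ∀ h → ¬ T (not (h N.≡ᵇ h))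
 not-self h t with h N.≡ᵇ h in eq
 ... | false = subst T eq (N.≡⇒≡ᵇ h h refl)

length-others : ∀ {h} → h ∈ H₅ → length (others h) ≡ 4
length-others (here refl) = refl
length-others (there (here refl)) = refl
length-others (there (there (here refl))) = refl
length-others (there (there (there (here refl)))) = refl
length-others (there (there (there (there (here refl))))) = refl

-- n ≡ - h' (mod p)
root : ℕ → ℕ → ℕ
root h' p = h' N.* (p ∸ 1)

root-+ : ∀ h' {p} → 1 N.≤ p → root h' p N.+ h' ≡ h' N.* p
root-+ h' {p} p≥1 = N.+-comm (root h' p) h' ∙ sym (N.*-suc h' (p ∸ 1)) ∙ cong (h' N.*_) (suc-pred′ p≥1)

cong?-shift : ∀ q r n h → 1 N.≤ q → 𝟙 (cong? q r n) ≡ 𝟙 (cong? q (r N.+ h) (n N.+ h))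
cong?-shift q r n h q≥1 = 𝟙-cong (λ t → cong?⁺ q {r N.+ h} {n N.+ h} (mod-+ q {n} {r} h (cong?⁻ q {r} {n} t)))
 (λ t → cong?⁺ q {r} {n} (sym (back n) ∙ mod-+ q {n N.+ h} {r N.+ h} (root h q) (cong?⁻ q {r N.+ h} {n N.+ h} t) ∙ back r))
 where
 back : ∀ x → (x N.+ h N.+ root h q) mod q ≡ x mod q
 back x = cong (_mod q) (N.+-assoc x h _ ∙ cong (x N.+_) (N.+-comm h _ ∙ root-+ h q≥1)) ∙ mod-add q x h q≥1

exclusive : ∀ {p h h'} → 1 N.≤ p → h N.< p → h' N.< p → h ≢ h' → ∀ n → 𝟙 (cong? p (root h p) n) * 𝟙 (cong? p (root h' p) n) ≡ # 0
exclusive {p} {h} {h'} p≥1 h<p h'<p ne n = sym (𝟙-∧ (cong? p (root h p) n) (cong? p (root h' p) n)) ∙ (𝟙-false λ t → ne (small-mod (sym (zero-side h' h) ∙ lift t ∙ zero-side′ h h')))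
 where
 lift : T (cong? p (root h p) n ∧ cong? p (root h' p) n) → (root h' p N.+ (h N.+ h')) mod p ≡ (root h p N.+ (h N.+ h')) mod p
 lift t = mod-+ p {root h' p} {root h p} (h N.+ h') (sym (cong?⁻ p {root h' p} {n} (π₂ (∧⁻ {cong? p (root h p) n} t))) ∙ cong?⁻ p {root h p} {n} (π₁ (∧⁻ {cong? p (root h p) n} t)))
 zero-side : ∀ h' h → (root h' p N.+ (h N.+ h')) mod p ≡ h mod p
 zero-side h' h = cong (_mod p) (cong (root h' p N.+_) (N.+-comm h h') ∙ sym (N.+-assoc (root h' p) h' h) ∙ cong (N._+ h) (root-+ h' p≥1) ∙ N.+-comm (h' N.* p) h) ∙ mod-add p h h' p≥1
 zero-side′ : ∀ h h' → (root h p N.+ (h N.+ h')) mod p ≡ h' mod p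
 zero-side′ h h' = cong (λ z → (root h p N.+ z) mod p) (N.+-comm h h') ∙ zero-side h h'
 small-mod : h mod p ≡ h' mod p → h ≡ h'
 small-mod e = N.∣m-n∣≡0⇒m≡n (divides-small (mod-∣ p {h} {h'} p≥1 e) (N.≤-<-trans (N.∣m-n∣≤m⊔n h h') (N.⊔-lub h<p h'<p)))
  where
  divides-small : ∀ {d} → p ∣ d → d N.< p → d ≡ 0
  divides-small {zero} _ _ = refl
  divides-small {suc d} dv l = ⊥-elim (N.<⇒≱ l (∣.∣⇒≤ dv))

R₅ : ℕ → List ℕ
R₅ p = map (λ h' → root h' p) H₅

-- The indicator of p | ∏ (n + h), written as a sum over the five roots, which are distinct modulo p
-- ≥ 32.
hh : ℕ → ℕ → 𝔽
hh p n = ∑ (R₅ p) (λ r → 𝟙 (cong? p r n))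

hh-idem : ∀ p → 32 N.≤ p → ∀ n → hh p n * hh p n ≡ hh p n
hh-idem p p≥ n = go H₅ (λ i → i) unique-H₅
 where
 f : ℕ → 𝔽
 f r = 𝟙 (cong? p r n)
 unique-H₅ : Unique H₅
 unique-H₅ = ((λ ()) ∷ (λ ()) ∷ (λ ()) ∷ (λ ()) ∷ []) ∷ ((λ ()) ∷ (λ ()) ∷ (λ ()) ∷ []) ∷ ((λ ()) ∷ (λ ()) ∷ []) ∷ ((λ ()) ∷ []) ∷ [] ∷ []
 <p : ∀ {h} → h ∈ H₅ → h N.< p
 <p i = N.≤-<-trans (H₅≤12 i) (N.<-≤-trans (N.m≤m+n 13 19) p≥)
 cross : ∀ h xs → h ∈ H₅ → (∀ {x} → x ∈ xs → x ∈ H₅) → All (h ≢_) xs → f (root h p) * ∑ (map (λ h' → root h' p) xs) f ≡ # 0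
 cross h [] i k a = *0 _
 cross h (x ∷ xs) i k (ne ∷ a) = solve 3 (λ a b c → a :* (b :+ c) := a :* b :+ a :* c) refl (f (root h p)) (f (root x p)) (∑ (map (λ h' → root h' p) xs) f) ∙
   cong₂ _+_ (exclusive {p} {h} {x} (s≤s z≤n ⨟ p≥) (<p i) (<p (k (here refl))) ne n) (cross h xs i (λ j → k (there j)) a) ∙ solve 0 (κ 0 :+ κ 0 := κ 0) refl
 go : ∀ xs → (∀ {x} → x ∈ xs → x ∈ H₅) → Unique xs → ∑ (map (λ h' → root h' p) xs) f * ∑ (map (λ h' → root h' p) xs) f ≡ ∑ (map (λ h' → root h' p) xs) f
 go [] k u = solve 0 (κ 0 :* κ 0 := κ 0) refl
 go (x ∷ xs) k (x∉ ∷ u) = solve 2 (λ a s → (a :+ s) :* (a :+ s) := a :* a :+ κ 2 :* (a :* s) :+ s :* s) refl (f (root x p)) S ∙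
   cong₂ _+_ (cong₂ (λ y z → y + # 2 * z) (𝟙-idem (cong? p (root x p) n)) (cross x xs (k (here refl)) (λ j → k (there j)) x∉)) (go xs (λ j → k (there j)) u) ∙ solve 2 (λ a s → a :+ κ 2 :* κ 0 :+ s := a :+ s) refl (f (root x p)) S
  where S = ∑ (map (λ h' → root h' p) xs) f

prod-cong : ∀ D {f g : ℕ → 𝔽} → (∀ p → p ∈ D → f p ≡ g p) → ∏ f D ≡ ∏ g D
prod-cong [] h = refl
prod-cong (p ∷ D) h = cong₂ _*_ (h p (here refl)) (prod-cong D λ q i → h q (there i))

inv-Π : ∀ D → (∀ p → p ∈ D → Prime p) → inv (Π D) ≡ ∏ inv D
inv-Π [] h = inv-1
inv-Π (p ∷ D) h = inv-* p (Π D) (prime≥1 (h p (here refl))) (Π≥1 D λ q i → h q (there i)) ∙ cong (inv p *_) (inv-Π D λ q i → h q (there i))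

^-prod : ∀ k D (f : ℕ → 𝔽) → # k ^ length D * ∏ f D ≡ ∏ (λ p → # k * f p) D
^-prod k [] f = solve 0 (κ 1 :* κ 1 := κ 1) refl
^-prod k (p ∷ D) f = *-interchange (# k) (# k ^ length D) (f p) _ ∙ cong (# k * f p *_) (^-prod k D f)

module Classes (ws : List ℕ) (ws-prime : ∀ p → p ∈ ws → Prime p) (ν : ℕ) where

 W : ℕ
 W = Π ws

 W≥1 : 1 N.≤ W
 W≥1 = Π≥1 ws ws-prime

 Admissible : List ℕ → Set
 Admissible D = (∀ p → p ∈ D → Prime p × 32 N.≤ p × p ∉ ws) × Unique D

 adm : ∀ {D} → Admissible D → ∀ p → p ∈ D → Prime p × ¬ (p ∣ W)
 adm (h , _) p i = π₁ (h p i) , λ d → π₂ (π₂ (h p i)) (prime∣Π ws (π₁ (h p i)) ws-prime d)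

 adm-rem : ∀ {D} q → Admissible D → Admissible (rem q D)
 adm-rem {D} q (h , u) = (λ p i → h p (Sublist.lookup (rem-⊆ q D) i)) , Unique-⊆ (rem-⊆ q D) u

 plain-count : ∀ b n {D} → Admissible D → Abs≤ (∑ (rg b (b N.+ n)) (λ m → 𝟙 (cong? W ν m) * ∏ (λ p → hh p m) D) - # n * inv W * ∏ (λ p → # 5 * inv p) D) (# 5 ^ length D)
 plain-count b n {D} a@(h , u) = subst₂ Abs≤ (cong₂ _-_ (∑-ext (rg b (b N.+ n)) λ m → solve 2 (λ x y → κ 1 :* x :* y := x :* y) refl (𝟙 (cong? W ν m)) (∏ (λ p → hh p m) D)) main) (*1 (# 5 ^ length D))
   (split D W ν W≥1 tt (λ p i → π₁ (adm a p i) , π₂ (adm a p i) , refl) u (λ _ _ _ _ _ _ _ _ _ _ → tt)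
    (λ c _ → subst (λ z → Abs≤ z (# 1)) (cong (_- # n * inv (W N.* Π D)) (∑-ext (rg b (b N.+ n)) λ m → 1*˘ (𝟙 (cong? (W N.* Π D) c m)))) (class-count (WΠ≥1 W≥1 D (adm a) u) c b n)))
  where
  open Splitting (rg b (b N.+ n)) (λ _ → # 1) R₅ 5 (λ _ _ → ⊤)
  main : # 5 ^ length D * (# n * inv (W N.* Π D)) ≡ # n * inv W * ∏ (λ p → # 5 * inv p) D
  main = cong (λ z → # 5 ^ length D * (# n * z)) (inv-* W (Π D) W≥1 (Π≥1 D λ p i → π₁ (h p i)) ∙ cong (inv W *_) (inv-Π D λ p i → π₁ (h p i))) ∙
   solve 4 (λ f n w d → f :* (n :* (w :* d)) := n :* w :* (f :* d)) refl (# 5 ^ length D) (# n) (inv W) (∏ inv D) ∙ cong (# n * inv W *_) (^-prod 5 D inv)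

 1/φ-Π : ∀ {D} → Admissible D → inv (φ (W N.* Π D)) ≡ inv (φ W) * ∏ δf D
 1/φ-Π {D} a@(h , u) = sym (inv-unique (φ (W N.* Π D)) (φ≥1 _ (WΠ≥1 W≥1 D (adm a) u)) (cong (_* (inv (φ W) * ∏ δf D)) (φ-Π D W W≥1 (adm a) u) ∙
   *-interchange (# (φ W)) (∏ (λ p → # p - # 1) D) (inv (φ W)) (∏ δf D) ∙ cong₂ _*_ (#-inv (φ W) (φ≥1 W W≥1)) (prod-* D _ δf ∙ (ones D λ p i → π₁ (h p i))) ∙ solve 0 (κ 1 :* κ 1 := κ 1) refl))
  where
  ones : ∀ D → (∀ p → p ∈ D → Prime p) → ∏ (λ p → (# p - # 1) * δf p) D ≡ # 1
  ones [] h = refl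
  ones (p ∷ D) h = cong₂ _*_ (cong (_* δf p) (cong (_- # 1) (cong #_ (sym (N.m+[n∸m]≡n (prime≥1 (h p (here refl))))) ∙ #-suc (p ∸ 1)) ∙ solve 1 (λ a → κ 1 :+ a :- κ 1 := a) refl (# (p ∸ 1))) ∙
    #-inv (p ∸ 1) (N.∸-monoˡ-≤ 1 (prime≥2 (h p (here refl))))) (ones D λ q i → h q (there i)) ∙ solve 0 (κ 1 :* κ 1 := κ 1) refl

 module SemiPrimeClasses (ei ej N : ℕ) (N≥12 : 12 N.≤ N) (h : ℕ) (h∈ : h ∈ H₅) (ν+h : Cop.Coprime (ν N.+ h) W) (small-ws : ∀ p → p ∈ ws → p N.* p N.≤ N) where

  open SemiPrimes ei ej N

  -- The roots of the other four forms, in terms of the variable m = n + h.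
  R₄ : ℕ → List ℕ
  R₄ p = map (λ h' → root h' p N.+ h) (others h)

  hit₄ : ℕ → ℕ → 𝔽
  hit₄ p m = ∑ (R₄ p) (λ r → 𝟙 (cong? p r m))

  private
   <p : ∀ {p h} → 32 N.≤ p → h ∈ H₅ → h N.< p
   <p p≥ i = N.≤-<-trans (H₅≤12 i) (N.<-≤-trans (N.m≤m+n 13 19) p≥)

  hh-split : ∀ {p} m → 32 N.≤ p → h N.≤ m → hh p (m ∸ h) ≡ hit₄ p m + 𝟙 (cong? p (root h p) (m ∸ h))
  hh-split {p} m p≥ h≤m = ∑-map (λ h' → root h' p) H₅ (λ r → 𝟙 (cong? p r (m ∸ h))) ∙ H₅-split h∈ (λ h' → 𝟙 (cong? p (root h' p) (m ∸ h))) ∙ cong (_+ 𝟙 (cong? p (root h p) (m ∸ h))) ((∑-ext (others h) λ h' → cong?-shift p (root h' p) (m ∸ h) h (s≤s z≤n ⨟ p≥) ∙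
    cong (λ z → 𝟙 (cong? p (root h' p N.+ h) z)) (N.m∸n+n≡m h≤m)) ∙ sym (∑-map (λ h' → root h' p N.+ h) (others h) _))

  root-∣ : ∀ {p} m → 1 N.≤ p → h N.≤ m → 𝟙 (cong? p (root h p) (m ∸ h)) ≡ 𝟙 ⌊ p ∣? m ⌋
  root-∣ {p} m p≥1 h≤m = cong?-shift p (root h p) (m ∸ h) h p≥1 ∙ cong₂ (λ y z → 𝟙 (cong? p y z)) (root-+ h p≥1) (N.m∸n+n≡m h≤m) ∙ 𝟙-cong
    (λ t → ⌊⌋⁺ (mod-zero⁻ p p≥1 (cong?⁻ p {h N.* p} {m} t ∙ mod-zero p p≥1 (∣.n∣m*n h)))) (λ t → cong?⁺ p {h N.* p} {m} (mod-zero p p≥1 (⌊⌋⁻ {d = p ∣? m} t) ∙ sym (mod-zero p p≥1 (∣.n∣m*n h))))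

  hit₄-∤ : ∀ {p} m → 32 N.≤ p → h N.≤ m → ¬ (p ∣ m) → hh p (m ∸ h) ≡ hit₄ p m
  hit₄-∤ {p} m p≥ h≤m d = hh-split m p≥ h≤m ∙ cong (hit₄ p m +_) (root-∣ m (s≤s z≤n ⨟ p≥) h≤m ∙ (𝟙-false λ t → d (⌊⌋⁻ {d = p ∣? m} t))) ∙ +0 (hit₄ p m)

  hit₄-∣ : ∀ {p} m → 32 N.≤ p → h N.≤ m → p ∣ m → hit₄ p m ≡ # 0 × hh p (m ∸ h) ≡ # 1
  hit₄-∣ {p} m p≥ h≤m d = zero₄ , hh-split m p≥ h≤m ∙ cong₂ _+_ zero₄ one ∙ solve 0 (κ 0 :+ κ 1 := κ 1) refl
   where
   p≥1 = s≤s z≤n ⨟ p≥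
   one : 𝟙 (cong? p (root h p) (m ∸ h)) ≡ # 1
   one = root-∣ m p≥1 h≤m ∙ 𝟙-true (⌊⌋⁺ d)
   zero₄ : hit₄ p m ≡ # 0
   zero₄ = ∑-map (λ h' → root h' p N.+ h) (others h) _ ∙ (∑-zero (others h) λ h' i → sym (cong?-shift p (root h' p) (m ∸ h) h p≥1 ∙ cong (λ z → 𝟙 (cong? p (root h' p N.+ h) z)) (N.m∸n+n≡m h≤m)) ∙
    *1˘ _ ∙ cong (𝟙 (cong? p (root h' p) (m ∸ h)) *_) (sym one) ∙ exclusive {p} {h'} {h} p≥1 (<p p≥ (π₁ (others⁻ h∈ i))) (<p p≥ h∈) (π₂ (others⁻ h∈ i)) (m ∸ h))

  hit₄-bounds : ∀ p m → # 0 ≤ hit₄ p m × hit₄ p m ≤ # 4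
  hit₄-bounds p m = ∑≥0 (R₄ p) (λ r _ → 𝟙≥0 _) , (∑-mono (R₄ p) λ r _ → 𝟙≤1 _) ⨾ ≡⇒≤ (∑-const (R₄ p) (# 1) ∙ cong (λ n → # n * # 1) (List.length-map _ (others h) ∙ length-others h∈) ∙ solve 0 (κ 4 :* κ 1 := κ 4) refl)

  prod-hit₄ : ∀ m D → # 0 ≤ ∏ (λ p → hit₄ p m) D × ∏ (λ p → hit₄ p m) D ≤ # 4 ^ length D
  prod-hit₄ m [] = 0≤1 , ≤-refl
  prod-hit₄ m (p ∷ D) = *≥0 (π₁ (hit₄-bounds p m)) (π₁ (prod-hit₄ m D)) , *-mono (π₁ (prod-hit₄ m D)) (#≥0 4) (π₂ (hit₄-bounds p m)) (π₂ (prod-hit₄ m D))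

  root-coprime : ∀ {p h'} → Prime p → 32 N.≤ p → h' ∈ others h → ¬ (p ∣ root h' p N.+ h)
  root-coprime {p} {h'} hp p≥ i d = absurd
   where
   p≥1 = prime≥1 hp
   m = root h' p N.+ h
   absurd : ⊥
   absurd = 0≢1 (≡⇒≤ (sym (cong₂ _*_ (𝟙-true {cong? p (root h' p) (root h' p)} (cong?⁺ p {root h' p} {root h' p} refl)) (sym (cong (λ z → 𝟙 (cong? p (root h p) z)) (N.m+n∸n≡m (root h' p) h)) ∙ root-∣ m p≥1 (N.m≤n+m h _) ∙ 𝟙-true (⌊⌋⁺ d)) ∙ solve 0 (κ 1 :* κ 1 := κ 1) refl) ∙
     exclusive {p} {h'} {h} p≥1 (<p p≥ (π₁ (others⁻ h∈ i))) (<p p≥ h∈) (π₂ (others⁻ h∈ i)) (root h' p)))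

  -- A prime p of D is at most √N and so differs from the larger factor m. If p is not q, it does
  -- not divide q m and can only hit through the other four forms. If q belongs to D, then q hits
  -- through n + h itself and through no other form, which kills the first product and leaves a
  -- condition on D without q.
  factor-dichotomy : ∀ {D} → Admissible D → (∀ p → p ∈ D → p N.* p N.≤ N) → ∀ {q m} → q ∈ facs₁ → m ∈ facs₂ q →
            ∏ (λ p → hh p (q N.* m ∸ h)) D ≡ ∏ (λ p → hit₄ p (q N.* m)) D + 𝟙 (mem q D) * ∏ (λ p → hit₄ p (q N.* m)) (rem q D)
  factor-dichotomy {D} a@(hD , u) small {q} {m} i j = by-mem (mem q D) refl
   where
   n = q N.* m
   f2 = facs₂⁻ i j
   hq = π₁ (facs₁⁻ i)
   h≤n : h N.≤ n
   h≤n = H₅≤12 h∈ ⨟ N≥12 ⨟ N.<⇒≤ (π₂ (π₂ f2))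
   divides-n : ∀ p → Prime p → p N.* p N.≤ N → p ∣ n → p ≡ q
   divides-n p hp pp d = [ prime∣prime hp hq , (λ e → ⊥-elim (N.<⇒≱ (π₁ (π₂ f2)) (subst (λ z → z N.* z N.≤ N) (prime∣prime hp (π₁ f2) e) pp))) ]′ (euclidsLemma q m hp d)
   away : ∀ D' → (∀ p → p ∈ D' → p ∈ D × p ≢ q) → ∏ (λ p → hh p (n ∸ h)) D' ≡ ∏ (λ p → hit₄ p n) D'
   away D' k = prod-cong D' λ p l → let pD = π₁ (k p l) in hit₄-∤ n (π₁ (π₂ (hD p pD))) h≤n λ d → π₂ (k p l) (divides-n p (π₁ (hD p pD)) (small p pD) d)
   by-mem : ∀ b → mem q D ≡ b → ∏ (λ p → hh p (n ∸ h)) D ≡ ∏ (λ p → hit₄ p n) D + 𝟙 b * ∏ (λ p → hit₄ p n) (rem q D)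
   by-mem false e = (away D λ p l → l , λ { refl → subst T e (mem⁺ D l) }) ∙ solve 2 (λ a b → a := a :+ κ 0 :* b) refl _ _
   by-mem true e = rem-prod D _ q∈D ∙ cong₂ _*_ (π₂ hit) (away (rem q D) λ p l → Sublist.lookup (rem-⊆ q D) l , λ { refl → rem-∉ q D u l }) ∙
     solve 1 (λ a → κ 1 :* a := κ 0 :* a :+ κ 1 :* a) refl _ ∙ cong (_+ # 1 * ∏ (λ p → hit₄ p n) (rem q D)) (sym (rem-prod D _ q∈D ∙ cong (_* ∏ (λ p → hit₄ p n) (rem q D)) (π₁ hit)))
    where
    q∈D : q ∈ D
    q∈D = mem⁻ q D (subst T (sym e) tt)
    hit = hit₄-∣ n (π₁ (π₂ (hD q q∈D))) h≤n (∣.m∣m*n m)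

  small-coprime : ∀ {D} → Admissible D → ∀ q a c p → p ∈ D → Cop.Coprime a q → 1 N.≤ q → c mod q ≡ a mod q → ¬ (p ∣ c) → Cop.Coprime c (q N.* p)
  small-coprime {D} (hD , u) q a c p i cop q≥1 e p∤c {k} d = Cop.sym (coprime-*ˡ {q} {p} {c} (Cop.sym (coprime-mod q≥1 e cop)) (Cop.sym (prime-coprime (π₁ (hD p i)) p∤c))) {k} d

  ∤-mod : ∀ {p c r} → 1 N.≤ p → c mod p ≡ r mod p → ¬ (p ∣ r) → ¬ (p ∣ c)
  ∤-mod {p} p≥1 e h d = h (mod-zero⁻ p p≥1 (sym e ∙ mod-zero p p≥1 d))

  errE : ℕ → 𝔽
  errE = err {e2Discrepancy ei ej N}

  e2-eq : ∀ q a → fromℚᵘ (e2Discrepancy ei ej N q a) ≡ ∑ (rg (suc N) (suc (2 N.* N))) (λ n → 𝟙 (β ei ej N n) * 𝟙 (cong? q a n)) - # (πβq ei ej N q) * inv (φ q)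
  e2-eq q a = fromℚᵘ-+ (ℕ→ℚ (πβAP ei ej N q a)) (ℚᵘ.- frac (πβq ei ej N q) (φ q)) ∙ cong₂ _+_
   (fromℚᵘ-ℕ _ ∙ countIn-∑ (suc N) (suc (2 N.* N)) _ ∙ (∑-ext (rg (suc N) (suc (2 N.* N))) λ n → 𝟙-∧ ((n N.% suc (q ∸ 1)) N.≡ᵇ (a N.% suc (q ∸ 1))) (β ei ej N n) ∙
     *-comm (𝟙 ((n N.% suc (q ∸ 1)) N.≡ᵇ (a N.% suc (q ∸ 1)))) (𝟙 (β ei ej N n)) ∙ cong₂ (λ x y → 𝟙 (β ei ej N n) * 𝟙 (x N.≡ᵇ y)) (sym (mod-def q n)) (sym (mod-def q a))))
   (fromℚᵘ-neg (frac (πβq ei ej N q) (φ q)) ∙ cong -_ (fromℚᵘ-frac (πβq ei ej N q) (φ q)))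

  -- The other four forms fix 4^|D| classes prime to the modulus, and the discrepancy for products
  -- of two primes applies to each.
  part-A : ∀ {D} → Admissible D → Abs≤ (∑ (rg (suc N) (suc (2 N.* N))) (λ m → 𝟙 (β ei ej N m) * 𝟙 (cong? W (ν N.+ h) m) * ∏ (λ p → hit₄ p m) D) - # 4 ^ length D * (# (πβq ei ej N (W N.* Π D)) * inv (φ (W N.* Π D)))) (# 4 ^ length D * errE (W N.* Π D))
  part-A {D} a@(hD , u) = split D W (ν N.+ h) W≥1 (λ _ → ν+h) (λ p i → π₁ (adm a p i) , π₂ (adm a p i) , List.length-map _ (others h) ∙ length-others h∈) u clos leaf
   where
   open Splitting (rg (suc N) (suc (2 N.* N))) (λ m → 𝟙 (β ei ej N m)) R₄ 4 (λ q a → 1 N.≤ q → Cop.Coprime a q)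
   q = W N.* Π D
   q≥1 = WΠ≥1 W≥1 D (adm a) u
   clos : ∀ q a c p r → p ∈ D → r ∈ R₄ p → (1 N.≤ q → Cop.Coprime a q) → c mod q ≡ a mod q → c mod p ≡ r mod p → 1 N.≤ q N.* p → Cop.Coprime c (q N.* p)
   clos q′ a′ c p r i j g e e' qp≥1 = small-coprime a q′ a′ c p i (g q′≥1) q′≥1 e (∤-mod (prime≥1 (π₁ (hD p i))) e' not-root)
    where
    q′≥1 : 1 N.≤ q′
    q′≥1 = N.n≢0⇒n>0 λ { refl → N.<⇒≱ qp≥1 z≤n }
    not-root : ¬ (p ∣ r)
    not-root d = let k = ∈-map⁻ (λ h' → root h' p N.+ h) j in root-coprime (π₁ (hD p i)) (π₁ (π₂ (hD p i))) (π₁ (π₂ k)) (subst (p ∣_) (π₂ (π₂ k)) d)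
   leaf : ∀ c → (1 N.≤ q → Cop.Coprime c q) → Abs≤ (∑ (rg (suc N) (suc (2 N.* N))) (λ n → 𝟙 (β ei ej N n) * 𝟙 (cong? q c n)) - # (πβq ei ej N q) * inv (φ q)) (errE q)
   leaf c g = subst (λ z → Abs≤ z (errE q)) (e2-eq q (c mod q) ∙ cong (_- # (πβq ei ej N q) * inv (φ q)) (∑-ext (rg (suc N) (suc (2 N.* N))) λ n → cong (λ z → 𝟙 (β ei ej N n) * 𝟙 (n mod q N.≡ᵇ z)) (mod-idem q c)))
    (err-bound {e2Discrepancy ei ej N} q (c mod q) (mod-< q c q≥1) (coprime⁺ {c mod q} {q} (coprime-mod q≥1 (mod-idem q c) (g q≥1))))

  errP : ℕ → ℕ → 𝔽
  errP M = err {primeDiscrepancy M}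

  prime-eq : ∀ M q a → fromℚᵘ (primeDiscrepancy M q a) ≡ ∑ (rg M (2 N.* M)) (λ n → 𝟙 (isPrime n) * 𝟙 (cong? q a n)) - # (π♭ M) * inv (φ q)
  prime-eq M q a = fromℚᵘ-+ (ℕ→ℚ (π♭AP M q a)) (ℚᵘ.- frac (π♭ M) (φ q)) ∙ cong₂ _+_
   (fromℚᵘ-ℕ _ ∙ countIn-∑ M (2 N.* M) _ ∙ (∑-ext (rg M (2 N.* M)) λ n → 𝟙-∧ (isPrime n) _ ∙ cong₂ (λ x y → 𝟙 (isPrime n) * 𝟙 (x N.≡ᵇ y)) (sym (mod-def q n)) (sym (mod-def q a))))
   (fromℚᵘ-neg (frac (π♭ M) (φ q)) ∙ cong -_ (fromℚᵘ-frac (π♭ M) (φ q)))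

  -- The first integer m with p m > N; the partners of p are treated as primes in [M, 2 M) with this
  -- M.
  start : ℕ → ℕ
  start p = suc (N N./ suc (p ∸ 1))

  X : ℕ → 𝔽
  X p = ∑ (facs₂ p) (λ _ → # 1)

  module PartB (W≥2 : 2 N.≤ W) {q₁ : ℕ} (q₁∈ : q₁ ∈ facs₁) (q₁∉ws : q₁ ∉ ws) {D : List ℕ} (a : Admissible D) (q₁∉D : q₁ ∉ D) where

   private
    hD = π₁ a
    hq = π₁ (facs₁⁻ q₁∈)
    M = start q₁
    q = W N.* Π D
    q≥1 = WΠ≥1 W≥1 D (adm a) (π₂ a)

   inverse : ℕ → ℕ
   inverse p = choose (2 N.≤? p) (Cop.coprime? q₁ p)
    where
    choose : Dec (2 N.≤ p) → Dec (Cop.Coprime q₁ p) → ℕ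
    choose (yes x) (yes c) = π₁ (invert x c)
    -- A default for moduli not known to be at least 2 and prime to q₁; `inverse-eq` assumes both.
    choose _ _ = 0

   inverse-eq : ∀ p → 2 N.≤ p → Cop.Coprime q₁ p → ∃ λ k → inverse p N.* q₁ ≡ 1 N.+ k N.* p
   inverse-eq p p≥2 c with 2 N.≤? p | Cop.coprime? q₁ p
   ... | yes x | yes c′ = π₂ (invert x c′)
   ... | no x | _ = ⊥-elim (x p≥2)
   ... | yes _ | no x = ⊥-elim (x c)

   W-coprime : Cop.Coprime q₁ W
   W-coprime = Cop.sym (prime-coprime hq λ d → q₁∉ws (prime∣Π ws hq ws-prime d))

   D-coprime : ∀ p → p ∈ D → Cop.Coprime q₁ p
   D-coprime p i = prime-coprime (π₁ (hD p i)) λ d → q₁∉D (subst (_∈ D) (prime∣prime (π₁ (hD p i)) hq d) i)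

   undo : ∀ p → 2 N.≤ p → Cop.Coprime q₁ p → ∀ r → (q₁ N.* (inverse p N.* r)) mod p ≡ r mod p
   undo p p≥2 c r = let k , e = inverse-eq p p≥2 c in cong (_mod p) (sym (N.*-assoc q₁ (inverse p) r) ∙ cong (N._* r) (N.*-comm q₁ (inverse p) ∙ e) ∙ cong (r N.+_) (N.*-assoc k p r ∙ cong (k N.*_) (N.*-comm p r) ∙ sym (N.*-assoc k r p))) ∙
    mod-add p r (k N.* r) (N.<⇒≤ p≥2)

   -- When q₁ divides the modulus, q₁ m is not prime to it and the hypothesis for E₂ says nothing.
   -- Dividing by q₁ turns the condition into one on the prime m, where the hypothesis for primes
   -- applies.
   transfer : ∀ p → 2 N.≤ p → Cop.Coprime q₁ p → ∀ r m → 𝟙 (cong? p (inverse p N.* r) m) ≡ 𝟙 (cong? p r (q₁ N.* m))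
   transfer p p≥2 c r m = 𝟙-cong (λ t → cong?⁺ p {r} {q₁ N.* m} (mod-* p {m} {inverse p N.* r} q₁ (cong?⁻ p {inverse p N.* r} {m} t) ∙ undo p p≥2 c r))
    (λ t → cong?⁺ p {inverse p N.* r} {m} (sym (cong (_mod p) (sym (N.*-assoc (inverse p) q₁ m) ∙ cong (N._* m) (N.*-comm (inverse p) q₁) ∙ N.*-assoc q₁ (inverse p) m) ∙ undo p p≥2 c m) ∙
      mod-* p {q₁ N.* m} {r} (inverse p) (cong?⁻ p {r} {q₁ N.* m} t)))

   R : ℕ → List ℕ
   R p = map (inverse p N.*_) (R₄ p)

   private
    class = inverse W N.* (ν N.+ h)

    class-coprime : Cop.Coprime class W
    class-coprime {k} (x , y) = coprime-mod W≥1 (undo W W≥2 W-coprime (ν N.+ h)) ν+h (∣.∣n⇒∣m*n q₁ x , y)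

    f : ℕ → 𝔽
    f m = 𝟙 (cong? W (ν N.+ h) (q₁ N.* m)) * ∏ (λ p → hit₄ p (q₁ N.* m)) D

    f-bounds : ∀ m → # 0 ≤ f m × f m ≤ # 4 ^ length D
    f-bounds m = *≥0 (𝟙≥0 _) (π₁ (prod-hit₄ (q₁ N.* m) D)) , *-mono (π₁ (prod-hit₄ (q₁ N.* m) D)) 0≤1 (𝟙≤1 _) (π₂ (prod-hit₄ (q₁ N.* m) D)) ⨾ ≡⇒≤ (1* (# 4 ^ length D))

   full : Abs≤ (∑ (rg M (2 N.* M)) (λ m → 𝟙 (isPrime m) * f m) - # 4 ^ length D * (# (π♭ M) * inv (φ q))) (# 4 ^ length D * errP M q)
   full = subst (λ z → Abs≤ (z - # 4 ^ length D * (# (π♭ M) * inv (φ q))) (# 4 ^ length D * errP M q)) (∑-ext (rg M (2 N.* M)) λ m → *-assoc (𝟙 (isPrime m)) (𝟙 (cong? W class m)) (∏ (λ p → hit p m) D) ∙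
       cong (𝟙 (isPrime m) *_) (cong₂ _*_ (transfer W W≥2 W-coprime (ν N.+ h) m) (prod-cong D λ p i → ∑-map (inverse p N.*_) (R₄ p) _ ∙ (∑-ext (R₄ p) λ r → transfer p (prime≥2 (π₁ (hD p i))) (D-coprime p i) r m))))
    (split D W class W≥1 (λ _ → class-coprime) (λ p i → π₁ (adm a p i) , π₂ (adm a p i) , List.length-map _ (R₄ p) ∙ List.length-map _ (others h) ∙ length-others h∈) (π₂ a) clos leaf)
    where
    open Splitting (rg M (2 N.* M)) (λ m → 𝟙 (isPrime m)) R 4 (λ q a → 1 N.≤ q → Cop.Coprime a q)
    clos : ∀ q a c p r → p ∈ D → r ∈ R p → (1 N.≤ q → Cop.Coprime a q) → c mod q ≡ a mod q → c mod p ≡ r mod p → 1 N.≤ q N.* p → Cop.Coprime c (q N.* p)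
    clos q′ a′ c p r i j g e e' qp≥1 = small-coprime a q′ a′ c p i (g q′≥1) q′≥1 e (∤-mod p≥1 e' not-root)
     where
     q′≥1 : 1 N.≤ q′
     q′≥1 = N.n≢0⇒n>0 λ { refl → N.<⇒≱ qp≥1 z≤n }
     p≥1 = prime≥1 (π₁ (hD p i))
     not-root : ¬ (p ∣ r)
     not-root d = let k = ∈-map⁻ (inverse p N.*_) j ; s = π₁ k ; l = ∈-map⁻ (λ h' → root h' p N.+ h) (π₁ (π₂ k)) in
      root-coprime (π₁ (hD p i)) (π₁ (π₂ (hD p i))) (π₁ (π₂ l)) (subst (p ∣_) (π₂ (π₂ l))
       (mod-zero⁻ p p≥1 (sym (undo p (prime≥2 (π₁ (hD p i))) (D-coprime p i) s) ∙ mod-zero p p≥1 (∣.∣n⇒∣m*n q₁ (subst (p ∣_) (π₂ (π₂ k)) d)))))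
    leaf : ∀ c → (1 N.≤ q → Cop.Coprime c q) → Abs≤ (∑ (rg M (2 N.* M)) (λ n → 𝟙 (isPrime n) * 𝟙 (cong? q c n)) - # (π♭ M) * inv (φ q)) (errP M q)
    leaf c g = subst (λ z → Abs≤ z (errP M q)) (prime-eq M q (c mod q) ∙ cong (_- # (π♭ M) * inv (φ q)) (∑-ext (rg M (2 N.* M)) λ n → cong (λ z → 𝟙 (isPrime n) * 𝟙 (n mod q N.≡ᵇ z)) (mod-idem q c)))
     (err-bound {primeDiscrepancy M} q (c mod q) (mod-< q c q≥1) (coprime⁺ {c mod q} {q} (coprime-mod q≥1 (mod-idem q c) (g q≥1))))

   -- (N/q₁, 2N/q₁] and [M, 2M) differ by at most one integer
   part-B : Abs≤ (∑ (facs₂ q₁) f - # 4 ^ length D * (X q₁ * inv (φ q))) (# 4 ^ length D * (errP M q + # 2))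
   part-B = lin (π₁ full ⊕ π₂ fl ⊕ scale F≥0 (*≥0 (π₁ πl) φ≥0) ⊕ F≥0)
      (solve 7 (λ s x y F E l π → s :- F :* (x :* y) :+ (:- (F :* E) :+ l :+ F :* κ 0 :+ κ 0) := :- (F :* (E :+ κ 2)) :+ (s :+ l :- F :* ((x :+ π) :* y) :+ F :+ F :* (π :* y) :+ F)) refl (∑ (facs₂ q₁) f) (X q₁) y F (errP M q) l π ∙
       cong₂ (λ s x → - (F * (errP M q + # 2)) + (s - F * (x * y) + F + F * (π * y) + F)) (sym f-split) (sym π-split))
     , lin (π₂ full ⊕ π₁ fl ⊕ scale F≥0 (*-mono φ≥0 0≤1 (π₂ πl) φ≤1) ⊕ F≥0)
      (cong₂ (λ s x → F * (errP M q + # 2) + (s - F * (x * y) + # 0 + F * (π * y) + # 0)) f-split π-split ∙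
       solve 7 (λ s x y F E l π → F :* (E :+ κ 2) :+ (s :+ l :- F :* ((x :+ π) :* y) :+ κ 0 :+ F :* (π :* y) :+ κ 0) := s :- F :* (x :* y) :+ (F :* E :+ l :+ F :* (κ 1 :* κ 1) :+ F)) refl (∑ (facs₂ q₁) f) (X q₁) y F (errP M q) l π)
    where
    F = # 4 ^ length D
    F≥0 : # 0 ≤ F
    F≥0 = ^≥0 (length D) (#≥0 4)
    y = inv (φ q)
    φ≥0 : # 0 ≤ y
    φ≥0 = inv-nonneg (φ q)
    φ≤1 : y ≤ # 1
    φ≤1 = inv≤1 (φ q) (φ≥1 q q≥1)
    Q = suc (q₁ ∸ 1)
    t = suc (2 N.* N N./ Q)
    M≤t : M N.≤ t
    M≤t = s≤s (DM./-monoˡ-≤ Q (N.m≤m+n N _))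
    t≤ : t N.≤ 2 N.* M
    t≤ = DM.m<n*o⇒m/o<n {2 N.* N} {2 N.* M} {Q} (N.<-≤-trans (N.*-monoʳ-< 2 (n<[1+n/L]L N Q)) (reflexive (sym (N.*-assoc 2 M Q))))
    ≤t+1 : 2 N.* M N.≤ suc t
    ≤t+1 = reflexive (N.*-suc 2 (N N./ Q)) ⨟ s≤s (s≤s (mL≤n⇒m≤n/L {2 N.* (N N./ Q)} Q (reflexive (N.*-assoc 2 (N N./ Q) Q) ⨟ N.*-monoʳ-≤ 2 (DM.m/n*n≤m N Q))))
    edge : ∀ (g : ℕ → 𝔽) c → (∀ m → # 0 ≤ g m × g m ≤ c) → # 0 ≤ c → # 0 ≤ ∑ (rg t (2 N.* M)) g × ∑ (rg t (2 N.* M)) g ≤ c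
    edge g c hg c≥0 = ∑≥0 (rg t (2 N.* M)) (λ m _ → π₁ (hg m)) , (∑-mono (rg t (2 N.* M)) λ m _ → π₂ (hg m)) ⨾ ≡⇒≤ (∑-const (rg t (2 N.* M)) c ∙ cong (λ n → # n * c) (length-rg t (2 N.* M))) ⨾
      scaleʳ c≥0 (#-mono {2 N.* M ∸ t} {1} (N.m≤n+o⇒m∸n≤o (2 N.* M) t (≤t+1 ⨟ reflexive (N.+-comm 1 t)))) ⨾ ≡⇒≤ (1* c)
    l π : 𝔽
    l = ∑ (rg t (2 N.* M)) (λ m → 𝟙 (isPrime m) * f m)
    π = ∑ (rg t (2 N.* M)) (λ m → 𝟙 (isPrime m))
    fl : # 0 ≤ l × l ≤ F
    fl = edge (λ m → 𝟙 (isPrime m) * f m) F (λ m → *≥0 (𝟙≥0 _) (π₁ (f-bounds m)) , *-mono (π₁ (f-bounds m)) 0≤1 (𝟙≤1 (isPrime m)) (π₂ (f-bounds m)) ⨾≡ 1* F) F≥0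
    πl : # 0 ≤ π × π ≤ # 1
    πl = edge (λ m → 𝟙 (isPrime m)) (# 1) (λ m → 𝟙≥0 _ , 𝟙≤1 _) 0≤1
    f-split : ∑ (rg M (2 N.* M)) (λ m → 𝟙 (isPrime m) * f m) ≡ ∑ (facs₂ q₁) f + l
    f-split = ∑-split {M} {t} (2 N.* M) M≤t t≤ _ ∙ cong (_+ l) (sym (∑-primes M t f))
    π-split : # (π♭ M) ≡ X q₁ + π
    π-split = countIn-∑ M (2 N.* M) isPrime ∙ ∑-split {M} {t} (2 N.* M) M≤t t≤ _ ∙ cong (_+ π) (sym (∑-primes M t (λ _ → # 1) ∙ (∑-ext (rg M t) λ m → *1 (𝟙 (isPrime m)))))

  -- The density of hits among n + h = q₁ m: certain at q₁, four classes out of p - 1 elsewhere.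
  gq : ℕ → ℕ → 𝔽
  gq q₁ p = if p N.≡ᵇ q₁ then # 1 else # 4 * δf p

  gq-≢ : ∀ {q₁ p} → p ≢ q₁ → gq q₁ p ≡ # 4 * δf p
  gq-≢ {q₁} {p} ne with p N.≡ᵇ q₁ in eq
  ... | true = ⊥-elim (ne (N.≡ᵇ⇒≡ p q₁ (subst T (sym eq) tt)))
  ... | false = refl

  gq-≡ : ∀ q₁ → gq q₁ q₁ ≡ # 1
  gq-≡ q₁ with q₁ N.≡ᵇ q₁ in eq
  ... | true = refl
  ... | false = ⊥-elim (subst T eq (N.≡⇒≡ᵇ q₁ q₁ refl))

  module Count (W≥2 : 2 N.≤ W) (f∉ws : ∀ {p} → p ∈ facs₁ → p ∉ ws) {D : List ℕ} (a : Admissible D) (small : ∀ p → p ∈ D → p N.* p N.≤ N) where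

   private
    hD = π₁ a
    uD = π₂ a
    q = W N.* Π D
    F = # 4 ^ length D
    y = inv (φ q)
    R = rg (suc N) (suc (2 N.* N))

    ψ₄ : List ℕ → ℕ → 𝔽
    ψ₄ D n = 𝟙 (cong? W (ν N.+ h) n) * ∏ (λ p → hit₄ p n) D

    ψ : ℕ → 𝔽
    ψ n = 𝟙 (cong? W (ν N.+ h) n) * ∏ (λ p → hh p (n ∸ h)) D

    B : ℕ → 𝔽
    B q₁ = ∑ (facs₂ q₁) (λ m → ψ₄ (rem q₁ D) (q₁ N.* m))

    y′ : ℕ → 𝔽
    y′ q₁ = # 4 ^ length (rem q₁ D) * (X q₁ * inv (φ (W N.* Π (rem q₁ D))))

   total-split : ∑ R (λ m → 𝟙 (β ei ej N m) * ψ m) ≡ ∑ R (λ m → 𝟙 (β ei ej N m) * 𝟙 (cong? W (ν N.+ h) m) * ∏ (λ p → hit₄ p m) D) + ∑ facs₁ (λ q₁ → 𝟙 (mem q₁ D) * B q₁)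
   total-split = β-pairs ψ ∙ (∑-cong facs₁ λ q₁ i → (∑-cong (facs₂ q₁) λ m j → cong (𝟙 (cong? W (ν N.+ h) (q₁ N.* m)) *_) (factor-dichotomy a small i j) ∙
       solve 4 (λ w a b c → w :* (a :+ b :* c) := w :* a :+ b :* (w :* c)) refl (𝟙 (cong? W (ν N.+ h) (q₁ N.* m))) (∏ (λ p → hit₄ p (q₁ N.* m)) D) (𝟙 (mem q₁ D)) (∏ (λ p → hit₄ p (q₁ N.* m)) (rem q₁ D))) ∙
      ∑-+ (facs₂ q₁) _ _ ∙ cong (∑ (facs₂ q₁) (λ m → ψ₄ D (q₁ N.* m)) +_) (∑-scale (facs₂ q₁) (𝟙 (mem q₁ D)) _)) ∙
    ∑-+ facs₁ _ _ ∙ cong (_+ ∑ facs₁ (λ q₁ → 𝟙 (mem q₁ D) * B q₁)) (sym (β-pairs (ψ₄ D)) ∙ (∑-ext R λ m → *-assoc˘ (𝟙 (β ei ej N m)) (𝟙 (cong? W (ν N.+ h) m)) (∏ (λ p → hit₄ p m) D)))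

   -- Coprimality to q = W ∏ D excludes exactly the smaller factors in D: those of W are too small
   -- for `facs₁`, and the larger factor exceeds √N.
   πβq-eq : # (πβq ei ej N q) ≡ ∑ facs₁ (λ q₁ → (# 1 - 𝟙 (mem q₁ D)) * X q₁)
   πβq-eq = countIn-∑ (suc N) (suc (2 N.* N)) _ ∙ (∑-ext R λ m → 𝟙-∧ (coprime m q) (β ei ej N m) ∙ *-comm (𝟙 (coprime m q)) (𝟙 (β ei ej N m))) ∙
     β-pairs (λ m → 𝟙 (coprime m q)) ∙ (∑-cong facs₁ λ q₁ i → (∑-cong (facs₂ q₁) λ m j → each q₁ m i j (mem q₁ D) refl ∙ *1˘ _) ∙ ∑-scale (facs₂ q₁) (# 1 - 𝟙 (mem q₁ D)) _)
    where
    avoid : ∀ p → Prime p → p ∉ ws → p ∉ D → Cop.Coprime p q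
    avoid p hp w d {k} z = Cop.sym (prime-coprime hp λ e → [ (λ e → w (prime∣Π ws hp ws-prime e)) , (λ e → d (prime∣Π D hp (λ r i → π₁ (hD r i)) e)) ]′ (euclidsLemma W (Π D) hp e)) {k} z
    each : ∀ q₁ m → q₁ ∈ facs₁ → m ∈ facs₂ q₁ → ∀ b → mem q₁ D ≡ b → 𝟙 (coprime (q₁ N.* m) q) ≡ # 1 - 𝟙 b
    each q₁ m i j true e = (𝟙-false λ t → N.<⇒≱ (prime≥2 (π₁ (facs₁⁻ i))) (reflexive (coprime⁻ {q₁ N.* m} {q} t (∣.m∣m*n m , ∣.∣n⇒∣m*n W (member D (mem⁻ q₁ D (subst T (sym e) tt))))))) ∙ solve 0 (κ 0 := κ 1 :- κ 1) refl
     where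
     member : ∀ D → q₁ ∈ D → q₁ ∣ Π D
     member (x ∷ D) (here refl) = ∣.m∣m*n (Π D)
     member (x ∷ D) (there l) = ∣.∣n⇒∣m*n x (member D l)
    each q₁ m i j false e = 𝟙-true (coprime⁺ {q₁ N.* m} {q} (λ {k} → coprime-*ˡ {q₁} {m} {q} (avoid q₁ (π₁ (facs₁⁻ i)) (f∉ws i) (λ l → subst T e (mem⁺ D l)))
      (avoid m (π₁ (facs₂⁻ i j)) (λ l → N.<⇒≱ (π₁ (π₂ (facs₂⁻ i j))) (small-ws m l)) (λ l → N.<⇒≱ (π₁ (π₂ (facs₂⁻ i j))) (small m l))) {k})) ∙ solve 0 (κ 1 := κ 1 :- κ 0) refl

   -- The terms with q₁ outside D come from `πβq`, those with q₁ in D from the primes m. Together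
   -- they form, for each q₁, one multiplicative function of D, as `Main` requires.
   main-split : F * (# (πβq ei ej N q) * y) + ∑ facs₁ (λ q₁ → 𝟙 (mem q₁ D) * y′ q₁) ≡ ∑ facs₁ (λ q₁ → X q₁ * inv (φ W) * ∏ (gq q₁) D)
   main-split = cong (_+ ∑ facs₁ (λ q₁ → 𝟙 (mem q₁ D) * y′ q₁)) (cong (λ z → F * (z * y)) πβq-eq ∙ cong (F *_) (sym (∑-scaleʳ facs₁ y _)) ∙ sym (∑-scale facs₁ F _)) ∙
    sym (∑-+ facs₁ _ _) ∙ (∑-ext facs₁ λ q₁ → each q₁ (mem q₁ D) refl)
    where
    value : ∀ {D'} q₁ → Admissible D' → q₁ ∉ D' → X q₁ * inv (φ W) * ∏ (gq q₁) D' ≡ # 4 ^ length D' * (X q₁ * inv (φ (W N.* Π D')))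
    value {D'} q₁ a' n = cong (X q₁ * inv (φ W) *_) ((prod-cong D' λ p i → gq-≢ {q₁} {p} (λ { refl → n i })) ∙ sym (^-prod 4 D' δf)) ∙ solve 4 (λ x w f d → x :* w :* (f :* d) := f :* (x :* (w :* d))) refl (X q₁) (inv (φ W)) (# 4 ^ length D') (∏ δf D') ∙
      cong (λ z → # 4 ^ length D' * (X q₁ * z)) (sym (1/φ-Π a'))
    each : ∀ q₁ b → mem q₁ D ≡ b → F * ((# 1 - 𝟙 b) * X q₁ * y) + 𝟙 b * y′ q₁ ≡ X q₁ * inv (φ W) * ∏ (gq q₁) D
    each q₁ false e = solve 4 (λ f x y z → f :* ((κ 1 :- κ 0) :* x :* y) :+ κ 0 :* z := f :* (x :* y)) refl F (X q₁) y (y′ q₁) ∙ sym (value q₁ a λ i → subst T e (mem⁺ D i))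
    each q₁ true e = solve 4 (λ f x y z → f :* ((κ 1 :- κ 1) :* x :* y) :+ κ 1 :* z := z) refl F (X q₁) y (y′ q₁) ∙ sym (value q₁ (adm-rem q₁ a) (rem-∉ q₁ D uD)) ∙
      cong (X q₁ * inv (φ W) *_) (sym (rem-prod D (gq q₁) (mem⁻ q₁ D (subst T (sym e) tt)) ∙ cong (_* ∏ (gq q₁) (rem q₁ D)) (gq-≡ q₁) ∙ 1* _))

   errorE : ℕ → 𝔽
   errorE q₁ = 𝟙 (mem q₁ D) * (# 4 ^ length (rem q₁ D) * (errP (start q₁) (W N.* Π (rem q₁ D)) + # 2))

   e2-count : Abs≤ (∑ R (λ m → 𝟙 (β ei ej N m) * ψ m) - ∑ facs₁ (λ q₁ → X q₁ * inv (φ W) * ∏ (gq q₁) D)) (F * errE q + ∑ facs₁ errorE)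
   e2-count = subst (λ z → Abs≤ z (F * errE q + ∑ facs₁ errorE)) (cong (S₁ - F * (# (πβq ei ej N q) * y) +_) (∑-sub) ∙ solve 4 (λ a b c d → a :- b :+ (c :- d) := a :+ c :- (b :+ d)) refl S₁ (F * (# (πβq ei ej N q) * y)) (∑ facs₁ (λ q₁ → 𝟙 (mem q₁ D) * B q₁)) (∑ facs₁ (λ q₁ → 𝟙 (mem q₁ D) * y′ q₁)) ∙
      cong₂ _-_ (sym total-split) main-split) (Abs≤-+ (part-A a) (Abs≤-∑ facs₁ λ q₁ i → each q₁ i (mem q₁ D) refl))
    where
    S₁ = ∑ R (λ m → 𝟙 (β ei ej N m) * 𝟙 (cong? W (ν N.+ h) m) * ∏ (λ p → hit₄ p m) D)
    ∑-sub : ∑ facs₁ (λ q₁ → 𝟙 (mem q₁ D) * (B q₁ - y′ q₁)) ≡ ∑ facs₁ (λ q₁ → 𝟙 (mem q₁ D) * B q₁) - ∑ facs₁ (λ q₁ → 𝟙 (mem q₁ D) * y′ q₁)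
    ∑-sub = (∑-ext facs₁ λ q₁ → solve 3 (λ m b c → m :* (b :- c) := m :* b :+ (:- κ 1) :* (m :* c)) refl (𝟙 (mem q₁ D)) (B q₁) (y′ q₁)) ∙ ∑-+ facs₁ _ _ ∙ cong (∑ facs₁ (λ q₁ → 𝟙 (mem q₁ D) * B q₁) +_) (∑-scale facs₁ (- # 1) _) ∙
     solve 2 (λ a b → a :+ (:- κ 1) :* b := a :- b) refl _ _
    each : ∀ q₁ → q₁ ∈ facs₁ → ∀ b → mem q₁ D ≡ b → Abs≤ (𝟙 b * (B q₁ - y′ q₁)) (𝟙 b * (# 4 ^ length (rem q₁ D) * (errP (start q₁) (W N.* Π (rem q₁ D)) + # 2)))
    each q₁ i false e = subst₂ Abs≤ (0*˘ _) (0*˘ _) (Abs≤-0 ≤-refl)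
    each q₁ i true e = Abs≤-scale 0≤1 (PartB.part-B W≥2 i (f∉ws i) (adm-rem q₁ a) (rem-∉ q₁ D uD))

   inside : ℕ → Bool
   inside n = (N N.<ᵇ n) ∧ (n N.≤ᵇ 2 N.* N) ∧ β ei ej N n

   -- Starting 12 below N + 1 lets n + h cover (N, 2 N] for each of the five h; `inside` removes
   -- what sticks out.
   shifted : ∑ (rg (suc N ∸ 12) (suc (2 N.* N))) (λ n → 𝟙 (cong? W ν n) * 𝟙 (inside (h N.+ n)) * ∏ (λ p → hh p n) D) ≡ ∑ R (λ m → 𝟙 (β ei ej N m) * ψ m)
   shifted = (∑-ext (rg (suc N ∸ 12) (suc (2 N.* N))) λ n → cong (λ z → 𝟙 (cong? W ν z) * 𝟙 (inside (h N.+ n)) * ∏ (λ p → hh p z) D) (sym (N.m+n∸m≡n h n))) ∙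
    sym (∑-shift (suc N ∸ 12) (suc (2 N.* N)) h G) ∙ ∑-split {h N.+ (suc N ∸ 12)} {suc N} (h N.+ suc (2 N.* N)) below (s≤s (N.m≤m+n N _) ⨟ above) G ∙
     cong₂ _+_ (∑-zero (rg (h N.+ (suc N ∸ 12)) (suc N)) λ m i → outside m λ t → N.<⇒≱ (π₂ (∈-range⁻ i)) (N.<ᵇ⇒< N m (π₁ (∧⁻ {N N.<ᵇ m} t))))
       (∑-split {suc N} {suc (2 N.* N)} (h N.+ suc (2 N.* N)) (s≤s (N.m≤m+n N _)) above G ∙ cong₂ _+_ (∑-cong R λ m i → within m (π₁ (∈-range⁻ i)) (N.≤-pred (π₂ (∈-range⁻ i))))
        (∑-zero (rg (suc (2 N.* N)) (h N.+ suc (2 N.* N))) λ m i → outside m λ t → N.<⇒≱ (π₁ (∈-range⁻ i)) (N.≤ᵇ⇒≤ m (2 N.* N) (π₁ (∧⁻ {m N.≤ᵇ 2 N.* N} (π₂ (∧⁻ {N N.<ᵇ m} t))))))) ∙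
      solve 1 (λ a → κ 0 :+ (a :+ κ 0) := a) refl _
    where
    G : ℕ → 𝔽
    G m = 𝟙 (cong? W ν (m ∸ h)) * 𝟙 (inside m) * ∏ (λ p → hh p (m ∸ h)) D
    below : h N.+ (suc N ∸ 12) N.≤ suc N
    below = N.+-monoˡ-≤ (suc N ∸ 12) (H₅≤12 h∈) ⨟ reflexive (N.m+[n∸m]≡n (N.m≤n⇒m≤1+n N≥12))
    above : suc (2 N.* N) N.≤ h N.+ suc (2 N.* N)
    above = N.m≤n+m _ h
    outside : ∀ m → ¬ T (inside m) → G m ≡ # 0
    outside m k = cong (λ z → 𝟙 (cong? W ν (m ∸ h)) * z * ∏ (λ p → hh p (m ∸ h)) D) (𝟙-false k) ∙ solve 2 (λ a b → a :* κ 0 :* b := κ 0) refl _ _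
    within : ∀ m → N N.< m → m N.≤ 2 N.* N → G m ≡ 𝟙 (β ei ej N m) * ψ m
    within m l r = cong₂ (λ x y → x * y * ∏ (λ p → hh p (m ∸ h)) D) (cong?-shift W ν (m ∸ h) h W≥1 ∙ cong (λ z → 𝟙 (cong? W (ν N.+ h) z)) (N.m∸n+n≡m (H₅≤12 h∈ ⨟ N≥12 ⨟ N.<⇒≤ l)))
       (𝟙-cong {inside m} {β ei ej N m} (λ t → π₂ (∧⁻ {m N.≤ᵇ 2 N.* N} (π₂ (∧⁻ {N N.<ᵇ m} t)))) (λ t → ∧⁺ (N.<⇒<ᵇ l) (∧⁺ (N.≤⇒≤ᵇ r) t))) ∙
      *-pull (𝟙 (cong? W (ν N.+ h) m)) (𝟙 (β ei ej N m)) (∏ (λ p → hh p (m ∸ h)) D)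

-- An admissible residue class and the passage to gaps

special : List ℕ
special = 11 ∷ 13 ∷ 17 ∷ 19 ∷ 23 ∷ []

-- The numbers 11 + h are the primes 11, 13, 17, 19, 23, so the residue 11 works for every other
-- prime. For these five, 2 + h takes the values 2, 4, 8, 10, 14, whose prime factors are 2, 5 and
-- 7.
residue : ℕ → ℕ
residue p = if mem p special then 2 else 11

residue-good : ∀ {p h} → Prime p → h ∈ H₅ → ¬ (p ∣ residue p N.+ h)
residue-good {p} {h} hp i d = by-mem (mem p special) refl
 where
 not-special : ∀ r → Prime r → r ∈ special → p ∣ r → mem p special ≡ false → ⊥
 not-special r hr j e f = subst T f (mem⁺ special (subst (_∈ special) (sym (prime∣prime hp hr e)) j))
 eleven : ∀ {h} → h ∈ H₅ → p ∣ 11 N.+ h → mem p special ≡ false → ⊥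
 eleven (here refl) e = not-special 11 (toWitness {a? = prime? 11} tt) (here refl) e
 eleven (there (here refl)) e = not-special 13 (toWitness {a? = prime? 13} tt) (there (here refl)) e
 eleven (there (there (here refl))) e = not-special 17 (toWitness {a? = prime? 17} tt) (there (there (here refl))) e
 eleven (there (there (there (here refl)))) e = not-special 19 (toWitness {a? = prime? 19} tt) (there (there (there (here refl)))) e
 eleven (there (there (there (there (here refl))))) e = not-special 23 (toWitness {a? = prime? 23} tt) (there (there (there (there (here refl))))) e
 divisors : All (λ r → All (λ h → ¬ (r ∣ 2 N.+ h)) H₅) special
 divisors = toWitness {a? = All.all? (λ r → All.all? (λ h → ¬? (r ∣? (2 N.+ h))) H₅) special} tt
 by-mem : ∀ b → mem p special ≡ b → ⊥
 by-mem true e = All.lookup (All.lookup divisors (mem⁻ p special (subst T (sym e) tt))) i (subst (λ b → p ∣ (if b then 2 else 11) N.+ h) e d)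
 by-mem false e = eleven i (subst (λ b → p ∣ (if b then 2 else 11) N.+ h) e d) e

∈∣Π : ∀ {p} D → p ∈ D → p ∣ Π D
∈∣Π (x ∷ D) (here refl) = ∣.m∣m*n (Π D)
∈∣Π (x ∷ D) (there l) = ∣.∣n⇒∣m*n x (∈∣Π D l)

simultaneous : ∀ D → (∀ p → p ∈ D → Prime p) → Unique D → ∃ λ ν → ∀ p → p ∈ D → ν mod p ≡ residue p mod p
simultaneous [] h u = 0 , λ p ()
simultaneous (p ∷ D) h (p∉ ∷ u) = c , both
 where
 hp = h p (here refl)
 IH = simultaneous D (λ q i → h q (there i)) u
 Π≥ = Π≥1 D λ q i → h q (there i)
 sol = chinese Π≥ (prime≥2 hp) (prime-coprime hp λ d → All.lookup p∉ (prime∣Π D hp (λ q i → h q (there i)) d) refl) (π₁ IH) (residue p)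
 c = π₁ sol
 both : ∀ q → q ∈ p ∷ D → c mod q ≡ residue q mod q
 both q (here refl) = π₂ (π₂ sol)
 both q (there i) = ∣-mod q {c} {π₁ IH} (prime≥1 (h q (there i))) (∣.∣-trans (∈∣Π D i) (mod-∣ (Π D) {c} {π₁ IH} Π≥ (π₁ (π₂ sol)))) ∙ π₂ IH q i

admissible-class : ∀ D → (∀ p → p ∈ D → Prime p) → Unique D → ∃ λ ν → ∀ h → h ∈ H₅ → Cop.Coprime (ν N.+ h) (Π D)
admissible-class D hD u = ν , coprime-all
 where
 sol = simultaneous D hD u
 ν = π₁ sol
 coprime-all : ∀ h → h ∈ H₅ → Cop.Coprime (ν N.+ h) (Π D)
 coprime-all h i {k} (x , y) with k N.≟ 1
 ... | yes e = e
 ... | no k≢1 = ⊥-elim contra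
  where
  k≥1 : 1 N.≤ k
  k≥1 = N.n≢0⇒n>0 λ { refl → N.<⇒≱ (Π≥1 D hD) (reflexive (∣.0∣⇒≡0 y)) }
  contra : ⊥
  contra = let r , hr , rk = prime-factor k (N.≤∧≢⇒< k≥1 (λ e → k≢1 (sym e))) ; r∈ = prime∣Π D hr hD (∣.∣-trans rk y) in
   residue-good hr i (mod-zero⁻ r (prime≥1 hr) (sym (mod-+ r {ν} {residue r} h (π₂ sol r r∈)) ∙ mod-zero r (prime≥1 hr) (∣.∣-trans rk x)))

β⇒E₂ : ∀ ei ej N m → N N.< m → T (β ei ej N m) → E₂ m
β⇒E₂ ei ej N m N<m t = p , m N./ suc (p ∸ 1) , hp , ⌊⌋⁻ {d = prime? (m N./ suc (p ∸ 1))} (π₂ (∧⁻ {⌊ p ∣? m ⌋} s)) , p<r , sym eq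
 where
 open SemiPrimes ei ej N
 p = π₁ (β⁻ m t)
 i = π₁ (π₂ (β⁻ m t))
 s = π₂ (π₂ (β⁻ m t))
 hp = π₁ (facs₁⁻ i)
 eq = cofactor hp (⌊⌋⁻ {d = p ∣? m} (π₁ (∧⁻ {⌊ p ∣? m ⌋} s)))
 p<r : p N.< m N./ suc (p ∸ 1)
 p<r = N.≰⇒> λ q → N.<⇒≱ N<m (reflexive (sym eq) ⨟ N.*-monoʳ-≤ p q ⨟ π₂ (π₂ (facs₁⁻ i)))

module _ {q : ℕ → ℕ} (enum : IsE₂Enumeration q) where

 private
  q-step = π₁ enum

 q-mono : ∀ {m n} → m N.≤ n → q m N.≤ q n
 q-mono {m} {n} p = subst (λ z → q m N.≤ q z) (N.m∸n+n≡m p) (go (n ∸ m))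
  where
  go : ∀ d → q m N.≤ q (d N.+ m)
  go zero = N.≤-refl
  go (suc d) = go d ⨟ N.<⇒≤ (q-step (d N.+ m))

 q-cancel : ∀ {m n} → q m N.< q n → m N.< n
 q-cancel l = N.≰⇒> λ p → N.<⇒≱ l (q-mono p)

 three⇒gap : ∀ M n → q M N.< n → ∀ {a b c} → a N.< b → b N.< c → c N.≤ 12 → E₂ (a N.+ n) → E₂ (b N.+ n) → E₂ (c N.+ n) → ∃ λ k → M N.≤ k × (q (suc (suc k)) ∸ q k) N.≤ 12
 three⇒gap M n big {a} {b} {c} a<b b<c c≤12 ea eb ec = k , N.<⇒≤ (q-cancel (N.<-≤-trans big (N.m≤n+m n a ⨟ reflexive (sym (π₂ ka))))) ,
   N.m≤n+o⇒m∸n≤o (q (suc (suc k))) (q k) (q-mono (s≤s (order ka kb a<b) ⨟ order kb kc b<c) ⨟ reflexive (π₂ kc) ⨟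
    N.+-monoˡ-≤ n c≤12 ⨟ reflexive (N.+-comm 12 n) ⨟ N.+-monoˡ-≤ 12 (N.m≤n+m n a ⨟ reflexive (sym (π₂ ka))))
  where
  index = π₂ (π₂ enum)
  ka = index (a N.+ n) ea
  kb = index (b N.+ n) eb
  kc = index (c N.+ n) ec
  k = π₁ ka
  order : ∀ {x y} (kx : ∃ λ k → q k ≡ x N.+ n) (ky : ∃ λ k → q k ≡ y N.+ n) → x N.< y → π₁ kx N.< π₁ ky
  order kx ky l = q-cancel (s≤s (reflexive (π₂ kx)) ⨟ N.+-monoˡ-≤ n l ⨟ reflexive (sym (π₂ ky)))

 many⇒gap : ∀ M n → q M N.< n → (P : ℕ → Bool) → (∀ h → T (P h) → E₂ (h N.+ n)) → # 2 < ∑ H₅ (λ h → 𝟙 (P h)) → ∃ λ k → M N.≤ k × (q (suc (suc k)) ∸ q k) N.≤ 12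
 many⇒gap M n big P hP more = extract (filter (λ h → Bool.T? (P h)) H₅) (AllPairs.filter⁺ (λ h → Bool.T? (P h)) sorted) (λ i → let m = ∈-filter⁻ (λ h → Bool.T? (P h)) {xs = H₅} i in H₅≤12 (π₁ m) , hP _ (π₂ m))
   (N.≰⇒> λ l → <⇒≱ more (count H₅ ≡⨾ #-mono l))
  where
  sorted : AllPairs N._<_ H₅
  sorted = (s≤s z≤n ∷ s≤s z≤n ∷ s≤s z≤n ∷ s≤s z≤n ∷ []) ∷ (s≤s (s≤s (s≤s z≤n)) ∷ s≤s (s≤s (s≤s z≤n)) ∷ s≤s (s≤s (s≤s z≤n)) ∷ []) ∷ (N.m≤m+n 7 1 ∷ N.m≤m+n 7 5 ∷ []) ∷ (N.m≤m+n 9 3 ∷ []) ∷ [] ∷ []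
  count : ∀ xs → ∑ xs (λ h → 𝟙 (P h)) ≡ # (length (filter (λ h → Bool.T? (P h)) xs))
  count [] = refl
  count (x ∷ xs) with P x
  ... | true = cong (# 1 +_) (count xs) ∙ sym (#-suc _)
  ... | false = 0+ _ ∙ count xs
  extract : ∀ xs → AllPairs N._<_ xs → (∀ {h} → h ∈ xs → h N.≤ 12 × E₂ (h N.+ n)) → 2 N.< length xs → ∃ λ k → M N.≤ k × (q (suc (suc k)) ∸ q k) N.≤ 12
  extract [] _ _ ()
  extract (_ ∷ []) _ _ (s≤s ())
  extract (_ ∷ _ ∷ []) _ _ (s≤s (s≤s ()))
  extract (a ∷ b ∷ c ∷ _) ((a<b ∷ _) ∷ (b<c ∷ _) ∷ _) h _ = three⇒gap M n big a<b b<c (π₁ (h (there (there (here refl))))) (π₂ (h (here refl))) (π₂ (h (there (here refl)))) (π₂ (h (there (there (here refl)))))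

-- The numerical inequality

-- The lists run downwards from the top block and the window sum `u` is updated: f enters, g leaves.
-- In `loop₁`, the start, nothing leaves yet. Each window length thus takes time linear in the
-- number of blocks, and `force` keeps the accumulators evaluated.
loop₂ : List ℕ → List ℕ → List ℕ → ℕ → ℕ → ℕ
loop₂ (f ∷ fs) (g ∷ gs) (w ∷ ws) u acc = force (acc N.+ (u ∸ 1) N.* (u ∸ 1) N.* w) λ acc' → force (u N.+ f ∸ g) λ u' → loop₂ fs gs ws u' acc'
loop₂ _ _ _ u acc = acc

loop₁ : ℕ → List ℕ → List ℕ → List ℕ → ℕ → ℕ → ℕ
loop₁ zero gs fs ws u acc = loop₂ fs gs ws u acc
loop₁ (suc j) gs (f ∷ fs) (w ∷ ws) u acc = force (acc N.+ (u ∸ 1) N.* (u ∸ 1) N.* w) λ acc' → force (u N.+ f) λ u' → loop₁ j gs fs ws u' acc'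
loop₁ (suc j) gs _ _ u acc = acc

-- The division rounds down, which is harmless on the larger side of the inequality.
outer : ℕ → List ℕ → List ℕ → ℕ → ℕ → ℕ
outer G fs ws zero acc = acc
outer G fs ws (suc a) acc = force (acc N.+ loop₁ (suc a) fs fs ws 0 0 N./ suc (suc (suc a) N.* (suc (suc (2 N.* G)) ∸ suc a) ∸ 1)) λ acc' → outer G fs ws a acc'

squares : List ℕ → List ℕ → ℕ → ℕ
squares (f ∷ fs) (w ∷ ws) acc = force (acc N.+ f N.* f N.* w) λ acc' → squares fs ws acc'
squares _ _ acc = acc

descend : (ℕ → ℕ) → ℕ → List ℕ
descend f zero = []
descend f (suc n) = f n ∷ descend f n

power-gap : ℕ → ℕ → ℕ
power-gap k b = suc b N.^ k ∸ b N.^ k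

#-^ : ∀ n k → # (n N.^ k) ≡ # n ^ k
#-^ n zero = refl
#-^ n (suc k) = #-* n (n N.^ k) ∙ cong (# n *_) (#-^ n k)

#-∸ : ∀ {m n} → n N.≤ m → # (m ∸ n) ≡ # m - # n
#-∸ {m} {n} h = solve 2 (λ a b → a := a :+ b :- b) refl (# (m ∸ n)) (# n) ∙ cong (_- # n) (sym (#-+ (m ∸ n) n) ∙ cong #_ (N.m∸n+n≡m h))

-- Moves the differences from the squares to the powers, so that the computation involves natural
-- numbers only.
summation-by-parts : ∀ k (h : ℕ → 𝔽) n → ∑ (rg 0 n) (λ b → (h b - h (suc b)) * # (suc b) ^ suc k) ≡ ∑ (rg 0 n) (λ b → h b * # (power-gap (suc k) b)) - h n * # n ^ suc k
summation-by-parts k h zero = ∑-nil {0} {0} z≤n _ ∙ solve 2 (λ h p → κ 0 := κ 0 :- h :* (κ 0 :* p)) refl (h 0) (# 0 ^ k) ∙ cong (_- h 0 * # 0 ^ suc k) (sym (∑-nil {0} {0} z≤n _))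
summation-by-parts k h (suc n) = ∑-suc {0} {n} z≤n _ ∙ cong (_+ (h n - h (suc n)) * # (suc n) ^ suc k) (summation-by-parts k h n) ∙
 solve 5 (λ s h h' a b → s :- h :* a :+ (h :- h') :* b := s :+ h :* (b :- a) :- h' :* b) refl _ (h n) (h (suc n)) (# n ^ suc k) (# (suc n) ^ suc k) ∙
  cong (_- h (suc n) * # (suc n) ^ suc k) (cong (λ z → S + h n * z) (sym (#-∸ (N.^-monoˡ-≤ (suc k) (N.n≤1+n n)) ∙ cong₂ _-_ (#-^ (suc n) (suc k)) (#-^ n (suc k)))) ∙ sym (∑-suc {0} {n} z≤n _))
 where S = ∑ (rg 0 n) (λ b → h b * # (power-gap (suc k) b))

module Numerical (G : ℕ) (G≥1 : 1 N.≤ G) (fN : ℕ → ℕ) (f-anti : ∀ {b c} → b N.≤ c → fN c N.≤ fN b) (f-supp : ∀ {b} → G N.≤ b → fN b ≡ 0) where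

 window : ℕ → ℕ → ℕ
 window zero n = 0
 window (suc a) n = window a n N.+ fN (a N.+ n)

 slide : ∀ a n → window a n N.+ fN (a N.+ n) ≡ window a (suc n) N.+ fN n
 slide zero n = refl
 slide (suc a) n = cong (N._+ fN (suc a N.+ n)) (slide a n) ∙ solveℕ 3 (λ x y z → x ⊞ y ⊞ z ≗ x ⊞ z ⊞ y) refl (window a (suc n)) (fN n) (fN (suc a N.+ n)) ∙ cong (λ z → window a (suc n) N.+ fN z N.+ fN n) (sym (N.+-suc a n))

 moment : ℕ → ℕ → 𝔽
 moment a n = ∑ (rg 0 n) (λ b → sq (λ b → # (window a (suc b) ∸ 1)) b * # (power-gap 4 b))

 private
  gaps = power-gap 4

  head-step : ∀ a b acc → # (acc N.+ (window a (suc b) ∸ 1) N.* (window a (suc b) ∸ 1) N.* gaps b) + moment a b ≡ # acc + moment a (suc b)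
  head-step a b acc = cong (_+ moment a b) (#-+ acc _ ∙ cong (# acc +_) (#-* (v₀ N.* v₀) (gaps b) ∙ cong (_* # (gaps b)) (#-* v₀ v₀))) ∙
   solve 3 (λ a b c → a :+ b :+ c := a :+ (c :+ b)) refl (# acc) (# v₀ * # v₀ * # (gaps b)) (moment a b) ∙ cong (# acc +_) (sym (∑-suc {0} {b} z≤n _))
   where v₀ = window a (suc b) ∸ 1

 loop₂-spec : ∀ a n {u} acc → u ≡ window a n → # (loop₂ (descend fN n) (descend fN (a N.+ n)) (descend gaps n) u acc) ≡ # acc + moment a n
 loop₂-spec a zero acc e = +0˘ (# acc) ∙ cong (# acc +_) (sym (∑-nil {0} {0} z≤n _))
 loop₂-spec a (suc b) {u} acc refl = cong #_ (cong (λ l → loop₂ (descend fN (suc b)) l (descend gaps (suc b)) u acc) (cong (descend fN) (N.+-suc a b)) ∙ force-≡ acc' _ ∙ force-≡ u' _) ∙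
   loop₂-spec a b acc' (cong (_∸ fN (a N.+ b)) (sym (slide a b)) ∙ N.m+n∸n≡m (window a b) (fN (a N.+ b))) ∙ head-step a b acc
  where
  acc' = acc N.+ (u ∸ 1) N.* (u ∸ 1) N.* gaps b
  u' = u N.+ fN b ∸ fN (a N.+ b)

 loop₁-spec : ∀ a j n {u} acc → a N.+ n ≡ G N.+ j → j N.≤ n → u ≡ window a n → # (loop₁ j (descend fN G) (descend fN n) (descend gaps n) u acc) ≡ # acc + moment a n
 loop₁-spec a zero n {u} acc eq le e = cong (λ z → # (loop₂ (descend fN n) (descend fN z) (descend gaps n) u acc)) (sym (N.+-identityʳ G) ∙ sym eq) ∙ loop₂-spec a n acc e
 loop₁-spec a (suc j) (suc b) {u} acc eq le refl = cong #_ (force-≡ acc' _ ∙ force-≡ (u N.+ fN b) _) ∙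
   loop₁-spec a j b acc' eq' (N.≤-pred le) (sym (slide a b) ∙ cong (window a b N.+_) (f-supp (N.m≤m+n G j ⨟ reflexive (sym eq'))) ∙ N.+-identityʳ _) ∙ head-step a b acc
  where
  acc' = acc N.+ (u ∸ 1) N.* (u ∸ 1) N.* gaps b
  eq' : a N.+ b ≡ G N.+ j
  eq' = N.suc-injective (sym (N.+-suc a b) ∙ eq ∙ N.+-suc G j)

 window-G : ∀ a → window a G ≡ 0
 window-G zero = refl
 window-G (suc a) = cong₂ N._+_ (window-G a) (f-supp (N.m≤n+m G a))

 floor-≤ : ∀ m d → 1 N.≤ d → # (m N./ suc (d ∸ 1)) ≤ inv d * # m
 floor-≤ m (suc d) h = ≡⇒≤ (1*˘ _ ∙ cong (_* # (m N./ suc d)) (sym (#-inv (suc d) h)) ∙ solve 3 (λ a b c → a :* b :* c := b :* (c :* a)) refl (# (suc d)) (inv (suc d)) (# (m N./ suc d))) ⨾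
  scale (inv-nonneg (suc d)) (sym (#-* (m N./ suc d) (suc d)) ≡⨾ #-mono (DM.m/n*n≤m m (suc d)))

 denominator : ℕ → ℕ
 denominator a = suc a N.* (suc (suc (2 N.* G)) ∸ a)

 denominator≥1 : ∀ a → a N.≤ G → 1 N.≤ denominator a
 denominator≥1 a h = N.*-mono-≤ (s≤s {n = a} z≤n) (N.m<n⇒0<n∸m (s≤s (h ⨟ N.m≤m+n G _ ⨟ N.n≤1+n _)))

 outer-spec : ∀ n acc → n N.≤ G → # (outer G (descend fN G) (descend gaps G) n acc) ≤ # acc + ∑ (rg 1 (suc n)) (λ a → inv (denominator a) * moment a G)
 outer-spec zero acc h = ≡⇒≤ (+0˘ (# acc) ∙ cong (# acc +_) (sym (∑-nil {1} {1} N.≤-refl _)))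
 outer-spec (suc a) acc h = cong #_ (force-≡ acc' _) ≡⨾ outer-spec a acc' (N.<⇒≤ h) ⨾
   (≡⇒≤ (#-+ acc _) `then` (≤-refl ⊕ (floor-≤ _ (denominator (suc a)) (denominator≥1 (suc a) h) `then` scale (inv-nonneg (denominator (suc a))) (≡⇒≤ (loop₁-spec (suc a) (suc a) G 0 (N.+-comm (suc a) G) h (sym (window-G (suc a))) ∙ 0+ _))))) ⊕ ≤-refl ⨾
    ≡⇒≤ (solve 3 (λ a b c → a :+ b :+ c := a :+ (c :+ b)) refl (# acc) (inv (denominator (suc a)) * moment (suc a) G) (∑ (rg 1 (suc a)) (λ a → inv (denominator a) * moment a G)) ∙ cong (# acc +_) (sym (∑-suc {1} {suc a} (s≤s z≤n) _)))
  where
  _`then`_ : ∀ {a b c : 𝔽} → a ≤ b → b ≤ c → a ≤ c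
  _`then`_ = ≤-trans
  acc' = acc N.+ loop₁ (suc a) (descend fN G) (descend fN G) (descend gaps G) 0 0 N./ suc (denominator (suc a) ∸ 1)

 squares-spec : ∀ n acc → # (squares (descend fN n) (descend (power-gap 5) n) acc) ≡ # acc + ∑ (rg 0 n) (λ b → sq (λ b → # (fN b)) b * # (power-gap 5 b))
 squares-spec zero acc = +0˘ (# acc) ∙ cong (# acc +_) (sym (∑-nil {0} {0} z≤n _))
 squares-spec (suc b) acc = cong #_ (force-≡ acc' _) ∙ squares-spec b acc' ∙ cong (_+ S) (#-+ acc _ ∙ cong (# acc +_) (#-* (fN b N.* fN b) (power-gap 5 b) ∙ cong (_* # (power-gap 5 b)) (#-* (fN b) (fN b)))) ∙
   solve 3 (λ a b c → a :+ b :+ c := a :+ (c :+ b)) refl (# acc) (# (fN b) * # (fN b) * # (power-gap 5 b)) S ∙ cong (# acc +_) (sym (∑-suc {0} {b} z≤n _))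
  where
  acc' = acc N.+ fN b N.* fN b N.* power-gap 5 b
  S = ∑ (rg 0 b) (λ b → sq (λ b → # (fN b)) b * # (power-gap 5 b))

 module _ (V : ℕ) (V≥ : 4004 N.≤ V) where

  open Estimate V V≥ G G≥1 fN f-anti f-supp using (wN; u; u-supp; Nn; D; f-Supp)

  wN-window : ∀ a b → wN a b ≡ window a (suc b)
  wN-window zero b = refl
  wN-window (suc a) b = cong₂ (λ x y → x N.+ fN y) (wN-window a b) (sym (N.+-suc a b))

  Nn-moment : ∀ a → Nn a ≡ moment a G
  Nn-moment a = summation-by-parts 3 (sq (u a)) G ∙ cong (λ z → ∑ (rg 0 G) (λ b → sq (u a) b * # (power-gap 4 b)) - z * z * # G ^ 4) (u-supp a N.≤-refl) ∙
   solve 2 (λ a b → a :- κ 0 :* κ 0 :* b := a) refl _ (# G ^ 4) ∙ (∑-ext (rg 0 G) λ b → cong (λ z → # (z ∸ 1) * # (z ∸ 1) * # (power-gap 4 b)) (wN-window a b))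

  D-squares : D ≡ # (squares (descend fN G) (descend (power-gap 5) G) 0)
  D-squares = summation-by-parts 4 (sq (λ b → # (fN b))) G ∙ cong (λ z → ∑ (rg 0 G) (λ b → sq (λ b → # (fN b)) b * # (power-gap 5 b)) - z * z * # G ^ 5) (f-Supp N.≤-refl) ∙
   solve 2 (λ a b → a :- κ 0 :* κ 0 :* b := κ 0 :+ a) refl _ (# G ^ 5) ∙ sym (squares-spec G 0)

  numerical : ∀ {m n} → m N.* squares (descend fN G) (descend (power-gap 5) G) 0 N.≤ n N.* outer G (descend fN G) (descend (power-gap 4) G) (G ∸ 1) 0 →
        # m * D ≤ # n * ∑ (rg 1 G) (λ a → inv (denominator a) * Nn a)
  numerical {m} {n} h = (cong (# m *_) D-squares ∙ sym (#-* m _)) ≡⨾ #-mono h ⨾ #-* n _ ≡⨾ scale (#≥0 n) (outer-spec (G ∸ 1) 0 (N.m∸n≤m G 1) ⨾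
    ≡⇒≤ (0+ _ ∙ cong (λ z → ∑ (rg 1 z) (λ a → inv (denominator a) * moment a G)) (N.m+[n∸m]≡n G≥1) ∙ (∑-ext (rg 1 G) λ a → cong (inv (denominator a) *_) (sym (Nn-moment a)))))

-- A close-to-optimal polynomial for the ratio of the two integrals
profile : (c₀ c₁ c₂ : ℕ) → ℕ → ℕ
profile c₀ c₁ c₂ zero = 0
profile c₀ c₁ c₂ y@(suc _) = c₀ N.+ (c₁ N.* y N.+ c₂ N.* (y N.* y))

profile-mono : ∀ c₀ c₁ c₂ {x y} → x N.≤ y → profile c₀ c₁ c₂ x N.≤ profile c₀ c₁ c₂ y
profile-mono c₀ c₁ c₂ {zero} h = z≤n
profile-mono c₀ c₁ c₂ {suc x} {suc y} h = N.+-monoʳ-≤ c₀ (N.+-mono-≤ (N.*-monoʳ-≤ c₁ h) (N.*-monoʳ-≤ c₂ (N.*-mono-≤ h h)))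

-- The threshold is 4000/50000 = 0.08, from 5 Q/24 > 2 D/120; the 2 in 4002 is the margin that pays
-- for all errors of order 1/V.
Inequality : (G : ℕ) → (ℕ → ℕ) → Set
Inequality G f = 4002 N.* squares (descend f G) (descend (power-gap 5) G) 0 N.≤ 50000 N.* outer G (descend f G) (descend (power-gap 4) G) (G ∸ 1) 0

inequality? : (G : ℕ) → (ℕ → ℕ) → Bool
inequality? G f = 4002 N.* squares (descend f G) (descend (power-gap 5) G) 0 N.≤ᵇ 50000 N.* outer G (descend f G) (descend (power-gap 4) G) (G ∸ 1) 0

-- A Boolean comparison can be evaluated to `true`, while a canonical proof of ≤ would be as large
-- as the numbers.
inequality?⇒ : ∀ G f → inequality? G f ≡ true → Inequality G f
inequality?⇒ G f e = N.≤ᵇ⇒≤ _ _ (subst T (sym e) tt)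

abstract
 blocks : ℕ
 blocks = 2000

 -- 2000² (6 + 27 s + 100 s²) with s = (2000 - b)/2000; the factor 2000² makes the values integral.
 -- The constant term is the jump at the end of the support.
 shape : ℕ → ℕ
 shape b = profile (6 N.* 4000000) (27 N.* 2000) 100 (2000 ∸ b)

 blocks≥2 : 2 N.≤ blocks
 blocks≥2 = N.m≤m+n 2 1998

 shape-anti : ∀ {b c} → b N.≤ c → shape c N.≤ shape b
 shape-anti h = profile-mono _ _ _ (N.∸-monoʳ-≤ 2000 h)

 shape-supp : ∀ {b} → blocks N.≤ b → shape b ≡ 0
 shape-supp h = cong (profile (6 N.* 4000000) (27 N.* 2000) 100) (N.m≤n⇒m∸n≡0 h)

 shape-0 : 1 N.≤ shape 0
 shape-0 = s≤s z≤n

 shape-inequality : Inequality blocks shape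
 -- `refl` evaluates about 2000² steps of the loops; `shape` and `blocks` are opaque everywhere
 -- else.
 shape-inequality = inequality?⇒ blocks shape refl

-- Bounds for the error terms

^-+ : ∀ a m n → a ^ (m N.+ n) ≡ a ^ m * a ^ n
^-+ a zero n = 1*˘ (a ^ n)
^-+ a (suc m) n = cong (a *_) (^-+ a m n) ∙ *-assoc˘ a (a ^ m) (a ^ n)

^-≥1 : ∀ {a} n → # 1 ≤ a → # 1 ≤ a ^ n
^-≥1 zero h = ≤-refl
^-≥1 (suc n) h = solve 0 (κ 1 := κ 1 :* κ 1) refl ≡⨾ *-mono 0≤1 (0≤1 ⨾ h) h (^-≥1 n h)

^-mono-exponent : ∀ {a m n} → # 1 ≤ a → m N.≤ n → a ^ m ≤ a ^ n
^-mono-exponent {a} {m} {n} h p = *1˘ (a ^ m) ≡⨾ scale (^≥0 m (0≤1 ⨾ h)) (^-≥1 (n ∸ m) h) ⨾ ≡⇒≤ (sym (^-+ a m (n ∸ m)) ∙ cong (a ^_) (N.m+[n∸m]≡n p))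

-- L ≤ j 2^(L/j), raised to the power j.
power≤exponential : ∀ j → 1 N.≤ j → ∃ λ C → ∀ L → L N.^ j N.≤ C N.* 2^ L
power≤exponential j j≥1 = j N.^ j , λ L → N.^-monoˡ-≤ j (N.<⇒≤ (n<[1+n/L]L L j) ⨟ N.*-monoˡ-≤ j (n<2^n (L N./ j))) ⨟ reflexive (^-distribʳ-* j (2^ (L N./ j)) j ∙
  N.*-comm _ (j N.^ j) ∙ cong (j N.^ j N.*_) (N.^-*-assoc 2 (L N./ j) j)) ⨟ N.*-monoʳ-≤ (j N.^ j) (2^-mono (DM.m/n*n≤m L j))
 where
 instance
  j≢0 : NonZero j
  j≢0 = N.>-nonZero j≥1

Π≤2^lsum : ∀ D → Π D N.≤ 2^ lsum D
Π≤2^lsum [] = N.≤-refl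
Π≤2^lsum (p ∷ D) = N.*-mono-≤ (N.<⇒≤ (n<2^lg p)) (Π≤2^lsum D) ⨟ reflexive (sym (N.^-distribˡ-+-* 2 (lg p) (lsum D)))

countIn≤ : ∀ a b P → countIn a b P N.≤ b ∸ a
countIn≤ a b P = #-cancel-≤ (countIn-∑ a b P ≡⨾ (∑-mono (rg a b) λ n _ → 𝟙≤1 (P n)) ⨾≡ ∑-const (rg a b) (# 1) ∙ cong (λ n → # n * # 1) (length-rg a b) ∙ *1 (# (b ∸ a)))

*-cancel-inv : ∀ {n x y} → 1 N.≤ n → x * # n ≤ y → x ≤ y * inv n
*-cancel-inv {n} {x} {y} h p = scale-cancel (#-pos n h) (solve 2 (λ x n → n :* x := x :* n) refl x (# n) ≡⨾ p ⨾≡ *1˘ y ∙ cong (y *_) (sym (#-inv n h)) ∙ *-swap y (# n) (inv n))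

Op-ind-≤ : ∀ {c} ps X {t} → (∀ p → p ∈ ps → # 0 ≤ c p) → Op c ps (ind X) 0 ≤ t → ∀ x → Op c ps (ind X) x ≤ t * ind X x
Op-ind-≤ {c} ps X {t} h ht x = [ (λ l → Op-antitone ps h (ind-antitone X) z≤n ⨾ ht ⨾≡ *1˘ t ∙ cong (t *_) (sym (ind-true l)))
 , (λ l → ≡⇒≤ (Op-supp ps (ind-supp X) l ∙ *0˘ t ∙ cong (t *_) (sym (ind-false l)))) ]′ (N.<-≤-connex x X)

OpN-ind-≤ : ∀ {c} ps X {t} → (∀ p → p ∈ ps → # 0 ≤ c p) → # 0 ≤ t → Op c ps (ind X) 0 ≤ t → ∀ k x → OpN c ps k (ind X) x ≤ t ^ k * ind X x
OpN-ind-≤ ps X h t≥0 ht zero x = ≡⇒≤ (1*˘ (ind X x))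
OpN-ind-≤ {c} ps X {t} h t≥0 ht (suc k) x = Op-mono ps h (OpN-ind-≤ ps X h t≥0 ht k) x ⨾ ≡⇒≤ (Op-scale c ps (t ^ k) (ind X) x) ⨾
 scale (^≥0 k t≥0) (Op-ind-≤ ps X h ht x) ⨾ ≡⇒≤ (*-swapˡ (t ^ k) t (ind X x))

module Discrepancies (V : ℕ) (V≥1 : 1 N.≤ V) (G : ℕ) (G≥1 : 1 N.≤ G) (c : ℕ) where

 open Dimension1 V V≥1

 -- With the weight c^(2|D|) and the trivial density 2/p, sums over D are `Op` with coefficient 2
 -- c²/p, hence of order L^n. `Z` serves both as 1/ε in the level and as 1/η in `β`.
 n Z : ℕ
 n = c N.* c N.* 2
 Z = suc (suc (2 N.* G))

 W : ℕ
 W = Π ws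

 W≥1 : 1 N.≤ W
 W≥1 = Π≥1 ws ws-prime

 -- Makes h L an upper bound for the sum of 1/d over products d of sieving primes of length below 2
 -- K; all sums over D are bounded by powers of it.
 h : ℕ
 h = suc (π₁ (archimedean (α * (# 2 * # G + # B))))

 module AtLevel (L : ℕ) (L≥1 : 1 N.≤ L) (wL : lg W N.* Z N.≤ L) where

  K K₂ : ℕ
  K = G N.* L
  K₂ = K N.+ K

  ps : List ℕ
  ps = sieving K

  l Y : 𝔽
  l = # L
  Y = (# h * l) ^ n

  l≥1 : # 1 ≤ l
  l≥1 = #-mono L≥1

  l>0 : # 0 < l
  l>0 = #-pos L L≥1

  inv≥0 : ∀ p → p ∈ ps → # 0 ≤ inv p
  inv≥0 p _ = inv-nonneg p

  hl≥1 : # 1 ≤ # h * l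
  hl≥1 = #-mono (N.*-mono-≤ (s≤s {n = π₁ (archimedean (α * (# 2 * # G + # B)))} z≤n) L≥1) ⨾ ≡⇒≤ (#-* h L)

  Op-inv-K₂ : Op inv ps (ind K₂) 0 ≤ # h * l
  Op-inv-K₂ = Op-inv-upper K K₂ ⨾ scale α≥0 (≤-refl {# K₂} ⊕ ≤-trans (≡⇒≤ (*1˘ (# B))) (scale (#≥0 B) l≥1)) ⨾
   ≡⇒≤ (cong (λ z → α * (z + # B * l)) (#-+ K K ∙ cong₂ _+_ (#-* G L) (#-* G L)) ∙ solve 4 (λ a g l b → a :* (g :* l :+ g :* l :+ b :* l) := a :* (κ 2 :* g :+ b) :* l) refl α (# G) l (# B)) ⨾
    scaleʳ (<⇒≤ l>0) (π₂ (archimedean (α * (# 2 * # G + # B))) ⨾ #-mono (N.n≤1+n _))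

  Op-j : ∀ j → j N.≤ n → ∀ m → Op (λ p → # j * inv p) ps (ind K₂) m ≤ Y
  Op-j j j≤n m = Op-multiple ps inv≥0 j (ind-nonneg K₂) m ⨾ OpN-ind-≤ ps K₂ inv≥0 (0≤1 ⨾ hl≥1) Op-inv-K₂ j m ⨾
   scale (^≥0 j (0≤1 ⨾ hl≥1)) (𝟙≤1 (m N.<ᵇ K₂)) ⨾ *1 _ ≡⨾ ^-mono-exponent hl≥1 j≤n

  𝟙-guard : ∀ m D {x y : 𝔽} → (m N.+ lsum D N.< K₂ → x ≤ y) → 𝟙 (m N.+ lsum D N.<ᵇ K₂) * x ≤ 𝟙 (m N.+ lsum D N.<ᵇ K₂) * y
  𝟙-guard m D {x} {y} f with m N.+ lsum D N.<ᵇ K₂ in eq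
  ... | true = scale 0≤1 (f (N.<ᵇ⇒< _ K₂ (subst T (sym eq) tt)))
  ... | false = ≡⇒≤ (solve 2 (λ x y → κ 0 :* x := κ 0 :* y) refl x y)

  module Range (m y M : ℕ) (my : K₂ N.≤ m N.+ y) (M≥ : 2^ (y N.+ L) N.≤ M) where

   lsum≤ : ∀ D → m N.+ lsum D N.< K₂ → lsum D N.≤ y
   lsum≤ D l = N.+-cancelˡ-≤ m _ _ (N.<⇒≤ l ⨟ my)

   -- Every D that occurs has ∏ D ≤ 2^y ≤ M / 2^L, so 2^L ≤ M ∏ 1/p. The gain 2^L outweighs any
   -- power of L, which disposes of errors O(1) per class.
   counting : ∀ j → j N.≤ n → SubSum j ps (λ D → 𝟙 (m N.+ lsum D N.<ᵇ K₂)) * # (2^ L) ≤ # M * Y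
   counting j j≤n = ≡⇒≤ (*-comm _ (# (2^ L)) ∙ sym (SubSum-scale j ps (# (2^ L)) _)) ⨾
    (SubSum-mono j ps λ D s → *-comm (# (2^ L)) (𝟙 (m N.+ lsum D N.<ᵇ K₂)) ≡⨾ 𝟙-guard m D (each D s) ⨾≡ *-swap (𝟙 (m N.+ lsum D N.<ᵇ K₂)) (# M) (∏ inv D)) ⨾
     (SubSum-scale j ps (# M) _ ∙ cong (# M *_) (SubSum-Op K₂ j ps inv m)) ≡⨾ scale (#≥0 M) (Op-j j j≤n m)
    where
    each : ∀ D → D ⊆ ps → m N.+ lsum D N.< K₂ → # (2^ L) ≤ # M * ∏ inv D
    each D s l = *-cancel-inv (Π≥1 D hD) (sym (#-* (2^ L) (Π D)) ≡⨾ #-mono (N.*-monoʳ-≤ (2^ L) (Π≤2^lsum D ⨟ 2^-mono (lsum≤ D l)) ⨟ reflexive (sym (N.^-distribˡ-+-* 2 L y) ∙ cong 2^_ (N.+-comm L y)) ⨟ M≥)) ⨾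
      ≡⇒≤ (cong (# M *_) (inv-Π D hD))
     where
     hD : ∀ p → p ∈ D → Prime p
     hD p i = ps-prime K p (Sublist.lookup s i)

   L≤log : L N.≤ ⌊log₂ M ⌋
   L≤log = reflexive (sym (⌊log₂[2^n]⌋≡n L)) ⨟ ⌊log₂⌋-mono-≤ (2^-mono (N.m≤n+m L y) ⨟ M≥)

   -- With Z = 2 G + 2 the exponents satisfy y Z = y (2 G + 1) + y ≤ y (2 G + 1) + 2 G L. One of the
   -- 2 G + 1 available L remains and accommodates W.
   level : y N.≤ K₂ → ∀ D → m N.+ lsum D N.< K₂ → T (inLevel Z M (W N.* Π D)) × W N.* Π D N.≤ M
   level y≤ D l = N.≤⇒≤ᵇ (N.^-monoˡ-≤ Z q≤ ⨟ reflexive (N.^-*-assoc 2 (lg W N.+ y) Z) ⨟ 2^-mono exponent ⨟ reflexive (sym (N.^-*-assoc 2 (y N.+ L) (suc (2 N.* G)))) ⨟ N.^-monoˡ-≤ (suc (2 N.* G)) M≥)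
     , q≤ ⨟ 2^-mono (reflexive (N.+-comm (lg W) y) ⨟ N.+-monoʳ-≤ y (N.m≤m*n (lg W) Z ⨟ wL)) ⨟ M≥
    where
    q≤ : W N.* Π D N.≤ 2^ (lg W N.+ y)
    q≤ = N.*-mono-≤ (N.<⇒≤ (n<2^lg W)) (Π≤2^lsum D ⨟ 2^-mono (lsum≤ D l)) ⨟ reflexive (sym (N.^-distribˡ-+-* 2 (lg W) y))
    exponent : (lg W N.+ y) N.* Z N.≤ (y N.+ L) N.* suc (2 N.* G)
    exponent = reflexive (solveℕ 3 (λ w y g → (w ⊞ y) ⊛ (conℕ 2 ⊞ conℕ 2 ⊛ g) ≗ w ⊛ (conℕ 2 ⊞ conℕ 2 ⊛ g) ⊞ (y ⊛ (conℕ 1 ⊞ conℕ 2 ⊛ g) ⊞ y)) refl (lg W) y G) ⨟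
     N.+-mono-≤ wL (N.+-monoʳ-≤ (y N.* suc (2 N.* G)) y≤) ⨟ reflexive (solveℕ 3 (λ y l g → l ⊞ (y ⊛ (conℕ 1 ⊞ conℕ 2 ⊛ g) ⊞ (g ⊛ l ⊞ g ⊛ l)) ≗ (y ⊞ l) ⊛ (conℕ 1 ⊞ conℕ 2 ⊛ g)) refl y L G)

   ws++ps-prime : ∀ p → p ∈ ws ++ ps → Prime p
   ws++ps-prime p i = [ ws-prime p , ps-prime K p ]′ (∈-++⁻ ws i)

   -- `bv-total` with S = L^(n+s): saving n + 2 s logarithms leaves S² / L^(n+2s) = L^n in the first
   -- part, the trivial bound gives L^n in the second, and division by S saves L^s.
   discrepancies : y N.≤ K₂ → ∀ {e : ℕ → 𝔽} → (∀ q → # 0 ≤ e q) → ∀ s C →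
    ∑ (rg 1 (suc M)) (λ q → 𝟙 (inLevel Z M q ∧ μ² q) * e q) * # (⌊log₂ M ⌋ N.^ (n N.+ (s N.+ s))) ≤ # (C N.* M) →
    (∀ D → D ⊆ ps → W N.* Π D N.≤ M → e (W N.* Π D) ≤ # 3 * # M * ∏ 2inv D) →
    SumSub K₂ c ps (λ D → e (W N.* Π D)) m * l ^ s ≤ # M * (# C + # 3 * # h ^ n)
   discrepancies y≤ {e} e≥0 s C hS triv = scale-cancel l^n>0 (≡⇒≤ (*-rotate (l ^ n) x (l ^ s) ∙ cong (_* x) (sym (^-+ l n s))) ⨾
     bv-total {ws} {ps} ws++ps-prime (Unique.++⁺ (unique-primes 0 (2^ V)) (unique-primes _ _) (λ { (i , j) → disjoint K j i })) Z M e≥0 {Sb} {# 3 * # M} Sb≥ (*≥0 (#≥0 3) (#≥0 M)) K₂ m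
       (λ D s r → let t = level y≤ D r in π₁ t , π₂ t , triv D s (π₂ t)) S>0 c ⨾
      ≤-refl ⊕ scale (*≥0 (#≥0 3) (#≥0 M)) (Op-cong ps (λ p _ → solve 2 (λ a b → a :* (κ 2 :* b) := a :* κ 2 :* b) refl (# (c N.* c)) (inv p) ∙ cong (_* inv p) (sym (#-* (c N.* c) 2))) (ind K₂) m ≡⨾ Op-j n N.≤-refl m) ⨾
       ≡⇒≤ total)
    where
    x = SumSub K₂ c ps (λ D → e (W N.* Π D)) m
    A = n N.+ (s N.+ s)
    S = l ^ (n N.+ s)
    pos : ∀ j → # 0 < l ^ j
    pos j = <-≤-trans (#-pos 1 N.≤-refl) (^-≥1 j l≥1)
    l^n>0 = pos n
    S>0 : # 0 < S
    S>0 = pos (n N.+ s)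
    Sb = # (C N.* M) * inv (L N.^ A)
    L^A≥1 : 1 N.≤ L N.^ A
    L^A≥1 = N.m^n>0 L ⦃ N.>-nonZero L≥1 ⦄ A
    Sb≥ : ∑ (rg 1 (suc M)) (λ q → 𝟙 (inLevel Z M q ∧ μ² q) * e q) ≤ Sb
    Sb≥ = *-cancel-inv L^A≥1 (scale (∑≥0 (rg 1 (suc M)) λ q _ → *≥0 (𝟙≥0 (inLevel Z M q ∧ μ² q)) (e≥0 q)) (#-mono (N.^-monoˡ-≤ A L≤log)) ⨾ hS)
    recip : l ^ n * l ^ s * l ^ s * inv (L N.^ A) ≡ # 1
    recip = cong (_* inv (L N.^ A)) (solve 2 (λ a b → a :* b :* b := a :* (b :* b)) refl (l ^ n) (l ^ s) ∙ cong (l ^ n *_) (sym (^-+ l s s)) ∙ sym (^-+ l n (s N.+ s)) ∙ sym (#-^ L A)) ∙ #-inv (L N.^ A) L^A≥1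
    total : S * S * Sb + # 3 * # M * Y ≡ l ^ n * (# M * (# C + # 3 * # h ^ n))
    total = cong₂ (λ a b → a * a * (b * inv (L N.^ A)) + # 3 * # M * Y) (^-+ l n s) (#-* C M) ∙ cong (λ z → l ^ n * l ^ s * (l ^ n * l ^ s) * (# C * # M * inv (L N.^ A)) + # 3 * # M * z) (^-distrib (# h) l n) ∙
     solve 6 (λ a b c m i hn → a :* b :* (a :* b) :* (c :* m :* i) :+ κ 3 :* m :* (hn :* a) := a :* b :* b :* i :* (a :* (c :* m)) :+ κ 3 :* m :* (hn :* a)) refl (l ^ n) (l ^ s) (# C) (# M) (inv (L N.^ A)) (# h ^ n) ∙
      cong (λ z → z * (l ^ n * (# C * # M)) + # 3 * # M * (# h ^ n * l ^ n)) recip ∙ solve 4 (λ a c m hn → κ 1 :* (a :* (c :* m)) :+ κ 3 :* m :* (hn :* a) := a :* (m :* (c :+ κ 3 :* hn))) refl (l ^ n) (# C) (# M) (# h ^ n)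

inside : (ei ej N : ℕ) → ℕ → Bool
inside ei ej N n = (N N.<ᵇ n) ∧ (n N.≤ᵇ 2 N.* N) ∧ β ei ej N n

-- The two sieve sums for a single N

module Sieve (bvP : BV1-Primes) (bvE : BV1-E2) (V : ℕ) (V≥ : 4004 N.≤ V) (G : ℕ) (G≥2 : 2 N.≤ G) (c : ℕ) (c≡ : 8 N.* 4 ≡ c) (c≤n : c N.≤ c N.* c N.* 2) (40≤n : 40 N.≤ c N.* c N.* 2) where

 V≥5 : 5 N.≤ V
 V≥5 = N.m≤m+n 5 3999 ⨟ V≥

 V≥1 : 1 N.≤ V
 V≥1 = s≤s z≤n ⨟ V≥

 G≥1 : 1 N.≤ G
 G≥1 = N.<⇒≤ G≥2

 open Dimension1 V V≥1
 open Discrepancies V V≥1 G G≥1 c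
 open QuadraticForm κf tf
 open Weights hh

 private
  A : ℕ
  -- s = 12 in `discrepancies`: ten powers of L are lost to T₀², one to the sum over the smaller
  -- factors, and one is to spare.
  A = n N.+ (12 N.+ 12)

  savesP = saves {primeDiscrepancy} {Z} (bvP Z (s≤s z≤n)) A
  -- η = 1/Z has to be below 1/4, and 4 < 2 G + 2 follows from G ≥ 2.
  savesE = saves {e2Discrepancy 1 Z} {Z} (bvE 1 Z (s≤s z≤n) (N.+-mono-≤ (s≤s (s≤s {n = 0} z≤n)) (N.m≤m+n 3 1 ⨟ N.*-monoʳ-≤ 2 G≥2)) Z (s≤s z≤n)) A

  Cx = π₁ (power≤exponential (n N.+ 12) (s≤s z≤n ⨟ N.m≤n+m 12 n))

 NP NE : ℕ
 NP = π₁ (π₂ savesP)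
 NE = π₁ (π₂ savesE)

 -- Constants of the error terms: `ΩC` for counting sets D, `ΩP` for the primes m beside one q₁,
 -- `ΩE` for one form n + h, `Ω` for five forms and twice the plain sum.
 ΩC ΩP ΩE Ω : 𝔽
 ΩC = # h ^ n * # Cx
 ΩP = # 8 * (# (π₁ savesP) + # 3 * # h ^ n + # 2 * ΩC)
 ΩE = # (π₁ savesE) + # 3 * # h ^ n + # 2 * (dyadic 0 * # Z) * ΩP
 Ω = # 5 * ΩE + # 2 * ΩC

 private
  ΩC≥0 : # 0 ≤ ΩC
  ΩC≥0 = *≥0 (^≥0 n (#≥0 h)) (#≥0 Cx)
  3h≥0 : # 0 ≤ # 3 * # h ^ n
  3h≥0 = *≥0 (#≥0 3) (^≥0 n (#≥0 h))
  ΩP≥0 : # 0 ≤ ΩP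
  ΩP≥0 = *≥0 (#≥0 8) (+≥0 (+≥0 (#≥0 _) 3h≥0) (*≥0 (#≥0 2) ΩC≥0))

 Ω≥0 : # 0 ≤ Ω
 Ω≥0 = +≥0 (*≥0 (#≥0 5) (+≥0 (+≥0 (#≥0 _) 3h≥0) (*≥0 (*≥0 (#≥0 2) (*≥0 (dyadic-nonneg 0) (#≥0 Z))) ΩP≥0))) (*≥0 (#≥0 2) ΩC≥0)

 W≥2 : 2 N.≤ W
 W≥2 = ∣.∣⇒≤ ⦃ N.>-nonZero W≥1 ⦄ (∈∣Π ws (∈-primes⁺ (toWitness {a? = prime? 2} tt) z≤n (N.<-≤-trans (N.m≤m+n 3 1) (2^-mono {2} {V} (s≤s (s≤s z≤n) ⨟ V≥5)))))

 module Long (L : ℕ) (2V≤L : 2 N.* V N.≤ L) (wL : lg W N.* Z N.≤ L) (NP≤L : NP N.≤ L) (NE≤L : NE N.≤ L) where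

  L≥1 : 1 N.≤ L
  L≥1 = V≥1 ⨟ N.m≤m+n V _ ⨟ 2V≤L

  open AtLevel L L≥1 wL public

  module Wide (m y M : ℕ) (my : K₂ N.≤ m N.+ y) (M≥ : 2^ (y N.+ L) N.≤ M) where
   open Range m y M my M≥ public

   few : ∀ j → j N.≤ n → SubSum j ps (λ D → 𝟙 (m N.+ lsum D N.<ᵇ K₂)) * l ^ 12 ≤ # M * ΩC
   few j j≤n = scale-cancel (#-pos (2^ L) (2^≥1 L)) (solve 3 (λ e x l → e :* (x :* l) := l :* (x :* e)) refl (# (2^ L)) _ (l ^ 12) ≡⨾ scale (^≥0 12 (0≤1 ⨾ l≥1)) (counting j j≤n) ⨾
    ≡⇒≤ (cong (λ z → l ^ 12 * (# M * z)) (^-distrib (# h) l n) ∙ solve 4 (λ a m h b → a :* (m :* (h :* b)) := m :* h :* (b :* a)) refl (l ^ 12) (# M) (# h ^ n) (l ^ n) ∙ cong (# M * # h ^ n *_) (sym (^-+ l n 12) ∙ sym (#-^ L (n N.+ 12)))) ⨾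
     scale (*≥0 (#≥0 M) (^≥0 n (#≥0 h))) (#-mono (π₂ (power≤exponential (n N.+ 12) (s≤s z≤n ⨟ N.m≤n+m 12 n)) L) ⨾≡ #-* Cx (2^ L)) ⨾≡ solve 4 (λ m h c e → m :* h :* (c :* e) := e :* (m :* (h :* c))) refl (# M) (# h ^ n) (# Cx) (# (2^ L)))

  module At (N : ℕ) (N≥ : 2^ (K₂ N.+ L) N.≤ N) (N< : N N.< 2^ (Z N.* L)) (ν : ℕ) (ν-adm : ∀ h → h ∈ H₅ → Cop.Coprime (ν N.+ h) W)
       {F : ℕ → 𝔽} (aF : Antitone F) (sF : Supp K F) (F≥0 : ∀ x → # 0 ≤ F x) where

   open SemiPrimes 1 Z N
   module Cl = Classes ws ws-prime ν

   2^L≤N : 2^ L N.≤ N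
   2^L≤N = 2^-mono (N.m≤n+m L K₂) ⨟ N≥

   N≥12 : 12 N.≤ N
   N≥12 = N.m≤m+n 12 4 ⨟ 2^-mono {4} {L} (N.n≤1+n 4 ⨟ V≥5 ⨟ N.m≤m+n V _ ⨟ 2V≤L) ⨟ 2^L≤N

   square≤ : ∀ {p x} → p N.< 2^ x → x N.+ x N.≤ K₂ N.+ L → p N.* p N.≤ N
   square≤ {p} {x} p< x≤ = N.*-mono-≤ (N.<⇒≤ p<) (N.<⇒≤ p<) ⨟ reflexive (sym (N.^-distribˡ-+-* 2 x x)) ⨟ 2^-mono x≤ ⨟ N≥

   small-ws : ∀ p → p ∈ ws → p N.* p N.≤ N
   small-ws p i = square≤ {p} {V} (π₂ (π₂ (∈-primes⁻ i))) (reflexive (sym (double V)) ⨟ 2V≤L ⨟ N.m≤n+m L K₂)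

   small-ps : ∀ p → p ∈ ps → p N.* p N.≤ N
   small-ps p i = square≤ {p} {K} (π₂ (π₂ (∈-primes⁻ i))) (N.m≤m+n K₂ L)

   -- A smaller factor satisfies p^Z > N ≥ 2^(V Z), so it exceeds 2^V.
   f∉ws : ∀ {p} → p ∈ facs₁ → p ∉ ws
   f∉ws {p} i j = N.<⇒≱ (π₁ (π₂ (facs₁⁻ i))) (N.^-monoˡ-≤ Z (N.<⇒≤ (π₂ (π₂ (∈-primes⁻ j)))) ⨟ reflexive (N.^-*-assoc 2 V Z) ⨟ 2^-mono VZ ⨟ N≥ ⨟ reflexive (sym (N.*-identityʳ N)))
    where
    VZ : V N.* Z N.≤ K₂ N.+ L
    VZ = reflexive (solveℕ 2 (λ v g → v ⊛ (conℕ 2 ⊞ conℕ 2 ⊛ g) ≗ (conℕ 1 ⊞ g) ⊛ (conℕ 2 ⊛ v)) refl V G) ⨟ N.*-monoʳ-≤ (suc G) 2V≤L ⨟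
     N.m≤m+n (suc G N.* L) K ⨟ reflexive (solveℕ 2 (λ g l → (conℕ 1 ⊞ g) ⊛ l ⊞ g ⊛ l ≗ g ⊛ l ⊞ g ⊛ l ⊞ l) refl G L)

   ps≥32 : ∀ p → p ∈ ps → 32 N.≤ p
   ps≥32 p i = 2^-mono V≥5 ⨟ π₁ (π₂ (∈-primes⁻ i))

   admissible : ∀ {D} → D ⊆ ps → Cl.Admissible D
   admissible s = (λ p i → let j = Sublist.lookup s i in ps-prime K p j , ps≥32 p j , λ k → disjoint K j k) , Unique-⊆ s (unique-primes _ _)

   module SP h (h∈ : h ∈ H₅) = Cl.SemiPrimeClasses 1 Z N N≥12 h h∈ (ν-adm h h∈) small-ws
   -- The discrepancies do not involve h, so those for h = 0 serve all five forms.
   open SP 0 (here refl) using (errE; errP; start; X; gq; e2-eq; prime-eq)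

   trivE : ∀ D → D ⊆ ps → W N.* Π D N.≤ N → errE (W N.* Π D) ≤ # 3 * # N * ∏ 2inv D
   trivE D s q≤ = err-trivial W≥1 D (Cl.adm a) (π₂ a) {e2Discrepancy 1 Z N} N (suc N) (λ n → 𝟙 (β 1 Z N n)) (πβq 1 Z N q) q≤ (countIn≤ (suc N) (suc (2 N.* N)) _ ⨟ reflexive (cong (_∸ N) (double N) ∙ N.m+n∸n≡m N N)) (λ n → 𝟙≥0 _) (λ n → 𝟙≤1 _)
     (λ a → e2-eq q a ∙ cong (λ z → ∑ (rg (suc N) z) (λ n → 𝟙 (β 1 Z N n) * 𝟙 (cong? q a n)) - # (πβq 1 Z N q) * inv (φ q)) (cong suc (double N)))
    where
    a = admissible s
    q = W N.* Π D

   trivP : ∀ M D → D ⊆ ps → W N.* Π D N.≤ M → errP M (W N.* Π D) ≤ # 3 * # M * ∏ 2inv D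
   trivP M D s q≤ = err-trivial W≥1 D (Cl.adm a) (π₂ a) {primeDiscrepancy M} M M (λ n → 𝟙 (isPrime n)) (π♭ M) q≤ (countIn≤ M (2 N.* M) isPrime ⨟ reflexive (cong (_∸ M) (double M) ∙ N.m+n∸n≡m M M)) (λ n → 𝟙≥0 _) (λ n → 𝟙≤1 _)
     (λ a → prime-eq M q a ∙ cong (λ z → ∑ (rg M z) (λ n → 𝟙 (isPrime n) * 𝟙 (cong? q a n)) - # (π♭ M) * inv (φ q)) (double M))
    where
    a = admissible s
    q = W N.* Π D

   2^L>L : ∀ {M} → 2^ L N.≤ M → L N.≤ M
   2^L>L p = N.<⇒≤ (n<2^n L) ⨟ p

   errorE : ℕ → List ℕ → 𝔽
   errorE q₁ D = 𝟙 (mem q₁ D) * (# 4 ^ length (rem q₁ D) * (errP (start q₁) (W N.* Π (rem q₁ D)) + # 2))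

   errorD : List ℕ → 𝔽
   errorD D = # 4 ^ length D * errE (W N.* Π D) + ∑ facs₁ (λ q₁ → errorE q₁ D)

   errE≥0 : ∀ q → # 0 ≤ errE q
   errE≥0 = err≥0 {e2Discrepancy 1 Z N}

   errP+2≥0 : ∀ M q → # 0 ≤ errP M q + # 2
   errP+2≥0 M q = +≥0 (err≥0 {primeDiscrepancy M} q) (#≥0 2)

   errorD≥0 : ∀ D → # 0 ≤ errorD D
   errorD≥0 D = +≥0 (*≥0 (^≥0 (length D) (#≥0 4)) (errE≥0 (W N.* Π D))) (∑≥0 facs₁ λ q₁ _ → *≥0 (𝟙≥0 (mem q₁ D)) (*≥0 (^≥0 (length (rem q₁ D)) (#≥0 4)) (errP+2≥0 (start q₁) (W N.* Π (rem q₁ D)))))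

   -- A set D containing q leaves length K₂ - lg q for the rest, and M is about N/q ≥ 2^(K₂ + L - lg
   -- q): the modulus and the interval shrink together, so the level suffices. If q is longer than
   -- K₂, only M ≥ 2^L is needed, which follows from q² ≤ N.
   start-wide : ∀ {q} → q ∈ facs₁ → ∃ λ y → K₂ N.≤ lg q N.+ y × y N.≤ K₂ × 2^ (y N.+ L) N.≤ start q
   start-wide {q} i = [ below , above ]′ (N.≤-total (lg q) K₂)
    where
    M = start q
    hq = facs₁⁻ i
    N<Mq : N N.< M N.* q
    N<Mq = N.<-≤-trans (n<[1+n/L]L N (suc (q ∸ 1))) (reflexive (cong (M N.*_) (suc-pred′ (prime≥1 (π₁ hq)))))
    below : lg q N.≤ K₂ → ∃ λ y → K₂ N.≤ lg q N.+ y × y N.≤ K₂ × 2^ (y N.+ L) N.≤ M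
    below v≤ = K₂ ∸ lg q , reflexive (sym (N.m+[n∸m]≡n v≤)) , N.m∸n≤m K₂ (lg q) , N.*-cancelʳ-≤ _ _ (2^ lg q) ⦃ N.>-nonZero (2^≥1 (lg q)) ⦄
     (reflexive (sym (N.^-distribˡ-+-* 2 (K₂ ∸ lg q N.+ L) (lg q)) ∙ cong 2^_ (+-swap (K₂ ∸ lg q) L (lg q) ∙ cong (N._+ L) (N.m∸n+n≡m v≤))) ⨟ N≥ ⨟ N.<⇒≤ N<Mq ⨟ N.*-monoʳ-≤ M (N.<⇒≤ (n<2^lg q)))
    above : K₂ N.≤ lg q → ∃ λ y → K₂ N.≤ lg q N.+ y × y N.≤ K₂ × 2^ (y N.+ L) N.≤ M
    above K₂≤ = 0 , K₂≤ ⨟ N.m≤m+n _ 0 , z≤n , N.≮⇒≥ λ M< → N.<⇒≱ N<Mq (N.*-monoʳ-≤ M (N.<⇒≤ (N.≰⇒> λ M≤q → N.<⇒≱ N<Mq (N.*-monoˡ-≤ q M≤q ⨟ π₂ (π₂ hq)))) ⨟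
     square≤ {M} {L} M< (N.+-monoˡ-≤ L (reflexive (sym (N.*-identityˡ L)) ⨟ N.*-monoˡ-≤ L G≥1 ⨟ N.m≤m+n K K)))

   -- Taking q₁ out of D costs the factor 8; the remaining weights 8^|D| · 4^|D| are c^|D|. The 2
   -- per class from the end points is covered by `few`.
   per-factor : ∀ q₁ → q₁ ∈ facs₁ → SubSum 8 ps (λ D → 𝟙 (lsum D N.<ᵇ K₂) * errorE q₁ D) * l ^ 12 ≤ # (start q₁) * ΩP
   per-factor q₁ i = scaleʳ (^≥0 12 (0≤1 ⨾ l≥1)) ((SubSum-mono 8 ps λ D _ → ≡⇒≤ (transfer D (mem q₁ D) refl)) ⨾ SubSum-rem 8 ps q₁ (unique-primes _ _) {F′} F′≥0 ⨾ scale (#≥0 8) (≡⇒≤ expand)) ⨾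
     ≡⇒≤ (solve 3 (λ a b l → κ 8 :* (a :+ κ 2 :* b) :* l := κ 8 :* (a :* l :+ κ 2 :* (b :* l))) refl S₁ S₂ (l ^ 12)) ⨾
      scale (#≥0 8) (discrepancies y≤ (err≥0 {primeDiscrepancy M}) 12 (π₁ savesP) (π₂ (π₂ savesP) M (NP≤L ⨟ 2^L>L (2^-mono (N.m≤n+m L y) ⨟ M≥))) (trivP M) ⊕ scale (#≥0 2) (few c c≤n)) ⨾
       ≡⇒≤ (solve 4 (λ m p h w → κ 8 :* (m :* (p :+ h) :+ κ 2 :* (m :* w)) := m :* (κ 8 :* (p :+ h :+ κ 2 :* w))) refl (# M) (# (π₁ savesP)) (# 3 * # h ^ n) ΩC)
    where
    M = start q₁
    v₁ = lg q₁
    wide = start-wide i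
    y = π₁ wide
    y≤ = π₁ (π₂ (π₂ wide))
    M≥ = π₂ (π₂ (π₂ wide))
    open Wide v₁ y M (π₁ (π₂ wide)) M≥
    F′ : List ℕ → 𝔽
    F′ D = 𝟙 (v₁ N.+ lsum D N.<ᵇ K₂) * (# 4 ^ length D * (errP M (W N.* Π D) + # 2))
    F′≥0 : ∀ D → # 0 ≤ F′ D
    F′≥0 D = *≥0 (𝟙≥0 _) (*≥0 (^≥0 (length D) (#≥0 4)) (errP+2≥0 M (W N.* Π D)))
    transfer : ∀ D b → mem q₁ D ≡ b → 𝟙 (lsum D N.<ᵇ K₂) * (𝟙 b * (# 4 ^ length (rem q₁ D) * (errP M (W N.* Π (rem q₁ D)) + # 2))) ≡ 𝟙 b * F′ (rem q₁ D)
    transfer D false e = solve 3 (λ a b c → a :* (κ 0 :* b) := κ 0 :* c) refl (𝟙 (lsum D N.<ᵇ K₂)) _ (F′ (rem q₁ D))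
    transfer D true e = cong (λ z → 𝟙 (z N.<ᵇ K₂) * (# 1 * r)) (rem-lsum D (mem⁻ q₁ D (subst T (sym e) tt))) ∙ solve 2 (λ a b → a :* (κ 1 :* b) := κ 1 :* (a :* b)) refl (𝟙 (v₁ N.+ lsum (rem q₁ D) N.<ᵇ K₂)) r
     where r = # 4 ^ length (rem q₁ D) * (errP M (W N.* Π (rem q₁ D)) + # 2)
    S₁ = SumSub K₂ c ps (λ D → errP M (W N.* Π D)) v₁
    S₂ = SubSum c ps (λ D → 𝟙 (v₁ N.+ lsum D N.<ᵇ K₂))
    expand : SubSum 8 ps F′ ≡ S₁ + # 2 * S₂
    expand = (SubSum-cong 8 ps λ D _ → solve 3 (λ a b e → a :* (b :* (e :+ κ 2)) := b :* (a :* e :+ κ 2 :* a)) refl (𝟙 (v₁ N.+ lsum D N.<ᵇ K₂)) (# 4 ^ length D) (errP M (W N.* Π D))) ∙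
     SubSum-power 8 4 ps (λ D → 𝟙 (v₁ N.+ lsum D N.<ᵇ K₂) * errP M (W N.* Π D) + # 2 * 𝟙 (v₁ N.+ lsum D N.<ᵇ K₂)) ∙ cong (λ j → SubSum j ps (λ D → 𝟙 (v₁ N.+ lsum D N.<ᵇ K₂) * errP M (W N.* Π D) + # 2 * 𝟙 (v₁ N.+ lsum D N.<ᵇ K₂))) c≡ ∙ SubSum-+ c ps _ _ ∙ cong₂ _+_ (sym (SumSub-SubSum K₂ c ps _ v₁)) (SubSum-scale c ps (# 2) _)

   -- The sum of 1/q is bounded crudely by the harmonic sum up to N; the resulting factor L is
   -- affordable.
   ∑-start : ∑ facs₁ (λ q → # (start q)) ≤ # N * (# 2 * (dyadic 0 * # Z) * l)
   ∑-start = ∑-mono facs₁ each ⨾ ≡⇒≤ (∑-scale facs₁ (# N * # 2) inv ∙ cong (# N * # 2 *_) (∑-filter (λ p → Bool.T? (smallFactor p)) (rg 1 (suc N)) inv ∙ refl)) ⨾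
     scale (*≥0 (#≥0 N) (#≥0 2)) ((∑-mono (rg 1 (suc N)) λ q _ → if-𝟙 ⌊ Bool.T? (smallFactor q) ⌋ (inv q) ≡⨾ scaleʳ (inv-nonneg q) (𝟙≤1 ⌊ Bool.T? (smallFactor q) ⌋) ⨾≡ 1* (inv q)) ⨾
       ∑-subrange {1} {suc N} {2^ 0} {2^ (Z N.* L N.+ 0)} N.≤-refl (N< ⨟ 2^-mono {Z N.* L} (N.m≤m+n (Z N.* L) 0)) inv-nonneg ⨾ ∑-dyadic-≤ {0} {0} z≤n (Z N.* L)) ⨾
      ≡⇒≤ (cong (λ z → # N * # 2 * (dyadic 0 * z)) (#-* Z L) ∙ solve 4 (λ n d z l → n :* κ 2 :* (d :* (z :* l)) := n :* (κ 2 :* (d :* z) :* l)) refl (# N) (dyadic 0) (# Z) l)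
    where
    each : ∀ q → q ∈ facs₁ → # (start q) ≤ # N * # 2 * inv q
    each q i = *-cancel-inv q≥1 (sym (#-* (start q) q) ≡⨾ #-mono le ⨾≡ #-* N 2)
     where
     hq = facs₁⁻ i
     q≥1 = prime≥1 (π₁ hq)
     le : start q N.* q N.≤ N N.* 2
     le = N.+-mono-≤ (N.m≤m*n q q ⦃ N.>-nonZero q≥1 ⦄ ⨟ π₂ (π₂ hq)) (reflexive (cong (N N./ suc (q ∸ 1) N.*_) (sym (suc-pred′ q≥1))) ⨟ DM.m/n*n≤m N (suc (q ∸ 1))) ⨟ reflexive (sym (double N) ∙ N.*-comm 2 N)

   E2-error : SumSub K₂ 8 ps errorD 0 * l ^ 12 ≤ # N * ΩE * l
   E2-error = ≡⇒≤ (cong (_* l ^ 12) (SumSub-SubSum K₂ 8 ps errorD 0 ∙ (SubSum-cong 8 ps λ D _ → solve 4 (λ a b e s → a :* (b :* e :+ s) := b :* (a :* e) :+ a :* s) refl (𝟙 (lsum D N.<ᵇ K₂)) (# 4 ^ length D) (errE (W N.* Π D)) (∑ facs₁ (λ q₁ → errorE q₁ D)) ∙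
       cong (# 4 ^ length D * (𝟙 (lsum D N.<ᵇ K₂) * errE (W N.* Π D)) +_) (sym (∑-scale facs₁ (𝟙 (lsum D N.<ᵇ K₂)) (λ q₁ → errorE q₁ D)))) ∙
      SubSum-+ 8 ps _ _ ∙ cong₂ _+_ (SubSum-power 8 4 ps (λ D → 𝟙 (lsum D N.<ᵇ K₂) * errE (W N.* Π D)) ∙ cong (λ j → SubSum j ps (λ D → 𝟙 (lsum D N.<ᵇ K₂) * errE (W N.* Π D))) c≡ ∙ sym (SumSub-SubSum K₂ c ps (λ D → errE (W N.* Π D)) 0)) (SubSum-∑ 8 ps facs₁ (λ q₁ D → 𝟙 (lsum D N.<ᵇ K₂) * errorE q₁ D)))) ⨾
    ≡⇒≤ (solve 3 (λ a b l → (a :+ b) :* l := a :* l :+ b :* l) refl S₁ (∑ facs₁ S₂) (l ^ 12) ∙ cong (S₁ * l ^ 12 +_) (sym (∑-scaleʳ facs₁ (l ^ 12) S₂))) ⨾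
     ≤-trans (discrepancies N.≤-refl errE≥0 12 (π₁ savesE) (π₂ (π₂ savesE) N (NE≤L ⨟ 2^L>L 2^L≤N)) trivE) (*1˘ _ ≡⨾ scale (*≥0 (#≥0 N) (+≥0 (#≥0 (π₁ savesE)) 3h≥0)) l≥1)
        ⊕ ≤-trans (∑-mono facs₁ per-factor) (∑-scaleʳ facs₁ ΩP _ ≡⨾ scaleʳ ΩP≥0 ∑-start) ⨾
      ≡⇒≤ (solve 6 (λ n a b d p l → n :* (a :+ b) :* l :+ n :* (d :* l) :* p := n :* (a :+ b :+ d :* p) :* l) refl (# N) (# (π₁ savesE)) (# 3 * # h ^ n) (# 2 * (dyadic 0 * # Z)) ΩP l)
    where
    open Wide 0 K₂ N N.≤-refl N≥
    S₁ = SumSub K₂ c ps (λ D → errE (W N.* Π D)) 0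
    S₂ : ℕ → 𝔽
    S₂ q₁ = SubSum 8 ps (λ D → 𝟙 (lsum D N.<ᵇ K₂) * errorE q₁ D)

   -- An error of 1 in each of 5^|D| classes, weighted by 8^|D|: the origin of the 40.
   plain-error : SumSub K₂ 8 ps (λ D → # 5 ^ length D) 0 * l ^ 12 ≤ # N * ΩC
   plain-error = cong (_* l ^ 12) (SumSub-SubSum K₂ 8 ps _ 0 ∙ (SubSum-cong 8 ps λ D _ → *-comm (𝟙 (lsum D N.<ᵇ K₂)) (# 5 ^ length D)) ∙ SubSum-power 8 5 ps _) ≡⨾ Wide.few 0 K₂ N N.≤-refl N≥ 40 40≤n

   ns : List ℕ
   ns = rg (suc N ∸ 12) (suc (2 N.* N))

   T₀ : 𝔽
   T₀ = Op κf ps F 0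

   Λ² : ℕ → 𝔽
   Λ² n = Lam ps F n * Lam ps F n

   dens₂ : ℕ → ℕ → 𝔽
   dens₂ q p = if p N.≡ᵇ q then # 1 else # 4 * δf p

   private
    weights : ∀ p → p ∈ ps → # 0 ≤ κf p × # 0 ≤ tf p × tf p ≤ # 2 × (∀ n → hh p n * hh p n ≡ hh p n)
    weights p i = Cf.κ≥0 , Cf.t≥0 , Cf.t≤2 , hh-idem p (ps≥32 p i)
     where module Cf = Coefficients p (ps≥32 p i)

    majorant : ∀ {I : Set} (g : I → ℕ → 𝔽) is → Majorant g ns is K 0 F F
    majorant g is = record { bound = λ x → lin (F≥0 x ⊕ F≥0 x) (solve 1 (λ a → a :+ (κ 0 :+ κ 0) := :- a :+ (a :+ a)) refl (F x)) , ≤-refl ; anti = aF ; supp = λ {x} p → sF (p ⨟ reflexive (N.+-identityʳ x)) }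

   -- `Form-approx` with one density per smaller factor. The bound is the same for all h, which
   -- yields the factor 5 later.
   pair-form : ∀ h → h ∈ H₅ → ∑ facs₁ (λ q → X q * inv (φ W) * Mn (dens₂ q) ps F F) - T₀ * T₀ * SumSub K₂ 8 ps errorD 0 ≤ ∑ ns (λ n → 𝟙 (cong? W ν n) * 𝟙 (inside 1 Z N (h N.+ n)) * Λ² n)
   pair-form h h∈ = lin (π₁ (Form-approx dens₂ ns facs₁ K ps weights {m = 0} (λ n → 𝟙 (cong? W ν n) * 𝟙 (inside 1 Z N (h N.+ n))) (λ q → X q * inv (φ W)) errorD (majorant dens₂ facs₁) (majorant dens₂ facs₁) z≤n errorD≥0
     (λ D s _ → subst (λ z → Abs≤ (z - ∑ facs₁ (λ q → X q * inv (φ W) * ∏ (dens₂ q) D)) (errorD D)) (sym (Ct.shifted D s)) (Ct.e2-count D s))))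
    (solve 3 (λ a m e → a :+ (:- e) := m :- e :+ (a :- m)) refl _ _ _)
    where module Ct D (s : D ⊆ ps) = SP.Count h h∈ W≥2 f∉ws (admissible s) (λ p i → small-ps p (Sublist.lookup s i))

   plain-form : ∑ ns (λ n → 𝟙 (cong? W ν n) * Λ² n) ≤ # (N N.+ 12) * inv W * Mn (λ p → # 5 * inv p) ps F F + T₀ * T₀ * SumSub K₂ 8 ps (λ D → # 5 ^ length D) 0
   plain-form = lin (π₂ (Form-approx (λ (_ : ⊤) p → # 5 * inv p) ns (tt ∷ []) K ps weights {m = 0} (λ n → 𝟙 (cong? W ν n)) (λ _ → # (N N.+ 12) * inv W) (λ D → # 5 ^ length D) (majorant _ _) (majorant _ _) z≤n (λ D → ^≥0 (length D) (#≥0 5))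
     (λ D s _ → subst₂ (λ z y → Abs≤ (z - y) (# 5 ^ length D)) (cong (λ z → ∑ (rg (suc N ∸ 12) z) (λ m → 𝟙 (cong? W ν m) * ∏ (λ p → hh p m) D)) end) (+0˘ _) (Cl.plain-count (suc N ∸ 12) (N N.+ 12) (admissible s)))))
    (solve 3 (λ a m e → m :+ e :+ (a :- (m :+ κ 0)) := a :+ e) refl _ _ _)
    where
    end : (suc N ∸ 12) N.+ (N N.+ 12) ≡ suc (2 N.* N)
    end = solveℕ 3 (λ x n t → x ⊞ (n ⊞ t) ≗ x ⊞ t ⊞ n) refl (suc N ∸ 12) N 12 ∙ cong (N._+ N) (N.m∸n+n≡m (N.m≤n⇒m≤1+n N≥12)) ∙ cong suc (sym (double N))

   excess : 𝔽
   excess = ∑ ns (λ n → 𝟙 (cong? W ν n) * (∑ H₅ (λ h → 𝟙 (inside 1 Z N (h N.+ n))) - # 2) * Λ² n)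

   excess-lower : # 5 * ∑ facs₁ (λ q → X q * inv (φ W) * Mn (dens₂ q) ps F F) - # 2 * (# (N N.+ 12) * inv W * Mn (λ p → # 5 * inv p) ps F F)
           - T₀ * T₀ * (# 5 * SumSub K₂ 8 ps errorD 0 + # 2 * SumSub K₂ 8 ps (λ D → # 5 ^ length D) 0) ≤ excess
   excess-lower = lin (≤-trans (≡⇒≤ (sym (∑-const H₅ (Σq - T₀ * T₀ * EE)))) (∑-mono H₅ pair-form) ⊕ scale (#≥0 2) plain-form)
    (cong (_+ (# 5 * (Σq - T₀ * T₀ * EE) + # 2 * S₁)) decompose ∙ solve 7 (λ s q m t e f g → s :- κ 2 :* f :+ (κ 5 :* (q :- t :* e) :+ κ 2 :* f) := κ 5 :* q :- κ 2 :* m :- t :* (κ 5 :* e :+ κ 2 :* g) :+ (s :+ κ 2 :* (m :+ t :* g))) refl Σh Σq Mp (T₀ * T₀) EE S₁ (SumSub K₂ 8 ps (λ D → # 5 ^ length D) 0))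
    where
    EE = SumSub K₂ 8 ps errorD 0
    Σq = ∑ facs₁ (λ q → X q * inv (φ W) * Mn (dens₂ q) ps F F)
    Mp = # (N N.+ 12) * inv W * Mn (λ p → # 5 * inv p) ps F F
    S₁ = ∑ ns (λ n → 𝟙 (cong? W ν n) * Λ² n)
    Σh = ∑ H₅ (λ h → ∑ ns (λ n → 𝟙 (cong? W ν n) * 𝟙 (inside 1 Z N (h N.+ n)) * Λ² n))
    decompose : excess ≡ Σh - # 2 * S₁
    decompose = (∑-ext ns λ n → solve 3 (λ c s l → c :* (s :- κ 2) :* l := c :* l :* s :+ (:- κ 2) :* (c :* l)) refl (𝟙 (cong? W ν n)) (∑ H₅ (λ h → 𝟙 (inside 1 Z N (h N.+ n)))) (Λ² n) ∙
       cong (_+ (- # 2) * (𝟙 (cong? W ν n) * Λ² n)) (sym (∑-scale H₅ (𝟙 (cong? W ν n) * Λ² n) (λ h → 𝟙 (inside 1 Z N (h N.+ n)))) ∙ (∑-ext H₅ λ h → *-swapʳ (𝟙 (cong? W ν n)) (Λ² n) (𝟙 (inside 1 Z N (h N.+ n)))))) ∙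
     ∑-+ ns _ _ ∙ cong₂ _+_ (∑-swap ns H₅ (λ n h → 𝟙 (cong? W ν n) * 𝟙 (inside 1 Z N (h N.+ n)) * Λ² n)) (∑-scale ns (- # 2) _ ∙ solve 1 (λ a → (:- κ 2) :* a := :- (κ 2 :* a)) refl S₁)

   total-error : T₀ * T₀ * (# 5 * SumSub K₂ 8 ps errorD 0 + # 2 * SumSub K₂ 8 ps (λ D → # 5 ^ length D) 0) * l ^ 12 ≤ T₀ * T₀ * (# N * Ω * l)
   total-error = ≡⇒≤ (solve 4 (λ t e g l → t :* (κ 5 :* e :+ κ 2 :* g) :* l := t :* (κ 5 :* (e :* l) :+ κ 2 :* (g :* l))) refl (T₀ * T₀) _ _ (l ^ 12)) ⨾
    scale (sq-nonneg T₀) (scale (#≥0 5) E2-error ⊕ scale (#≥0 2) (plain-error ⨾ *1˘ _ ≡⨾ scale (*≥0 (#≥0 N) ΩC≥0) l≥1) ⨾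
     ≡⇒≤ (solve 4 (λ n e c l → κ 5 :* (n :* e :* l) :+ κ 2 :* (n :* c :* l) := n :* (κ 5 :* e :+ κ 2 :* c) :* l) refl (# N) ΩE ΩC l))

-- Positivity of the main term

1+-power : ∀ {x} n → # 0 ≤ x → x ≤ # 1 → (# 1 + x) ^ n + x ≤ # 1 + # (2^ n) * x
1+-power {x} zero h h' = ≡⇒≤ (solve 1 (λ x → κ 1 :+ x := κ 1 :+ κ 1 :* x) refl x)
1+-power {x} (suc n) h h' = lin (scale (+≥0 0≤1 h) (1+-power n h h') ⊕ scale (*≥0 (sub-nonneg (#-mono (2^≥1 n))) h) h')
 (cong (λ z → # 1 + z * x + ((# 1 + x) * ((# 1 + x) ^ n + x) + (# (2^ n) - # 1) * x * x)) (#-* 2 (2^ n)) ∙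
  solve 3 (λ x t p → κ 1 :+ κ 2 :* t :* x :+ ((κ 1 :+ x) :* (p :+ x) :+ (t :- κ 1) :* x :* x) := (κ 1 :+ x) :* p :+ x :+ ((κ 1 :+ x) :* (κ 1 :+ t :* x) :+ (t :- κ 1) :* x :* κ 1)) refl x (# (2^ n)) ((# 1 + x) ^ n))

-- One small θ dominates every precision parameter. The thirteen factors 1 - η, 1 - 2 i, 1 - e cost
-- 13 θ by Bernoulli, the thirteen factors 1 + i, 1 + e cost 2^13 θ = 8192 θ, and the slack term
-- costs θ C. All of this has to fit into one half of the margin 2 D.
main-term-positive : ∀ {θ η i e D Q C C₁} → # 0 ≤ i → # 0 ≤ e → i ≤ θ → # 2 * i ≤ θ → e ≤ θ → η ≤ θ → # 0 ≤ η → # 0 ≤ C → # 0 ≤ C₁ → C₁ ≤ C → # 1 ≤ D → # 4002 * D ≤ # 50000 * Q → # 10000 * (# 3300 + # 5 * C) * θ ≤ # 1 →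
 D ≤ # 50000 * ((# 1 - η) ^ 2 * (# 1 - # 2 * i) * ((# 1 - e) ^ 10 * Q - e * C₁)) - # 4000 * ((# 1 + i) ^ 3 * (# 1 + e) ^ 10 * D)
main-term-positive {θ} {η} {i} {e} {D} {Q} {C} {C₁} i≥0 e≥0 i≤ 2i≤ e≤ η≤ η≥0 C≥0 C₁≥0 C₁≤ D≥1 num small =
 -- 13 · 4002 + 4000 · 8192 = 32820026, and 179974 completes it to the 33000000 = 10000 · 3300 of
 -- the smallness condition.
 lin (scaleʳ D≥0 small ⊕ scale (#≥0 50000) (scale (*≥0 θ≥0 C≥0) D≥1) ⊕ scale (#≥0 179974) (*≥0 θ≥0 D≥0) ⊕ lower ⊕ scale (#≥0 50000) minus ⊕ scale (#≥0 4000) (scaleʳ D≥0 upper))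
  (solve 10 (λ D t C k q e c u x s → κ 50000 :* (k :* (q :- e :* c)) :- κ 4000 :* (u :* D) :+ (κ 10000 :* (κ 3300 :+ κ 5 :* C) :* t :* D :+ κ 50000 :* (t :* C :* κ 1) :+ κ 179974 :* κ 0 :+ (κ 1 :- κ 13 :* t) :* (κ 4002 :* D) :+ κ 50000 :* (k :* (e :* c)) :+ κ 4000 :* (u :* D)) :=
    D :+ (κ 1 :* D :+ κ 50000 :* (t :* C :* D) :+ κ 179974 :* (t :* D) :+ κ 50000 :* (k :* q) :+ κ 50000 :* (t :* C) :+ κ 4000 :* ((κ 1 :+ κ 8192 :* t) :* D))) refl D θ C k₁ ((# 1 - e) ^ 10 * Q) e C₁ ((# 1 + i) ^ 3 * (# 1 + e) ^ 10) θ θ)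
 where
 D≥0 = 0≤1 ⨾ D≥1
 θ≥0 = i≥0 ⨾ i≤
 k₁ = (# 1 - η) ^ 2 * (# 1 - # 2 * i)
 θC≥0 = *≥0 θ≥0 C≥0
 13θ≤1 : # 13 * θ ≤ # 1
 13θ≤1 = lin (scale (#≥0 50000) θC≥0 ⊕ scale (#≥0 32999987) θ≥0) (solve 2 (λ t C → κ 10000 :* (κ 3300 :+ κ 5 :* C) :* t :+ (κ 50000 :* κ 0 :+ κ 32999987 :* κ 0) := κ 13 :* t :+ (κ 50000 :* (t :* C) :+ κ 32999987 :* t)) refl θ C) ⨾ small
 θ≤1 : θ ≤ # 1
 θ≤1 = lin (scale (#≥0 12) θ≥0) (solve 1 (λ t → κ 13 :* t :+ κ 12 :* κ 0 := t :+ κ 12 :* t) refl θ) ⨾ 13θ≤1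
 1- : ∀ {x} → x ≤ θ → # 1 - θ ≤ # 1 - x
 1- {x} h = lin h (solve 2 (λ x t → κ 1 :- x :+ x := κ 1 :- t :+ t) refl x θ)
 1-θ≥0 = sub-nonneg θ≤1
 1-≤1 : ∀ {x} → # 0 ≤ x → # 1 - x ≤ # 1
 1-≤1 {x} h = lin h (solve 1 (λ x → κ 1 :+ κ 0 := κ 1 :- x :+ x) refl x)
 1-η≥0 = 1-θ≥0 ⨾ 1- η≤
 1-2i≥0 = 1-θ≥0 ⨾ 1- 2i≤
 1-13θ : # 1 - # 13 * θ ≤ k₁ * (# 1 - e) ^ 10
 1-13θ = bernoulli 13 θ≥0 θ≤1 ⨾ ≡⇒≤ (^-+ (# 1 - θ) 3 10 ∙ solve 2 (λ a b → a :* (a :* (a :* κ 1)) :* b := a :* (a :* κ 1) :* a :* b) refl (# 1 - θ) ((# 1 - θ) ^ 10)) ⨾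
  *-mono (^≥0 10 1-θ≥0) (*≥0 (^≥0 2 1-η≥0) 1-2i≥0) (*-mono 1-θ≥0 (^≥0 2 1-η≥0) (^-mono 2 1-θ≥0 (1- η≤)) (1- 2i≤)) (^-mono 10 1-θ≥0 (1- e≤))
 lower : (# 1 - # 13 * θ) * (# 4002 * D) ≤ # 50000 * (k₁ * ((# 1 - e) ^ 10 * Q))
 lower = *-mono 4002D≥0 (sub-nonneg 13θ≤1 ⨾ 1-13θ) 1-13θ num ⨾ ≡⇒≤ (solve 3 (λ k p q → k :* p :* (κ 50000 :* q) := κ 50000 :* (k :* (p :* q))) refl k₁ ((# 1 - e) ^ 10) Q)
  where 4002D≥0 = *≥0 (#≥0 4002) D≥0
 minus : k₁ * (e * C₁) ≤ θ * C
 minus = *-mono (*≥0 e≥0 C₁≥0) 0≤1 (*-mono 1-2i≥0 0≤1 (^-mono 2 1-η≥0 (1-≤1 η≥0) ⨾≡ solve 0 (κ 1 :* (κ 1 :* κ 1) := κ 1) refl) (1-≤1 (*≥0 (#≥0 2) i≥0)) ⨾≡ solve 0 (κ 1 :* κ 1 := κ 1) refl) (*-mono C₁≥0 θ≥0 e≤ C₁≤) ⨾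
  ≡⇒≤ (1* (θ * C))
 upper : (# 1 + i) ^ 3 * (# 1 + e) ^ 10 ≤ # 1 + # 8192 * θ
 upper = *-mono (^≥0 10 (+≥0 0≤1 e≥0)) (^≥0 3 (+≥0 0≤1 θ≥0)) (^-mono 3 (+≥0 0≤1 i≥0) (≤-refl ⊕ i≤)) (^-mono 10 (+≥0 0≤1 e≥0) (≤-refl ⊕ e≤)) ⨾
  sym (^-+ (# 1 + θ) 3 10) ≡⨾ lin θ≥0 (solve 2 (λ p t → p :+ t :+ κ 0 := p :+ t) refl ((# 1 + θ) ^ 13) θ) ⨾ 1+-power 13 θ≥0 θ≤1

∑-prime-blocks : ∀ L k f → ∑ (rg 1 (suc k)) (λ a → ∑ (primes (2^ (a N.* L)) (2^ (suc a N.* L))) f) ≡ ∑ (primes (2^ (1 N.* L)) (2^ (suc k N.* L))) f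
∑-prime-blocks L zero f = ∑-nil {1} {1} N.≤-refl _ ∙ sym (∑-primes _ _ f ∙ ∑-nil {2^ (1 N.* L)} N.≤-refl _)
∑-prime-blocks L (suc k) f = ∑-suc {1} {suc k} (s≤s z≤n) _ ∙ cong (_+ ∑ (primes (2^ (suc k N.* L)) (2^ (suc (suc k) N.* L))) f) (∑-prime-blocks L k f) ∙
 sym (∑-primes-split _ (2^-mono (N.*-monoˡ-≤ L {1} {suc k} (s≤s z≤n))) (2^-mono (N.m≤n+m (suc k N.* L) L)) f)

-- The lower bound t may be negative, since the slack is subtracted in it; then f ≥ 0 is used
-- instead.
∑-weight-lower : ∀ {A : Set} (xs : List A) {m f : A → 𝔽} {t μ : 𝔽} → (∀ x → x ∈ xs → # 0 ≤ m x × # 0 ≤ f x × t ≤ f x) → # 0 ≤ μ → μ ≤ ∑ xs m → μ * t ≤ ∑ xs (λ x → m x * f x)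
∑-weight-lower xs {m} {f} {t} {μ} h μ≥0 hμ = [ (λ t≥0 → scaleʳ t≥0 hμ ⨾ sym (∑-scaleʳ xs t m) ≡⨾ (∑-mono xs λ x i → scale (π₁ (h x i)) (π₂ (π₂ (h x i)))))
 , (λ t≤0 → scale μ≥0 t≤0 ⨾ *0 μ ≡⨾ (∑≥0 xs λ x i → *≥0 (π₁ (h x i)) (π₁ (π₂ (h x i))))) ]′ (≤-total (# 0) t)

pick : ∀ {A : Set} {b} {x y : A} → T b → (if b then x else y) ≡ x
pick {b = true} _ = refl

pick-not : ∀ {A : Set} {b} {x y : A} → ¬ T b → (if b then x else y) ≡ y
pick-not {b = true} h = ⊥-elim (h tt)
pick-not {b = false} _ = refl

pos-factor : ∀ {a b} → # 0 ≤ a → # 0 < a * b → # 0 < b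
pos-factor {a} h p = ≰⇒> λ q → <⇒≱ p (scale h q ⨾≡ *0 a)

abstract
 upper-bound : ∀ xs → ∃ λ L → ∀ {x} → x ∈ xs → x N.≤ L
 upper-bound [] = 0 , λ ()
 upper-bound (x ∷ xs) = x N.+ π₁ (upper-bound xs) , λ { (here refl) → N.m≤m+n x _ ; (there j) → π₂ (upper-bound xs) j ⨟ N.m≤n+m _ x }

eventually : ∀ x {y} → # 0 < y → ∃ λ n → ∀ L → n N.≤ L → x ≤ y * # L
eventually x {y} h = π₁ (arch x h) , λ L p → π₂ (arch x h) ⨾ scaleʳ (<⇒≤ h) (#-mono p) ⨾ ≡⇒≤ (*-comm (# L) y)

-- Comparison of the averaged sums and choice of the parameters

module Conclusion (bvP : BV1-Primes) (bvE : BV1-E2) (V : ℕ) (V≥ : 4004 N.≤ V) (G : ℕ) (G≥2 : 2 N.≤ G) (c : ℕ) (c≡ : 8 N.* 4 ≡ c) (c≤n : c N.≤ c N.* c N.* 2) (40≤n : 40 N.≤ c N.* c N.* 2)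
 (fN : ℕ → ℕ) (f-anti : ∀ {b c} → b N.≤ c → fN c N.≤ fN b) (f-supp : ∀ {b} → G N.≤ b → fN b ≡ 0) (f≥1 : 1 N.≤ fN 0) where

 open Estimate V V≥ G (N.<⇒≤ G≥2) fN f-anti f-supp
 open QuadraticForm κf tf using (Mn; Mn-diagonal; module Weights)
 open Weights hh using (Lam)
 NP NE : ℕ
 NP = Sieve.NP bvP bvE V V≥ G G≥2 c c≡ c≤n 40≤n
 NE = Sieve.NE bvP bvE V V≥ G G≥2 c c≡ c≤n 40≤n

 Ω : 𝔽
 Ω = Sieve.Ω bvP bvE V V≥ G G≥2 c c≡ c≤n 40≤n

 Ω≥0 : # 0 ≤ Ω
 Ω≥0 = Sieve.Ω≥0 bvP bvE V V≥ G G≥2 c c≡ c≤n 40≤n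

 G≥1 : 1 N.≤ G
 G≥1 = N.<⇒≤ G≥2

 V≥2 : 2 N.≤ V
 V≥2 = s≤s (s≤s z≤n) ⨟ V≥5

 W : ℕ
 W = Π ws

 W≥1 : 1 N.≤ W
 W≥1 = Π≥1 ws ws-prime

 -- `C₀` bounds the slack constant `C₁`, with 8192 = 2^13 ≥ E^13 and at most G reciprocals; its
 -- summand f₀ provides the condition `he`. `U₀` is the unit common to both main terms, `τ` the size
 -- of the total error relative to N.
 C₀ θ den′ U₀ y₀ τ : 𝔽
 C₀ = f₀ * f₀ * # 8192 * # G ^ 7 + f₀
 θ = # 4004 * # G * i
 den′ = inv (φ W)
 U₀ = inv W * (c₂ * α ^ 5)
 y₀ = E * (f₀ * # (Discrepancies.h V V≥1 G G≥1 c) ^ 5)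
 τ = y₀ * y₀ * Ω

 den : ℕ → ℕ
 den a = suc a N.* (suc (suc (2 N.* G)) ∸ a)

 U₀>0 : # 0 < U₀
 U₀>0 = *-pos (inv-pos W W≥1) (*-pos (<-≤-trans (inv-pos 2 (s≤s z≤n)) c₂≥½) (*-pos α>0 (*-pos α>0 (*-pos α>0 (*-pos α>0 (*-pos α>0 (#-pos 1 N.≤-refl)))))))

 -- φ(W) = W ∏_{p ∣ W} (1 - 1/p)
 φW-euler : den′ * P ≡ inv W
 φW-euler = inv-unique W W≥1 (*-swap (# W) den′ P ∙ cong (den′ *_) (go ws ws-prime ∙ 1*˘ _ ∙ cong (_* ∏ (λ p → # p - # 1) ws) (sym φ-1) ∙
   sym (φ-Π ws 1 N.≤-refl (λ p m → ws-prime p m , λ d → N.<⇒≱ (prime≥2 (ws-prime p m)) (∣.∣⇒≤ d)) (unique-primes _ _)) ∙ cong (λ z → # (φ z)) (N.*-identityˡ W)) ∙ *-comm den′ (# (φ W)) ∙ #-inv (φ W) (φ≥1 W W≥1))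
  where
  go : ∀ D → (∀ p → p ∈ D → Prime p) → # (Π D) * euler D ≡ ∏ (λ p → # p - # 1) D
  go [] h = solve 0 (κ 1 :* κ 1 := κ 1) refl
  go (p ∷ D) h = cong (_* euler (p ∷ D)) (#-* p (Π D)) ∙ solve 4 (λ p i q e → p :* q :* ((κ 1 :- i) :* e) := (p :- p :* i) :* (q :* e)) refl (# p) (inv p) (# (Π D)) (euler D) ∙ cong₂ (λ x y → (# p - x) * y) (#-inv p (prime≥1 (h p (here refl)))) (go D λ q j → h q (there j))

 i≤θ : # 4004 * i ≤ θ
 i≤θ = solve 1 (λ i → κ 4004 :* i := κ 4004 :* κ 1 :* i) refl i ≡⨾ scaleʳ i≥0 (scale (#≥0 4004) (#-mono G≥1))

 θ≥0 : # 0 ≤ θ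
 θ≥0 = *≥0 (*≥0 (#≥0 4004) (#≥0 G)) i≥0

 multiple≤θ : ∀ k → k N.≤ 4004 → # k * i ≤ θ
 multiple≤θ k h = scaleʳ i≥0 (#-mono h) ⨾ i≤θ

 f₀≥1 : # 1 ≤ f₀
 f₀≥1 = #-mono f≥1

 8192≥0 : # 0 ≤ f₀ * f₀ * # 8192 * # G ^ 7
 8192≥0 = *≥0 (*≥0 (*≥0 f₀≥0 f₀≥0) (#≥0 8192)) (^≥0 7 (#≥0 G))

 D≥1 : # 1 ≤ D
 D≥1 = *-mono 0≤1 f₀≥0 f₀≥1 f₀≥1 `after` ≡⇒≤ (solve 0 (κ 1 := κ 1 :* κ 1) refl) ⨾ ≡⇒≤ (solve 1 (λ a → a := a :- κ 0 :* κ 0) refl (f₀ * f₀) ∙ cong (λ z → f₀ * f₀ - z * z) (sym (f-Supp N.≤-refl)) ∙ sym (∑-telescope (sq f) {0} {G} z≤n)) ⨾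
   (∑-mono (rg 0 G) λ b _ → *1˘ _ ≡⨾ scale (sub-nonneg (sq-antitone f-antitone (λ x → #≥0 (fN x)) (N.n≤1+n b))) (^-≥1 5 (#-mono {1} {suc b} (s≤s z≤n))))
  where
  _`after`_ : ∀ {a b c : 𝔽} → b ≤ c → a ≤ b → a ≤ c
  p `after` q = q ⨾ p

 module Small (hV : # 10000 * (# 3300 + # 5 * C₀) * θ ≤ # 1) (num : # 4002 * D ≤ # 50000 * ∑ (rg 1 G) (λ a → inv (den a) * Nn a)) where

  he : # 8 * e * # G * f₀ ≤ # 1
  he = lin (*≥0 θ≥0 (+≥0 (+≥0 (#≥0 33000000) (*≥0 (#≥0 50000) 8192≥0)) (*≥0 (#≥0 49992) f₀≥0)))
    (solve 4 (λ i g f x → κ 10000 :* (κ 3300 :+ κ 5 :* (x :+ f)) :* (κ 4004 :* g :* i) :+ κ 0 := κ 8 :* (κ 4004 :* i) :* g :* f :+ κ 4004 :* g :* i :* (κ 33000000 :+ κ 50000 :* x :+ κ 49992 :* f)) refl i (# G) f₀ (f₀ * f₀ * # 8192 * # G ^ 7)) ⨾ hV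

  33θ≤1 : # 33000000 * θ ≤ # 1
  33θ≤1 = lin (*≥0 (#≥0 50000) (*≥0 (+≥0 8192≥0 f₀≥0) θ≥0)) (solve 2 (λ C t → κ 10000 :* (κ 3300 :+ κ 5 :* C) :* t :+ κ 0 := κ 33000000 :* t :+ κ 50000 :* (C :* t)) refl C₀ θ) ⨾ hV

  e≤½ : # 2 * e ≤ # 1
  e≤½ = scale (#≥0 2) i≤θ ⨾ scaleʳ θ≥0 (#-mono {2} {33000000} (N.m≤m+n 2 32999998)) ⨾ 33θ≤1

  θ≤1 : θ ≤ # 1
  θ≤1 = 1*˘ θ ≡⨾ scaleʳ θ≥0 (#-mono {1} {33000000} (s≤s z≤n)) ⨾ 33θ≤1

  module Long (L : ℕ) (2V≤L : 2 N.* V N.≤ L) (wL : lg W N.* suc (suc (2 N.* G)) N.≤ L) (NP≤L : NP N.≤ L) (NE≤L : NE N.≤ L)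
   (hL₁ : # 5 * # (suc B) ≤ e * # L) (hL₂ : # 4 * # B' ≤ e * # L) (hL₃ : # 4 * ((S₀ + E * (α * # B)) * f₀) ≤ α * # L) (hC : Mertens.C₃ V V≥2 + # 2 ≤ i * # G * # L) (hL₄ : # 24 ≤ i * # L)
   (hΩ : # 1 + # 15360000 * τ * c₂ ≤ U₀ * # L) where

   module SL = Sieve.Long bvP bvE V V≥ G G≥2 c c≡ c≤n 40≤n L 2V≤L wL NP≤L NE≤L
   open SL using (L≥1; l; l≥1; K; K₂; ps)
   open AtLength L L≥1 hL₁ hL₂ hL₃ he e≤½ using (F; F-antitone; F-supp; F-nonneg; M₁-upper; module AtPrime; E≥; E≤2)

   V≤L : V N.≤ L
   V≤L = N.m≤m+n V _ ⨟ 2V≤L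

   open Mertens.Mass V V≥2 G L G≥1 V≤L hC using (N₁; N₂; weight; weight≥0; X; η; block-mass)

   l≥0 : # 0 ≤ l
   l≥0 = 0≤1 ⨾ l≥1

   dens₂ : ℕ → ℕ → 𝔽
   dens₂ q p = if p N.≡ᵇ q then # 1 else # 4 * δf p

   M₂ : ℕ → 𝔽
   M₂ q = Mn (dens₂ q) ps F F

   M₁ : 𝔽
   M₁ = Op κf ps (sq F) 0

   private
    δ′ ρ′ : ℕ → ℕ → 𝔽
    δ′ q p = κf p - tf p * dens₂ q p
    ρ′ q p = tf p * tf p * dens₂ q p * (# 1 - dens₂ q p)

    module Cf p (j : p ∈ ps) = Coefficients p (2^-mono V≥5 ⨟ π₁ (π₂ (∈-primes⁻ {2^ V} {2^ K} j)))

   M₂-diagonal : ∀ q → M₂ q ≡ Mq (δ′ q) (ρ′ q) ps F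
   M₂-diagonal q = Mn-diagonal (dens₂ q) (δ′ q) (ρ′ q) ps (λ _ _ → refl , refl) F

   M₂≥0 : ∀ q → # 0 ≤ M₂ q
   M₂≥0 q = Mq-nonneg ps (λ p j → either p j (p N.≡ᵇ q)) F ⨾ ≡⇒≤ (sym (M₂-diagonal q))
    where
    either : ∀ p (j : p ∈ ps) b → # 0 ≤ tf p * tf p * (if b then # 1 else # 4 * δf p) * (# 1 - (if b then # 1 else # 4 * δf p))
    either p j true = ≡⇒≤ (π₂ (Cf.sure-density p j))
    either p j false = Cf.ρ≥0 p j ⨾ ≡⇒≤ (π₂ (Cf.twin-density p j))

   M₂-off : ∀ q → q ∈ ps → M₂ q ≡ Mq (off q δf) (off q ρf) ps (λ x → F x - F (x N.+ lg q))
   M₂-off q j = M₂-diagonal q ∙ Mq-off q ps (unique-primes _ _) j {δ′ q} {ρ′ q} {δf} {ρf} (cong (λ g → κf q - tf q * g) one ∙ sym (π₁ (Cf.sure-density q j))) (cong (λ g → tf q * tf q * g * (# 1 - g)) one ∙ sym (π₂ (Cf.sure-density q j)))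
     (λ p k ne → let g≡ = pick-not {x = # 1} {# 4 * δf p} (λ t → ne (N.≡ᵇ⇒≡ p q t)) in cong (λ g → κf p - tf p * g) g≡ ∙ sym (π₁ (Cf.twin-density p k)) , cong (λ g → tf p * tf p * g * (# 1 - g)) g≡ ∙ sym (π₂ (Cf.twin-density p k))) F
    where
    one : dens₂ q q ≡ # 1
    one = pick (N.≡⇒≡ᵇ q q refl)

   M₁-diagonal : Mn (λ p → # 5 * inv p) ps F F ≡ M₁
   M₁-diagonal = Mn-diagonal (λ p → # 5 * inv p) (λ _ → # 0) κf ps (λ p j → Cf.main-density p j) F ∙ Mq-diagonal (λ _ → # 0) κf ps (λ _ _ → refl) F

   block : ℕ → List ℕ
   block a = primes (2^ (a N.* L)) (2^ (suc a N.* L))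

   t : ℕ → 𝔽
   t a = (# 1 - e) ^ 10 * Nn a - e * (f₀ * f₀ * E ^ 13 * # G ^ 6)

   block-lower : ∀ a → 1 N.≤ a → a N.< G → ∀ p → p ∈ block a → α ^ 6 * l ^ 6 * t a ≤ # 24 * E ^ 4 * M₂ p
   block-lower a a≥1 a<G p j = AtPrime.M₂-lower p 2^V≤p a (N.<⇒≤ (lg-≥ {p} (π₁ (π₂ pj)))) ⨾ ≡⇒≤ (cong (# 24 * E ^ 4 *_) (sym (M₂-off p (∈-primes⁺ (π₁ pj) 2^V≤p (N.<-≤-trans (π₂ (π₂ pj)) (2^-mono (N.*-monoˡ-≤ L a<G)))))))
    where
    pj = ∈-primes⁻ {2^ (a N.* L)} j
    2^V≤p : 2^ V N.≤ p
    2^V≤p = 2^-mono (V≤L ⨟ reflexive (sym (N.*-identityˡ L)) ⨟ N.*-monoˡ-≤ L a≥1) ⨟ π₁ (π₂ pj)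

   R : List ℕ
   R = rg N₁ N₂

   m : ℕ → 𝔽
   m p = ∑ R (λ N → weight N * X p N)

   N₁≥1 : 1 N.≤ N₁
   N₁≥1 = 2^≥1 (suc (2 N.* G) N.* L)

   weight-R≥0 : ∀ N → N ∈ R → # 0 ≤ weight N
   weight-R≥0 N j = weight≥0 N (N₁≥1 ⨟ π₁ (∈-range⁻ j))

   X≥0 : ∀ p N → # 0 ≤ X p N
   X≥0 p N = ∑≥0 (primes (suc (N N./ suc (p ∸ 1))) (suc (2 N.* N N./ suc (p ∸ 1)))) λ _ _ → 0≤1

   η≤θ : η ≤ θ
   η≤θ = solve 2 (λ i g → κ 30 :* i :* g := κ 30 :* g :* i) refl i (# G) ≡⨾ scaleʳ i≥0 (scaleʳ (#≥0 G) (#-mono {30} {4004} (N.m≤m+n 30 3974)))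

   k₁ k₂ Q Mass : 𝔽
   k₁ = (# 1 - η) ^ 2 * (# 1 - # 2 * i)
   k₂ = (# 1 + i) ^ 2 * (# 24 * E ^ 4)
   Q = ∑ (rg 1 G) (λ a → inv (den a) * Nn a)
   Mass = ∑ (rg 1 G) (λ a → ∑ (block a) (λ p → m p * M₂ p))

   C₁ : 𝔽
   C₁ = ∑ (rg 1 G) (inv ∘ den) * (f₀ * f₀ * E ^ 13 * # G ^ 6)

   1+i≥0 : # 0 ≤ # 1 + i
   1+i≥0 = +≥0 0≤1 i≥0

   k₁≥0 : # 0 ≤ k₁
   k₁≥0 = *≥0 (^≥0 2 (sub-nonneg (η≤θ ⨾ θ≤1))) (sub-nonneg (multiple≤θ 2 (N.m≤m+n 2 4002) ⨾ θ≤1))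

   k₂≥0 : # 0 ≤ k₂
   k₂≥0 = *≥0 (^≥0 2 1+i≥0) (*≥0 (#≥0 24) (^≥0 4 E≥0))

   -- On block a the averaged count of products is at least about 1/den(a) by `block-mass`, and the
   -- form M₂ of each prime is bounded below by the same t(a).
   Mass-lower : k₁ * (α ^ 6 * l ^ 6) * ((# 1 - e) ^ 10 * Q - e * C₁) ≤ k₂ * Mass
   Mass-lower = (cong (k₁ * (α ^ 6 * l ^ 6) *_) (sym total) ∙ sym (∑-scale (rg 1 G) (k₁ * (α ^ 6 * l ^ 6)) _)) ≡⨾ ∑-mono (rg 1 G) each ⨾ ≡⇒≤ (∑-scale (rg 1 G) k₂ _)
    where
    T₁ = f₀ * f₀ * E ^ 13 * # G ^ 6
    total : ∑ (rg 1 G) (λ a → inv (den a) * t a) ≡ (# 1 - e) ^ 10 * Q - e * C₁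
    total = (∑-ext (rg 1 G) λ a → solve 5 (λ d x n e c → d :* (x :* n :- e :* c) := x :* (d :* n) :+ d :* (:- (e :* c))) refl (inv (den a)) ((# 1 - e) ^ 10) (Nn a) e T₁) ∙ ∑-+ (rg 1 G) _ _ ∙
      cong₂ _+_ (∑-scale (rg 1 G) ((# 1 - e) ^ 10) _) (∑-scaleʳ (rg 1 G) (- (e * T₁)) (inv ∘ den)) ∙ solve 5 (λ x q d e c → x :* q :+ d :* (:- (e :* c)) := x :* q :- e :* (d :* c)) refl ((# 1 - e) ^ 10) Q (∑ (rg 1 G) (inv ∘ den)) e T₁
    each : ∀ a → a ∈ rg 1 G → k₁ * (α ^ 6 * l ^ 6) * (inv (den a) * t a) ≤ k₂ * ∑ (block a) (λ p → m p * M₂ p)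
    each a j = ≡⇒≤ (solve 5 (λ k a l d t → k :* (a :* l) :* (d :* t) := d :* (k :* (a :* l :* t))) refl k₁ (α ^ 6) (l ^ 6) (inv (den a)) (t a)) ⨾
     scale (inv-nonneg (den a)) (∑-weight-lower (block a) {λ p → (# 1 + i) ^ 2 * (# (den a) * m p)} {λ p → # 24 * E ^ 4 * M₂ p} (λ p k → *≥0 (^≥0 2 1+i≥0) (*≥0 (#≥0 (den a)) (∑≥0 R λ N r → *≥0 (weight-R≥0 N r) (X≥0 p N))) ,
        *≥0 (*≥0 (#≥0 24) (^≥0 4 E≥0)) (M₂≥0 p) , block-lower a a≥1 a<G p k) k₁≥0 mass) ⨾
      ≡⇒≤ (cong (inv (den a) *_) ((∑-ext (block a) λ p → solve 5 (λ s d m c x → s :* (d :* m) :* (c :* x) := d :* (s :* c) :* (m :* x)) refl ((# 1 + i) ^ 2) (# (den a)) (m p) (# 24 * E ^ 4) (M₂ p)) ∙ ∑-scale (block a) (# (den a) * k₂) _) ∙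
       solve 4 (λ d n k s → d :* (n :* k :* s) := n :* d :* (k :* s)) refl (inv (den a)) (# (den a)) k₂ _ ∙ cong (_* (k₂ * ∑ (block a) (λ p → m p * M₂ p))) (#-inv (den a) den≥1) ∙ 1* _)
     where
     a≥1 = π₁ (∈-range⁻ j)
     a<G = π₂ (∈-range⁻ j)
     den≥1 : 1 N.≤ den a
     den≥1 = N.*-mono-≤ (s≤s {n = a} z≤n) (N.m<n⇒0<n∸m (s≤s (N.<⇒≤ a<G ⨟ N.m≤m+n G _ ⨟ N.n≤1+n _)))
     mass : k₁ ≤ ∑ (block a) (λ p → (# 1 + i) ^ 2 * (# (den a) * m p))
     mass = block-mass a a≥1 a<G (η≤θ ⨾ θ≤1) ⨾ ≡⇒≤ (cong (λ z → (# 1 + i) ^ 2 * (z * ∑ (block a) m)) (sym (#-* (suc a) (suc (suc (2 N.* G)) ∸ a))) ∙ cong ((# 1 + i) ^ 2 *_) (sym (∑-scale (block a) (# (den a)) m)) ∙ sym (∑-scale (block a) ((# 1 + i) ^ 2) _))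

   private
    sol = admissible-class ws ws-prime (unique-primes _ _)
    ν = π₁ sol
    Z = suc (suc (2 N.* G))

   excess : ℕ → 𝔽
   excess N = ∑ (rg (suc N ∸ 12) (suc (2 N.* N))) (λ n → 𝟙 (cong? W ν n) * (∑ H₅ (λ h → 𝟙 (inside 1 Z N (h N.+ n))) - # 2) * (Lam ps F n * Lam ps F n))

   pairs : ℕ → 𝔽
   pairs N = ∑ (rg 1 G) (λ a → ∑ (block a) (λ p → X p N * M₂ p))

   module AtN (N : ℕ) (N∈ : N ∈ R) where

    N≥ : 2^ (K₂ N.+ L) N.≤ N
    N≥ = reflexive (cong 2^_ (solveℕ 2 (λ g l → g ⊛ l ⊞ g ⊛ l ⊞ l ≗ (conℕ 1 ⊞ conℕ 2 ⊛ g) ⊛ l) refl G L)) ⨟ π₁ (∈-range⁻ N∈)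

    module A = SL.At N N≥ (π₂ (∈-range⁻ N∈)) ν (π₂ sol) F-antitone F-supp F-nonneg
    open SemiPrimes 1 Z N

    inv≥ : ∀ p → p ∈ ps → # 0 ≤ inv p
    inv≥ p _ = inv-nonneg p

    T₀≤ : A.T₀ ≤ y₀ * l ^ 5
    T₀≤ = Comparison.upper-κ V V≥5 E E≥ E≤2 K F-antitone F-nonneg 0 ⨾ scale E≥0 (OpN-mono ps 5 inv≥ F≤ 0 ⨾ ≡⇒≤ (Linear.lin′ (OpN-linear inv ps 5 0) f₀ (# 0) (ind K₂) (ind K₂)) ⨾
       solve 2 (λ f x → f :* x :+ κ 0 :* x := f :* x) refl f₀ (OpN inv ps 5 (ind K₂) 0) ≡⨾ scale f₀≥0 (OpN-ind-≤ ps K₂ inv≥ (0≤1 ⨾ SL.hl≥1) SL.Op-inv-K₂ 5 0 ⨾ scale (^≥0 5 (0≤1 ⨾ SL.hl≥1)) (𝟙≤1 _))) ⨾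
      ≡⇒≤ (cong (λ z → E * (f₀ * (z * # 1))) (^-distrib (# (Discrepancies.h V V≥1 G G≥1 c)) l 5) ∙ solve 4 (λ E f h l → E :* (f :* (h :* l :* κ 1)) := E :* (f :* h) :* l) refl E f₀ _ (l ^ 5))
     where
     F≤ : ∀ x → F x ≤ f₀ * ind K₂ x + # 0 * ind K₂ x
     F≤ x = [ (λ s → #-mono (f-anti z≤n) ⨾≡ solve 1 (λ f → f := f :* κ 1 :+ κ 0 :* κ 1) refl f₀ ∙ cong (λ z → f₀ * z + # 0 * z) (sym (ind-true s)))
         , (λ s → ≡⇒≤ (F-supp (N.m≤m+n K K ⨟ s) ∙ solve 1 (λ f → κ 0 := f :* κ 0 :+ κ 0 :* κ 0) refl f₀ ∙ cong (λ z → f₀ * z + # 0 * z) (sym (ind-false s)))) ]′ (N.<-≤-connex x K₂)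

    T₀≥0 : # 0 ≤ A.T₀
    T₀≥0 = Op-nonneg ps (λ p j → Cf.κ≥0 p j) F-nonneg 0

    error : 𝔽
    error = A.T₀ * A.T₀ * (# 5 * SumSub K₂ 8 ps A.errorD 0 + # 2 * SumSub K₂ 8 ps (λ D → # 5 ^ length D) 0)

    error≥0 : # 0 ≤ error
    error≥0 = *≥0 (sq-nonneg A.T₀) (+≥0 (*≥0 (#≥0 5) (SumSub-nonneg K₂ 8 ps 0 A.errorD≥0)) (*≥0 (#≥0 2) (SumSub-nonneg K₂ 8 ps 0 λ D → ^≥0 (length D) (#≥0 5))))

    -- T₀² is at most y₀² L^10, so `total-error` even bounds L times the error; that factor L ≥ 1 is
    -- dropped.
    error≤ : error ≤ # N * τ
    error≤ = *1˘ error ≡⨾ scale error≥0 l≥1 ⨾ scale-cancel (<-≤-trans (#-pos 1 N.≤-refl) (^-≥1 11 l≥1))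
     ((solve 3 (λ p e l → p :* (e :* l) := e :* (l :* p)) refl (l ^ 11) error l ∙ refl) ≡⨾ A.total-error ⨾ scaleʳ (*≥0 (*≥0 (#≥0 N) Ω≥0) l≥0) (*-mono T₀≥0 (T₀≥0 ⨾ T₀≤) T₀≤ T₀≤) ⨾
      ≡⇒≤ (solve 5 (λ y p n w l → y :* p :* (y :* p) :* (n :* w :* l) := l :* (p :* p) :* (n :* (y :* y :* w))) refl y₀ (l ^ 5) (# N) Ω l ∙ cong (λ z → l * z * (# N * τ)) (sym (^-+ l 5 5))))

    -- The forms M₂ are nonnegative, so smaller factors outside the blocks 1 ≤ a < G may be dropped.
    -- Those inside satisfy p ≥ 2^L and N < 2^(Z L), hence p^Z > N, and p < 2^K gives p² ≤ N.
    pairs≤ : pairs N ≤ ∑ facs₁ (λ q → X q N * M₂ q)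
    pairs≤ = ≡⇒≤ (cong (λ g → ∑ (rg 1 g) (λ a → ∑ (block a) f′)) (sym G≡) ∙ ∑-prime-blocks L (G ∸ 1) f′ ∙ ∑-primes _ _ f′) ⨾
     (∑-mono (rg (2^ (1 N.* L)) (2^ (suc (G ∸ 1) N.* L))) λ n j → scaleʳ (f′≥0 n) (𝟙-mono {⌊ prime? n ⌋} {⌊ Bool.T? (smallFactor n) ⌋} λ t → ⌊⌋⁺ {d = Bool.T? (smallFactor n)} (small n j (⌊⌋⁻ {d = prime? n} t)))) ⨾
      ∑-subrange {d = suc N} (2^≥1 (1 N.* L)) top (λ n → *≥0 (𝟙≥0 _) (f′≥0 n)) ⨾ ≡⇒≤ (sym (∑-filter (λ p → Bool.T? (smallFactor p)) (rg 1 (suc N)) f′ ∙ (∑-ext (rg 1 (suc N)) λ n → if-𝟙 ⌊ Bool.T? (smallFactor n) ⌋ (f′ n))))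
     where
     f′ : ℕ → 𝔽
     f′ q = X q N * M₂ q
     f′≥0 : ∀ q → # 0 ≤ f′ q
     f′≥0 q = *≥0 (X≥0 q N) (M₂≥0 q)
     G≡ : suc (G ∸ 1) ≡ G
     G≡ = N.m+[n∸m]≡n G≥1
     top : 2^ (suc (G ∸ 1) N.* L) N.≤ suc N
     top = 2^-mono (reflexive (cong (N._* L) G≡) ⨟ N.m≤m+n K K ⨟ N.m≤m+n K₂ L) ⨟ N.m≤n⇒m≤1+n N≥
     small : ∀ n → n ∈ rg (2^ (1 N.* L)) (2^ (suc (G ∸ 1) N.* L)) → Prime n → T (smallFactor n)
     small n j hn = π₂ (∈-filter⁻ (λ p → Bool.T? (smallFactor p)) {xs = rg 1 (suc N)} (facs₁⁺ hn
      (N.≤-<-trans (reflexive (N.*-identityʳ N)) (N.<-≤-trans (π₂ (∈-range⁻ N∈)) (reflexive (cong 2^_ (N.*-comm Z L ∙ cong (N._* Z) (sym (N.*-identityˡ L))) ∙ sym (N.^-*-assoc 2 (1 N.* L) Z)) ⨟ N.^-monoˡ-≤ Z (π₁ (∈-range⁻ j)))))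
      (A.square≤ {n} {suc (G ∸ 1) N.* L} (π₂ (∈-range⁻ j)) (reflexive (cong (λ g → g N.* L N.+ g N.* L) G≡) ⨟ N.m≤m+n K₂ L))))

    excess≥ : # 5 * den′ * pairs N + ((- (# 2 * inv W * M₁)) * # (N N.+ 12) + (- τ) * # N) ≤ excess N
    excess≥ = lin (error≤ ⊕ scale (*≥0 (#≥0 5) (inv-nonneg (φ W))) pairs≤) (cong (λ z → # 5 * z - # 2 * (# (N N.+ 12) * inv W * M) - error + (error + # 5 * den′ * pairs N)) factor ∙
       cong (λ z → # 5 * (den′ * S) - # 2 * (# (N N.+ 12) * inv W * z) - error + (error + # 5 * den′ * pairs N)) M₁-diagonal ∙
        solve 9 (λ d s n w m e p t k → κ 5 :* (d :* s) :- κ 2 :* (n :* w :* m) :- e :+ (e :+ κ 5 :* d :* p) := κ 5 :* d :* p :+ ((:- (κ 2 :* w :* m)) :* n :+ (:- t) :* k) :+ (k :* t :+ κ 5 :* d :* s)) refl den′ S (# (N N.+ 12)) (inv W) M₁ error (pairs N) τ (# N)) ⨾ A.excess-lower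
     where
     S = ∑ facs₁ (λ q → X q N * M₂ q)
     M = Mn (λ p → # 5 * inv p) ps F F
     factor : ∑ facs₁ (λ q → X q N * den′ * M₂ q) ≡ den′ * S
     factor = (∑-ext facs₁ λ q → *-pull (X q N) den′ (M₂ q)) ∙ ∑-scale facs₁ den′ _

   weights : ∑ R (λ N → weight N * # N) ≤ c₂ * l
   weights = (∑-mono R λ N j → each N (N₁≥1 ⨟ π₁ (∈-range⁻ j))) ⨾ ∑-dyadic-≤ {V} {suc (2 N.* G) N.* L} (V≤L ⨟ N.m≤m+n L _) L
    where
    each : ∀ N → 1 N.≤ N → weight N * # N ≤ inv N
    each N h = ≡⇒≤ (solve 3 (λ a b n → (a :- b) :* n := n :* a :- (κ 1 :+ n) :* b :+ b) refl (inv N) (inv (suc N)) (# N) ∙ cong₂ (λ x y → x - y * inv (suc N) + inv (suc N)) (#-inv N h) (sym (#-suc N)) ∙ cong (λ z → # 1 - z + inv (suc N)) (#-inv (suc N) (s≤s z≤n)) ∙ solve 1 (λ a → κ 1 :- κ 1 :+ a := a) refl (inv (suc N))) ⨾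
      inv-mono h (N.n≤1+n N)

   -- The interval for n has N + 12 elements. The extra 12 costs at most 12 in total, which is at
   -- most i c₂ L because i L ≥ 24 and c₂ ≥ 1/2.
   weights+12 : ∑ R (λ N → weight N * # (N N.+ 12)) ≤ (# 1 + i) * c₂ * l
   weights+12 = ≡⇒≤ ((∑-ext R λ N → cong (weight N *_) (#-+ N 12) ∙ solve 2 (λ w n → w :* (n :+ κ 12) := w :* n :+ κ 12 :* w) refl (weight N) (# N)) ∙ ∑-+ R _ _) ⨾
    lin (weights ⊕ ≡⇒≤ (∑-scale R (# 12) weight) ⊕ scale (#≥0 12) (∑-telescope inv (2^-mono {suc (2 N.* G) N.* L} (N.m≤n+m _ L)) ≡⨾ lin (inv-nonneg N₂) (solve 2 (λ a b → a :+ κ 0 := a :- b :+ b) refl (inv N₁) (inv N₂)) ⨾ inv≤1 N₁ N₁≥1)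
      ⊕ scale (inv-nonneg 2) hL₄ ⊕ scale (*≥0 i≥0 l≥0) c₂≥½ ⊕ scale (#≥0 12) (≡⇒≤ (sym (#-inv 2 (s≤s z≤n)))))
     (solve 7 (λ i c l s u w h → (κ 1 :+ i) :* c :* l :+ (s :+ u :+ κ 12 :* w :+ h :* κ 24 :+ i :* l :* h :+ κ 12 :* κ 1) := s :+ u :+ (c :* l :+ κ 12 :* w :+ κ 12 :* κ 1 :+ h :* (i :* l) :+ i :* l :* c :+ κ 12 :* (κ 2 :* h))) refl i c₂ l _ _ (∑ R weight) (inv 2))

   ∑-pairs′ : ∑ R (λ N → weight N * pairs N) ≡ Mass
   ∑-pairs′ = (∑-ext R λ N → sym (∑-scale (rg 1 G) (weight N) _) ∙ (∑-ext (rg 1 G) λ a → sym (∑-scale (block a) (weight N) _))) ∙ ∑-swap R (rg 1 G) (λ N a → ∑ (block a) (λ p → weight N * (X p N * M₂ p))) ∙ (∑-ext (rg 1 G) λ a →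
    ∑-swap R (block a) (λ N p → weight N * (X p N * M₂ p)) ∙ (∑-ext (block a) λ p → (∑-ext R λ N → *-assoc˘ (weight N) (X p N) (M₂ p)) ∙ ∑-scaleʳ R (M₂ p) (λ N → weight N * X p N)))

   private
    τ≥0 : # 0 ≤ τ
    τ≥0 = *≥0 (sq-nonneg y₀) Ω≥0

    M₁≥0 : # 0 ≤ M₁
    M₁≥0 = Op-nonneg ps (λ p j → Cf.κ≥0 p j) (λ x → sq-nonneg (F x)) 0

    C₁≤C₀ : C₁ ≤ C₀
    C₁≤C₀ = *-mono T≥0 (#≥0 G) dens (scaleʳ (^≥0 6 (#≥0 G)) (scale (*≥0 f₀≥0 f₀≥0) (^-mono 13 E≥0 E≤2 ⨾≡ sym (#-^ 2 13)))) ⨾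
     lin f₀≥0 (solve 3 (λ f g x → f :* f :* κ 8192 :* (g :* x) :+ f :+ κ 0 := g :* (f :* f :* κ 8192 :* x) :+ f) refl f₀ (# G) (# G ^ 6))
     where
     T≥0 : # 0 ≤ f₀ * f₀ * E ^ 13 * # G ^ 6
     T≥0 = *≥0 (*≥0 (*≥0 f₀≥0 f₀≥0) (^≥0 13 E≥0)) (^≥0 6 (#≥0 G))
     dens : ∑ (rg 1 G) (inv ∘ den) ≤ # G
     dens = (∑-mono (rg 1 G) λ a j → inv≤1 (den a) (N.*-mono-≤ (s≤s {n = a} z≤n) (N.m<n⇒0<n∸m (s≤s (N.<⇒≤ (π₂ (∈-range⁻ j)) ⨟ N.m≤m+n G _ ⨟ N.n≤1+n _))))) ⨾
      (∑-const (rg 1 G) (# 1) ∙ cong (λ n → # n * # 1) (length-rg 1 G) ∙ *1 _) ≡⨾ #-mono (N.m∸n≤m G 1)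

    C₁≥0 : # 0 ≤ C₁
    C₁≥0 = *≥0 (∑≥0 (rg 1 G) λ a _ → inv-nonneg (den a)) (*≥0 (*≥0 (*≥0 f₀≥0 f₀≥0) (^≥0 13 E≥0)) (^≥0 6 (#≥0 G)))

    Y : 𝔽
    Y = (# 1 - e) ^ 10 * Q - e * C₁

    positive : D ≤ # 50000 * (k₁ * Y) - # 4000 * ((# 1 + i) ^ 3 * E ^ 10 * D)
    positive = main-term-positive i≥0 e≥0 (1*˘ i ≡⨾ multiple≤θ 1 (s≤s z≤n)) (multiple≤θ 2 (N.m≤m+n 2 4002)) i≤θ η≤θ (*≥0 (*≥0 (#≥0 30) i≥0) (#≥0 G)) (+≥0 8192≥0 f₀≥0) C₁≥0 C₁≤C₀ D≥1 num hV

    Tot : 𝔽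
    Tot = # 5 * den′ * Mass + ((- (# 2 * inv W * M₁)) * ((# 1 + i) * c₂ * l) + (- τ) * (c₂ * l))

    -- The local factors of the two main terms agree: P/φ(W) = 1/W converts one of the six factors α
    -- = P c₂ of the sum over products into the c₂/W of the plain sum.
    U₀-den : U₀ ≡ den′ * α ^ 6
    U₀-den = cong (_* (c₂ * α ^ 5)) (sym φW-euler) ∙ solve 4 (λ d p c a → d :* p :* (c :* a) := d :* (p :* c :* a)) refl den′ P c₂ (α ^ 5)

    mass-part : U₀ * l ^ 6 * (# 50000 * (k₁ * Y)) ≤ # 50000 * den′ * (k₂ * Mass)
    mass-part = ≡⇒≤ (cong (λ u → u * l ^ 6 * (# 50000 * (k₁ * Y))) U₀-den ∙ solve 5 (λ d a l k y → d :* a :* l :* (κ 50000 :* (k :* y)) := κ 50000 :* d :* (k :* (a :* l) :* y)) refl den′ (α ^ 6) (l ^ 6) k₁ Y) ⨾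
     scale (*≥0 (#≥0 50000) (inv-nonneg (φ W))) Mass-lower

    plain-part : # 20000 * k₂ * (inv W * M₁ * ((# 1 + i) * c₂ * l)) ≤ U₀ * l ^ 6 * (# 4000 * ((# 1 + i) ^ 3 * E ^ 10 * D))
    plain-part = ≡⇒≤ (solve 6 (λ j E w m c l → κ 20000 :* (j :* (j :* κ 1) :* (κ 24 :* E)) :* (w :* m :* (j :* c :* l)) := κ 4000 :* (j :* (j :* (j :* κ 1)) :* E :* (w :* c :* l)) :* (κ 120 :* m)) refl (# 1 + i) (E ^ 4) (inv W) M₁ c₂ l) ⨾
     scale (*≥0 (#≥0 4000) (*≥0 (*≥0 (^≥0 3 1+i≥0) (^≥0 4 E≥0)) (*≥0 (*≥0 (inv-nonneg W) (inv-nonneg 2 ⨾ c₂≥½)) l≥0))) M₁-upper ⨾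
      ≡⇒≤ (solve 9 (λ s E4 w c l E6 a l5 d → κ 4000 :* (s :* E4 :* (w :* c :* l)) :* (E6 :* (a :* l5 :* d)) := w :* (c :* a) :* (l :* l5) :* (κ 4000 :* (s :* (E4 :* E6) :* d))) refl ((# 1 + i) ^ 3) (E ^ 4) (inv W) c₂ l (E ^ 6) (α ^ 5) (l ^ 5) D ∙
       cong (λ z → U₀ * l ^ 6 * (# 4000 * ((# 1 + i) ^ 3 * z * D))) (sym (^-+ E 4 6)))

    k₂≤ : k₂ ≤ # 1536
    k₂≤ = *-mono (*≥0 (#≥0 24) (^≥0 4 E≥0)) (^≥0 2 (#≥0 2)) (^-mono 2 1+i≥0 (lin (multiple≤θ 1 (s≤s z≤n) ⨾ θ≤1) (solve 1 (λ i → κ 2 :+ κ 1 :* i := κ 1 :+ i :+ κ 1) refl i))) (scale (#≥0 24) (^-mono 4 E≥0 E≤2)) ⨾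
     ≡⇒≤ (solve 0 (κ 2 :* (κ 2 :* κ 1) :* (κ 24 :* (κ 2 :* (κ 2 :* (κ 2 :* (κ 2 :* κ 1))))) := κ 1536) refl)

    -- The main terms leave a surplus of at least U₀ L^6. The error term has only the order τ L, and
    -- by `hΩ` the surplus covers it together with L; 15360000 = 10000 · 1536, where 1536 bounds k₂.
    Tot-lower : l ≤ # 10000 * k₂ * Tot
    Tot-lower = lin (mass-part ⊕ plain-part ⊕ scale (*≥0 (<⇒≤ U₀>0) (^≥0 6 l≥0)) (positive ⊕ D≥1) ⊕ scale (#≥0 10000) (scaleʳ (*≥0 τ≥0 (*≥0 (inv-nonneg 2 ⨾ c₂≥½) l≥0)) k₂≤)
       ⊕ scale l≥0 (hΩ ⨾ *1˘ _ ≡⨾ scale (*≥0 (<⇒≤ U₀>0) l≥0) (^-≥1 4 l≥1)))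
     (solve 14 (λ l k d M w m j c t U l4 p q D → κ 10000 :* k :* (κ 5 :* d :* M :+ ((:- (κ 2 :* w :* m)) :* (j :* c :* l) :+ (:- t) :* (c :* l)))
        :+ (U :* (l :* (l :* l4)) :* (κ 50000 :* p) :+ κ 20000 :* k :* (w :* m :* (j :* c :* l)) :+ U :* (l :* (l :* l4)) :* (D :+ κ 1) :+ κ 10000 :* (k :* (t :* (c :* l))) :+ l :* (κ 1 :+ κ 15360000 :* t :* c))
       := l :+ (κ 50000 :* d :* (k :* M) :+ U :* (l :* (l :* l4)) :* (κ 4000 :* q) :+ U :* (l :* (l :* l4)) :* (κ 50000 :* p :- κ 4000 :* q :+ D) :+ κ 10000 :* (κ 1536 :* (t :* (c :* l))) :+ l :* (U :* l :* l4)))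
       refl l k₂ den′ Mass (inv W) M₁ (# 1 + i) c₂ τ U₀ (l ^ 4) (k₁ * Y) ((# 1 + i) ^ 3 * E ^ 10 * D) D)

    Tot≤ : Tot ≤ ∑ R (λ N → weight N * excess N)
    Tot≤ = lin (scale (*≥0 (*≥0 (#≥0 2) (inv-nonneg W)) M₁≥0) weights+12 ⊕ scale τ≥0 weights)
       (solve 7 (λ a m t x y u v → a :+ ((:- m) :* x :+ (:- t) :* y) :+ (m :* x :+ t :* y) := a :+ ((:- m) :* u :+ (:- t) :* v) :+ (m :* u :+ t :* v)) refl (# 5 * den′ * Mass) (# 2 * inv W * M₁) τ (∑ R (λ N → weight N * # (N N.+ 12))) (∑ R (λ N → weight N * # N)) ((# 1 + i) * c₂ * l) (c₂ * l)) ⨾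
     ≡⇒≤ (sym ((∑-ext R λ N → solve 7 (λ w d p m x t y → w :* (d :* p :+ (m :* x :+ t :* y)) := d :* (w :* p) :+ (m :* (w :* x) :+ t :* (w :* y))) refl (weight N) (# 5 * den′) (pairs N) (- (# 2 * inv W * M₁)) (# (N N.+ 12)) (- τ) (# N)) ∙ ∑-+ R _ _ ∙
       cong₂ _+_ (∑-scale R (# 5 * den′) _ ∙ cong (# 5 * den′ *_) ∑-pairs′) (∑-+ R _ _ ∙ cong₂ _+_ (∑-scale R (- (# 2 * inv W * M₁)) _) (∑-scale R (- τ) _)))) ⨾
      (∑-mono R λ N j → scale (weight-R≥0 N j) (AtN.excess≥ N j))

   -- A positive weighted sum over N has a positive term, and this sum over n has one too. The class
   -- indicator and Λ² are nonnegative, so at this n the bracket ∑ - 2 is positive.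
   solution : ∃ λ N → 2^ L N.≤ N × ∃ λ n → suc N ∸ 12 N.≤ n × # 2 < ∑ H₅ (λ h → 𝟙 (inside 1 Z N (h N.+ n)))
   solution = N , 2^-mono (N.m≤m+n L _) ⨟ π₁ (∈-range⁻ N∈) , n , π₁ (∈-range⁻ (π₁ (π₂ second))) ,
     ≰⇒> λ le → <⇒≱ (π₂ (π₂ second)) (scaleʳ (sq-nonneg (Lam ps F n)) (scale (𝟙≥0 (cong? W ν n)) (lin le (solve 1 (λ s → κ 0 :+ s := s :- κ 2 :+ κ 2) refl _))) ⨾≡ solve 2 (λ a b → a :* κ 0 :* b := κ 0) refl _ _)
    where
    first = pos-term R _ (<-≤-trans (pos-factor (*≥0 (#≥0 10000) k₂≥0) (<-≤-trans (<-≤-trans (#-pos 1 N.≤-refl) l≥1) Tot-lower)) Tot≤)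
    N = π₁ first
    N∈ = π₁ (π₂ first)
    second = pos-term (rg (suc N ∸ 12) (suc (2 N.* N))) _ (pos-factor (weight-R≥0 N N∈) (π₂ (π₂ first)))
    n = π₁ second

 module Choice (ineq : Inequality G fN) (#V : # V ≡ ((# (fN 0) * # (fN 0) * # 8192 * # G ^ 7 + # (fN 0)) * # 5 + # 3300) * # 10000 * (# G * # 4004)) where

  -- An equality, as `V` is taken to be the product of all the other factors.
  hV : # 10000 * (# 3300 + # 5 * C₀) * θ ≤ # 1
  hV = ≡⇒≤ (solve 4 (λ C a g i → a :* (κ 3300 :+ κ 5 :* C) :* (κ 4004 :* g :* i) := (C :* κ 5 :+ κ 3300) :* a :* (g :* κ 4004) :* i) refl C₀ (# 10000) (# G) i ∙ cong (_* i) (sym #V) ∙ #-inv V V≥1)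

  num : # 4002 * D ≤ # 50000 * ∑ (rg 1 G) (λ a → inv (den a) * Nn a)
  num = Numerical.numerical G G≥1 fN f-anti f-supp V V≥ {4002} {50000} ineq

  i>0 : # 0 < i
  i>0 = inv-pos V V≥1

  e>0 : # 0 < e
  e>0 = *-pos (#-pos 4004 (s≤s z≤n)) i>0

  e₁ = eventually (# 5 * # (suc B)) e>0
  e₂ = eventually (# 4 * # B') e>0
  e₃ = eventually (# 4 * ((S₀ + E * (α * # B)) * f₀)) α>0
  e₄ = eventually (Mertens.C₃ V V≥2 + # 2) {i * # G} (*-pos i>0 (#-pos G G≥1))
  e₅ = eventually (# 24) i>0
  e₆ = eventually (# 1 + # 15360000 * τ * c₂) U₀>0

  solution : ∀ m → ∃ λ L → m N.≤ L × ∃ λ N → 2^ L N.≤ N × ∃ λ n → suc N ∸ 12 N.≤ n × # 2 < ∑ H₅ (λ h → 𝟙 (inside 1 (suc (suc (2 N.* G))) N (h N.+ n)))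
  solution m = L , below (here refl) ,
   Small.Long.solution hV num L (below (there (here refl))) (below (there (there (here refl)))) (below (there (there (there (here refl))))) (below (there (there (there (there (here refl))))))
    (π₂ e₁ L (below (late (here refl)))) (π₂ e₂ L (below (late (there (here refl))))) (π₂ e₃ L (below (late (there (there (here refl)))))) (π₂ e₄ L (below (late (there (there (there (here refl)))))))
    (π₂ e₅ L (below (late (there (there (there (there (here refl)))))))) (π₂ e₆ L (below (late (there (there (there (there (there (here refl)))))))))
   where
   es = π₁ e₁ ∷ π₁ e₂ ∷ π₁ e₃ ∷ π₁ e₄ ∷ π₁ e₅ ∷ π₁ e₆ ∷ []
   xs = m ∷ 2 N.* V ∷ lg W N.* suc (suc (2 N.* G)) ∷ NP ∷ NE ∷ es
   L = π₁ (upper-bound xs)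
   below : ∀ {x} → x ∈ xs → x N.≤ L
   below = π₂ (upper-bound xs)
   late : ∀ {x} → x ∈ es → x ∈ xs
   late j = there (there (there (there (there j))))

abstract
 -- 8 from the expansion of Λ² and 4 from the residue classes. Packed and opaque, so that powers
 -- with exponent 2 c² = 2048 stay symbolic.
 scale-parameter : ∃ λ c → 8 N.* 4 ≡ c × c N.≤ c N.* c N.* 2 × 40 N.≤ c N.* c N.* 2
 scale-parameter = 32 , refl , N.m≤m+n 32 2016 , N.m≤m+n 40 2008

module _ (G f : ℕ) where

 private
  C : ℕ
  C = f N.* f N.* 8192 N.* G N.^ 7 N.+ f

 abstract
  -- The value of `V`. It must stay opaque, because 2^V occurs as an end point of intervals.
  limit : ℕ
  limit = (C N.* 5 N.+ 3300) N.* 10000 N.* (G N.* 4004)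

  limit-≡ : limit ≡ (C N.* 5 N.+ 3300) N.* 10000 N.* (G N.* 4004)
  limit-≡ = refl

  limit-≥ : 1 N.≤ G → 4004 N.≤ limit
  limit-≥ G≥1 = N.*-monoˡ-≤ 4004 G≥1 ⨟ N.m≤n*m (G N.* 4004) ((C N.* 5 N.+ 3300) N.* 10000) ⦃ N.>-nonZero (N.*-mono-≤ (s≤s {n = 3299} z≤n ⨟ N.m≤n+m 3300 (C N.* 5)) (s≤s {n = 9999} z≤n)) ⦄

 #limit : # limit ≡ ((# f * # f * # 8192 * # G ^ 7 + # f) * # 5 + # 3300) * # 10000 * (# G * # 4004)
 #limit = cong #_ limit-≡ ∙ #-* ((C N.* 5 N.+ 3300) N.* 10000) (G N.* 4004) ∙ cong₂ _*_ (#-* (C N.* 5 N.+ 3300) 10000 ∙ cong (_* # 10000) (#-+ (C N.* 5) 3300 ∙ cong (_+ # 3300) (#-* C 5 ∙ cong (_* # 5) #C))) (#-* G 4004)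
  where
  #C : # C ≡ # f * # f * # 8192 * # G ^ 7 + # f
  #C = #-+ (f N.* f N.* 8192 N.* G N.^ 7) f ∙ cong (_+ # f) (#-* (f N.* f N.* 8192) (G N.^ 7) ∙ cong₂ _*_ (#-* (f N.* f) 8192 ∙ cong (_* # 8192) (#-* f f)) (#-^ G 7))

-- N ≥ 2^L > q M + 12 and n ≥ N + 1 - 12 put n beyond q M, so the gaps found have an index of at
-- least M.
gap : ∀ {q} → IsE₂Enumeration q → ∀ M Z → (∃ λ L → q M N.+ 12 N.≤ L × ∃ λ N → 2^ L N.≤ N × ∃ λ n → suc N ∸ 12 N.≤ n × # 2 < ∑ H₅ (λ h → 𝟙 (inside 1 Z N (h N.+ n)))) → ∃ λ k → M N.≤ k × (q (suc (suc k)) ∸ q k) N.≤ 12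
gap {q} enum M Z (L , L≥ , N , N≥ , n , n≥ , more) = many⇒gap enum M n (N.<-≤-trans (N.m+n≤o⇒m≤o∸n (suc (q M)) (s≤s (L≥ ⨟ N.<⇒≤ (n<2^n L) ⨟ N≥))) n≥) (λ h → inside 1 Z N (h N.+ n))
 (λ h t → β⇒E₂ 1 Z N (h N.+ n) (N.<ᵇ⇒< N (h N.+ n) (π₁ (∧⁻ {N N.<ᵇ h N.+ n} t))) (π₂ (∧⁻ {h N.+ n N.≤ᵇ 2 N.* N} (π₂ (∧⁻ {N N.<ᵇ h N.+ n} t))))) more

theorem1p4 : BV1-Primes → BV1-E2 → (q : ℕ → ℕ) → IsE₂Enumeration q → LiminfGapLe q 12
theorem1p4 bvP bvE q enum M = gap enum M (suc (suc (2 N.* blocks))) (Conclusion.Choice.solution bvP bvE (limit blocks f) (limit-≥ blocks f (N.<⇒≤ blocks≥2)) blocks blocks≥2 (π₁ c) (π₁ (π₂ c)) (π₁ (π₂ (π₂ c))) (π₂ (π₂ (π₂ c))) shape shape-anti shape-supp shape-0 shape-inequality (#limit blocks f) (q M N.+ 12))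
 where
 c = scale-parameter
 f = shape 0
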